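{- Every cubic bridgeless graph $G$ with $m$ edges has a cycle cover comprised of three cycles of total length at most $34m/21$.
   Context: Graphs may have loops and parallel edges. A cycle of a graph is a subgraph in which every vertex has even degree. A cycle cover of $G$ is a collection of cycles such that every edge of $G$ lies in at least one of them; its (total) length is the sum of the numbers of edges of its cycles. A graph is bridgeless if it has no edge-cut of size one (it need not be connected), where an edge-cut $E(A,B)$ is the set of edges with one end in $A$ and the other in $B$ for a partition $(A,B)$ of the vertex set. -}

module Defs where

open import Data.Nat using (ℕ; zero; suc; _+_; _*_; _≤_)
open import Data.Nat.Divisibility using (_∣_)
open import Data.Fin using (Fin; zero; suc; _≟_)
open import Data.Bool using (Bool; true; false; if_then_else_; _∧_; not)
open import Data.Product using (_×_; proj₁; proj₂)
open import Relation.Nullary using (¬_)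
open import Relation.Binary.PropositionalEquality using (_≡_)
open import Data.Sum using (_⊎_)
open import Relation.Nullary.Decidable using (⌊_⌋)

sumFin : ∀ {m} → (Fin m → ℕ) → ℕ
sumFin {zero}  f = 0
sumFin {suc m} f = f zero + sumFin (λ i → f (suc i))

-- A finite multigraph (loops and parallel edges allowed):
-- vertex set Fin n, edge set Fin m, each edge has two (possibly equal) ends.
record Graph : Set where
  field
    n    : ℕ
    m    : ℕ
    ends : Fin m → Fin n × Fin n
open Graph public

Vertex : Graph → Set
Vertex G = Fin (n G)

Edge : Graph → Set
Edge G = Fin (m G)

EdgeSet : Graph → Set
EdgeSet G = Edge G → Bool

ind : Bool → ℕ
ind true  = 1
ind false = 0

-- number of ends of edge e at v (a loop at v contributes 2)
endsAt : (G : Graph) → Edge G → Vertex G → ℕ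
endsAt G e v = ind ⌊ proj₁ (ends G e) ≟ v ⌋ + ind ⌊ proj₂ (ends G e) ≟ v ⌋

degIn : (G : Graph) → EdgeSet G → Vertex G → ℕ
degIn G C v = sumFin (λ e → if C e then endsAt G e v else 0)

degree : (G : Graph) → Vertex G → ℕ
degree G v = degIn G (λ _ → true) v

Cubic : Graph → Set
Cubic G = ∀ v → degree G v ≡ 3

IsCycle : (G : Graph) → EdgeSet G → Set
IsCycle G C = ∀ v → 2 ∣ degIn G C v

size : (G : Graph) → EdgeSet G → ℕ
size G C = sumFin (λ e → ind (C e))

crosses : (G : Graph) → (Vertex G → Bool) → Edge G → Bool
crosses G A e = if A (proj₁ (ends G e)) then not (A (proj₂ (ends G e))) else A (proj₂ (ends G e))

cutSize : (G : Graph) → (Vertex G → Bool) → ℕ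
cutSize G A = sumFin (λ e → ind (crosses G A e))

Bridgeless : Graph → Set
Bridgeless G = ∀ (A : Vertex G → Bool) → ¬ (cutSize G A ≡ 1)

Covers3 : (G : Graph) → EdgeSet G → EdgeSet G → EdgeSet G → Set
Covers3 G C₁ C₂ C₃ = ∀ e → (C₁ e ≡ true) ⊎ ((C₂ e ≡ true) ⊎ (C₃ e ≡ true))

-- A cubic bridgeless graph has a perfect matching M that meets every cut of three edges exactly once (Frink's reduction, after
-- contracting the sides of such cuts). Contracting the circuits of the complementary 2-factor then leaves a bridgeless graph
-- in which every odd cut has at least five edges. Circuits of length two and four are eliminated by splitting off pairs of
-- edges, and matroid partition into two connected spanning sets (once one edge of each 2-cut is contracted) yields a
-- nowhere-zero Z₂²-flow (a , b) on M. Each of a, b, a + b extends to a cycle of the graph, and the extension is free up to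
-- complementation on every circuit. The bound is the weighted mean, with weights 6, 4, 4, of three covers:
-- {a, b, a + b}, {a, a with all circuits complemented, b}, and the latter with a + b in place of b.
-- Circuits of length five are the critical ones. The colour classes a b and a (1 + b) are made into forests by adding cycles
-- to the flow, and counting their edges against the circuits shows that enough of these circuits are covered cheaply.
module Submission where

open import Defs
open import Data.Nat using (ℕ; zero; suc; _+_; _*_; _∸_; _≤_; _<_; z≤n; s≤s; _≤?_; _<?_; _≡ᵇ_; _≤ᵇ_)
open import Data.Nat.Properties renaming (_≟_ to _≟ℕ_)
open import Data.Nat.Divisibility using (_∣_; divides)
open import Data.Nat.Tactic.RingSolver using (solve-∀)
open import Data.Fin using (Fin; zero; suc; toℕ; _↑ˡ_; _↑ʳ_; splitAt)
open import Data.Fin.Properties using (toℕ-injective; all?; any?; splitAt-↑ˡ; splitAt-↑ʳ; splitAt⁻¹-↑ˡ; splitAt⁻¹-↑ʳ) renaming (_≟_ to _≟F_; suc-injective to sucF-injective)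
open import Data.Bool using (Bool; true; false; if_then_else_; _∧_; _∨_; not; _xor_; T) renaming (_≟_ to _≟B_)
open import Data.Product using (Σ; Σ-syntax; _×_; _,_; proj₁; proj₂)
open import Data.Sum using (_⊎_; inj₁; inj₂; [_,_]′)
open import Data.Empty using (⊥; ⊥-elim)
open import Data.Unit using (⊤; tt)
open import Function using (_∘_; case_of_)
open import Relation.Nullary using (¬_; Dec; yes; no)
open import Relation.Nullary.Decidable using (⌊_⌋; _×-dec_; _→-dec_; ¬?; map′)
open import Relation.Binary.PropositionalEquality using (_≡_; _≢_; refl; sym; trans; cong; cong₂; subst; subst₂; module ≡-Reasoning)
open import Relation.Binary.Definitions using (tri<; tri≈; tri>)

-- The budget is five per vertex. On a circuit of length l, let `τ` be the number of edges that the
-- first cover uses three times and p the minority side of the third cycle in one of the other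
-- covers. The mean comes out right once 6τ + 4p, summed over the circuits, plus three times the
-- number of points of a is at most `5 * N`. Away from circuits of length two and four, a is the
-- union of a red and a green forest, each with at most as many edges as there are circuits; so a
-- has at most four points per circuit on average, whence a charge of 12 per circuit. From 4τ ≤ l
-- and 2p ≤ l, with rounding, 6τ + 4p + 12 ≤ 5l holds for l ≥ 6, with equality possible at six, and
-- can fail by one at l = 5. If the pair of values on a circuit of length five misses one of its
-- four possibilities, then τ = 0 and six is won. The deficit of one per such circuit must therefore
-- be met by missed values or by slack in the forest bounds. Cuts of at least five edges are needed
-- three times: for the two spanning sets, against circuits of length three, and against chords in
-- circuits of length five.

private variable
  N : ℕ

-- Finite sums and counting

S : ℕ → Set
S N = Fin N → Bool

infix 5 _==_
opaque
  _==_ : Fin N → Fin N → Bool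
  u == v = ⌊ u ≟F v ⌋

  ==-def : (u v : Fin N) → (u == v) ≡ ⌊ u ≟F v ⌋
  ==-def u v = refl

  ==-refl : (u : Fin N) → (u == u) ≡ true
  ==-refl u with u ≟F u
  ... | yes _ = refl
  ... | no ne = ⊥-elim (ne refl)

  ==-true : {u v : Fin N} → (u == v) ≡ true → u ≡ v
  ==-true {u = u} {v} p with u ≟F v
  ... | yes q = q
  ==-true () | no _

  ==-false : {u v : Fin N} → u ≢ v → (u == v) ≡ false
  ==-false {u = u} {v} ne with u ≟F v
  ... | yes q = ⊥-elim (ne q)
  ... | no _ = refl

≢-== : {u v : Fin N} → (u == v) ≡ false → u ≢ v
≢-== {u = u} p refl with trans (sym (==-refl u)) p
... | ()

t≢f : true ≢ false
t≢f ()

tf : ∀ {ℓ} {A : Set ℓ} {b : Bool} → b ≡ true → b ≡ false → A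
tf p q = ⊥-elim (t≢f (trans (sym p) q))

bool : ∀ b → (b ≡ true) ⊎ (b ≡ false)
bool true = inj₁ refl
bool false = inj₂ refl

¬t⇒f : ∀ {b} → ¬ (b ≡ true) → b ≡ false
¬t⇒f {true} p = ⊥-elim (p refl)
¬t⇒f {false} p = refl

¬f⇒t : ∀ {b} → ¬ (b ≡ false) → b ≡ true
¬f⇒t {true} p = refl
¬f⇒t {false} p = ⊥-elim (p refl)

iff : ∀ {a b} → (a ≡ true → b ≡ true) → (b ≡ true → a ≡ true) → a ≡ b
iff {true} {true} f g = refl
iff {true} {false} f g = sym (f refl)
iff {false} {true} f g = g refl
iff {false} {false} f g = refl

∧-intro : ∀ {a b} → a ≡ true → b ≡ true → (a ∧ b) ≡ true
∧-intro refl q = q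

∧-fst : ∀ {a b} → (a ∧ b) ≡ true → a ≡ true
∧-fst {true} p = refl

∧-snd : ∀ {a b} → (a ∧ b) ≡ true → b ≡ true
∧-snd {true} p = p

∧-false₁ : ∀ {a b} → a ≡ false → (a ∧ b) ≡ false
∧-false₁ refl = refl

∧-false₂ : ∀ {a b} → b ≡ false → (a ∧ b) ≡ false
∧-false₂ {true} p = p
∧-false₂ {false} p = refl

∨-inl : ∀ {a b} → a ≡ true → (a ∨ b) ≡ true
∨-inl refl = refl

∨-inr : ∀ {a b} → b ≡ true → (a ∨ b) ≡ true
∨-inr {true} p = refl
∨-inr {false} p = p

∨-case : ∀ {a b} → (a ∨ b) ≡ true → (a ≡ true) ⊎ (b ≡ true)
∨-case {true} p = inj₁ refl
∨-case {false} p = inj₂ p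

∨-false : ∀ {a b} → a ≡ false → b ≡ false → (a ∨ b) ≡ false
∨-false refl q = q

∨-false₁ : ∀ {a b} → (a ∨ b) ≡ false → a ≡ false
∨-false₁ {false} p = refl

∨-false₂ : ∀ {a b} → (a ∨ b) ≡ false → b ≡ false
∨-false₂ {false} p = p

not-t : ∀ {a} → a ≡ false → not a ≡ true
not-t refl = refl

not-f : ∀ {a} → a ≡ true → not a ≡ false
not-f refl = refl

not-t⁻ : ∀ {a} → not a ≡ true → a ≡ false
not-t⁻ {false} p = refl

not-f⁻ : ∀ {a} → not a ≡ false → a ≡ true
not-f⁻ {true} p = refl

xor-f : ∀ {a b} → a ≡ b → (a xor b) ≡ false
xor-f {true} refl = refl
xor-f {false} refl = refl

xor-f⁻ : ∀ {a b} → (a xor b) ≡ false → a ≡ b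
xor-f⁻ {true} {true} p = refl
xor-f⁻ {false} {false} p = refl

xor-t⁻ : ∀ {a b} → (a xor b) ≡ true → a ≢ b
xor-t⁻ {true} {true} () refl
xor-t⁻ {false} {false} () refl

ind≤1 : ∀ b → ind b ≤ 1
ind≤1 true = s≤s z≤n
ind≤1 false = z≤n

ind-t : ∀ {b} → b ≡ true → ind b ≡ 1
ind-t refl = refl

ind-f : ∀ {b} → b ≡ false → ind b ≡ 0
ind-f refl = refl

ind-mono : ∀ {a b} → (a ≡ true → b ≡ true) → ind a ≤ ind b
ind-mono {true} f rewrite f refl = ≤-refl
ind-mono {false} f = z≤n

private
  mid4 : ∀ a b c d → (a + b) + (c + d) ≡ (a + c) + (b + d)
  mid4 = solve-∀

-- Opaque, because sumFin unfolds and the unifier then no longer recovers the summand.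
opaque
  sum : {N : ℕ} → (Fin N → ℕ) → ℕ
  sum = sumFin

  sum-def : {N : ℕ} (f : Fin N → ℕ) → sum f ≡ sumFin f
  sum-def f = refl

  sum-cong : {f g : Fin N → ℕ} → (∀ v → f v ≡ g v) → sum f ≡ sum g
  sum-cong {zero} h = refl
  sum-cong {suc N} h = cong₂ _+_ (h zero) (sum-cong (λ i → h (suc i)))

  sum-mono : {f g : Fin N → ℕ} → (∀ v → f v ≤ g v) → sum f ≤ sum g
  sum-mono {zero} h = z≤n
  sum-mono {suc N} h = +-mono-≤ (h zero) (sum-mono (λ i → h (suc i)))

  sum-zero : (N : ℕ) → sum {N} (λ _ → 0) ≡ 0
  sum-zero zero = refl
  sum-zero (suc N) = sum-zero N

  sum-0 : {f : Fin N → ℕ} → (∀ v → f v ≡ 0) → sum f ≡ 0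
  sum-0 {N} h = trans (sum-cong h) (sum-zero N)

  sum-one : (N : ℕ) → sum {N} (λ _ → 1) ≡ N
  sum-one zero = refl
  sum-one (suc N) = cong suc (sum-one N)

  sum-+ : (f g : Fin N → ℕ) → sum (λ v → f v + g v) ≡ sum f + sum g
  sum-+ {zero} f g = refl
  sum-+ {suc N} f g rewrite sum-+ (λ i → f (suc i)) (λ i → g (suc i)) = mid4 (f zero) (g zero) _ _

  sum-* : (c : ℕ) (f : Fin N → ℕ) → sum (λ v → c * f v) ≡ c * sum f
  sum-* {zero} c f = sym (*-zeroʳ c)
  sum-* {suc N} c f rewrite sum-* c (λ i → f (suc i)) = sym (*-distribˡ-+ c (f zero) _)

  sum-swap : ∀ {k} (f : Fin N → Fin k → ℕ) → sum (λ u → sum (f u)) ≡ sum (λ v → sum (λ u → f u v))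
  sum-swap {zero} {k} f = sym (sum-zero k)
  sum-swap {suc N} f rewrite sum-swap (λ i → f (suc i)) = sym (sum-+ (f zero) (λ v → sum (λ u → f (suc u) v)))

  sum-single : (u : Fin N) (f : Fin N → ℕ) → (∀ v → v ≢ u → f v ≡ 0) → sum f ≡ f u
  sum-single zero f h rewrite sum-0 {f = λ i → f (suc i)} (λ v → h (suc v) (λ ())) = +-identityʳ _
  sum-single (suc u) f h rewrite h zero (λ ()) = sum-single u (λ i → f (suc i)) (λ v ne → h (suc v) (λ e → ne (sucF-injective e)))

  sum-≥ : (u : Fin N) (f : Fin N → ℕ) → f u ≤ sum f
  sum-≥ zero f = m≤m+n _ _
  sum-≥ (suc u) f = ≤-trans (sum-≥ u (λ i → f (suc i))) (m≤n+m _ (f zero))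

  -- Both sides are the double sum of `f u` over the pairs with `u == π v`: for fixed `v` one term
  -- survives, and for fixed `u` only the one at `v = ρ u`.
  sum-perm : (π ρ : Fin N → Fin N) → (∀ v → π (ρ v) ≡ v) → (∀ v → ρ (π v) ≡ v) → (f : Fin N → ℕ) →
    sum (λ v → f (π v)) ≡ sum f
  sum-perm π ρ πρ ρπ f = begin
    sum (λ v → f (π v)) ≡⟨ sum-cong (λ v → sym (lem v)) ⟩
    sum (λ v → sum (λ u → ind (u == π v) * f u)) ≡⟨ sum-swap (λ v u → ind (u == π v) * f u) ⟩
    sum (λ u → sum (λ v → ind (u == π v) * f u)) ≡⟨ sum-cong lem′ ⟩
    sum f ∎
    where
    open ≡-Reasoning
    lem : ∀ v → sum (λ u → ind (u == π v) * f u) ≡ f (π v)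
    lem v = trans (sum-single (π v) _ (λ u ne → cong (λ b → ind b * f u) (==-false ne)))
      (trans (cong (λ b → ind b * f (π v)) (==-refl (π v))) (+-identityʳ _))
    lem′ : ∀ u → sum (λ v → ind (u == π v) * f u) ≡ f u
    lem′ u = trans (sum-single (ρ u) _ (λ v ne → cong (λ b → ind b * f u) (==-false (λ e → ne (trans (sym (ρπ v)) (cong ρ (sym e)))))))
      (trans (cong (λ w → ind (u == w) * f u) (πρ u)) (trans (cong (λ b → ind b * f u) (==-refl u)) (+-identityʳ _)))

  # : S N → ℕ
  # f = sum (λ v → ind (f v))

  #-cong : {f g : S N} → (∀ v → f v ≡ g v) → # f ≡ # g
  #-cong h = sum-cong (λ v → cong ind (h v))

  #-mono : {f g : S N} → (∀ v → f v ≡ true → g v ≡ true) → # f ≤ # g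
  #-mono h = sum-mono (λ v → ind-mono (h v))

  #-empty : {f : S N} → (∀ v → f v ≡ false) → # f ≡ 0
  #-empty h = sum-0 (λ v → ind-f (h v))

  #-pos : (f : S N) (v : Fin N) → f v ≡ true → 1 ≤ # f
  #-pos f v p = ≤-trans (≤-reflexive (sym (ind-t p))) (sum-≥ v _)

  #-pos⁻ : (f : S N) → 1 ≤ # f → Σ (Fin N) λ v → f v ≡ true
  #-pos⁻ f h with any? (λ v → f v ≟B true)
  ... | yes p = p
  ... | no np = ⊥-elim (1+n≰n (≤-trans h (≤-reflexive (#-empty (λ v → ¬t⇒f (λ e → np (v , e)))))))

  #-zero : (f : S N) → # f ≡ 0 → ∀ v → f v ≡ false
  #-zero f h v = ¬t⇒f (λ p → 1+n≰n (≤-trans (#-pos f v p) (≤-reflexive h)))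

  #-single : (u : Fin N) → # (λ v → v == u) ≡ 1
  #-single u = trans (sum-single u _ (λ v ne → ind-f (==-false ne))) (ind-t (==-refl u))

  #-perm : (π ρ : Fin N → Fin N) → (∀ v → π (ρ v) ≡ v) → (∀ v → ρ (π v) ≡ v) → (f : S N) → # (λ v → f (π v)) ≡ # f
  #-perm π ρ p q f = sum-perm π ρ p q (λ v → ind (f v))

  #-def : (f : S N) → # f ≡ sum (λ v → ind (f v))
  #-def f = refl

  sum2≡ : (f g h k : Fin N → ℕ) → (∀ v → f v + g v ≡ h v + k v) → sum f + sum g ≡ sum h + sum k
  sum2≡ f g h k p = trans (sym (sum-+ f g)) (trans (sum-cong p) (sum-+ h k))

  sum≤2 : (f h k : Fin N → ℕ) → (∀ v → f v ≤ h v + k v) → sum f ≤ sum h + sum k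
  sum≤2 f h k p = subst (_ ≤_) (sum-+ h k) (sum-mono p)

  sum≡2 : (f h k : Fin N → ℕ) → (∀ v → f v ≡ h v + k v) → sum f ≡ sum h + sum k
  sum≡2 f h k p = trans (sum-cong p) (sum-+ h k)

  ind-split : ∀ a b → ind a ≡ ind (a ∧ b) + ind (a ∧ not b)
  ind-split true true = refl
  ind-split true false = refl
  ind-split false b = refl

  #-split : (f g : S N) → # f ≡ # (λ v → f v ∧ g v) + # (λ v → f v ∧ not (g v))
  #-split f g = sum≡2 _ _ _ (λ v → ind-split (f v) (g v))

  #-∨ : (f g : S N) → # (λ v → f v ∨ g v) ≤ # f + # g
  #-∨ f g = sum≤2 _ _ _ (λ v → lem (f v) (g v))
    where
    lem : ∀ a b → ind (a ∨ b) ≤ ind a + ind b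
    lem true b = s≤s z≤n
    lem false b = ≤-refl

  ind-∨∧ : ∀ a b → ind a + ind b ≡ ind (a ∨ b) + ind (a ∧ b)
  ind-∨∧ true true = refl
  ind-∨∧ true false = refl
  ind-∨∧ false true = refl
  ind-∨∧ false false = refl

  #-∨∧ : (f g : S N) → # f + # g ≡ # (λ v → f v ∨ g v) + # (λ v → f v ∧ g v)
  #-∨∧ f g = sum2≡ _ _ _ _ (λ v → ind-∨∧ (f v) (g v))

  #-all : (N : ℕ) → # {N} (λ _ → true) ≡ N
  #-all N = sum-one N

  #-suc : (f : S (suc N)) → # f ≡ ind (f zero) + # (λ i → f (suc i))
  #-suc f = refl

  #2≡ : (f g h k : S N) → (∀ v → ind (f v) + ind (g v) ≡ ind (h v) + ind (k v)) → # f + # g ≡ # h + # k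
  #2≡ f g h k p = sum2≡ _ _ _ _ p

  #≤2 : (f h k : S N) → (∀ v → ind (f v) ≤ ind (h v) + ind (k v)) → # f ≤ # h + # k
  #≤2 f h k p = sum≤2 _ _ _ p

infixl 7 _∖_ _∪₁_
_∖_ : S N → Fin N → S N
(f ∖ u) v = f v ∧ not (v == u)

_∪₁_ : S N → Fin N → S N
(f ∪₁ u) v = f v ∨ (v == u)

∖-self : (f : S N) (u : Fin N) → (f ∖ u) u ≡ false
∖-self f u = ∧-false₂ (not-f (==-refl u))

∖-other : (f : S N) {u v : Fin N} → v ≢ u → (f ∖ u) v ≡ f v
∖-other f {u} {v} ne rewrite ==-false ne = lem (f v)
  where
  lem : ∀ a → (a ∧ true) ≡ a
  lem true = refl
  lem false = refl

∖-remove : (f : S N) (u : Fin N) → f u ≡ true → # f ≡ suc (# (f ∖ u))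
∖-remove f u p = trans (#-split f (λ v → v == u)) (cong (_+ # (f ∖ u))
  (trans (#-cong (λ v → iff (λ q → ∧-snd {f v} q) (λ q → ∧-intro (subst (λ w → f w ≡ true) (sym (==-true q)) p) q))) (#-single u)))

#-mono-< : {f g : S N} → (∀ v → f v ≡ true → g v ≡ true) → (u : Fin N) → g u ≡ true → f u ≡ false → # f < # g
#-mono-< {f = f} {g} h u p q = subst (# f <_) (sym (∖-remove g u p))
  (s≤s (#-mono (λ v fv → ∧-intro (h v fv) (not-t (==-false (λ e → tf fv (subst (λ w → f w ≡ false) (sym e) q)))))))

#-full : {f g : S N} → (∀ v → f v ≡ true → g v ≡ true) → # g ≤ # f → ∀ v → g v ≡ true → f v ≡ true
#-full {f = f} h le v p with bool (f v)
... | inj₁ q = q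
... | inj₂ q = ⊥-elim (<⇒≱ (#-mono-< h v p q) le)

#≤1 : (f : S N) → (∀ u v → f u ≡ true → f v ≡ true → u ≡ v) → # f ≤ 1
#≤1 f h with any? (λ v → f v ≟B true)
... | no np = ≤-trans (≤-reflexive (#-empty (λ v → ¬t⇒f (λ e → np (v , e))))) z≤n
... | yes (u , p) = ≤-trans (#-mono (λ v q → subst (λ w → (w == u) ≡ true) (h u v p q) (==-refl u))) (≤-reflexive (#-single u))

-- Induction on the size of a subset. The base case speaks of pointwise empty sets because equal
-- sets need not be equal functions.
setInd : (P : S N → Set) → (∀ B → (∀ v → B v ≡ false) → P B) → (∀ B i → B i ≡ true → P (B ∖ i) → P B) → ∀ B → P B
setInd {N} P base step B = go (# B) B ≤-refl
  where
  go : ∀ k B → # B ≤ k → P B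
  go k B le with any? (λ v → B v ≟B true)
  ... | no np = base B (λ v → ¬t⇒f (λ e → np (v , e)))
  go zero B le | yes (i , p) = ⊥-elim (1+n≰n (≤-trans (#-pos B i p) le))
  go (suc k) B le | yes (i , p) = step B i p (go k (B ∖ i) (≤-pred (subst (_≤ suc k) (∖-remove B i p) le)))

least : (f : S N) (v : Fin N) → f v ≡ true → Σ (Fin N) λ u → (f u ≡ true) × (∀ w → toℕ w < toℕ u → f w ≡ false)
least {suc N} f v p with bool (f zero)
... | inj₁ q = zero , q , λ w ()
least {suc N} f zero p | inj₂ q = tf p q
least {suc N} f (suc v) p | inj₂ q with least (λ i → f (suc i)) v p
... | u , fu , h = suc u , fu , λ { zero _ → q ; (suc w) (s≤s lt) → h w lt }

-- Exhaustive search over subsets; P must respect pointwise equality since functions are not extensional.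

Ext : {N : ℕ} → (S N → Set) → Set
Ext {N} P = ∀ {f g : S N} → (∀ v → f v ≡ g v) → P f → P g

cons : Bool → S N → S (suc N)
cons b f zero = b
cons b f (suc i) = f i

cons-η : (f : S (suc N)) → ∀ v → cons (f zero) (λ i → f (suc i)) v ≡ f v
cons-η f zero = refl
cons-η f (suc i) = refl

cons-cong : ∀ b {f g : S N} → (∀ v → f v ≡ g v) → ∀ v → cons b f v ≡ cons b g v
cons-cong b h zero = refl
cons-cong b h (suc i) = h i

search : {P : S N → Set} → Ext P → (∀ f → Dec (P f)) → Dec (Σ (S N) P)
search {zero} {P} ext d with d (λ ())
... | yes p = yes (_ , p)
... | no np = no (λ { (f , p) → np (ext (λ ()) p) })
search {suc N} {P} ext d with search {N} {λ f → P (cons true f)} (λ h → ext (cons-cong true h)) (λ f → d (cons true f))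
... | yes (f , p) = yes (_ , p)
... | no np with search {N} {λ f → P (cons false f)} (λ h → ext (cons-cong false h)) (λ f → d (cons false f))
... | yes (f , p) = yes (_ , p)
... | no nq = no λ { (f , p) → lem f p (bool (f zero)) }
  where
  lem : ∀ f → P f → (f zero ≡ true) ⊎ (f zero ≡ false) → ⊥
  lem f p (inj₁ e) = np (_ , ext (λ v → trans (sym (cons-η f v)) (cong (λ b → cons b (λ i → f (suc i)) v) e)) p)
  lem f p (inj₂ e) = nq (_ , ext (λ v → trans (sym (cons-η f v)) (cong (λ b → cons b (λ i → f (suc i)) v) e)) p)

-- Local search. It produces flows with a minimal zero set, maximal forests, and flows without red
-- edges outside a given forest.
descend : {A : Set} (μ : A → ℕ) (P : A → Set) → (∀ a → P a ⊎ Σ A λ a′ → μ a′ < μ a) → A → Σ A P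
descend {A} μ P step a = go (μ a) a ≤-refl
  where
  go : ∀ k a → μ a ≤ k → Σ A P
  go k a le with step a
  ... | inj₁ p = a , p
  go zero a le | inj₂ (a′ , lt) = ⊥-elim (n≮0 (≤-trans lt le))
  go (suc k) a le | inj₂ (a′ , lt) = go k a′ (≤-pred (≤-trans lt le))

-- Fixed-point-free involutions

record Invol {N : ℕ} (mate : Fin N → Fin N) : Set where
  field
    mm : ∀ v → mate (mate v) ≡ v
    mf : ∀ v → mate v ≢ v
open Invol public

module _ {N : ℕ} {mate : Fin N → Fin N} (I : Invol mate) where

  -- Picks one end of every pair, so that edges can be counted once.
  half : S N
  half v = ⌊ toℕ v <? toℕ (mate v) ⌋

  half-mate : ∀ v → half (mate v) ≡ not (half v)
  half-mate v rewrite mm I v with toℕ v <? toℕ (mate v) | toℕ (mate v) <? toℕ v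
  ... | yes p | yes q = ⊥-elim (<-asym p q)
  ... | yes p | no _ = refl
  ... | no _ | yes q = refl
  ... | no np | no nq = ⊥-elim (mf I v (toℕ-injective (≤-antisym (≮⇒≥ np) (≮⇒≥ nq))))

  #-mate : (f : S N) → # (λ v → f (mate v)) ≡ # f
  #-mate f = #-perm mate mate (mm I) (mm I) f

  #-half : (f : S N) → (∀ v → f (mate v) ≡ f v) → # f ≡ # (λ v → f v ∧ half v) + # (λ v → f v ∧ half v)
  #-half f inv = trans (#-split f half) (cong (# (λ v → f v ∧ half v) +_)
    (trans (#-cong (λ v → cong₂ _∧_ (sym (inv v)) (sym (half-mate v)))) (#-mate (λ v → f v ∧ half v))))

-- Connectivity, defined through cuts: u and v are connected when no closed set separates them.

Link : ℕ → Set
Link N = Fin N → Fin N → Bool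

Closed : {N : ℕ} → Link N → S N → Set
Closed L Z = ∀ u v → L u v ≡ true → Z u ≡ Z v

closed? : {N : ℕ} (L : Link N) (Z : S N) → Dec (Closed L Z)
closed? L Z = all? λ u → all? λ v → (L u v ≟B true) →-dec (Z u ≟B Z v)

module _ {N : ℕ} (L : Link N) where

  separated? : ∀ u v → Dec (Σ (S N) λ Z → Closed L Z × (Z u ≢ Z v))
  separated? u v = search
    (λ h (c , ne) → (λ x y l → trans (sym (h x)) (trans (c x y l) (h y))) , λ e → ne (trans (h u) (trans e (sym (h v)))))
    (λ Z → closed? L Z ×-dec ¬? (Z u ≟B Z v))

  opaque
    conn : Fin N → Fin N → Bool
    conn u v = not ⌊ separated? u v ⌋

    conn-elim : ∀ {u v} → conn u v ≡ true → ∀ Z → Closed L Z → Z u ≡ Z v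
    conn-elim {u} {v} p Z c with separated? u v | p
    ... | yes _ | ()
    ... | no ns | _ with Z u ≟B Z v
    ... | yes e = e
    ... | no ne = ⊥-elim (ns (Z , c , ne))

    conn-intro : ∀ {u v} → (∀ Z → Closed L Z → Z u ≡ Z v) → conn u v ≡ true
    conn-intro {u} {v} h with separated? u v
    ... | yes (Z , c , ne) = ⊥-elim (ne (h Z c))
    ... | no _ = refl

  conn-refl : ∀ u → conn u u ≡ true
  conn-refl u = conn-intro (λ Z c → refl)

  conn-sym : ∀ {u v} → conn u v ≡ true → conn v u ≡ true
  conn-sym p = conn-intro (λ Z c → sym (conn-elim p Z c))

  conn-trans : ∀ {u v w} → conn u v ≡ true → conn v w ≡ true → conn u w ≡ true
  conn-trans p q = conn-intro (λ Z c → trans (conn-elim p Z c) (conn-elim q Z c))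

  conn-link : ∀ {u v} → L u v ≡ true → conn u v ≡ true
  conn-link l = conn-intro (λ Z c → c _ _ l)

  conn-closed : ∀ u → Closed L (conn u)
  conn-closed u v w l = iff (λ p → conn-trans p (conn-link l)) (λ p → conn-trans p (conn-sym (conn-link l)))

  opaque
    root : S N
    root v = ⌊ all? (λ u → (toℕ u <? toℕ v) →-dec (conn u v ≟B false)) ⌋

    root-elim : ∀ {v} → root v ≡ true → ∀ u → toℕ u < toℕ v → conn u v ≡ false
    root-elim {v} p with all? (λ u → (toℕ u <? toℕ v) →-dec (conn u v ≟B false)) | p
    ... | yes h | _ = h
    ... | no _ | ()

    root-intro : ∀ {v} → (∀ u → toℕ u < toℕ v → conn u v ≡ false) → root v ≡ true
    root-intro {v} h with all? (λ u → (toℕ u <? toℕ v) →-dec (conn u v ≟B false))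
    ... | yes _ = refl
    ... | no nh = ⊥-elim (nh h)

  rep : ∀ v → Σ (Fin N) λ r → (root r ≡ true) × (conn r v ≡ true)
  rep v with least (λ u → conn u v) v (conn-refl v)
  ... | r , p , h = r , root-intro (λ w lt → ¬t⇒f (λ q → tf (conn-trans q p) (h w lt))) , p

  root-unique : ∀ {r r′} → root r ≡ true → root r′ ≡ true → conn r r′ ≡ true → r ≡ r′
  root-unique {r} {r′} p q c with <-cmp (toℕ r) (toℕ r′)
  ... | tri< lt _ _ = tf c (root-elim q r lt)
  ... | tri≈ _ e _ = toℕ-injective e
  ... | tri> _ _ gt = tf (conn-sym c) (root-elim p r′ gt)

  root-sum : ∀ v → # (λ r → root r ∧ conn r v) ≡ 1
  root-sum v with rep v
  ... | r , p , q = trans (#-def _) (trans (sum-single r _ (λ u ne → ind-f (¬t⇒f (λ e →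
           ne (root-unique (∧-fst e) p (conn-trans (∧-snd e) (conn-sym q)))))))
         (ind-t (∧-intro p q)))

  comp : ℕ
  comp = # root

  class-sum : (f : Fin N → ℕ) → sum f ≡ sum (λ r → ind (root r) * sum (λ v → ind (conn r v) * f v))
  class-sum f = sym (begin
    sum (λ r → ind (root r) * sum (λ v → ind (conn r v) * f v))
      ≡⟨ sum-cong (λ r → sym (sum-* (ind (root r)) _)) ⟩
    sum (λ r → sum (λ v → ind (root r) * (ind (conn r v) * f v)))
      ≡⟨ sum-swap (λ r v → ind (root r) * (ind (conn r v) * f v)) ⟩
    sum (λ v → sum (λ r → ind (root r) * (ind (conn r v) * f v)))
      ≡⟨ sum-cong (λ v → sum-cong (λ r → lem (root r) (conn r v) (f v))) ⟩
    sum (λ v → sum (λ r → f v * ind (root r ∧ conn r v)))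
      ≡⟨ sum-cong (λ v → trans (sum-* (f v) _) (trans (cong (f v *_) (trans (sym (#-def _)) (root-sum v))) (*-identityʳ (f v)))) ⟩
    sum f ∎)
    where
    open ≡-Reasoning
    lem : ∀ a b x → ind a * (ind b * x) ≡ x * ind (a ∧ b)
    lem true true x = trans (+-identityʳ _) (trans (+-identityʳ x) (sym (*-identityʳ x)))
    lem true false x = sym (*-zeroʳ x)
    lem false b x = sym (*-zeroʳ x)

conn-mono : {N : ℕ} {L L′ : Link N} → (∀ Z → Closed L′ Z → Closed L Z) → ∀ {u v} → conn L u v ≡ true → conn L′ u v ≡ true
conn-mono {L = L} {L′} h p = conn-intro L′ (λ Z c → conn-elim L p Z (h Z c))

root-mono : {N : ℕ} {L L′ : Link N} → (∀ Z → Closed L′ Z → Closed L Z) → ∀ {v} → root L′ v ≡ true → root L v ≡ true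
root-mono {L = L} {L′} h p = root-intro L (λ u lt → ¬t⇒f (λ c → tf (conn-mono {L = L} {L′} h c) (root-elim L′ p u lt)))

comp-mono : {N : ℕ} {L L′ : Link N} → (∀ Z → Closed L′ Z → Closed L Z) → comp L′ ≤ comp L
comp-mono {L = L} {L′} h = #-mono (λ v → root-mono {L = L} {L′} h)

comp-cong : {N : ℕ} {L L′ : Link N} → (∀ Z → Closed L′ Z → Closed L Z) → (∀ Z → Closed L Z → Closed L′ Z) → comp L ≡ comp L′
comp-cong {L = L} {L′} h k = ≤-antisym (comp-mono {L = L′} {L} k) (comp-mono {L = L} {L′} h)

-- L′ is L together with one new link between e and f.
module _ {N : ℕ} (L L′ : Link N) (e f : Fin N)
  (to : ∀ Z → Closed L′ Z → Closed L Z × (Z e ≡ Z f)) (from : ∀ Z → Closed L Z → Z e ≡ Z f → Closed L′ Z) where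

  private
    c : Fin N → Fin N → Bool
    c = conn L
    c′ : Fin N → Fin N → Bool
    c′ = conn L′

    up : ∀ {u v} → c u v ≡ true → c′ u v ≡ true
    up = conn-mono {L = L} {L′} (λ Z k → proj₁ (to Z k))

    e~f : c′ e f ≡ true
    e~f = conn-intro L′ (λ Z k → proj₂ (to Z k))

    -- A shortest walk uses the new link at most once, in one of its two directions. In terms of
    -- cuts: the set of points reached in one of the three ways is closed under `L′`.
    split : ∀ {u v} → c′ u v ≡ true → (c u v ≡ true) ⊎ (((c u e ≡ true) × (c f v ≡ true)) ⊎ ((c u f ≡ true) × (c e v ≡ true)))
    split {u} {v} p with ∨-case {c u v} (trans (sym (conn-elim L′ p Z clo)) (∨-inl (conn-refl L u)))
      where
      Z : S N
      Z w = c u w ∨ ((c u e ∧ c f w) ∨ (c u f ∧ c e w))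
      Ze : Z e ≡ Z f
      Ze = iff (λ q → go (∨-case q)) (λ q → go′ (∨-case q))
        where
        go : (c u e ≡ true) ⊎ (((c u e ∧ c f e) ∨ (c u f ∧ c e e)) ≡ true) → Z f ≡ true
        go (inj₁ q) = ∨-inr {c u f} (∨-inl (∧-intro q (conn-refl L f)))
        go (inj₂ q) with ∨-case {c u e ∧ c f e} q
        ... | inj₁ r = ∨-inr {c u f} (∨-inl (∧-intro (∧-fst {c u e} r) (conn-refl L f)))
        ... | inj₂ r = ∨-inl {c u f} (∧-fst {c u f} r)
        go′ : (c u f ≡ true) ⊎ (((c u e ∧ c f f) ∨ (c u f ∧ c e f)) ≡ true) → Z e ≡ true
        go′ (inj₁ q) = ∨-inr {c u e} (∨-inr {c u e ∧ c f e} (∧-intro q (conn-refl L e)))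
        go′ (inj₂ q) with ∨-case {c u e ∧ c f f} q
        ... | inj₁ r = ∨-inl {c u e} (∧-fst {c u e} r)
        ... | inj₂ r = ∨-inr {c u e} (∨-inr {c u e ∧ c f e} (∧-intro (∧-fst r) (conn-refl L e)))
      clo : Closed L′ Z
      clo = from Z (λ x y l → cong₂ _∨_ (conn-closed L u x y l)
        (cong₂ _∨_ (cong (c u e ∧_) (conn-closed L f x y l)) (cong (c u f ∧_) (conn-closed L e x y l)))) Ze
    ... | inj₁ q = inj₁ q
    ... | inj₂ q with ∨-case {c u e ∧ c f v} q
    ... | inj₁ r = inj₂ (inj₁ (∧-fst r , ∧-snd {c u e} r))
    ... | inj₂ r = inj₂ (inj₂ (∧-fst r , ∧-snd {c u f} r))

    root-of : ∀ {r v} → root L r ≡ true → root L v ≡ true → ∀ {x} → c r x ≡ true → c x v ≡ true → v ≡ r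
    root-of p q a b = sym (root-unique L p q (conn-trans L a b))

    -- Of the two roots that are merged, the larger one stops being a root.
    lost : ∀ {x y r₁ r₂} → (∀ {u v} → c′ u v ≡ true → (c u v ≡ true) ⊎ (((c u x ≡ true) × (c y v ≡ true)) ⊎ ((c u y ≡ true) × (c x v ≡ true)))) →
      root L r₁ ≡ true → c r₁ x ≡ true → root L r₂ ≡ true → c r₂ y ≡ true → c′ x y ≡ true → toℕ r₁ < toℕ r₂ →
      comp L ≡ suc (comp L′)
    lost {x} {y} {r₁} {r₂} spl p₁ q₁ p₂ q₂ xy lt = trans (∖-remove (root L) r₂ p₂) (cong suc (#-cong λ v → sym (iff (fwd v) (bwd v))))
      where
      fwd : ∀ v → root L′ v ≡ true → (root L ∖ r₂) v ≡ true
      fwd v p = ∧-intro (root-mono {L = L} {L′} (λ Z k → proj₁ (to Z k)) p) (not-t (==-false λ { refl →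
        tf (conn-trans L′ (up q₁) (conn-trans L′ xy (conn-sym L′ (up q₂)))) (root-elim L′ p r₁ lt) }))
      bwd : ∀ v → (root L ∖ r₂) v ≡ true → root L′ v ≡ true
      bwd v p = root-intro L′ (λ u u<v → ¬t⇒f (λ k → case spl k of λ
        { (inj₁ a) → tf a (root-elim L pv u u<v)
        ; (inj₂ (inj₁ (a , b))) → ≢-== (not-t⁻ (∧-snd {root L v} p)) (root-of p₂ pv q₂ b)
        ; (inj₂ (inj₂ (a , b))) → case root-of p₁ pv q₁ b of λ { refl →
            tf (conn-trans L a (conn-sym L q₂)) (root-elim L p₂ u (<-trans u<v lt)) } }))
        where pv = ∧-fst p

  comp-link : conn L e f ≡ false → comp L ≡ suc (comp L′)
  comp-link ne with rep L e | rep L f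
  ... | r₁ , p₁ , q₁ | r₂ , p₂ , q₂ with <-cmp (toℕ r₁) (toℕ r₂)
  ... | tri< lt _ _ = lost split p₁ q₁ p₂ q₂ e~f lt
  ... | tri≈ _ eq _ with toℕ-injective eq
  ... | refl = tf (conn-trans L (conn-sym L q₁) q₂) ne
  comp-link ne | r₁ , p₁ , q₁ | r₂ , p₂ , q₂ | tri> _ _ gt =
    lost (λ k → case split k of λ { (inj₁ a) → inj₁ a ; (inj₂ (inj₁ a)) → inj₂ (inj₂ a) ; (inj₂ (inj₂ a)) → inj₂ (inj₁ a) }) p₂ q₂ p₁ q₁ (conn-sym L′ e~f) gt

-- Matroid partition

module _ where
  private
    _∪_ _∩_ : {N : ℕ} → S N → S N → S N
    (A ∪ B) v = A v ∨ B v
    (A ∩ B) v = A v ∧ B v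

  -- Sets are functions, so invariance under pointwise equality is a condition of its own.
  record Supermodular {N : ℕ} (F : S N → ℕ) : Set where
    field
      resp : ∀ {A B} → (∀ v → A v ≡ B v) → F A ≡ F B
      super : ∀ A B → F A + F B ≤ F (λ v → A v ∨ B v) + F (λ v → A v ∧ B v)
  open Supermodular public

  private
    super-cons : {N : ℕ} {F : S (suc N) → ℕ} → Supermodular F → (b : Bool) → Supermodular (λ A → F (cons b A))
    resp (super-cons sF b) h = resp sF (cons-cong b h)
    super (super-cons {F = F} sF b) A B = subst (F (cons b A) + F (cons b B) ≤_)
      (cong₂ _+_ (resp sF (λ { zero → or b ; (suc i) → refl })) (resp sF (λ { zero → and b ; (suc i) → refl })))
      (super sF (cons b A) (cons b B))
      where
      or : ∀ b → (b ∨ b) ≡ b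
      or true = refl
      or false = refl
      and : ∀ b → (b ∧ b) ≡ b
      and true = refl
      and false = refl

    co : {N : ℕ} → S N → ℕ
    co A = # (λ v → not (A v))

    -- This is where integrality enters: the two violations add up to an excess of two, while the
    -- uncrossed sets leave room for only one, namely for the element 0, which is missing from the
    -- intersection.
    arith : ∀ p q r s x y u w k₁ k₂ κ → p + q ≤ x + y → r + s ≤ u + w → x + u ≤ k₁ + κ → y + w ≤ suc k₂ + κ →
      ∀ {c₁ c₂} → c₁ + c₂ ≡ k₁ + k₂ → suc (c₁ + κ) ≤ p + r → suc (c₂ + κ) ≤ q + s → ⊥
    arith p q r s x y u w k₁ k₂ κ a b c d {c₁} {c₂} e f g = 1+n≰n (begin
      suc (suc (c₁ + c₂ + (κ + κ)))      ≡⟨ l₁ c₁ c₂ κ ⟩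
      suc (c₁ + κ) + suc (c₂ + κ)        ≤⟨ +-mono-≤ f g ⟩
      (p + r) + (q + s)                  ≡⟨ l₂ p q r s ⟩
      (p + q) + (r + s)                  ≤⟨ +-mono-≤ a b ⟩
      (x + y) + (u + w)                  ≡⟨ l₂ x u y w ⟩
      (x + u) + (y + w)                  ≤⟨ +-mono-≤ c d ⟩
      (k₁ + κ) + (suc k₂ + κ)            ≡⟨ l₃ k₁ k₂ κ ⟩
      suc (k₁ + k₂ + (κ + κ))            ≡⟨ cong (λ z → suc (z + (κ + κ))) (sym e) ⟩
      suc (c₁ + c₂ + (κ + κ))            ∎)
      where
      open ≤-Reasoning
      l₁ : ∀ c₁ c₂ κ → suc (suc (c₁ + c₂ + (κ + κ))) ≡ suc (c₁ + κ) + suc (c₂ + κ)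
      l₁ = solve-∀
      l₂ : ∀ p q r s → (p + r) + (q + s) ≡ (p + q) + (r + s)
      l₂ = solve-∀
      l₃ : ∀ k₁ k₂ κ → (k₁ + κ) + (suc k₂ + κ) ≡ suc (k₁ + k₂ + (κ + κ))
      l₃ = solve-∀

  -- Greedy choice: if both T ∋ 0 and T ∌ 0 violate the hypothesis, uncrossing the two violators contradicts it.
  partition : {N : ℕ} (F₁ F₂ : S N → ℕ) (κ : ℕ) → Supermodular F₁ → Supermodular F₂ →
    (∀ A → F₁ A + F₂ A ≤ # (λ v → not (A v)) + κ) → Σ (S N) λ T → F₁ T + F₂ (λ v → not (T v)) ≤ κ
  partition {zero} F₁ F₂ κ s₁ s₂ h = (λ ()) , subst (λ z → F₁ (λ ()) + z ≤ κ) (resp s₂ (λ ())) (subst (λ z → F₁ (λ ()) + F₂ (λ ()) ≤ z + κ) (#-empty {0} (λ ())) (h (λ ())))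
  partition {suc N} F₁ F₂ κ s₁ s₂ h
    with search {P = λ A → ¬ (F₁ (cons true A) + F₂ (cons false A) ≤ co A + κ)}
           (λ e np p → np (subst₂ _≤_ (cong₂ _+_ (resp s₁ (cons-cong true (λ v → sym (e v)))) (resp s₂ (cons-cong false (λ v → sym (e v)))))
             (cong (_+ κ) (#-cong (λ v → cong not (sym (e v))))) p))
           (λ A → ¬? (_ ≤? _))
  ... | no good with partition (λ A → F₁ (cons true A)) (λ A → F₂ (cons false A)) κ (super-cons s₁ true) (super-cons s₂ false)
                       (λ A → case _ ≤? _ of λ { (yes p) → p ; (no np) → ⊥-elim (good (A , np)) })
  ... | T , p = cons true T , subst (λ z → F₁ (cons true T) + z ≤ κ) (resp s₂ (λ { zero → refl ; (suc i) → refl })) p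
  partition {suc N} F₁ F₂ κ s₁ s₂ h | yes (A₁ , n₁)
    with search {P = λ A → ¬ (F₁ (cons false A) + F₂ (cons true A) ≤ co A + κ)}
           (λ e np p → np (subst₂ _≤_ (cong₂ _+_ (resp s₁ (cons-cong false (λ v → sym (e v)))) (resp s₂ (cons-cong true (λ v → sym (e v)))))
             (cong (_+ κ) (#-cong (λ v → cong not (sym (e v))))) p))
           (λ A → ¬? (_ ≤? _))
  ... | no good with partition (λ A → F₁ (cons false A)) (λ A → F₂ (cons true A)) κ (super-cons s₁ false) (super-cons s₂ true)
                       (λ A → case _ ≤? _ of λ { (yes p) → p ; (no np) → ⊥-elim (good (A , np)) })
  ... | T , p = cons false T , subst (λ z → F₁ (cons false T) + z ≤ κ) (resp s₂ (λ { zero → refl ; (suc i) → refl })) p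
  partition {suc N} F₁ F₂ κ s₁ s₂ h | yes (A₁ , n₁) | yes (A₂ , n₂) =
    ⊥-elim (arith (F₁ (cons true A₁)) (F₁ (cons false A₂)) (F₂ (cons false A₁)) (F₂ (cons true A₂))
      (F₁ (cons true (A₁ ∪ A₂))) (F₁ (cons false (A₁ ∩ A₂))) (F₂ (cons true (A₁ ∪ A₂))) (F₂ (cons false (A₁ ∩ A₂))) (co (A₁ ∪ A₂)) (co (A₁ ∩ A₂)) κ
      (subst (F₁ (cons true A₁) + F₁ (cons false A₂) ≤_)
        (cong₂ _+_ (resp s₁ {_} {cons true (A₁ ∪ A₂)} (λ { zero → refl ; (suc i) → refl })) (resp s₁ {_} {cons false (A₁ ∩ A₂)} (λ { zero → refl ; (suc i) → refl }))) (super s₁ (cons true A₁) (cons false A₂)))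
      (subst (F₂ (cons false A₁) + F₂ (cons true A₂) ≤_)
        (cong₂ _+_ (resp s₂ {_} {cons true (A₁ ∪ A₂)} (λ { zero → refl ; (suc i) → refl })) (resp s₂ {_} {cons false (A₁ ∩ A₂)} (λ { zero → refl ; (suc i) → refl }))) (super s₂ (cons false A₁) (cons true A₂)))
      (subst (λ z → F₁ (cons true (A₁ ∪ A₂)) + F₂ (cons true (A₁ ∪ A₂)) ≤ z + κ) (#-suc _) (h (cons true (A₁ ∪ A₂))))
      (subst (λ z → F₁ (cons false (A₁ ∩ A₂)) + F₂ (cons false (A₁ ∩ A₂)) ≤ z + κ) (#-suc _) (h (cons false (A₁ ∩ A₂))))
      (#2≡ _ _ _ _ (λ v → lem (A₁ v) (A₂ v)))
      (≰⇒> n₁) (≰⇒> n₂))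
    where
    lem : ∀ a b → ind (not a) + ind (not b) ≡ ind (not (a ∨ b)) + ind (not (a ∧ b))
    lem true true = refl
    lem true false = refl
    lem false true = refl
    lem false false = refl

-- Boolean identities are verified by evaluating all cases.

Pred : ℕ → Set
Pred zero = Bool
Pred (suc k) = Bool → Pred k

check : ∀ k → Pred k → Bool
check zero b = b
check (suc k) f = check k (f true) ∧ check k (f false)

Holds : ∀ k → Pred k → Set
Holds zero b = b ≡ true
Holds (suc k) f = ∀ x → Holds k (f x)

tauto : ∀ k (f : Pred k) → check k f ≡ true → Holds k f
tauto zero f p = p
tauto (suc k) f p true = tauto k (f true) (∧-fst p)
tauto (suc k) f p false = tauto k (f false) (∧-snd {check k (f true)} p)

eqN : ∀ {a b} → (a ≡ᵇ b) ≡ true → a ≡ b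
eqN {a} {b} p = ≡ᵇ⇒≡ a b (subst T (sym p) tt)

leN : ∀ {a b} → (a ≤ᵇ b) ≡ true → a ≤ b
leN {a} {b} p = ≤ᵇ⇒≤ a b (subst T (sym p) tt)

eqB : Bool → Bool → Bool
eqB true b = b
eqB false b = not b

eqB-≡ : ∀ {a b} → eqB a b ≡ true → a ≡ b
eqB-≡ {true} {true} p = refl
eqB-≡ {false} {false} p = refl

-- Parity

par : ℕ → Bool
par zero = false
par (suc k) = not (par k)

par-+ : ∀ a b → par (a + b) ≡ (par a xor par b)
par-+ zero b = refl
par-+ (suc a) b = trans (cong not (par-+ a b)) (lem (par a) (par b))
  where
  lem : ∀ x y → not (x xor y) ≡ (not x xor y)
  lem true true = refl
  lem true false = refl
  lem false true = refl
  lem false false = refl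

par-twice : ∀ a → par (a + a) ≡ false
par-twice a = trans (par-+ a a) (xor-f {par a} refl)

halve : ∀ a → Σ ℕ λ k → a ≡ ind (par a) + (k + k)
halve zero = 0 , refl
halve (suc a) with halve a
... | k , e with par a
... | true = suc k , cong suc (trans e (sym (+-suc k k)))
... | false = k , cong suc e

par-ind : ∀ b → par (ind b) ≡ b
par-ind true = refl
par-ind false = refl

par-sum : {N : ℕ} (f g : Fin N → ℕ) → (∀ v → par (f v) ≡ par (g v)) → par (sum f) ≡ par (sum g)
par-sum f g h = trans (cong par (sum-def f)) (trans (go f g h) (sym (cong par (sum-def g))))
  where
  go : {N : ℕ} (f g : Fin N → ℕ) → (∀ v → par (f v) ≡ par (g v)) → par (sumFin f) ≡ par (sumFin g)
  go {zero} f g h = refl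
  go {suc N} f g h = trans (par-+ (f zero) _) (trans (cong₂ _xor_ (h zero) (go (λ i → f (suc i)) (λ i → g (suc i)) (λ i → h (suc i)))) (sym (par-+ (g zero) _)))

par-xor : {N : ℕ} (f g : S N) → par (# (λ v → f v xor g v)) ≡ (par (# f) xor par (# g))
par-xor f g = trans (cong par (#-def _)) (trans (par-sum _ (λ v → ind (f v) + ind (g v)) (λ v → trans (par-ind _) (lem (f v) (g v))))
  (trans (cong par (trans (sum-+ _ _) (cong₂ _+_ (sym (#-def f)) (sym (#-def g))))) (par-+ (# f) (# g))))
  where
  lem : ∀ a b → (a xor b) ≡ par (ind a + ind b)
  lem true true = refl
  lem true false = refl
  lem false true = refl
  lem false false = refl

-- Edge cuts. Every edge of a cut is counted twice, once from each end.

-- The edges between the two differences of `A` and `B`, that is, the defect in the submodular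
-- inequality.
diag : {N : ℕ} → (Fin N → Fin N) → S N → S N → S N → S N
diag mate w A B v = w v ∧ ((A v ∧ (not (B v) ∧ (B (mate v) ∧ not (A (mate v))))) ∨ (B v ∧ (not (A v) ∧ (A (mate v) ∧ not (B (mate v))))))

opaque
  D : {N : ℕ} → (Fin N → Fin N) → S N → S N → ℕ
  D mate w Z = # (λ v → w v ∧ (Z v xor Z (mate v)))

  D-def : {N : ℕ} (mate : Fin N → Fin N) (w Z : S N) → D mate w Z ≡ # (λ v → w v ∧ (Z v xor Z (mate v)))
  D-def mate w Z = refl

  D-cong : {N : ℕ} (mate : Fin N → Fin N) (w : S N) {Z Z′ : S N} → (∀ v → Z v ≡ Z′ v) → D mate w Z ≡ D mate w Z′
  D-cong mate w h = #-cong (λ v → cong (w v ∧_) (cong₂ _xor_ (h v) (h (mate v))))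

  D-not : {N : ℕ} (mate : Fin N → Fin N) (w Z : S N) → D mate w (λ v → not (Z v)) ≡ D mate w Z
  D-not mate w Z = #-cong (λ v → cong (w v ∧_) (lem (Z v) (Z (mate v))))
    where
    lem : ∀ a b → (not a xor not b) ≡ (a xor b)
    lem true true = refl
    lem true false = refl
    lem false true = refl
    lem false false = refl

  D-uncross : {N : ℕ} (mate : Fin N → Fin N) (w A B : S N) →
    D mate w A + D mate w B ≡ (D mate w (λ v → A v ∧ B v) + D mate w (λ v → A v ∨ B v)) + (# (diag mate w A B) + # (diag mate w A B))
  D-uncross mate w A B = trans (cong₂ _+_ (#-def _) (#-def _)) (trans (sym (sum-+ _ _)) (trans (sum-cong (λ v → eqN (lem (w v) (A v) (A (mate v)) (B v) (B (mate v)))))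
    (trans (sum-+ _ _) (cong₂ _+_ (trans (sum-+ _ _) (cong₂ _+_ (sym (#-def _)) (sym (#-def _)))) (trans (sum-+ _ _) (cong₂ _+_ (sym (#-def _)) (sym (#-def _))))))))
    where
    dg : Bool → Bool → Bool → Bool → Bool → Bool
    dg w a a′ b b′ = w ∧ ((a ∧ (not b ∧ (b′ ∧ not a′))) ∨ (b ∧ (not a ∧ (a′ ∧ not b′))))
    lem : Holds 5 (λ w a a′ b b′ → (ind (w ∧ (a xor a′)) + ind (w ∧ (b xor b′))) ≡ᵇ
      ((ind (w ∧ ((a ∧ b) xor (a′ ∧ b′))) + ind (w ∧ ((a ∨ b) xor (a′ ∨ b′)))) + (ind (dg w a a′ b b′) + ind (dg w a a′ b b′))))
    lem = tauto 5 _ refl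

D-sub : {N : ℕ} (mate : Fin N → Fin N) (w A B : S N) →
  D mate w (λ v → A v ∧ B v) + D mate w (λ v → A v ∨ B v) ≤ D mate w A + D mate w B
D-sub mate w A B = ≤-trans (m≤m+n _ _) (≤-reflexive (sym (D-uncross mate w A B)))

-- Submodularity for `A` and the complement of `B`, which has the same cut as `B`.
D-sub∖ : {N : ℕ} (mate : Fin N → Fin N) (w A B : S N) →
  D mate w (λ v → A v ∧ not (B v)) + D mate w (λ v → B v ∧ not (A v)) ≤ D mate w A + D mate w B
D-sub∖ mate w A B = subst₂ _≤_
  (cong (D mate w (λ v → A v ∧ not (B v)) +_) (trans (sym (D-not mate w (λ v → A v ∨ not (B v)))) (D-cong mate w (λ v → lem (A v) (B v)))))
  (cong (D mate w A +_) (D-not mate w B)) (D-sub mate w A (λ v → not (B v)))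
  where
  lem : ∀ a b → not (a ∨ not b) ≡ (b ∧ not a)
  lem true true = refl
  lem true false = refl
  lem false true = refl
  lem false false = refl

module _ {N : ℕ} {mate : Fin N → Fin N} (I : Invol mate) where

  opaque
    unfolding D

    -- Only the edge at `u` can enter the cut, and it is counted at both of its ends.
    D-point : (w Z Z′ : S N) (u : Fin N) → (∀ v → v ≢ u → Z v ≡ Z′ v) → D mate w Z ≤ D mate w Z′ + 2
    D-point w Z Z′ u h = subst (D mate w Z ≤_) (cong (D mate w Z′ +_) (cong₂ _+_ (#-single u) (#-single (mate u))))
      (≤-trans (#≤2 _ _ _ lem) (+-monoʳ-≤ (D mate w Z′) (#-∨ (λ v → v == u) (λ v → v == mate u))))
      where
      lem : ∀ v → ind (w v ∧ (Z v xor Z (mate v))) ≤ ind (w v ∧ (Z′ v xor Z′ (mate v))) + ind ((v == u) ∨ (v == mate u))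
      lem v with v ≟F u
      ... | yes refl rewrite ==-refl v = ≤-trans (ind≤1 _) (m≤n+m 1 _)
      ... | no ne with v ≟F mate u
      ... | yes refl rewrite ∨-inr {v == u} (==-refl v) = ≤-trans (ind≤1 _) (m≤n+m 1 _)
      ... | no ne′ rewrite h v ne | h (mate v) (λ e → ne′ (trans (sym (mm I v)) (cong mate e))) = m≤m+n _ _

    -- An edge with both ends in `Z` contributes two to the number of darts in `Z`, an edge of the
    -- cut contributes one. Twice this number therefore differs from `D` by a multiple of four, and
    -- odd sets have cuts that are 2 modulo 4.
    D-parity : (w Z : S N) → (∀ v → w (mate v) ≡ w v) → Σ ℕ λ j → D mate w Z ≡ 4 * j + 2 * ind (par (# (λ v → w v ∧ Z v)))
    D-parity w Z winv with halve (# (λ v → w v ∧ Z v))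
    ... | q , e = q ∸ k , arith (D mate w Z) k q _ (trans main (cong (2 *_) e)) (ind≤1 (par (# (λ v → w v ∧ Z v))))
      where
      f : S N
      f v = w v ∧ (Z v ∧ Z (mate v))
      finv : ∀ v → f (mate v) ≡ f v
      finv v rewrite winv v | mm I v = eqB-≡ (tauto 3 (λ w a b → eqB (w ∧ (a ∧ b)) (w ∧ (b ∧ a))) refl (w v) (Z (mate v)) (Z v))
      k : ℕ
      k = # (λ v → f v ∧ half I v)
      main : D mate w Z + 2 * (k + k) ≡ 2 * # (λ v → w v ∧ Z v)
      main = begin
        D mate w Z + 2 * (k + k) ≡⟨ cong (λ z → D mate w Z + 2 * z) (sym (#-half I f finv)) ⟩
        D mate w Z + 2 * # f ≡⟨ cong₂ _+_ (#-def _) (trans (cong (2 *_) (#-def f)) (sym (sum-* 2 _))) ⟩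
        _ ≡⟨ sum2≡ _ _ (λ v → ind (w v ∧ Z v)) (λ v → ind (w (mate v) ∧ Z (mate v))) (λ v → trans
               (eqN (tauto 3 (λ w a b → (ind (w ∧ (a xor b)) + 2 * ind (w ∧ (a ∧ b))) ≡ᵇ (ind (w ∧ a) + ind (w ∧ b))) refl (w v) (Z v) (Z (mate v))))
               (cong (λ x → ind (w v ∧ Z v) + ind (x ∧ Z (mate v))) (sym (winv v)))) ⟩
        sum (λ v → ind (w v ∧ Z v)) + sum (λ v → ind (w (mate v) ∧ Z (mate v))) ≡⟨ sym (cong₂ _+_ (#-def _) (#-def _)) ⟩
        # (λ v → w v ∧ Z v) + # (λ v → w (mate v) ∧ Z (mate v)) ≡⟨ cong (# (λ v → w v ∧ Z v) +_) (trans (#-mate I (λ v → w v ∧ Z v)) (sym (+-identityʳ _))) ⟩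
        2 * # (λ v → w v ∧ Z v) ∎
        where open ≡-Reasoning
      arith : ∀ d k q b → d + 2 * (k + k) ≡ 2 * (b + (q + q)) → b ≤ 1 → d ≡ 4 * (q ∸ k) + 2 * b
      arith d k q b e b≤1 with k ≤? q
      ... | yes le = +-cancelʳ-≡ (2 * (k + k)) d _ (trans e (trans (cong (λ z → 2 * (b + (z + z))) (sym (m∸n+n≡m le))) (r (q ∸ k) k b)))
        where
        r : ∀ x k b → 2 * (b + ((x + k) + (x + k))) ≡ (4 * x + 2 * b) + 2 * (k + k)
        r = solve-∀
      -- The subtraction does not truncate: `k` above `q` would force 4k ≤ 4q + 2.
      ... | no nle = ⊥-elim (<-irrefl refl (begin-strict
        4 * k                 ≡⟨ r₁ k ⟩
        2 * (k + k)           ≤⟨ m≤n+m _ d ⟩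
        d + 2 * (k + k)       ≡⟨ e ⟩
        2 * (b + (q + q))     ≡⟨ r₃ b q ⟩
        4 * q + 2 * b         ≤⟨ +-monoʳ-≤ (4 * q) (*-monoʳ-≤ 2 b≤1) ⟩
        4 * q + 2             <⟨ +-monoʳ-< (4 * q) {2} {4} (s≤s (s≤s (s≤s z≤n))) ⟩
        4 * q + 4             ≡⟨ r₂ q ⟩
        4 * (1 + q)           ≤⟨ *-monoʳ-≤ 4 (≰⇒> nle) ⟩
        4 * k                 ∎))
        where
        open ≤-Reasoning
        r₁ : ∀ k → 4 * k ≡ 2 * (k + k)
        r₁ = solve-∀
        r₂ : ∀ q → 4 * q + 4 ≡ 4 * (1 + q)
        r₂ = solve-∀
        r₃ : ∀ b q → 2 * (b + (q + q)) ≡ 4 * q + 2 * b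
        r₃ = solve-∀

∪₁-self : {N : ℕ} (f : S N) (u : Fin N) → (f ∪₁ u) u ≡ true
∪₁-self f u = ∨-inr {f u} (==-refl u)

∪₁-other : {N : ℕ} (f : S N) {u v : Fin N} → v ≢ u → (f ∪₁ u) v ≡ f v
∪₁-other f {u} {v} ne rewrite ==-false ne = lem (f v)
  where
  lem : ∀ a → (a ∨ false) ≡ a
  lem true = refl
  lem false = refl

∪₁-old : {N : ℕ} (f : S N) {u v : Fin N} → f v ≡ true → (f ∪₁ u) v ≡ true
∪₁-old f p = ∨-inl p

-- Splitting off a pair of edges

swp : {N : ℕ} → Fin N → Fin N → Fin N → Fin N
swp x y v = if v == x then y else if v == y then x else v

swp-l : {N : ℕ} (x y : Fin N) → swp x y x ≡ y
swp-l x y rewrite ==-refl x = refl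

swp-r : {N : ℕ} (x y : Fin N) → swp x y y ≡ x
swp-r x y with y ≟F x
... | yes refl rewrite ==-refl x = refl
... | no ne rewrite ==-false ne | ==-refl y = refl

swp-o : {N : ℕ} (x y : Fin N) {v : Fin N} → v ≢ x → v ≢ y → swp x y v ≡ v
swp-o x y p q rewrite ==-false p | ==-false q = refl

swp-swp : {N : ℕ} (x y v : Fin N) → swp x y (swp x y v) ≡ v
swp-swp x y v with v ≟F x
... | yes refl = trans (cong (swp x y) (swp-l x y)) (swp-r x y)
... | no p with v ≟F y
... | yes refl = trans (cong (swp x y) (swp-r x y)) (swp-l x y)
... | no q = trans (cong (swp x y) (swp-o x y p q)) (swp-o x y p q)

swp-fix : {N : ℕ} (Z : S N) (x y : Fin N) → Z x ≡ Z y → ∀ v → Z (swp x y v) ≡ Z v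
swp-fix Z x y e v with v ≟F x
... | yes refl = trans (cong Z (swp-l x y)) (sym e)
... | no p with v ≟F y
... | yes refl = trans (cong Z (swp-r x y)) e
... | no q = cong Z (swp-o x y p q)

-- Conjugation of `mate` by the transposition of `f` and `mate e`. It makes `e` and `f` partners and
-- joins their former partners to each other; being a conjugate, it is an involution without fixed
-- points, with no case distinction even if `mate e` is `f`.
repair : {N : ℕ} → (Fin N → Fin N) → Fin N → Fin N → Fin N → Fin N
repair mate e f v = swp f (mate e) (mate (swp f (mate e) v))

module _ {N : ℕ} {mate : Fin N → Fin N} (I : Invol mate) (e f : Fin N) (e≢f : e ≢ f) where

  private
    τ : Fin N → Fin N
    τ = swp f (mate e)
    mate′ : Fin N → Fin N
    mate′ = repair mate e f

  repair-Invol : Invol mate′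
  mm repair-Invol v = trans (cong (λ z → τ (mate z)) (swp-swp f (mate e) (mate (τ v)))) (trans (cong τ (mm I (τ v))) (swp-swp f (mate e) v))
  mf repair-Invol v p = mf I (τ v) (trans (sym (swp-swp f (mate e) (mate (τ v)))) (cong τ p))

  repair-e : mate′ e ≡ f
  repair-e = trans (cong (λ z → τ (mate z)) (swp-o f (mate e) e≢f (λ p → mf I e (sym p)))) (swp-r f (mate e))

  repair-f : mate′ f ≡ e
  repair-f = trans (cong mate′ (sym repair-e)) (mm repair-Invol e)

  repair-me : mate′ (mate e) ≡ mate f
  repair-me = trans (cong (λ z → τ (mate z)) (swp-r f (mate e))) (swp-o f (mate e) (mf I f)
    (λ p → e≢f (trans (sym (mm I e)) (trans (cong mate (sym p)) (mm I f)))))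

  repair-o : ∀ {v} → v ≢ e → v ≢ f → mate v ≢ e → mate v ≢ f → mate′ v ≡ mate v
  repair-o {v} a b c d = trans (cong (λ z → τ (mate z)) (swp-o f (mate e) b (λ p → c (trans (cong mate p) (mm I e)))))
    (swp-o f (mate e) d (λ p → a (trans (sym (mm I v)) (trans (cong mate p) (mm I e)))))

  repair-inv : (w : S N) → (∀ v → w (mate v) ≡ w v) → w e ≡ w f → ∀ v → w (mate′ v) ≡ w v
  repair-inv w winv h v = trans (fix _) (trans (winv _) (fix v))
    where
    fix : ∀ v → w (τ v) ≡ w v
    fix = swp-fix w f (mate e) (trans (sym h) (sym (winv e)))

  opaque
    unfolding D

    D-τ : (w Z : S N) → (∀ v → w (mate v) ≡ w v) → w e ≡ w f → D mate′ w Z ≡ D mate w (λ v → Z (τ v))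
    D-τ w Z winv h = trans (sym (#-perm τ τ (swp-swp f (mate e)) (swp-swp f (mate e)) _))
      (#-cong (λ v → cong₂ _∧_ (swp-fix w f (mate e) (trans (sym h) (sym (winv e))) v)
        (cong (λ z → Z (τ v) xor Z (τ (mate z))) (swp-swp f (mate e) v))))

    -- If `mate e` is outside `Z`, the transposition preserves `Z`. If it is inside, add `e` and `f`
    -- to `Z`: this does not change the repaired cut, since they are partners after the repair, and
    -- the enlarged set is preserved by the transposition.
    D-repair : (w Z : S N) → (∀ v → w (mate v) ≡ w v) → w e ≡ w f → Z e ≡ false → Z f ≡ false →
      (D mate′ w Z ≡ D mate w Z) ⊎ (D mate′ w Z ≡ D mate w (Z ∪₁ e ∪₁ f))
    D-repair w Z winv h ze zf with bool (Z (mate e))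
    ... | inj₂ p = inj₁ (trans (D-τ w Z winv h) (D-cong mate w (swp-fix Z f (mate e) (trans zf (sym p)))))
    ... | inj₁ p = inj₂ (trans (#-cong (λ v → cong (w v ∧_) (same v))) (trans (D-τ w Z⁺ winv h)
        (D-cong mate w (swp-fix Z⁺ f (mate e) (trans (∪₁-self (Z ∪₁ e) f) (sym (∪₁-old (Z ∪₁ e) (∪₁-old Z p))))))))
      where
      Z⁺ : S N
      Z⁺ = Z ∪₁ e ∪₁ f
      Z⁺e : Z⁺ e ≡ true
      Z⁺e = ∪₁-old (Z ∪₁ e) (∪₁-self Z e)
      Z⁺f : Z⁺ f ≡ true
      Z⁺f = ∪₁-self (Z ∪₁ e) f
      off : ∀ v → v ≢ e → v ≢ f → Z⁺ v ≡ Z v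
      off v a b = trans (∪₁-other (Z ∪₁ e) b) (∪₁-other Z a)
      same : ∀ v → (Z v xor Z (mate′ v)) ≡ (Z⁺ v xor Z⁺ (mate′ v))
      same v with v ≟F e
      ... | yes refl = trans (cong₂ _xor_ ze (trans (cong Z repair-e) zf)) (sym (cong₂ _xor_ Z⁺e (trans (cong Z⁺ repair-e) Z⁺f)))
      ... | no a with v ≟F f
      ... | yes refl = trans (cong₂ _xor_ zf (trans (cong Z repair-f) ze)) (sym (cong₂ _xor_ Z⁺f (trans (cong Z⁺ repair-f) Z⁺e)))
      ... | no b = cong₂ _xor_ (sym (off v a b))
              (sym (off (mate′ v) (λ p → b (trans (sym (mm repair-Invol v)) (trans (cong mate′ p) repair-e)))
                                  (λ p → a (trans (sym (mm repair-Invol v)) (trans (cong mate′ p) repair-f)))))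

module Undo {N : ℕ} {mate : Fin N → Fin N} (I : Invol mate) (e f : Fin N) (e≢f : e ≢ f) where

  -- The edge between the former partners of `e` and `f` is cut again into two edges, and both
  -- inherit its value.
  undo : S N → S N
  undo c v = if (v == e) ∨ (v == f) then c (mate e) else c v

  undo-e : ∀ c → undo c e ≡ c (mate e)
  undo-e c rewrite ==-refl e = refl
  undo-f : ∀ c → undo c f ≡ c (mate e)
  undo-f c rewrite ∨-inr {f == e} (==-refl f) = refl
  undo-o : ∀ c {v} → v ≢ e → v ≢ f → undo c v ≡ c v
  undo-o c p q rewrite ==-false p | ==-false q = refl

  undo-inv : ∀ c → (∀ v → c ((repair mate e f) v) ≡ c v) → ∀ v → undo c (mate v) ≡ undo c v
  undo-inv c h v with v ≟F e
  ... | yes refl = trans (at-me e (inj₁ refl)) (sym (undo-e c))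
    where
    at-me : ∀ u → (u ≡ e) ⊎ (u ≡ f) → undo c (mate u) ≡ c (mate e)
    at-me u (inj₁ refl) with mate e ≟F f
    ... | yes q = trans (cong (undo c) q) (undo-f c)
    ... | no q = undo-o c (mf I e) q
    at-me u (inj₂ refl) with mate f ≟F e
    ... | yes q = trans (cong (undo c) q) (undo-e c)
    ... | no q = trans (undo-o c q (mf I f)) (trans (cong c (sym (repair-me I e f e≢f))) (h (mate e)))
  ... | no n₁ with v ≟F f
  ... | yes refl = trans (at-mf) (sym (undo-f c))
    where
    at-mf : undo c (mate f) ≡ c (mate e)
    at-mf with mate f ≟F e
    ... | yes q = trans (cong (undo c) q) (undo-e c)
    ... | no q = trans (undo-o c q (mf I f)) (trans (cong c (sym (repair-me I e f e≢f))) (h (mate e)))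
  ... | no n₂ with mate v ≟F e
  ... | yes q = trans (cong (undo c) q) (trans (undo-e c) (trans (cong c (trans (cong mate (sym q)) (mm I v))) (sym (undo-o c n₁ n₂))))
  ... | no n₃ with mate v ≟F f
  ... | yes q = trans (cong (undo c) q) (trans (undo-f c) (trans (sym (h (mate e))) (trans (cong c (trans (repair-me I e f e≢f) (trans (cong mate (sym q)) (mm I v)))) (sym (undo-o c n₁ n₂)))))
  ... | no n₄ = trans (undo-o c n₃ n₄) (trans (trans (cong c (sym (repair-o I e f e≢f n₁ n₂ n₃ n₄))) (h v)) (sym (undo-o c n₁ n₂)))

-- Among four marked points, Z with exactly a and b added.
record Marked {N : ℕ} (Z X : S N) (a b c d : Fin N) : Set where
  constructor marked
  field
    in-a : X a ≡ true
    in-b : X b ≡ true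
    out-c : X c ≡ false
    out-d : X d ≡ false
    off : ∀ v → v ≢ a → v ≢ b → v ≢ c → v ≢ d → X v ≡ Z v

marked-∪ : {N : ℕ} (Z : S N) {a b c d : Fin N} → c ≢ a → c ≢ b → d ≢ a → d ≢ b → Z c ≡ false → Z d ≡ false → Marked Z (Z ∪₁ a ∪₁ b) a b c d
marked-∪ Z {a} {b} ca cb da db zc zd = marked (∪₁-old (Z ∪₁ a) (∪₁-self Z a)) (∪₁-self (Z ∪₁ a) b)
  (trans (∪₁-other (Z ∪₁ a) cb) (trans (∪₁-other Z ca) zc)) (trans (∪₁-other (Z ∪₁ a) db) (trans (∪₁-other Z da) zd))
  (λ v va vb _ _ → trans (∪₁-other (Z ∪₁ a) vb) (∪₁-other Z va))

marked-ab : {N : ℕ} {Z X : S N} {a b c d : Fin N} → Marked Z X a b c d → Marked Z X b a c d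
marked-ab (marked p q r s o) = marked q p r s (λ v b a c d → o v a b c d)

marked-cd : {N : ℕ} {Z X : S N} {a b c d : Fin N} → Marked Z X a b c d → Marked Z X a b d c
marked-cd (marked p q r s o) = marked p q s r (λ v a b d c → o v a b c d)

module _ {N : ℕ} {mate : Fin N → Fin N} (I : Invol mate) (w : S N) where

  Odd : S N → Set
  Odd Z = par (# (λ v → w v ∧ Z v)) ≡ true

  odd? : ∀ Z → Dec (Odd Z)
  odd? Z = _ ≟B _

  odd-∩ : ∀ A B → Odd A → Odd (λ v → A v ∧ B v) ⊎ Odd (λ v → A v ∧ not (B v))
  odd-∩ A B p with bool (par (# (λ v → w v ∧ (A v ∧ B v))))
  ... | inj₁ q = inj₁ q
  ... | inj₂ q = inj₂ (lem _ _ (trans (sym (par-+ (# (λ v → w v ∧ (A v ∧ B v))) (# (λ v → w v ∧ (A v ∧ not (B v)))))) (trans (cong par (sym eq)) p)) q)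
    where
    lem : ∀ a b → (a xor b) ≡ true → a ≡ false → b ≡ true
    lem false b p refl = p
    eq : # (λ v → w v ∧ A v) ≡ # (λ v → w v ∧ (A v ∧ B v)) + # (λ v → w v ∧ (A v ∧ not (B v)))
    eq = trans (#-split (λ v → w v ∧ A v) B) (cong₂ _+_ (#-cong (λ v → ass (w v) (A v) (B v))) (#-cong (λ v → ass (w v) (A v) (not (B v)))))
      where
      ass : ∀ a b c → ((a ∧ b) ∧ c) ≡ (a ∧ (b ∧ c))
      ass true b c = refl
      ass false b c = refl

  odd-∪ : ∀ A B → Odd A → Odd B → Odd (λ v → A v ∧ B v) → Odd (λ v → A v ∨ B v)
  odd-∪ A B p q r = lem _ _ (trans (sym (par-+ (# (λ v → w v ∧ (A v ∨ B v))) (# (λ v → w v ∧ (A v ∧ B v)))))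
      (trans (cong par (sym eq)) (trans (par-+ (# (λ v → w v ∧ A v)) (# (λ v → w v ∧ B v))) (cong₂ _xor_ p q)))) r
    where
    lem : ∀ a b → (a xor b) ≡ false → b ≡ true → a ≡ true
    lem true b p q = refl
    lem false b p q = tf q p
    eq : # (λ v → w v ∧ A v) + # (λ v → w v ∧ B v) ≡ # (λ v → w v ∧ (A v ∨ B v)) + # (λ v → w v ∧ (A v ∧ B v))
    eq = #2≡ _ _ _ _ (λ v → eqN (tauto 3 (λ w a b → (ind (w ∧ a) + ind (w ∧ b)) ≡ᵇ (ind (w ∧ (a ∨ b)) + ind (w ∧ (a ∧ b)))) refl (w v) (A v) (B v)))

  odd-∖′ : ∀ A B → Odd A → Odd B → Odd (λ v → A v ∧ not (B v)) → Odd (λ v → B v ∧ not (A v))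
  odd-∖′ A B p q r = lem _ _ (trans (sym (par-+ (# (λ v → w v ∧ (B v ∧ not (A v)))) (# (λ v → w v ∧ A v))))
      (trans (cong par eq) (trans (par-+ (# (λ v → w v ∧ (A v ∧ not (B v)))) (# (λ v → w v ∧ B v))) (cong₂ _xor_ r q)))) p
    where
    lem : ∀ a b → (a xor b) ≡ false → b ≡ true → a ≡ true
    lem true b p q = refl
    lem false b p q = tf q p
    eq : # (λ v → w v ∧ (B v ∧ not (A v))) + # (λ v → w v ∧ A v) ≡ # (λ v → w v ∧ (A v ∧ not (B v))) + # (λ v → w v ∧ B v)
    eq = #2≡ _ _ _ _ (λ v → eqN (tauto 3 (λ w a b → (ind (w ∧ (b ∧ not a)) + ind (w ∧ a)) ≡ᵇ (ind (w ∧ (a ∧ not b)) + ind (w ∧ b))) refl (w v) (A v) (B v)))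

  -- A family of sets whose odd members have large cuts.
  record Family : Set₁ where
    field
      C : S N → Set
      C-ext : Ext C
      C? : ∀ W → Dec (C W)
      C-∩ : ∀ {A B} → C A → C B → C (λ v → A v ∧ B v)
      C-∪ : ∀ {A B} → C A → C B → C (λ v → A v ∨ B v)
      C-∖ : ∀ {A B} → C A → C B → C (λ v → A v ∧ not (B v))
      winv : ∀ v → w (mate v) ≡ w v
      -- As `D` counts an edge twice, the bound below stands for 2K + 1 edges. The value 2 serves
      -- for splitting off circuits of length four, the value 1 for Frink's reduction.
      K : ℕ
      h₀ : ∀ W → C W → Odd W → 4 * K + 2 ≤ D mate w W

  module Splitting (F : Family) where
    open Family F

    -- Four darts outside all members of the family; adding all of them keeps cuts large.
    record Quad (P : S N) (a b c d : Fin N) : Set where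
      field
        ab : a ≢ b
        ac : a ≢ c
        ad : a ≢ d
        bc : b ≢ c
        bd : b ≢ d
        cd : c ≢ d
        wa : w a ≡ true
        wb : w b ≡ true
        wc : w c ≡ true
        wd : w d ≡ true
        Pa : P a ≡ true
        Pb : P b ≡ true
        Pc : P c ≡ true
        Pd : P d ≡ true
        P-off : ∀ v → v ≢ a → v ≢ b → v ≢ c → v ≢ d → P v ≡ false
        C-off : ∀ W → C W → (W a ≡ false) × (W b ≡ false) × (W c ≡ false) × (W d ≡ false)
        h₄ : ∀ W → C W → Odd W → 4 * K + 2 ≤ D mate w (λ v → W v ∨ P v)
    open Quad

    private
      neq : {u v : Fin N} → u ≢ v → v ≢ u
      neq n e = n (sym e)

    turn : ∀ {P a b c d} → Quad P a b c d → Quad P d a b c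
    turn q = record { ab = neq (ad q) ; ac = neq (bd q) ; ad = neq (cd q) ; bc = ab q ; bd = ac q ; cd = bc q ; wa = wd q ; wb = wa q ; wc = wb q ; wd = wc q ; Pa = Pd q ; Pb = Pa q ; Pc = Pb q ; Pd = Pc q
      ; P-off = λ v d a b c → P-off q v a b c d ; C-off = λ W i → let (a , b , c , d) = C-off q W i in d , a , b , c ; h₄ = h₄ q }

    swap : ∀ {P a b c d} → Quad P a b c d → Quad P b a c d
    swap q = record { ab = neq (ab q) ; ac = bc q ; ad = bd q ; bc = ac q ; bd = ad q ; cd = cd q ; wa = wb q ; wb = wa q ; wc = wc q ; wd = wd q ; Pa = Pb q ; Pb = Pa q ; Pc = Pc q ; Pd = Pd q
      ; P-off = λ v b a c d → P-off q v a b c d ; C-off = λ W i → let (a , b , c , d) = C-off q W i in b , a , c , d ; h₄ = h₄ q }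

    -- X is an odd member of the family together with a and b, and its cut is too small.
    record Violation (a b c d : Fin N) : Set where
      field
        Z X : S N
        inC : C Z
        odd : Odd Z
        mark : Marked Z X a b c d
        less : D mate w X + 4 ≤ 4 * K + 2
    open Violation

    viol-ab : ∀ {a b c d} → Violation a b c d → Violation b a c d
    viol-ab v = record { Z = Z v ; X = X v ; inC = inC v ; odd = odd v ; mark = marked-ab (mark v) ; less = less v }

    viol-cd : ∀ {a b c d} → Violation a b c d → Violation a b d c
    viol-cd v = record { Z = Z v ; X = X v ; inC = inC v ; odd = odd v ; mark = marked-cd (mark v) ; less = less v }

    private
      -- The uncrossed cuts fall short of `B` by at most two each, the violating ones by at least
      -- four each, which contradicts submodularity.
      arith : ∀ B {a b c d} → a + b ≤ c + d → B ≤ a + 2 → B ≤ b + 2 → c + 4 ≤ B → d + 4 ≤ B → ⊥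
      arith B {a} {b} {c} {d} p q r s t = m+1+n≰m (B + B) {3} (begin
        B + B + 4 ≤⟨ +-monoˡ-≤ 4 (+-mono-≤ q r) ⟩
        (a + 2) + (b + 2) + 4 ≡⟨ l₁ a b ⟩
        (a + b) + 8 ≤⟨ +-monoˡ-≤ 8 p ⟩
        (c + d) + 8 ≡⟨ l₂ c d ⟩
        (c + 4) + (d + 4) ≤⟨ +-mono-≤ s t ⟩
        B + B ∎)
        where
        open ≤-Reasoning
        l₁ : ∀ a b → (a + 2) + (b + 2) + 4 ≡ (a + b) + 8
        l₁ = solve-∀
        l₂ : ∀ c d → (c + d) + 8 ≡ (c + 4) + (d + 4)
        l₂ = solve-∀

      -- Odd sets have cuts that are 2 modulo 4, so a cut below the bound is below it by four.
      gap : ∀ {mate′} → Invol mate′ → (∀ v → w (mate′ v) ≡ w v) → ∀ W → Odd W → D mate′ w W < 4 * K + 2 → D mate′ w W + 4 ≤ 4 * K + 2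
      gap {mate′} I′ winv′ W o lt = go (D-parity I′ w W winv′)
        where
        l : ∀ j → 4 * j + 2 + 4 ≡ 4 * (1 + j) + 2
        l = solve-∀
        up : ∀ j → 4 * j + 2 < 4 * K + 2 → 4 * j + 2 + 4 ≤ 4 * K + 2
        up j lt = ≤-trans (≤-reflexive (l j)) (+-monoˡ-≤ 2 (*-monoʳ-≤ 4 (*-cancelˡ-< 4 j K (+-cancelʳ-< 2 (4 * j) (4 * K) lt))))
        go : (Σ ℕ λ j → D mate′ w W ≡ 4 * j + 2 * ind (par (# (λ v → w v ∧ W v)))) → D mate′ w W + 4 ≤ 4 * K + 2
        go (j , e) = subst (λ y → y + 4 ≤ 4 * K + 2) (sym e′) (up j (subst (_< 4 * K + 2) e′ lt))
          where
          e′ : D mate′ w W ≡ 4 * j + 2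
          e′ = trans e (cong (λ b → 4 * j + 2 * ind b) o)

      module Uncross {P x y z t} (Q : Quad P x y z t) (V₁ : Violation x y z t) (V₂ : Violation x z y t) where
        open Violation V₁ renaming (Z to Z₁; X to X₁; inC to c₁; odd to o₁; mark to m₁; less to b₁)
        open Violation V₂ renaming (Z to Z₂; X to X₂; inC to c₂; odd to o₂; mark to m₂; less to b₂)
        open Marked m₁ renaming (in-a to 1x; in-b to 1y; out-c to 1z; out-d to 1t; off to 1o)
        open Marked m₂ renaming (in-a to 2x; in-b to 2z; out-c to 2y; out-d to 2t; off to 2o)
        Z₁o = C-off Q Z₁ c₁
        Z₂o = C-off Q Z₂ c₂

        -- Of the four marked points, `X₁` and `X₂` share only `x`; so the intersection agrees with
        -- that of members of the family except at `x`. In the same way the union is off by `t`, and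
        -- the two differences by `y` and by `z`.
        ptx : ∀ v → v ≢ x → (Z₁ v ∧ Z₂ v) ≡ (X₁ v ∧ X₂ v)
        ptx v nx = go (v ≟F y) (v ≟F z) (v ≟F t)
          where
          go : Dec (v ≡ y) → Dec (v ≡ z) → Dec (v ≡ t) → (Z₁ v ∧ Z₂ v) ≡ (X₁ v ∧ X₂ v)
          go (yes refl) _ _ = trans (∧-false₁ (proj₁ (proj₂ Z₁o))) (sym (∧-false₂ {X₁ y} 2y))
          go _ (yes refl) _ = trans (∧-false₁ (proj₁ (proj₂ (proj₂ Z₁o)))) (sym (∧-false₁ 1z))
          go _ _ (yes refl) = trans (∧-false₁ (proj₂ (proj₂ (proj₂ Z₁o)))) (sym (∧-false₁ 1t))
          go (no ny) (no nz) (no nt) = sym (cong₂ _∧_ (1o v nx ny nz nt) (2o v nx nz ny nt))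

        ptt : ∀ v → v ≢ t → ((Z₁ v ∨ Z₂ v) ∨ P v) ≡ (X₁ v ∨ X₂ v)
        ptt v nt = go (v ≟F x) (v ≟F y) (v ≟F z)
          where
          lem : ∀ a b {c} → c ≡ false → ((a ∨ b) ∨ c) ≡ (a ∨ b)
          lem true b refl = refl
          lem false true refl = refl
          lem false false refl = refl
          go : Dec (v ≡ x) → Dec (v ≡ y) → Dec (v ≡ z) → ((Z₁ v ∨ Z₂ v) ∨ P v) ≡ (X₁ v ∨ X₂ v)
          go (yes refl) _ _ = trans (∨-inr {Z₁ x ∨ Z₂ x} (Pa Q)) (sym (∨-inl 1x))
          go _ (yes refl) _ = trans (∨-inr {Z₁ y ∨ Z₂ y} (Pb Q)) (sym (∨-inl 1y))
          go _ _ (yes refl) = trans (∨-inr {Z₁ z ∨ Z₂ z} (Pc Q)) (sym (∨-inr {X₁ z} 2z))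
          go (no nx) (no ny) (no nz) = trans (lem (Z₁ v) (Z₂ v) (P-off Q v nx ny nz nt)) (sym (cong₂ _∨_ (1o v nx ny nz nt) (2o v nx nz ny nt)))

        pty : ∀ v → v ≢ y → (Z₁ v ∧ not (Z₂ v)) ≡ (X₁ v ∧ not (X₂ v))
        pty v ny = go (v ≟F x) (v ≟F z) (v ≟F t)
          where
          go : Dec (v ≡ x) → Dec (v ≡ z) → Dec (v ≡ t) → (Z₁ v ∧ not (Z₂ v)) ≡ (X₁ v ∧ not (X₂ v))
          go (yes refl) _ _ = trans (∧-false₁ (proj₁ Z₁o)) (sym (∧-false₂ {X₁ x} (not-f 2x)))
          go _ (yes refl) _ = trans (∧-false₁ (proj₁ (proj₂ (proj₂ Z₁o)))) (sym (∧-false₁ 1z))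
          go _ _ (yes refl) = trans (∧-false₁ (proj₂ (proj₂ (proj₂ Z₁o)))) (sym (∧-false₁ 1t))
          go (no nx) (no nz) (no nt) = sym (cong₂ (λ a b → a ∧ not b) (1o v nx ny nz nt) (2o v nx nz ny nt))

        ptz : ∀ v → v ≢ z → (Z₂ v ∧ not (Z₁ v)) ≡ (X₂ v ∧ not (X₁ v))
        ptz v nz = go (v ≟F x) (v ≟F y) (v ≟F t)
          where
          go : Dec (v ≡ x) → Dec (v ≡ y) → Dec (v ≡ t) → (Z₂ v ∧ not (Z₁ v)) ≡ (X₂ v ∧ not (X₁ v))
          go (yes refl) _ _ = trans (∧-false₁ (proj₁ Z₂o)) (sym (∧-false₂ {X₂ x} (not-f 1x)))
          go _ (yes refl) _ = trans (∧-false₁ (proj₁ (proj₂ Z₂o))) (sym (∧-false₁ 2y))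
          go _ _ (yes refl) = trans (∧-false₁ (proj₂ (proj₂ (proj₂ Z₂o)))) (sym (∧-false₁ 2t))
          go (no nx) (no ny) (no nt) = sym (cong₂ (λ a b → a ∧ not b) (2o v nx nz ny nt) (1o v nx ny nz nt))

        -- Each of the sets obtained by uncrossing has one marked point inside or one outside.
        absurd : ⊥
        absurd = [ (λ o → arith (4 * K + 2) (D-sub mate w X₁ X₂) (≤-trans (h₀ _ (C-∩ c₁ c₂) o) (D-point I w _ _ x ptx))
                     (≤-trans (h₄ Q _ (C-∪ c₁ c₂) (odd-∪ Z₁ Z₂ o₁ o₂ o)) (D-point I w _ _ t ptt)) b₁ b₂)
                 , (λ o → arith (4 * K + 2) (D-sub∖ mate w X₁ X₂) (≤-trans (h₀ _ (C-∖ c₁ c₂) o) (D-point I w _ _ y pty))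
                     (≤-trans (h₀ _ (C-∖ c₂ c₁) (odd-∖′ Z₁ Z₂ o₁ o₂ o)) (D-point I w _ _ z ptz)) b₁ b₂) ]′ (odd-∩ Z₁ Z₂ o₁)

      module Twice {P p q r s} (Q : Quad P p q r s) (W : S N) (c : C W) (o : Odd W) (lt : D (repair (repair mate p q) r s) w W < 4 * K + 2) where
        I′ : Invol (repair mate p q)
        I′ = repair-Invol I p q (ab Q)
        winv′ : ∀ v → w (repair mate p q v) ≡ w v
        winv′ = repair-inv I p q (ab Q) w winv (trans (wa Q) (sym (wb Q)))
        zs = C-off Q W c
        small : D (repair (repair mate p q) r s) w W + 4 ≤ 4 * K + 2
        small = gap (repair-Invol I′ r s (cd Q)) (repair-inv I′ r s (cd Q) w winv′ (trans (wc Q) (sym (wd Q)))) W o lt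
        W₂ W₃ : S N
        W₂ = W ∪₁ r ∪₁ s
        W₃ = W₂ ∪₁ p
        quad : ∀ v → (W₃ ∪₁ q) v ≡ (W v ∨ P v)
        quad v = go (v ≟F q) (v ≟F p) (v ≟F s) (v ≟F r)
          where
          lem : ∀ a → a ≡ (a ∨ false)
          lem true = refl
          lem false = refl
          go : Dec (v ≡ q) → Dec (v ≡ p) → Dec (v ≡ s) → Dec (v ≡ r) → (W₃ ∪₁ q) v ≡ (W v ∨ P v)
          go (yes refl) _ _ _ = trans (∪₁-self W₃ q) (sym (∨-inr {W q} (Pb Q)))
          go _ (yes refl) _ _ = trans (∪₁-old W₃ (∪₁-self W₂ p)) (sym (∨-inr {W p} (Pa Q)))
          go _ _ (yes refl) _ = trans (∪₁-old W₃ (∪₁-old W₂ (∪₁-self (W ∪₁ r) s))) (sym (∨-inr {W s} (Pd Q)))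
          go _ _ _ (yes refl) = trans (∪₁-old W₃ (∪₁-old W₂ (∪₁-old (W ∪₁ r) (∪₁-self W r)))) (sym (∨-inr {W r} (Pc Q)))
          go (no nq) (no np) (no ns) (no nr) = trans (trans (∪₁-other W₃ nq) (trans (∪₁-other W₂ np) (trans (∪₁-other (W ∪₁ r) ns) (∪₁-other W nr)))) (trans (lem (W v)) (cong (W v ∨_) (sym (P-off Q v np nq nr ns))))

        -- By `D-repair` for both pairs, the repaired cut of `W` is the old cut of `W` with no pair,
        -- one pair or both pairs added. The first is large by `h₀` and the last by `h₄`, so a small
        -- cut comes from exactly one pair.
        result : Violation p q r s ⊎ Violation r s p q
        result = [ first , second ]′ (D-repair I′ r s (cd Q) w W winv′ (trans (wc Q) (sym (wd Q))) (proj₁ (proj₂ (proj₂ zs))) (proj₂ (proj₂ (proj₂ zs))))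
          where
          first : D (repair (repair mate p q) r s) w W ≡ D (repair mate p q) w W → Violation p q r s ⊎ Violation r s p q
          first e₁ = [ (λ e₂ → ⊥-elim (<⇒≱ lt (subst (4 * K + 2 ≤_) (sym (trans e₁ e₂)) (h₀ W c o))))
            , (λ e₂ → inj₁ (record { Z = W ; X = W ∪₁ p ∪₁ q ; inC = c ; odd = o ; mark = marked-∪ W (neq (ac Q)) (neq (bc Q)) (neq (ad Q)) (neq (bd Q)) (proj₁ (proj₂ (proj₂ zs))) (proj₂ (proj₂ (proj₂ zs)))
                ; less = subst (λ z → z + 4 ≤ 4 * K + 2) (trans e₁ e₂) small })) ]′ (D-repair I p q (ab Q) w W winv (trans (wa Q) (sym (wb Q))) (proj₁ zs) (proj₁ (proj₂ zs)))
          second : D (repair (repair mate p q) r s) w W ≡ D (repair mate p q) w W₂ → Violation p q r s ⊎ Violation r s p q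
          second e₁ = [ (λ e₂ → inj₂ (record { Z = W ; X = W₂ ; inC = c ; odd = o ; mark = marked-∪ W (ac Q) (ad Q) (bc Q) (bd Q) (proj₁ zs) (proj₁ (proj₂ zs)) ; less = subst (λ z → z + 4 ≤ 4 * K + 2) (trans e₁ e₂) small }))
            , (λ e₂ → ⊥-elim (<⇒≱ lt (subst (4 * K + 2 ≤_) (sym (trans e₁ (trans e₂ (D-cong mate w quad)))) (h₄ Q W c o)))) ]′
            (D-repair I p q (ab Q) w W₂ winv (trans (wa Q) (sym (wb Q))) (trans (∪₁-other (W ∪₁ r) (ad Q)) (trans (∪₁-other W (ac Q)) (proj₁ zs))) (trans (∪₁-other (W ∪₁ r) (bd Q)) (trans (∪₁-other W (bc Q)) (proj₁ (proj₂ zs)))))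

    Good : (Fin N → Fin N) → Set
    Good mate′ = ∀ W → C W → Odd W → 4 * K + 2 ≤ D mate′ w W

    private
      good? : ∀ mate′ → Good mate′ ⊎ (Σ (S N) λ W → C W × Odd W × (D mate′ w W < 4 * K + 2))
      good? mate′ = go (search (λ h (c , o , lt) → C-ext h c , trans (cong par (#-cong (λ v → cong (w v ∧_) (sym (h v))))) o , subst (_< 4 * K + 2) (D-cong mate′ w h) lt) (λ W → C? W ×-dec (odd? W ×-dec (_ <? _))))
        where
        go : Dec (Σ (S N) λ W → C W × Odd W × (D mate′ w W < 4 * K + 2)) → Good mate′ ⊎ (Σ (S N) λ W → C W × Odd W × (D mate′ w W < 4 * K + 2))
        go (no nb) = inj₁ (λ W c o → ≮⇒≥ (λ lt → nb (W , c , o , lt)))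
        go (yes b) = inj₂ b

    -- If both ways of pairing neighbours failed, each would give a small set containing one of its
    -- pairs. Pairs from different pairings share exactly one dart, and then uncrossing is
    -- contradictory.
    splitting : ∀ {P v₀ v₁ v₂ v₃} → Quad P v₀ v₁ v₂ v₃ → Good (repair (repair mate v₀ v₁) v₂ v₃) ⊎ Good (repair (repair mate v₃ v₀) v₁ v₂)
    splitting {P} {v₀} {v₁} {v₂} {v₃} Q = [ inj₁ , (λ b₁ → [ inj₂ , (λ b₂ → ⊥-elim (both b₁ b₂)) ]′ (good? _)) ]′ (good? _)
      where
      Q′ : Quad P v₃ v₀ v₁ v₂
      Q′ = turn Q
      cases : Violation v₀ v₁ v₂ v₃ ⊎ Violation v₂ v₃ v₀ v₁ → Violation v₃ v₀ v₁ v₂ ⊎ Violation v₁ v₂ v₃ v₀ → ⊥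
      -- The darts are renamed so that the shared one becomes `x` and the one in neither pair
      -- becomes `t`.
      cases (inj₁ x) (inj₁ y) = Uncross.absurd (turn (turn (swap (turn (turn Q))))) (viol-cd x) (viol-ab y)
      cases (inj₁ x) (inj₂ y) = Uncross.absurd (swap Q) (viol-ab x) (viol-cd y)
      cases (inj₂ x) (inj₁ y) = Uncross.absurd (swap (turn (turn Q))) (viol-ab x) (viol-cd y)
      cases (inj₂ x) (inj₂ y) = Uncross.absurd (turn (turn (swap Q))) (viol-cd x) (viol-ab y)
      both : (Σ (S N) λ W → C W × Odd W × (D (repair (repair mate v₀ v₁) v₂ v₃) w W < 4 * K + 2)) → (Σ (S N) λ W → C W × Odd W × (D (repair (repair mate v₃ v₀) v₁ v₂) w W < 4 * K + 2)) → ⊥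
      both (W₁ , c₁ , o₁ , l₁) (W₂ , c₂ , o₂ , l₂) = cases (Twice.result Q W₁ c₁ o₁ l₁) (Twice.result Q′ W₂ c₂ o₂ l₂)

-- Cycles. V = Fin N carries a permutation σ (the 2-factor) and a matching mate.
-- z marks matching edges (at both ends), s v is the value on the edge from v to σ v.

infixl 6 _⊕_
_⊕_ : {N : ℕ} → S N → S N → S N
(f ⊕ g) v = f v xor g v

δ : {N : ℕ} → Fin N → S N
δ u v = v == u

-- Even degree at the vertex `σ v`, whose three edges carry `s v`, `s (σ v)` and `q (σ v)`.
Bal : {N : ℕ} → (Fin N → Fin N) → S N → S N → Set
Bal σ s q = ∀ v → s (σ v) ≡ (s v xor q (σ v))

Ev : {N : ℕ} → (Fin N → Fin N) → S N → Set
Ev {N} σ q = Σ (S N) λ s → Bal σ s q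

record Perm {N : ℕ} (σ σ⁻ : Fin N → Fin N) : Set where
  field
    σσ⁻ : ∀ v → σ (σ⁻ v) ≡ v
    σ⁻σ : ∀ v → σ⁻ (σ v) ≡ v

xor4 : ∀ a b c d → ((a xor b) xor (c xor d)) ≡ ((a xor c) xor (b xor d))
xor4 a b c d = eqB-≡ (tauto 4 (λ a b c d → eqB ((a xor b) xor (c xor d)) ((a xor c) xor (b xor d))) refl a b c d)

bal-⊕ : {N : ℕ} {σ : Fin N → Fin N} {s q s′ q′ : S N} → Bal σ s q → Bal σ s′ q′ → Bal σ (s ⊕ s′) (q ⊕ q′)
bal-⊕ {σ = σ} {s} {q} {s′} {q′} b b′ v = trans (cong₂ _xor_ (b v) (b′ v)) (xor4 (s v) (q (σ v)) (s′ v) (q′ (σ v)))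

ev-⊕ : {N : ℕ} {σ : Fin N → Fin N} {q q′ : S N} → Ev σ q → Ev σ q′ → Ev σ (q ⊕ q′)
ev-⊕ {σ = σ} {q} {q′} (s , b) (s′ , b′) = s ⊕ s′ , bal-⊕ {σ = σ} {s} {q} {s′} {q′} b b′

ev-ext : {N : ℕ} {σ : Fin N → Fin N} {q q′ : S N} → (∀ v → q v ≡ q′ v) → Ev σ q → Ev σ q′
ev-ext {σ = σ} h (s , b) = s , λ v → trans (b v) (cong (s v xor_) (h (σ v)))

ev-∅ : {N : ℕ} {σ : Fin N → Fin N} {q : S N} → (∀ v → q v ≡ false) → Ev σ q
ev-∅ {σ = σ} h = (λ _ → false) , λ v → sym (h (σ v))

ev? : {N : ℕ} (σ : Fin N → Fin N) (q : S N) → Dec (Ev σ q)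
ev? σ q = search (λ {f} {g} h b v → trans (sym (h (σ v))) (trans (b v) (cong (_xor q (σ v)) (h v)))) (λ s → all? (λ v → _ ≟B _))

module Cycles {N : ℕ} {σ σ⁻ : Fin N → Fin N} (π : Perm σ σ⁻) where
  open Perm π public

  σ-inj : ∀ {u v} → σ u ≡ σ v → u ≡ v
  σ-inj {u} {v} e = trans (sym (σ⁻σ u)) (trans (cong σ⁻ e) (σ⁻σ v))

  σ-inj-== : ∀ u v → (σ u == σ v) ≡ (u == v)
  σ-inj-== u v with u ≟F v
  ... | yes refl = trans (==-refl (σ u)) (sym (==-refl u))
  ... | no ne = trans (==-false (λ e → ne (σ-inj e))) (sym (==-false ne))

  ev-step : ∀ u → Ev σ (δ u ⊕ δ (σ u))
  ev-step u = δ u , λ v → trans (lem (σ v == u) (v == u)) (cong (λ z → (v == u) xor ((σ v == u) xor z)) (sym (σ-inj-== v u)))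
    where
    lem : ∀ a b → a ≡ (b xor (a xor b))
    lem a b = eqB-≡ (tauto 2 (λ a b → eqB a (b xor (a xor b))) refl a b)

  -- By balance `q (σ v)` is the sum of `s v` and `s (σ v)`; over an invariant set every value of
  -- `s` occurs twice.
  ev-par : ∀ {q} → Ev σ q → (Z : S N) → (∀ v → Z (σ v) ≡ Z v) → par (# (λ v → q v ∧ Z v)) ≡ false
  ev-par {q} (s , b) Z zinv = trans (cong par (trans (sym (#-perm σ σ⁻ σσ⁻ σ⁻σ _)) (#-cong pt)))
    (trans (par-xor (λ v → s (σ v) ∧ Z (σ v)) (λ v → s v ∧ Z v)) (xor-f (cong par (#-perm σ σ⁻ σσ⁻ σ⁻σ (λ v → s v ∧ Z v)))))
    where
    pt : ∀ v → (q (σ v) ∧ Z (σ v)) ≡ ((s (σ v) ∧ Z (σ v)) xor (s v ∧ Z v))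
    pt v rewrite b v | zinv v = eqB-≡ (tauto 3 (λ s q z → eqB (q ∧ z) (((s xor q) ∧ z) xor (s ∧ z))) refl (s v) (q (σ v)) (Z v))

  module Mate {mate : Fin N → Fin N} (I : Invol mate) where

    record Flow (z : S N) : Set where
      constructor flow
      field
        inv : ∀ v → z (mate v) ≡ z v
        even : Ev σ z
    open Flow public

    flow-⊕ : ∀ {z z′} → Flow z → Flow z′ → Flow (z ⊕ z′)
    flow-⊕ {z} {z′} (flow i e) (flow i′ e′) = flow (λ v → cong₂ _xor_ (i v) (i′ v)) (ev-⊕ {q = z} {z′} e e′)

    flow-∅ : Flow (λ _ → false)
    flow-∅ = flow (λ _ → refl) (ev-∅ (λ _ → refl))

    flow-ext : ∀ {z z′} → (∀ v → z v ≡ z′ v) → Flow z → Flow z′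
    flow-ext h (flow i e) = flow (λ v → trans (sym (h (mate v))) (trans (i v) (h v))) (ev-ext h e)

    flow? : ∀ z → Dec (Flow z)
    flow? z = map′ (λ (i , e) → flow i e) (λ (flow i e) → i , e) (all? (λ v → z (mate v) ≟B z v) ×-dec ev? σ z)

    edge : Fin N → S N
    edge u = δ u ⊕ δ (mate u)

    edge-mate : ∀ u v → (mate v == u) ≡ (v == mate u)
    edge-mate u v with v ≟F mate u
    ... | yes refl = trans (cong (_== u) (mm I u)) (trans (==-refl u) (sym (==-refl (mate u))))
    ... | no ne = trans (==-false (λ e → ne (trans (sym (mm I v)) (cong mate e)))) (sym (==-false ne))

    edge-inv : ∀ u v → edge u (mate v) ≡ edge u v
    edge-inv u v = trans (cong₂ _xor_ (edge-mate u v) (trans (edge-mate (mate u) v) (cong (v ==_) (mm I u)))) (lem (v == mate u) (v == u))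
      where
      lem : ∀ a b → (a xor b) ≡ (b xor a)
      lem a b = eqB-≡ (tauto 2 (λ a b → eqB (a xor b) (b xor a)) refl a b)

    edge-self : ∀ u → edge u u ≡ true
    edge-self u = cong₂ _xor_ (==-refl u) (==-false (λ e → mf I u (sym e)))

    edge-other : ∀ u v → v ≢ u → v ≢ mate u → edge u v ≡ false
    edge-other u v p q = cong₂ _xor_ (==-false p) (==-false q)

    -- A cycle meets every cut in an even number of edges, and `D` counts each of them twice.
    flow-cut : ∀ {a} → Flow a → (Z : S N) → (∀ v → Z (σ v) ≡ Z v) → Σ ℕ λ j → D mate a Z ≡ 4 * j
    flow-cut {a} f Z zinv with D-parity I a Z (inv f)
    ... | j , e rewrite ev-par {a} (even f) Z zinv = j , trans e (+-identityʳ _)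

    -- Its classes are the components of the graph on the contracted circuits with edge set `T`. One
    -- end of an edge in `T` is enough, since closed sets do not see the direction of a link.
    lk : S N → Link N
    lk T u v = (v == σ u) ∨ (T u ∧ (v == mate u))

    closed-σ : ∀ {T Z} → Closed (lk T) Z → ∀ u → Z (σ u) ≡ Z u
    closed-σ c u = sym (c u (σ u) (∨-inl (==-refl (σ u))))

    closed-T : ∀ {T Z} → Closed (lk T) Z → ∀ u → T u ≡ true → Z (mate u) ≡ Z u
    closed-T c u t = sym (c u (mate u) (∨-inr {mate u == σ u} (∧-intro t (==-refl (mate u)))))

    closed-mk : ∀ {T Z} → (∀ u → Z (σ u) ≡ Z u) → (∀ u → T u ≡ true → Z (mate u) ≡ Z u) → Closed (lk T) Z
    closed-mk {T} {Z} p q u v l with ∨-case {v == σ u} l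
    ... | inj₁ e = sym (trans (cong Z (==-true e)) (p u))
    ... | inj₂ e = sym (trans (cong Z (==-true (∧-snd {T u} e))) (q u (∧-fst e)))

    lk-mono : ∀ {T T′} → (∀ v → T v ≡ true → T′ v ≡ true) → ∀ Z → Closed (lk T′) Z → Closed (lk T) Z
    lk-mono h Z c = closed-mk (closed-σ c) (λ u t → closed-T c u (h u t))

    conn-σ : ∀ T u → conn (lk T) u (σ u) ≡ true
    conn-σ T u = conn-link (lk T) (∨-inl (==-refl (σ u)))

    conn-T : ∀ T u → T u ≡ true → conn (lk T) u (mate u) ≡ true
    conn-T T u t = conn-link (lk T) (∨-inr {mate u == σ u} (∧-intro t (==-refl (mate u))))

    cl : S N → S N
    cl T v = T v ∨ T (mate v)

    -- A T-join in the sense of graph theory, after contraction of the circuits: `z` consists of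
    -- edges of `T` and is odd exactly at the circuits of `u` and `v`, or nowhere if these coincide.
    record Join (T : S N) (u v : Fin N) (z : S N) : Set where
      constructor join
      field
        jinv : ∀ w → z (mate w) ≡ z w
        supp : ∀ w → z w ≡ true → cl T w ≡ true
        jeven : Ev σ (z ⊕ (δ u ⊕ δ v))

    private
      join? : ∀ T u v → Dec (Σ (S N) (Join T u v))
      join? T u v = search
        (λ h (join i s e) → join (λ w → trans (sym (h (mate w))) (trans (i w) (h w))) (λ w p → s w (trans (h w) p)) (ev-ext (λ w → cong (_xor ((w == u) xor (w == v))) (h w)) e))
        (λ z → map′ (λ (i , s , e) → join i s e) (λ (join i s e) → i , s , e)
          (all? (λ w → z (mate w) ≟B z w) ×-dec (all? (λ w → (z w ≟B true) →-dec (cl T w ≟B true)) ×-dec ev? σ (z ⊕ (δ u ⊕ δ v)))))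

      join-refl : ∀ T u → Join T u u (λ _ → false)
      join-refl T u = join (λ _ → refl) (λ _ ()) (ev-∅ (λ v → xor-f {v == u} refl))

      join-trans : ∀ {T u v w z z′} → Join T u v z → Join T v w z′ → Join T u w (z ⊕ z′)
      join-trans {T} {u} {v} {w} {z} {z′} (join i s e) (join i′ s′ e′) = join (λ x → cong₂ _xor_ (i x) (i′ x)) sup
        (ev-ext (λ x → lem (z x) (z′ x) (x == u) (x == v) (x == w)) (ev-⊕ {q = z ⊕ (δ u ⊕ δ v)} {z′ ⊕ (δ v ⊕ δ w)} e e′))
        where
        lem : ∀ a b p q r → ((a xor (p xor q)) xor (b xor (q xor r))) ≡ ((a xor b) xor (p xor r))
        lem a b p q r = eqB-≡ (tauto 5 (λ a b p q r → eqB ((a xor (p xor q)) xor (b xor (q xor r))) ((a xor b) xor (p xor r))) refl a b p q r)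
        sup : ∀ x → (z x xor z′ x) ≡ true → cl T x ≡ true
        sup x p with bool (z x)
        ... | inj₁ q = s x q
        ... | inj₂ q = s′ x (trans (cong (_xor z′ x) (sym q)) p)

      join-sym : ∀ {T u v z} → Join T u v z → Join T v u z
      join-sym {u = u} {v} {z} (join i s e) = join i s (ev-ext (λ x → cong (z x xor_) (lem (x == u) (x == v))) e)
        where
        lem : ∀ a b → (a xor b) ≡ (b xor a)
        lem a b = eqB-≡ (tauto 2 (λ a b → eqB (a xor b) (b xor a)) refl a b)

    -- Connectivity by cuts offers no walk to recurse on. But the set of points that can be joined
    -- to `u` is closed, because joins can be added, and so it contains `v`.
    path : ∀ T u v → conn (lk T) u v ≡ true → Σ (S N) (Join T u v)
    path T u v p with join? T u v in eq
    ... | yes j = j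
    ... | no nj = tf {b = ⌊ join? T u u ⌋} (yes! u (_ , join-refl T u)) (trans (conn-elim (lk T) p Z clo) (no! v nj))
      where
      Z : S N
      Z w = ⌊ join? T u w ⌋
      yes! : ∀ w → Σ (S N) (Join T u w) → Z w ≡ true
      yes! w j with join? T u w
      ... | yes _ = refl
      ... | no nj = ⊥-elim (nj j)
      no! : ∀ w → ¬ Σ (S N) (Join T u w) → Z w ≡ false
      no! w nj with join? T u w
      ... | yes j = ⊥-elim (nj j)
      ... | no _ = refl
      get : ∀ w → Z w ≡ true → Σ (S N) (Join T u w)
      get w q with join? T u w | q
      ... | yes j | _ = j
      ... | no _ | ()
      same : ∀ {x y c} → Join T x y c → Z y ≡ Z x
      same {x} {y} j = iff (λ q → yes! x (_ , join-trans (proj₂ (get y q)) (join-sym j))) (λ q → yes! y (_ , join-trans (proj₂ (get x q)) j))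
      clo : Closed (lk T) Z
      clo = closed-mk (λ x → same {x} {σ x} {λ _ → false} (join (λ _ → refl) (λ _ ()) (ev-step x)))
        (λ x t → same {x} {mate x} {edge x} (join (edge-inv x) (sup x t) (ev-∅ (λ y → xor-f {edge x y} refl))))
        where
        sup : ∀ x → T x ≡ true → ∀ y → edge x y ≡ true → cl T y ≡ true
        sup x t y q with y ≟F x
        ... | yes refl = ∨-inl t
        ... | no ne with y ≟F mate x
        ... | yes refl = ∨-inr {T (mate x)} (trans (cong T (mm I x)) t)
        ... | no ne′ = tf q (edge-other x y ne ne′)

    -- The fundamental cycle of an edge whose ends are connected by T.
    fundamental : ∀ T i → conn (lk T) i (mate i) ≡ true → cl T i ≡ false →
      Σ (S N) λ z → Flow z × (z i ≡ true) × (∀ v → z v ≡ true → v ≢ i → v ≢ mate i → cl T v ≡ true)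
    fundamental T i c off with path T i (mate i) c
    ... | z , join jin sp e = z ⊕ edge i , flow (λ v → cong₂ _xor_ (jin v) (edge-inv i v)) e ,
      cong₂ _xor_ (¬t⇒f (λ p → tf (sp i p) off)) (edge-self i) ,
      λ v p a b → sp v (trans (trans (lem (z v)) (cong (z v xor_) (sym (edge-other i v a b)))) p)
      where
      lem : ∀ a → a ≡ (a xor false)
      lem true = refl
      lem false = refl

    -- The zeros outside `T` are removed one edge at a time: outside `T`, the fundamental cycle of
    -- an edge contains nothing but that edge, so adding it spoils no other value there.
    extend : ∀ T → (∀ v → conn (lk T) v (mate v) ≡ true) → Σ (S N) λ z → Flow z × (∀ v → cl T v ≡ false → z v ≡ true)
    extend T c with setInd (λ B → Σ (S N) λ z → Flow z × (∀ v → B v ≡ true → cl T v ≡ false → z v ≡ true))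
      (λ B e → (λ _ → false) , flow-∅ , λ v b → tf b (e v)) step (λ _ → true)
      where
      step : ∀ B i → B i ≡ true → (Σ (S N) λ z → Flow z × (∀ v → (B ∖ i) v ≡ true → cl T v ≡ false → z v ≡ true)) →
        Σ (S N) λ z → Flow z × (∀ v → B v ≡ true → cl T v ≡ false → z v ≡ true)
      step B i b (z , fz , h) with bool (cl T i) | bool (z i)
      ... | inj₁ t | _ = z , fz , λ v bv o → h v (trans (∖-other B (λ { refl → tf t o })) bv) o
      ... | inj₂ _ | inj₁ zi = z , fz , λ v bv o → case v ≟F i of λ { (yes refl) → zi ; (no ne) → h v (trans (∖-other B ne) bv) o }
      ... | inj₂ o | inj₂ zi with fundamental T i (c i) o
      ... | y , fy , yi , ys = z ⊕ y , flow-⊕ fz fy , go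
        where
        go : ∀ v → B v ≡ true → cl T v ≡ false → (z v xor y v) ≡ true
        go v bv ov with v ≟F i
        ... | yes refl = cong₂ _xor_ zi yi
        ... | no ne with v ≟F mate i
        ... | yes refl = tf (h v (trans (∖-other B ne) bv) ov) (trans (inv fz i) zi)
        ... | no ne′ = cong₂ _xor_ (h v (trans (∖-other B ne) bv) ov) (¬t⇒f (λ p → tf (ys v p ne ne′) ov))
    ... | z , f , h = z , f , λ v → h v refl

-- Nowhere-zero Z₂²-flows

module Nowhere {N : ℕ} {σ σ⁻ : Fin N → Fin N} (π : Perm σ σ⁻) {mate : Fin N → Fin N} (I : Invol mate) where
  open Cycles π
  open Mate I

  G# : S N → ℕ
  G# T = comp (lk T)

  G#-cong : ∀ {T T′} → (∀ v → T v ≡ T′ v) → G# T ≡ G# T′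
  G#-cong {T} {T′} h = comp-cong {L = lk T} {lk T′} (lk-mono (λ v p → trans (sym (h v)) p)) (lk-mono (λ v p → trans (h v) p))

  G#-anti : ∀ {T T′} → (∀ v → T v ≡ true → T′ v ≡ true) → G# T′ ≤ G# T
  G#-anti {T} {T′} h = comp-mono {L = lk T} {lk T′} (lk-mono h)

  G#-add : ∀ T e → conn (lk T) e (mate e) ≡ false → G# T ≡ suc (G# (T ∪₁ e))
  G#-add T e nc = comp-link (lk T) (lk (T ∪₁ e)) e (mate e)
    (λ Z c → lk-mono (λ v p → ∪₁-old T p) Z c , sym (closed-T c e (∪₁-self T e)))
    (λ Z c q → closed-mk (closed-σ c) (λ u t → case u ≟F e of λ
      { (yes refl) → sym q ; (no ne) → closed-T c u (trans (sym (∪₁-other T ne)) t) })) nc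

  G#-add= : ∀ T e → conn (lk T) e (mate e) ≡ true → G# T ≡ G# (T ∪₁ e)
  G#-add= T e c = comp-cong {L = lk T} {lk (T ∪₁ e)} (lk-mono (λ v p → ∪₁-old T p))
    (λ Z k → closed-mk (closed-σ k) (λ u t → case u ≟F e of λ
      { (yes refl) → sym (conn-elim (lk T) c Z k) ; (no ne) → closed-T k u (trans (sym (∪₁-other T ne)) t) }))

  private
    _∪_ _∩_ : S N → S N → S N
    (A ∪ B) v = A v ∨ B v
    (A ∩ B) v = A v ∧ B v

  G#-diminish : ∀ Y X X′ → (∀ v → X v ≡ true → X′ v ≡ true) → G# X′ + G# (X ∪ Y) ≤ G# X + G# (X′ ∪ Y)
  G#-diminish = setInd (λ Y → ∀ X X′ → (∀ v → X v ≡ true → X′ v ≡ true) → G# X′ + G# (X ∪ Y) ≤ G# X + G# (X′ ∪ Y))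
    (λ B e X X′ h → ≤-reflexive (trans (cong₂ _+_ (G#-cong (λ v → emp (X′ v) (e v))) (G#-cong (λ v → sym (emp (X v) (e v))))) (+-comm (G# (X′ ∪ B)) (G# X)))) step
    where
    emp : ∀ a {b} → b ≡ false → a ≡ (a ∨ b)
    emp true refl = refl
    emp false refl = refl
    -- An edge that is redundant over `X` is redundant over the larger `X′`, so it merges components
    -- over `X′` only if it does so over `X`.
    step : ∀ B i → B i ≡ true → (∀ X X′ → (∀ v → X v ≡ true → X′ v ≡ true) → G# X′ + G# (X ∪ (B ∖ i)) ≤ G# X + G# (X′ ∪ (B ∖ i))) →
      ∀ X X′ → (∀ v → X v ≡ true → X′ v ≡ true) → G# X′ + G# (X ∪ B) ≤ G# X + G# (X′ ∪ B)
    step B i b ih X X′ h = go (bool (conn (lk (X ∪ (B ∖ i))) i (mate i))) (bool (conn (lk (X′ ∪ (B ∖ i))) i (mate i)))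
      where
      re : ∀ X → ∀ v → ((X ∪ (B ∖ i)) ∪₁ i) v ≡ (X ∪ B) v
      re X v with v ≟F i
      ... | yes refl = trans (∪₁-self (X ∪ (B ∖ i)) i) (sym (∨-inr {X i} b))
      ... | no ne = trans (∪₁-other (X ∪ (B ∖ i)) ne) (cong (X v ∨_) (∖-other B ne))
      stay : ∀ X → conn (lk (X ∪ (B ∖ i))) i (mate i) ≡ true → G# (X ∪ (B ∖ i)) ≡ G# (X ∪ B)
      stay X c = trans (G#-add= _ i c) (G#-cong (re X))
      drop : ∀ X → conn (lk (X ∪ (B ∖ i))) i (mate i) ≡ false → G# (X ∪ (B ∖ i)) ≡ suc (G# (X ∪ B))
      drop X c = trans (G#-add _ i c) (cong suc (G#-cong (re X)))
      up : conn (lk (X ∪ (B ∖ i))) i (mate i) ≡ true → conn (lk (X′ ∪ (B ∖ i))) i (mate i) ≡ true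
      up = conn-mono {L = lk (X ∪ (B ∖ i))} {lk (X′ ∪ (B ∖ i))} (lk-mono (λ v p → case ∨-case {X v} p of λ { (inj₁ q) → ∨-inl (h v q) ; (inj₂ q) → ∨-inr {X′ v} q }))
      go : (conn (lk (X ∪ (B ∖ i))) i (mate i) ≡ true) ⊎ (conn (lk (X ∪ (B ∖ i))) i (mate i) ≡ false) →
           (conn (lk (X′ ∪ (B ∖ i))) i (mate i) ≡ true) ⊎ (conn (lk (X′ ∪ (B ∖ i))) i (mate i) ≡ false) → G# X′ + G# (X ∪ B) ≤ G# X + G# (X′ ∪ B)
      go (inj₁ p) (inj₂ q) = tf (up p) q
      go (inj₁ p) (inj₁ q) = subst₂ (λ a b → G# X′ + a ≤ G# X + b) (stay X p) (stay X′ q) (ih X X′ h)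
      go (inj₂ p) (inj₁ q) = ≤-trans (+-monoʳ-≤ (G# X′) (≤-trans (n≤1+n _) (≤-reflexive (sym (drop X p)))))
        (subst (λ b → G# X′ + G# (X ∪ (B ∖ i)) ≤ G# X + b) (stay X′ q) (ih X X′ h))
      go (inj₂ p) (inj₂ q) = ≤-pred (subst₂ _≤_ (+-suc _ _) (+-suc _ _)
        (subst₂ (λ a b → G# X′ + a ≤ G# X + b) (drop X p) (drop X′ q) (ih X X′ h)))

  G#-super : ∀ A B → G# A + G# B ≤ G# (A ∪ B) + G# (A ∩ B)
  G#-super A B = subst₂ _≤_ (cong (G# A +_) (G#-cong (λ v → lem (A v) (B v)))) (+-comm (G# (A ∩ B)) (G# (A ∪ B)))
    (G#-diminish B (A ∩ B) A (λ v p → ∧-fst p))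
    where
    lem : ∀ a b → ((a ∧ b) ∨ b) ≡ b
    lem true true = refl
    lem true false = refl
    lem false b = refl

  module Contracted (T₀ : S N) (cut : ∀ Z → Closed (lk T₀) Z → (D mate (λ _ → true) Z ≡ 0) ⊎ (8 ≤ D mate (λ _ → true) Z)) where

    -- An edge is represented by its end in `half`, so `T` and its complement share out the edges;
    -- the contracted edges `T₀` belong to both parts.
    tl : S N → S N
    tl T v = T₀ v ∨ (T v ∧ half I v)

    F : S N → ℕ
    F T = G# (tl T)

    F-super : Supermodular F
    resp F-super h = G#-cong (λ v → cong (λ z → T₀ v ∨ (z ∧ half I v)) (h v))
    super F-super A B = subst (F A + F B ≤_) (cong₂ _+_
        (G#-cong (λ v → eqB-≡ (tauto 4 (λ t h a b → eqB ((t ∨ (a ∧ h)) ∨ (t ∨ (b ∧ h))) (t ∨ ((a ∨ b) ∧ h))) refl (T₀ v) (half I v) (A v) (B v))))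
        (G#-cong (λ v → eqB-≡ (tauto 4 (λ t h a b → eqB ((t ∨ (a ∧ h)) ∧ (t ∨ (b ∧ h))) (t ∨ ((a ∧ b) ∧ h))) refl (T₀ v) (half I v) (A v) (B v)))))
      (G#-super (tl A) (tl B))

    full : S N
    full _ = true

    tl-full : ∀ T v → tl T v ≡ true → tl full v ≡ true
    tl-full T v p = case ∨-case {T₀ v} p of λ { (inj₁ q) → ∨-inl q ; (inj₂ q) → ∨-inr {T₀ v} (∧-snd {T v} q) }

    -- Every component that is not closed is left by at least four edges, none of which lies in A.
    count : ∀ A → F A + F A ≤ # (λ v → not (A v)) + (F full + F full)
    count A = *-cancelˡ-≤ 4 (≤-trans (≤-reflexive (r₁ (F A))) (≤-trans (≤-trans lower (+-monoˡ-≤ (8 * F full) upper)) (≤-reflexive (r₂ (# (λ v → not (A v))) (F full)))))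
      where
      r₁ : ∀ x → 4 * (x + x) ≡ 8 * x
      r₁ = solve-∀
      r₂ : ∀ x y → 4 * x + 8 * y ≡ 4 * (x + (y + y))
      r₂ = solve-∀
      L : Link N
      L = lk (tl A)
      d : Fin N → ℕ
      d r = D mate (λ _ → true) (conn L r)
      per-root : ∀ r → 8 * ind (root L r) ≤ ind (root L r) * d r + 8 * ind (root (lk (tl full)) r)
      per-root r with bool (root L r)
      ... | inj₂ p rewrite p = z≤n
      ... | inj₁ p with cut (conn L r) (lk-mono {T₀} {tl A} (λ v → ∨-inl) _ (conn-closed L r))
      ... | inj₂ q rewrite p = ≤-trans q (≤-trans (≤-reflexive (sym (+-identityʳ _))) (m≤m+n _ _))
      ... | inj₁ q = ≤-trans (*-monoʳ-≤ 8 (ind≤1 (root L r))) (≤-trans (≤-reflexive (cong (8 *_) (sym (ind-t rt)))) (m≤n+m _ (ind (root L r) * d r)))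
        where
        none : ∀ v → conn L r (mate v) ≡ conn L r v
        none v = sym (xor-f⁻ (#-zero _ (trans (sym (D-def mate (λ _ → true) (conn L r))) q) v))
        rt : root (lk (tl full)) r ≡ true
        rt = root-intro (lk (tl full)) (λ u lt → ¬t⇒f (λ c → tf
          (conn-sym L (trans (conn-elim (lk (tl full)) c (conn L r) (closed-mk (closed-σ (conn-closed L r)) (λ v _ → none v))) (conn-refl L r)))
          (root-elim L p u lt)))
      lower : 8 * F A ≤ sum (λ r → ind (root L r) * d r) + 8 * F full
      lower = subst₂ _≤_ (trans (sum-* 8 _) (cong (8 *_) (sym (#-def _)))) (cong (sum (λ r → ind (root L r) * d r) +_) (trans (sum-* 8 _) (cong (8 *_) (sym (#-def _)))))
        (sum≤2 _ _ _ per-root)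
      e : Fin N → Fin N → ℕ
      e r v = ind (conn L r v xor conn L r (mate v))
      -- An edge between two classes is seen by the two roots. Its end in `half` cannot lie in `A`,
      -- but `v` may be the other end; hence both ends occur on the right.
      per-dart : ∀ v → sum (λ r → ind (root L r) * e r v) ≤ 2 * ind (not (A v)) + 2 * ind (not (A (mate v)))
      per-dart v with bool (conn L v (mate v))
      ... | inj₁ c = ≤-trans (≤-reflexive (sum-0 (λ r → trans (cong (ind (root L r) *_) (ind-f (xor-f
              (iff (λ p → conn-trans L p c) (λ p → conn-trans L p (conn-sym L c)))))) (*-zeroʳ (ind (root L r)))))) z≤n
      ... | inj₂ nc = ≤-trans (sum≤2 _ (λ r → ind (root L r ∧ conn L r v)) (λ r → ind (root L r ∧ conn L r (mate v)))
              (λ r → leN (tauto 3 (λ a b c → (ind a * ind (b xor c)) ≤ᵇ (ind (a ∧ b) + ind (a ∧ c))) refl (root L r) (conn L r v) (conn L r (mate v)))))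
            (≤-trans (≤-reflexive (cong₂ _+_ (trans (sym (#-def _)) (root-sum L v)) (trans (sym (#-def _)) (root-sum L (mate v))))) two)
        where
        two : 2 ≤ 2 * ind (not (A v)) + 2 * ind (not (A (mate v)))
        two with bool (half I v)
        ... | inj₁ h = ≤-trans (≤-reflexive (cong (2 *_) (sym (ind-t (not-t (¬t⇒f (λ a →
                tf (conn-T (tl A) v (∨-inr {T₀ v} (∧-intro a h))) nc))))))) (m≤m+n _ _)
        ... | inj₂ h = ≤-trans (≤-reflexive (cong (2 *_) (sym (ind-t (not-t (¬t⇒f (λ a →
                tf (conn-sym L (trans (cong (conn L (mate v)) (sym (mm I v))) (conn-T (tl A) (mate v) (∨-inr {T₀ (mate v)} (∧-intro a (trans (half-mate I v) (cong not h))))))) nc))))))) (m≤n+m _ (2 * ind (not (A v))))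
      upper : sum (λ r → ind (root L r) * d r) ≤ 4 * # (λ v → not (A v))
      upper = begin
        sum (λ r → ind (root L r) * d r) ≡⟨ sum-cong (λ r → trans (cong (ind (root L r) *_) (trans (D-def mate _ _) (#-def _))) (sym (sum-* (ind (root L r)) (e r)))) ⟩
        sum (λ r → sum (λ v → ind (root L r) * e r v)) ≡⟨ sum-swap (λ r v → ind (root L r) * e r v) ⟩
        sum (λ v → sum (λ r → ind (root L r) * e r v)) ≤⟨ sum≤2 _ _ _ per-dart ⟩
        sum (λ v → 2 * ind (not (A v))) + sum (λ v → 2 * ind (not (A (mate v)))) ≡⟨ cong₂ _+_ (trans (sum-* 2 _) (cong (2 *_) (sym (#-def _)))) (trans (sum-* 2 _) (cong (2 *_) (trans (sym (#-def _)) (#-mate I (λ v → not (A v)))))) ⟩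
        2 * # (λ v → not (A v)) + 2 * # (λ v → not (A v)) ≡⟨ r₃ (# (λ v → not (A v))) ⟩
        4 * # (λ v → not (A v)) ∎
        where
        open ≤-Reasoning
        r₃ : ∀ x → 2 * x + 2 * x ≡ 4 * x
        r₃ = solve-∀

    -- An edge whose ends are still separated would, when added, lower the number of components
    -- below `F full`.
    spanning : ∀ T → F T ≤ F full → ∀ v → conn (lk (tl T)) v (mate v) ≡ true
    spanning T le = all
      where
      onhalf : ∀ v → half I v ≡ true → conn (lk (tl T)) v (mate v) ≡ true
      onhalf v h = ¬f⇒t (λ nc → 1+n≰n (≤-trans (≤-reflexive (sym (G#-add (tl T) v nc))) (≤-trans le
        (G#-anti {tl T ∪₁ v} {tl full} (λ u p → case u ≟F v of λ { (yes refl) → ∨-inr {T₀ v} h ; (no ne) → tl-full T u (trans (sym (∪₁-other (tl T) ne)) p) })))))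
      all : ∀ v → conn (lk (tl T)) v (mate v) ≡ true
      all v with bool (half I v)
      ... | inj₁ h = onhalf v h
      ... | inj₂ h = conn-sym (lk (tl T)) (trans (cong (conn (lk (tl T)) (mate v)) (sym (mm I v))) (onhalf (mate v) (trans (half-mate I v) (cong not h))))

    -- With both parts of the partition connecting, one flow is nonzero outside `T` and the other
    -- outside the complement of `T`. Together they vanish at most on `T₀`, which lies in both
    -- parts.
    nowhere-zero : (∀ v → T₀ (mate v) ≡ T₀ v) → Σ (S N) λ a → Σ (S N) λ b → Flow a × Flow b × (∀ v → T₀ v ≡ false → (a v ∨ b v) ≡ true)
    nowhere-zero inv₀ = go (partition F F (F full + F full) F-super F-super count)
      where
      Result : Set
      Result = Σ (S N) λ a → Σ (S N) λ b → Flow a × Flow b × (∀ v → T₀ v ≡ false → (a v ∨ b v) ≡ true)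
      lem : ∀ t t′ x x′ h h′ → t ≡ false → t′ ≡ false → h′ ≡ not h → ((t ∨ (x ∧ h)) ∨ (t′ ∨ (x′ ∧ h′))) ≡ true → ((t ∨ (not x ∧ h)) ∨ (t′ ∨ (not x′ ∧ h′))) ≡ false
      lem .false .false true x′ true .false refl refl refl p = ∧-false₂ {not x′} refl
      lem .false .false false true true .false refl refl refl ()
      lem .false .false false false true .false refl refl refl ()
      lem .false .false true true false .true refl refl refl p = refl
      lem .false .false true false false .true refl refl refl ()
      lem .false .false false true false .true refl refl refl p = refl
      lem .false .false false false false .true refl refl refl ()
      combine : ∀ T → (Σ (S N) λ z → Flow z × (∀ v → cl (tl T) v ≡ false → z v ≡ true)) →
        (Σ (S N) λ z → Flow z × (∀ v → cl (tl (λ v → not (T v))) v ≡ false → z v ≡ true)) → Result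
      combine T (a , fa , ha) (b , fb , hb) = a , b , fa , fb , λ v t → case bool (cl (tl T) v) of λ
        { (inj₂ p) → ∨-inl (ha v p)
        ; (inj₁ p) → ∨-inr {a v} (hb v (lem (T₀ v) (T₀ (mate v)) (T v) (T (mate v)) (half I v) (half I (mate v)) t (trans (inv₀ v) t) (half-mate I v) p)) }
      go : (Σ (S N) λ T → F T + F (λ v → not (T v)) ≤ F full + F full) → Result
      go (T , le) = combine T (extend (tl T) (spanning T le₁)) (extend (tl (λ v → not (T v))) (spanning (λ v → not (T v)) le₂))
        where
        ge₁ : F full ≤ F T
        ge₁ = G#-anti (tl-full T)
        ge₂ : F full ≤ F (λ v → not (T v))
        ge₂ = G#-anti (tl-full (λ v → not (T v)))
        le₁ : F T ≤ F full
        le₁ = +-cancelʳ-≤ (F full) (F T) (F full) (≤-trans (+-monoʳ-≤ (F T) ge₂) le)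
        le₂ : F (λ v → not (T v)) ≤ F full
        le₂ = +-cancelˡ-≤ (F full) (F (λ v → not (T v))) (F full) (≤-trans (+-monoˡ-≤ (F (λ v → not (T v))) ge₁) le)

  -- Ten stands for five edges, because `D` counts both ends. The sets invariant under `σ` are the
  -- vertex sets of the graph with contracted circuits, with parity inherited from the vertices.
  O5 : Set
  O5 = ∀ Z → (∀ v → Z (σ v) ≡ Z v) → par (# Z) ≡ true → 10 ≤ D mate (λ _ → true) Z

  -- The two edges of a 2-cut carry the same value in every flow, so that one of them can be contracted.
  nowhere-zero-off : O5 → ∀ k T₀ → (∀ v → T₀ (mate v) ≡ T₀ v) → # (λ v → not (T₀ v)) ≤ k →
    Σ (S N) λ a → Σ (S N) λ b → Flow a × Flow b × (∀ v → T₀ v ≡ false → (a v ∨ b v) ≡ true)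
  nowhere-zero-off o5 k T₀ inv₀ le with search {P = λ Z → Closed (lk T₀) Z × (D mate (λ _ → true) Z ≡ 4)}
    (λ h (c , e) → (λ u v l → trans (sym (h u)) (trans (c u v l) (h v))) , trans (sym (D-cong mate _ h)) e)
    (λ Z → closed? (lk T₀) Z ×-dec (_ ≟ℕ _))
  ... | no none = Contracted.nowhere-zero T₀ cut inv₀
    where
    cut : ∀ Z → Closed (lk T₀) Z → (D mate (λ _ → true) Z ≡ 0) ⊎ (8 ≤ D mate (λ _ → true) Z)
    cut Z c with bool (par (# Z))
    ... | inj₁ o = inj₂ (≤-trans (n≤1+n 8) (≤-trans (n≤1+n 9) (o5 Z (closed-σ c) o)))
    ... | inj₂ o with D-parity I (λ _ → true) Z (λ _ → refl)
    ... | j , e rewrite o with j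
    ... | zero = inj₁ e
    ... | suc zero = ⊥-elim (none (Z , c , e))
    ... | suc (suc i) = inj₂ (≤-trans (≤-trans (*-monoʳ-≤ 4 {2} {suc (suc i)} (s≤s (s≤s z≤n))) (m≤m+n _ 0)) (≤-reflexive (sym e)))
  ... | yes (Z , c , d4) with #-pos⁻ (λ v → Z v xor Z (mate v)) (≤-trans (s≤s z≤n) (≤-reflexive (trans (sym d4) (D-def mate (λ _ → true) Z))))
  ... | e , ecr = contract k le
    where
    cross : S N
    cross v = Z v xor Z (mate v)
    #cross : # cross ≡ 4
    #cross = trans (sym (D-def mate (λ _ → true) Z)) d4
    T₁ : S N
    T₁ = T₀ ∪₁ e ∪₁ mate e
    e∉ : T₀ e ≡ false
    e∉ = ¬t⇒f (λ t → xor-t⁻ ecr (sym (closed-T c e t)))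
    inv₁ : ∀ v → T₁ (mate v) ≡ T₁ v
    inv₁ v = trans (cong₂ _∨_ (cong₂ _∨_ (inv₀ v) (edge-mate e v)) (trans (edge-mate (mate e) v) (cong (v ==_) (mm I e)))) (lem (T₀ v) (v == mate e) (v == e))
      where
      lem : ∀ a b c → ((a ∨ b) ∨ c) ≡ ((a ∨ c) ∨ b)
      lem a b c = eqB-≡ (tauto 3 (λ a b c → eqB ((a ∨ b) ∨ c) ((a ∨ c) ∨ b)) refl a b c)
    fewer : # (λ v → not (T₁ v)) < # (λ v → not (T₀ v))
    fewer = #-mono-< (λ v p → not-t (∨-false₁ {T₀ v} (∨-false₁ (not-t⁻ p)))) e (not-t e∉) (not-f (∪₁-old (T₀ ∪₁ e) (∪₁-self T₀ e)))
    other : Σ (Fin N) λ f → (cross f ≡ true) × (f ≢ e) × (f ≢ mate e)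
    other with #-pos⁻ (λ v → (cross ∖ e ∖ mate e) v) (≤-pred (≤-pred (≤-trans (s≤s (s≤s (s≤s z≤n)))
        (≤-trans (≤-reflexive (sym #cross)) (≤-trans (≤-reflexive (∖-remove cross e ecr)) (s≤s (≤-trans (drop (cross ∖ e) (mate e)) ≤-refl)))))))
      where
      drop : (f : S N) (u : Fin N) → # f ≤ suc (# (f ∖ u))
      drop f u with bool (f u)
      ... | inj₁ p = ≤-reflexive (∖-remove f u p)
      ... | inj₂ p = ≤-trans (#-mono (λ v q → trans (∖-other f (λ { refl → tf q p })) q)) (n≤1+n _)
    ... | f , p = f , ∧-fst (∧-fst p) , ≢-== (not-t⁻ (∧-snd {cross f} (∧-fst p))) , ≢-== (not-t⁻ (∧-snd {(cross ∖ e) f} p))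
    -- The cut has four darts, and a flow meets it in a multiple of four: in none or in all.
    same : ∀ {a} → Flow a → ∀ {f} → cross f ≡ true → a f ≡ true → a e ≡ true
    same {a} fa {f} cf af with flow-cut fa Z (closed-σ c)
    ... | zero , q = tf (∧-intro af cf) (#-zero _ (trans (sym (D-def mate a Z)) q) f)
    ... | suc j , q = ∧-fst (#-full {f = λ v → a v ∧ cross v} {cross} (λ v p → ∧-snd {a v} p)
            (≤-trans (≤-reflexive #cross) (≤-trans (≤-trans (m≤m*n 4 (suc j)) (≤-reflexive (sym q))) (≤-reflexive (D-def mate a Z)))) e ecr)
    contract : ∀ k → # (λ v → not (T₀ v)) ≤ k → Σ (S N) λ a → Σ (S N) λ b → Flow a × Flow b × (∀ v → T₀ v ≡ false → (a v ∨ b v) ≡ true)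
    contract zero le = ⊥-elim (n≮0 (≤-trans fewer le))
    contract (suc k) le with nowhere-zero-off o5 k T₁ inv₁ (≤-pred (≤-trans fewer le))
    ... | a , b , fa , fb , h = a , b , fa , fb , all
      where
      offT : ∀ v → v ≢ e → v ≢ mate e → T₁ v ≡ T₀ v
      offT v p q = trans (∪₁-other (T₀ ∪₁ e) q) (∪₁-other T₀ p)
      at-e : (a e ∨ b e) ≡ true
      at-e with other
      ... | f , cf , f≢e , f≢me with ∨-case {a f} (h f (trans (offT f f≢e f≢me) (¬t⇒f (λ t → xor-t⁻ cf (sym (closed-T c f t))))))
      ... | inj₁ q = ∨-inl (same fa cf q)
      ... | inj₂ q = ∨-inr {a e} (same fb cf q)
      all : ∀ v → T₀ v ≡ false → (a v ∨ b v) ≡ true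
      all v t with v ≟F e
      ... | yes refl = at-e
      ... | no p with v ≟F mate e
      ... | yes refl = trans (cong₂ _∨_ (inv fa e) (inv fb e)) at-e
      ... | no q = h v (trans (offT v p q) t)

  nowhere-zero : O5 → Σ (S N) λ a → Σ (S N) λ b → Flow a × Flow b × (∀ v → (a v ∨ b v) ≡ true)
  nowhere-zero o5 with nowhere-zero-off o5 _ (λ _ → false) (λ _ → refl) ≤-refl
  ... | a , b , fa , fb , h = a , b , fa , fb , λ v → h v refl

-- Forests

module Forest {N : ℕ} {σ σ⁻ : Fin N → Fin N} (π : Perm σ σ⁻) {mate : Fin N → Fin N} (I : Invol mate) where
  open Cycles π
  open Mate I
  open Nowhere π I

  infix 4 _⊆_
  _⊆_ : S N → S N → Set
  A ⊆ B = ∀ v → A v ≡ true → B v ≡ true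

  Inv : S N → Set
  Inv A = ∀ v → A (mate v) ≡ A v

  -- A forest after contraction of the circuits. A matching edge with both ends on one circuit is a
  -- loop there, hence a flow by itself and excluded.
  Acyclic : S N → Set
  Acyclic A = ∀ z → Flow z → z ⊆ A → ∀ v → z v ≡ false

  cycle? : ∀ A → Acyclic A ⊎ Σ (S N) λ z → Flow z × (z ⊆ A) × Σ (Fin N) λ v → z v ≡ true
  cycle? A with search {P = λ z → Flow z × (z ⊆ A) × Σ (Fin N) λ v → z v ≡ true}
    (λ h (f , s , v , p) → flow-ext h f , (λ v q → s v (trans (h v) q)) , v , trans (sym (h v)) p)
    (λ z → flow? z ×-dec (all? (λ v → (z v ≟B true) →-dec (A v ≟B true)) ×-dec any? (λ v → z v ≟B true)))
  ... | yes c = inj₂ c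
  ... | no nc = inj₁ (λ z f s v → ¬t⇒f (λ p → nc (z , f , s , v , p)))

  acyclic-⊆ : ∀ {A B} → A ⊆ B → Acyclic B → Acyclic A
  acyclic-⊆ h ac z f s = ac z f (λ v p → h v (s v p))

  infixl 7 _∪ₑ_
  _∪ₑ_ : S N → Fin N → S N
  A ∪ₑ e = A ∪₁ e ∪₁ mate e

  ∪ₑ-case : ∀ A e v → (A ∪ₑ e) v ≡ true → (v ≡ e) ⊎ (v ≡ mate e) ⊎ (A v ≡ true)
  ∪ₑ-case A e v p with ∨-case {(A ∪₁ e) v} p
  ... | inj₂ q = inj₂ (inj₁ (==-true q))
  ... | inj₁ q with ∨-case {A v} q
  ... | inj₁ r = inj₂ (inj₂ r)
  ... | inj₂ r = inj₁ (==-true r)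

  ∪ₑ-inv : ∀ A e → Inv A → Inv (A ∪ₑ e)
  ∪ₑ-inv A e inv₀ v = trans (cong₂ _∨_ (cong₂ _∨_ (inv₀ v) (edge-mate e v)) (trans (edge-mate (mate e) v) (cong (v ==_) (mm I e))))
    (eqB-≡ (tauto 3 (λ a b c → eqB ((a ∨ b) ∨ c) ((a ∨ c) ∨ b)) refl (A v) (v == mate e) (v == e)))

  record Spanning (A₀ K A : S N) : Set where
    field
      sinv : Inv A
      above : A₀ ⊆ A
      below : A ⊆ K
      acyc : Acyclic A
      fund : ∀ v → K v ≡ true → A v ≡ false → Σ (S N) λ z → Flow z × (z v ≡ true) × (∀ u → z u ≡ true → (u ≡ v) ⊎ (u ≡ mate v) ⊎ (A u ≡ true))
  open Spanning public

  -- A maximal acyclic set between `A₀` and `K`. Adding a further edge creates a cycle, and this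
  -- cycle uses the edge because `A` alone carries none.
  spanning-forest : ∀ A₀ K → Inv A₀ → Inv K → A₀ ⊆ K → Acyclic A₀ → Σ (S N) (Spanning A₀ K)
  spanning-forest A₀ K i₀ iK sub ac₀ with descend {Partial} (λ P → # (λ v → K v ∧ not (proj₁ P v))) Maximal step (A₀ , i₀ , (λ v p → p) , sub , ac₀)
    where
    Partial : Set
    Partial = Σ (S N) λ A → Inv A × (A₀ ⊆ A) × (A ⊆ K) × Acyclic A
    Maximal : Partial → Set
    Maximal (A , _) = ∀ v → K v ≡ true → A v ≡ false → Σ (S N) λ z → Flow z × (z v ≡ true) × (∀ u → z u ≡ true → (u ≡ v) ⊎ (u ≡ mate v) ⊎ (A u ≡ true))
    step : ∀ P → Maximal P ⊎ Σ Partial λ P′ → # (λ v → K v ∧ not (proj₁ P′ v)) < # (λ v → K v ∧ not (proj₁ P v))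
    step (A , iA , ab , be , ac) with any? {P = λ v → (K v ≡ true) × (A v ≡ false) × Acyclic (A ∪ₑ v)}
        (λ v → (K v ≟B true) ×-dec ((A v ≟B false) ×-dec acyclic? (A ∪ₑ v)))
      where
      acyclic? : ∀ A → Dec (Acyclic A)
      acyclic? A with cycle? A
      ... | inj₁ ac = yes ac
      ... | inj₂ (z , f , s , v , p) = no (λ ac → tf p (ac z f s v))
    ... | yes (v , kv , av , ac′) = inj₂ ((A ∪ₑ v , ∪ₑ-inv A v iA , (λ u p → ∪₁-old (A ∪₁ v) (∪₁-old A (ab u p))) ,
            (λ u p → case ∪ₑ-case A v u p of λ { (inj₁ refl) → kv ; (inj₂ (inj₁ refl)) → trans (iK v) kv ; (inj₂ (inj₂ q)) → be u q }) , ac′) ,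
            #-mono-< (λ u p → ∧-intro {K u} (∧-fst {K u} p) (not-t (∨-false₁ {A u} (∨-false₁ {A u ∨ (u == v)} (not-t⁻ (∧-snd {K u} p)))))) v
              (∧-intro kv (not-t av)) (∧-false₂ {K v} (not-f (∪₁-old (A ∪₁ v) (∪₁-self A v)))))
    ... | no none = inj₁ maximal
      where
      maximal : ∀ v → K v ≡ true → A v ≡ false → Σ (S N) λ z → Flow z × (z v ≡ true) × (∀ u → z u ≡ true → (u ≡ v) ⊎ (u ≡ mate v) ⊎ (A u ≡ true))
      maximal v kv av with cycle? (A ∪ₑ v)
      ... | inj₁ ac′ = ⊥-elim (none (v , kv , av , ac′))
      ... | inj₂ (z , f , s , w , p) = z , f , ¬f⇒t (λ zv → tf p (ac z f (λ u q → case ∪ₑ-case A v u (s u q) of λ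
              { (inj₁ refl) → tf q zv ; (inj₂ (inj₁ refl)) → tf q (trans (inv f v) zv) ; (inj₂ (inj₂ r)) → r }) w)) , λ u q → ∪ₑ-case A v u (s u q)
  ... | (A , iA , ab , be , ac) , mx = A , record { sinv = iA ; above = ab ; below = be ; acyc = ac ; fund = mx }

  -- The length of the orbit divides four. Under the cut condition length one is impossible, so this
  -- means two or four.
  small : S N
  small v = σ (σ (σ (σ v))) == v

  small-σ : ∀ v → small (σ v) ≡ small v
  small-σ v = σ-inj-== (σ (σ (σ (σ v)))) v

  -- The state reached by splitting off: every matching edge at a small circuit is parallel to an
  -- edge of the circuit, so it is a loop after contraction.
  Isolated : Set
  Isolated = ∀ v → small v ≡ true → (mate v ≡ σ v) ⊎ (mate v ≡ σ⁻ v)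

  ∅ : S N
  ∅ _ = false

  orbit : Fin N → S N
  orbit = conn (lk ∅)

  orbit-σ : ∀ r v → orbit r (σ v) ≡ orbit r v
  orbit-σ r = closed-σ (conn-closed (lk ∅) r)

  orbit-inv : ∀ {r v} (f : Fin N → Bool) → (∀ u → f (σ u) ≡ f u) → orbit r v ≡ true → f r ≡ f v
  orbit-inv f h c = conn-elim (lk ∅) c f (closed-mk h (λ _ ()))

  big-orbits : ℕ
  big-orbits = # (λ r → root (lk ∅) r ∧ not (small r))

  loop-flow : ∀ {v} → (mate v ≡ σ v) ⊎ (mate v ≡ σ⁻ v) → Flow (edge v)
  loop-flow {v} (inj₁ e) = flow (edge-inv v) (ev-ext (λ u → cong (λ x → (u == v) xor (u == x)) (sym e)) (ev-step v))
  loop-flow {v} (inj₂ e) = flow (edge-inv v) (ev-ext (λ u → trans (lem (u == σ⁻ v) (u == σ (σ⁻ v))) (cong₂ _xor_ (cong (u ==_) (σσ⁻ v)) (cong (u ==_) (sym e)))) (ev-step (σ⁻ v)))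
    where
    lem : ∀ a b → (a xor b) ≡ (b xor a)
    lem a b = eqB-≡ (tauto 2 (λ a b → eqB (a xor b) (b xor a)) refl a b)

  no-loop : ∀ {A v} → Inv A → Acyclic A → A v ≡ true → Flow (edge v) → ⊥
  no-loop {A} {v} iA ac av f = t≢f (trans (sym (edge-self v)) (ac (edge v) f sup v))
    where
    sup : edge v ⊆ A
    sup u p with u ≟F v
    ... | yes refl = av
    ... | no ne with u ≟F mate v
    ... | yes refl = trans (iA v) av
    ... | no ne′ = tf p (edge-other v u ne ne′)

  -- Every edge of a forest lowers the number of components by one. Small circuits carry only loops
  -- and remain components, so the number of edges is at most the number of big circuits; `# A`
  -- counts both ends of each.
  forest-bound : Isolated → ∀ A → Inv A → Acyclic A → # A ≤ big-orbits + big-orbits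
  forest-bound iso A iA ac = subst (_≤ big-orbits + big-orbits) (sym (#-half I A iA)) (+-mono-≤ bound bound)
    where
    H : S N
    H v = A v ∧ half I v
    rank : ∀ B → B ⊆ H → G# B + # B ≡ G# ∅
    rank = setInd (λ B → B ⊆ H → G# B + # B ≡ G# ∅)
      (λ B e _ → trans (cong₂ _+_ (G#-cong e) (#-empty e)) (+-identityʳ _)) step
      where
      step : ∀ B i → B i ≡ true → (B ∖ i ⊆ H → G# (B ∖ i) + # (B ∖ i) ≡ G# ∅) → B ⊆ H → G# B + # B ≡ G# ∅
      step B i b ih sub = trans (cong (G# B +_) (∖-remove B i b)) (trans (+-suc (G# B) (# (B ∖ i))) (trans (cong (_+ # (B ∖ i)) (sym drop)) (ih sub′)))
        where
        sub′ : B ∖ i ⊆ H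
        sub′ v p = sub v (∧-fst p)
        back : ∀ v → ((B ∖ i) ∪₁ i) v ≡ B v
        back v with v ≟F i
        ... | yes refl = trans (∪₁-self (B ∖ i) i) (sym b)
        ... | no ne = trans (∪₁-other (B ∖ i) ne) (∖-other B ne)
        off : cl (B ∖ i) i ≡ false
        off = ∨-false (∖-self B i) (¬t⇒f (λ p → tf (∧-snd {A (mate i)} (sub′ (mate i) p)) (trans (half-mate I i) (cong not (∧-snd {A i} (sub i b))))))
        drop : G# (B ∖ i) ≡ suc (G# B)
        drop = trans (G#-add (B ∖ i) i (¬t⇒f (λ c → let (z , f , zi , sp) = fundamental (B ∖ i) i c off in
          tf zi (ac z f (λ v p → supp′ v p sp) i)))) (cong suc (G#-cong back))
          where
          supp′ : ∀ {z : S N} v → z v ≡ true → (∀ v → z v ≡ true → v ≢ i → v ≢ mate i → cl (B ∖ i) v ≡ true) → A v ≡ true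
          supp′ v p sp with v ≟F i
          ... | yes refl = ∧-fst (sub i b)
          ... | no ne with v ≟F mate i
          ... | yes refl = trans (iA i) (∧-fst (sub i b))
          ... | no ne′ with ∨-case {(B ∖ i) v} (sp v p ne ne′)
          ... | inj₁ q = ∧-fst (sub′ v q)
          ... | inj₂ q = trans (sym (iA v)) (∧-fst (sub′ (mate v) q))
    -- Small orbits carry only loops, hence are components of their own.
    keep : # (λ r → root (lk ∅) r ∧ small r) ≤ G# H
    keep = #-mono (λ r p → root-intro (lk H) (λ u lt → ¬t⇒f (λ c → tf
      (conn-sym (lk ∅) (trans (conn-elim (lk H) c (orbit r) (clo r (∧-snd {root (lk ∅) r} p))) (conn-refl (lk ∅) r)))
      (root-elim (lk ∅) (∧-fst p) u lt))))
      where
      avoid : ∀ r → small r ≡ true → ∀ v → orbit r v ≡ true → A v ≡ true → ⊥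
      avoid r sr v c av = no-loop {A} {v} iA ac av (loop-flow (iso v (trans (sym (orbit-inv small small-σ c)) sr)))
      clo : ∀ r → small r ≡ true → Closed (lk H) (orbit r)
      clo r sr = closed-mk (orbit-σ r) (λ v h → trans (¬t⇒f (λ c → avoid r sr (mate v) c (trans (iA v) (∧-fst h)))) (sym (¬t⇒f (λ c → avoid r sr v c (∧-fst h)))))
    bound : # H ≤ big-orbits
    bound = +-cancelˡ-≤ (G# H) (# H) big-orbits (≤-trans (≤-reflexive (trans (rank H (λ v p → p)) (#-split (root (lk ∅)) small))) (+-monoˡ-≤ big-orbits keep))

-- Orbits of length five

∪₁-count : {N : ℕ} (f : S N) (u : Fin N) → f u ≡ false → # (f ∪₁ u) ≡ suc (# f)
∪₁-count f u p = trans (∖-remove (f ∪₁ u) u (∪₁-self f u)) (cong suc (#-cong (λ v → case v ≟F u of λ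
  { (yes refl) → trans (∖-self (f ∪₁ u) u) (sym p) ; (no ne) → trans (∖-other (f ∪₁ u) ne) (∪₁-other f ne) })))

module Five {N : ℕ} {σ σ⁻ : Fin N → Fin N} (π : Perm σ σ⁻) where
  open Cycles π

  σ² σ³ σ⁴ σ⁵ : Fin N → Fin N
  σ² v = σ (σ v)
  σ³ v = σ (σ² v)
  σ⁴ v = σ (σ³ v)
  σ⁵ v = σ (σ⁴ v)

  -- The length of the orbit divides five and is not one.
  five : S N
  five v = (σ⁵ v == v) ∧ not (σ v == v)

  five-σ : ∀ v → five (σ v) ≡ five v
  five-σ v = cong₂ (λ a b → a ∧ not b) (σ-inj-== (σ⁵ v) v) (σ-inj-== (σ v) v)

  module _ {x : Fin N} (f : five x ≡ true) where
    per5 : σ⁵ x ≡ x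
    per5 = ==-true (∧-fst f)
    ne1 : σ x ≢ x
    ne1 = ≢-== (not-t⁻ (∧-snd {σ⁵ x == x} f))
    ne2 : σ² x ≢ x
    ne2 e = ne1 (trans (cong σ (sym (trans (cong σ² e) e))) per5)
    ne3 : σ³ x ≢ x
    ne3 e = ne1 (trans (cong σ (sym per5)) (trans (cong σ³ e) e))
    ne4 : σ⁴ x ≢ x
    ne4 e = ne1 (trans (cong σ (sym e)) per5)

    five-par : ∀ {q} → Ev σ q → (q x xor (q (σ x) xor (q (σ² x) xor (q (σ³ x) xor q (σ⁴ x))))) ≡ false
    five-par {q} (s , b) = lem (s x) _ _ _ _ _ (q (σ x)) (q (σ² x)) (q (σ³ x)) (q (σ⁴ x)) (q x)
        (b x) (b (σ x)) (b (σ² x)) (b (σ³ x)) (trans (b (σ⁴ x)) (cong (λ z → s (σ⁴ x) xor q z) per5)) (cong s per5)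
      where
      lem : ∀ s₀ s₁ s₂ s₃ s₄ s₅ q₁ q₂ q₃ q₄ q₀ → s₁ ≡ (s₀ xor q₁) → s₂ ≡ (s₁ xor q₂) → s₃ ≡ (s₂ xor q₃) → s₄ ≡ (s₃ xor q₄) → s₅ ≡ (s₄ xor q₀) → s₅ ≡ s₀ →
        (q₀ xor (q₁ xor (q₂ xor (q₃ xor q₄)))) ≡ false
      lem s₀ _ _ _ _ _ q₁ q₂ q₃ q₄ q₀ refl refl refl refl refl e = xor-f⁻′ s₀ (trans (sym
        (eqB-≡ (tauto 6 (λ s a b c d e → eqB (((((s xor a) xor b) xor c) xor d) xor e) (s xor (e xor (a xor (b xor (c xor d)))))) refl s₀ q₁ q₂ q₃ q₄ q₀))) e)
        where
        xor-f⁻′ : ∀ s {y} → (s xor y) ≡ s → y ≡ false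
        xor-f⁻′ true {false} p = refl
        xor-f⁻′ false p = p

  -- X has at most one element in each five-orbit.
  Sparse : S N → Set
  Sparse X = ∀ x → X x ≡ true → (five x ≡ true) × (X (σ x) ≡ false) × (X (σ² x) ≡ false) × (X (σ³ x) ≡ false) × (X (σ⁴ x) ≡ false)

  sparse-⊆ : ∀ {X Y} → (∀ v → X v ≡ true → Y v ≡ true) → Sparse Y → Sparse X
  sparse-⊆ h sp x p = let (f , a , b , c , d) = sp x (h x p) in
    f , ¬t⇒f (λ q → tf (h _ q) a) , ¬t⇒f (λ q → tf (h _ q) b) , ¬t⇒f (λ q → tf (h _ q) c) , ¬t⇒f (λ q → tf (h _ q) d)

  around : S N → Fin N → Bool
  around h x = h x ∨ (h (σ x) ∨ (h (σ² x) ∨ (h (σ³ x) ∨ h (σ⁴ x))))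

  -- Double counting of the pairs of a point of `X` and a point of `h` on one circuit of length
  -- five: a point of `X` occurs at least once by `hit`, a point of `h` at most once because `X` is
  -- sparse.
  five-inj : ∀ X h → Sparse X → (∀ x → X x ≡ true → around h x ≡ true) → # X ≤ # h
  five-inj X h sp hit = begin
    # X ≤⟨ #≤sum ⟩
    sum (λ x → ind (X x ∧ h x) + (ind (X x ∧ h (σ x)) + (ind (X x ∧ h (σ² x)) + (ind (X x ∧ h (σ³ x)) + ind (X x ∧ h (σ⁴ x))))))
      ≡⟨ trans (sum-+ _ _) (cong (s0 +_) (trans (sum-+ _ _) (cong₂ _+_ (mv σ σ⁻ σσ⁻ σ⁻σ) (trans (sum-+ _ _) (cong₂ _+_ (mv σ² (λ v → σ⁻ (σ⁻ v)) e2 f2)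
          (trans (sum-+ _ _) (cong₂ _+_ (mv σ³ (λ v → σ⁻ (σ⁻ (σ⁻ v))) e3 f3) (mv σ⁴ (λ v → σ⁻ (σ⁻ (σ⁻ (σ⁻ v)))) e4 f4)))))))) ⟩
    s0 + (t σ⁻ + (t (λ v → σ⁻ (σ⁻ v)) + (t (λ v → σ⁻ (σ⁻ (σ⁻ v))) + t (λ v → σ⁻ (σ⁻ (σ⁻ (σ⁻ v)))))))
      ≡⟨ sym (trans (sum-+ _ _) (cong (s0 +_) (trans (sum-+ _ _) (cong (t σ⁻ +_) (trans (sum-+ _ _) (cong (t (λ v → σ⁻ (σ⁻ v)) +_) (sum-+ _ _))))))) ⟩
    sum (λ u → ind (X u ∧ h u) + (ind (X (σ⁻ u) ∧ h u) + (ind (X (σ⁻ (σ⁻ u)) ∧ h u) + (ind (X (σ⁻ (σ⁻ (σ⁻ u))) ∧ h u) + ind (X (σ⁻ (σ⁻ (σ⁻ (σ⁻ u)))) ∧ h u)))))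
      ≤⟨ sum-mono one ⟩
    sum (λ u → ind (h u)) ≡⟨ sym (#-def h) ⟩
    # h ∎
    where
    open ≤-Reasoning
    e2 : ∀ v → σ² (σ⁻ (σ⁻ v)) ≡ v
    e2 v = trans (cong σ (σσ⁻ (σ⁻ v))) (σσ⁻ v)
    e3 : ∀ v → σ³ (σ⁻ (σ⁻ (σ⁻ v))) ≡ v
    e3 v = trans (cong σ (e2 (σ⁻ v))) (σσ⁻ v)
    e4 : ∀ v → σ⁴ (σ⁻ (σ⁻ (σ⁻ (σ⁻ v)))) ≡ v
    e4 v = trans (cong σ (e3 (σ⁻ v))) (σσ⁻ v)
    f2 : ∀ v → σ⁻ (σ⁻ (σ² v)) ≡ v
    f2 v = trans (cong σ⁻ (σ⁻σ (σ v))) (σ⁻σ v)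
    f3 : ∀ v → σ⁻ (σ⁻ (σ⁻ (σ³ v))) ≡ v
    f3 v = trans (cong σ⁻ (f2 (σ v))) (σ⁻σ v)
    f4 : ∀ v → σ⁻ (σ⁻ (σ⁻ (σ⁻ (σ⁴ v)))) ≡ v
    f4 v = trans (cong σ⁻ (f3 (σ v))) (σ⁻σ v)
    s0 : ℕ
    s0 = sum (λ x → ind (X x ∧ h x))
    t : (Fin N → Fin N) → ℕ
    t ρ = sum (λ u → ind (X (ρ u) ∧ h u))
    mv : ∀ p ρ → (∀ v → p (ρ v) ≡ v) → (∀ v → ρ (p v) ≡ v) → sum (λ x → ind (X x ∧ h (p x))) ≡ t ρ
    mv p ρ pρ ρp = trans (sum-cong (λ x → cong (λ z → ind (X z ∧ h (p x))) (sym (ρp x)))) (sum-perm p ρ pρ ρp (λ u → ind (X (ρ u) ∧ h u)))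
    #≤sum : # X ≤ sum (λ x → ind (X x ∧ h x) + (ind (X x ∧ h (σ x)) + (ind (X x ∧ h (σ² x)) + (ind (X x ∧ h (σ³ x)) + ind (X x ∧ h (σ⁴ x))))))
    #≤sum = ≤-trans (≤-reflexive (#-def X)) (sum-mono (λ x → lem (X x) _ _ _ _ _ (hit x)))
      where
      lem : ∀ x a b c d e → (x ≡ true → (a ∨ (b ∨ (c ∨ (d ∨ e)))) ≡ true) → ind x ≤ ind (x ∧ a) + (ind (x ∧ b) + (ind (x ∧ c) + (ind (x ∧ d) + ind (x ∧ e))))
      lem false a b c d e p = z≤n
      lem true true b c d e p = s≤s z≤n
      lem true false true c d e p = s≤s z≤n
      lem true false false true d e p = s≤s z≤n
      lem true false false false true e p = s≤s z≤n
      lem true false false false false e p = ≤-reflexive (sym (ind-t (p refl)))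
    one : ∀ u → ind (X u ∧ h u) + (ind (X (σ⁻ u) ∧ h u) + (ind (X (σ⁻ (σ⁻ u)) ∧ h u) + (ind (X (σ⁻ (σ⁻ (σ⁻ u))) ∧ h u) + ind (X (σ⁻ (σ⁻ (σ⁻ (σ⁻ u)))) ∧ h u)))) ≤ ind (h u)
    one u = lem (h u) _ _ _ _ _
        (λ p → let (_ , a , _) = sp (σ⁻ u) p in via a (σσ⁻ u))
        (λ p → let (_ , a , b , _) = sp (σ⁻ (σ⁻ u)) p in via a (σσ⁻ _) , via b (e2 u))
        (λ p → let (_ , a , b , c , _) = sp (σ⁻ (σ⁻ (σ⁻ u))) p in via a (σσ⁻ _) , via b (e2 _) , via c (e3 u))
        (λ p → let (_ , a , b , c , d) = sp (σ⁻ (σ⁻ (σ⁻ (σ⁻ u)))) p in via a (σσ⁻ _) , via b (e2 _) , via c (e3 _) , via d (e4 u))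
      where
      via : ∀ {v w} → X v ≡ false → v ≡ w → X w ≡ false
      via p refl = p
      lem : ∀ h x₀ x₁ x₂ x₃ x₄ → (x₁ ≡ true → x₀ ≡ false) → (x₂ ≡ true → (x₁ ≡ false) × (x₀ ≡ false)) → (x₃ ≡ true → (x₂ ≡ false) × (x₁ ≡ false) × (x₀ ≡ false)) →
        (x₄ ≡ true → (x₃ ≡ false) × (x₂ ≡ false) × (x₁ ≡ false) × (x₀ ≡ false)) →
        ind (x₀ ∧ h) + (ind (x₁ ∧ h) + (ind (x₂ ∧ h) + (ind (x₃ ∧ h) + ind (x₄ ∧ h)))) ≤ ind h
      lem h x₀ x₁ x₂ x₃ true p₁ p₂ p₃ p₄ with p₄ refl
      ... | refl , refl , refl , refl = ≤-refl
      lem h x₀ x₁ x₂ true false p₁ p₂ p₃ p₄ with p₃ refl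
      ... | refl , refl , refl = ≤-reflexive (+-identityʳ _)
      lem h x₀ x₁ true false false p₁ p₂ p₃ p₄ with p₂ refl
      ... | refl , refl = ≤-reflexive (+-identityʳ _)
      lem h x₀ true false false false p₁ p₂ p₃ p₄ with p₁ refl
      ... | refl = ≤-reflexive (+-identityʳ _)
      lem h true false false false false p₁ p₂ p₃ p₄ = ≤-reflexive (+-identityʳ _)
      lem h false false false false false p₁ p₂ p₃ p₄ = z≤n

  module _ {mate : Fin N → Fin N} (I : Invol mate) where
    open Nowhere π I

    D-out : (Z : S N) → D mate (λ _ → true) Z ≡ # (λ v → Z v ∧ not (Z (mate v))) + # (λ v → Z v ∧ not (Z (mate v)))
    D-out Z = trans (D-def mate _ Z) (trans (#-split _ Z) (cong₂ _+_ (#-cong (λ v → lem₁ (Z v) (Z (mate v))))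
      (trans (#-cong (λ v → trans (lem₂ (Z v) (Z (mate v))) (cong (λ z → Z (mate v) ∧ not (Z z)) (sym (mm I v))))) (#-mate I (λ v → Z v ∧ not (Z (mate v)))))))
      where
      lem₁ : ∀ a b → ((a xor b) ∧ a) ≡ (a ∧ not b)
      lem₁ a b = eqB-≡ (tauto 2 (λ a b → eqB ((a xor b) ∧ a) (a ∧ not b)) refl a b)
      lem₂ : ∀ a b → ((a xor b) ∧ not a) ≡ (b ∧ not a)
      lem₂ a b = eqB-≡ (tauto 2 (λ a b → eqB ((a xor b) ∧ not a) (b ∧ not a)) refl a b)

    -- A loop at a five-orbit would leave a cut with three edges.
    five-loopless : O5 → ∀ {x} → five x ≡ true → (mate x ≢ σ x) × (mate x ≢ σ² x) × (mate x ≢ σ³ x) × (mate x ≢ σ⁴ x)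
    five-loopless o5 {x} f = (λ e → bad (orb (inj₁ e))) , (λ e → bad (orb (inj₂ (inj₁ e)))) , (λ e → bad (orb (inj₂ (inj₂ (inj₁ e))))) , (λ e → bad (orb (inj₂ (inj₂ (inj₂ e)))))
      where
      Z₁ Z₂ Z₃ Z₄ Z : S N
      Z₁ = δ x
      Z₂ = Z₁ ∪₁ σ x
      Z₃ = Z₂ ∪₁ σ² x
      Z₄ = Z₃ ∪₁ σ³ x
      Z = Z₄ ∪₁ σ⁴ x
      inj : ∀ {u v} → u ≢ v → σ u ≢ σ v
      inj ne e = ne (σ-inj e)
      #Z : # Z ≡ 5
      #Z = trans (∪₁-count Z₄ (σ⁴ x) (∨-false (∨-false (∨-false (==-false (ne4 f)) (==-false (inj (ne3 f)))) (==-false (inj (inj (ne2 f))))) (==-false (inj (inj (inj (ne1 f)))))))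
        (cong suc (trans (∪₁-count Z₃ (σ³ x) (∨-false (∨-false (==-false (ne3 f)) (==-false (inj (ne2 f)))) (==-false (inj (inj (ne1 f))))))
        (cong suc (trans (∪₁-count Z₂ (σ² x) (∨-false (==-false (ne2 f)) (==-false (inj (ne1 f))))) (cong suc (trans (∪₁-count Z₁ (σ x) (==-false (ne1 f))) (cong suc (#-single x))))))))
      zinv : ∀ v → Z (σ v) ≡ Z v
      zinv v = trans (cong₂ _∨_ (cong₂ _∨_ (cong₂ _∨_ (cong₂ _∨_ (trans (cong (σ v ==_) (sym (per5 f))) (σ-inj-== v (σ⁴ x))) (σ-inj-== v x)) (σ-inj-== v (σ x))) (σ-inj-== v (σ² x))) (σ-inj-== v (σ³ x)))
        (eqB-≡ (tauto 5 (λ a b c d e → eqB ((((e ∨ a) ∨ b) ∨ c) ∨ d) ((((a ∨ b) ∨ c) ∨ d) ∨ e)) refl (v == x) (v == σ x) (v == σ² x) (v == σ³ x) (v == σ⁴ x)))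
      Zx : Z x ≡ true
      Zx = ∪₁-old Z₄ (∪₁-old Z₃ (∪₁-old Z₂ (∪₁-old Z₁ (==-refl x))))
      orb : (mate x ≡ σ x) ⊎ (mate x ≡ σ² x) ⊎ (mate x ≡ σ³ x) ⊎ (mate x ≡ σ⁴ x) → Z (mate x) ≡ true
      orb (inj₁ e) = trans (cong Z e) (trans (zinv x) Zx)
      orb (inj₂ (inj₁ e)) = trans (cong Z e) (trans (zinv _) (trans (zinv x) Zx))
      orb (inj₂ (inj₂ (inj₁ e))) = trans (cong Z e) (trans (zinv _) (trans (zinv _) (trans (zinv x) Zx)))
      orb (inj₂ (inj₂ (inj₂ e))) = trans (cong Z e) (∪₁-self Z₄ (σ⁴ x))
      bad : Z (mate x) ≡ true → ⊥
      bad zm = <⇒≱ {8} {10} (s≤s (s≤s (s≤s (s≤s (s≤s (s≤s (s≤s (s≤s (s≤s z≤n))))))))) (≤-trans (o5 Z zinv (cong par #Z)) (≤-trans (≤-reflexive (D-out Z)) (+-mono-≤ le le)))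
        where
        le : # (λ v → Z v ∧ not (Z (mate v))) ≤ 4
        le = ≤-trans (#-mono {g = Z ∖ x} (λ v p → ∧-intro (∧-fst p) (not-t (==-false (λ { refl → tf zm (not-t⁻ (∧-snd {Z v} p)) })))))
          (≤-reflexive (cong (_∸ 1) (trans (sym (∖-remove Z x Zx)) #Z)))

    -- Three vertices are left by at most three matching edges, too few for an odd cut.
    no-three : O5 → ∀ {x} → σ³ x ≡ x → σ x ≡ x
    no-three o5 {x} e with σ x ≟F x
    ... | yes p = p
    ... | no n1 = ⊥-elim (<⇒≱ {6} {10} (s≤s (s≤s (s≤s (s≤s (s≤s (s≤s (s≤s z≤n))))))) (≤-trans (o5 Z zinv (cong par #Z)) (≤-trans (≤-reflexive (D-out Z)) (+-mono-≤ le le))))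
      where
      n2 : σ² x ≢ x
      n2 p = n1 (trans (cong σ (sym p)) e)
      Z : S N
      Z = δ x ∪₁ σ x ∪₁ σ² x
      #Z : # Z ≡ 3
      #Z = trans (∪₁-count (δ x ∪₁ σ x) (σ² x) (∨-false (==-false n2) (==-false (λ p → n1 (σ-inj p))))) (cong suc (trans (∪₁-count (δ x) (σ x) (==-false n1)) (cong suc (#-single x))))
      zinv : ∀ v → Z (σ v) ≡ Z v
      zinv v = trans (cong₂ _∨_ (cong₂ _∨_ (trans (cong (σ v ==_) (sym e)) (σ-inj-== v (σ² x))) (σ-inj-== v x)) (σ-inj-== v (σ x)))
        (eqB-≡ (tauto 3 (λ a b c → eqB ((c ∨ a) ∨ b) ((a ∨ b) ∨ c)) refl (v == x) (v == σ x) (v == σ² x)))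
      le : # (λ v → Z v ∧ not (Z (mate v))) ≤ 3
      le = ≤-trans (#-mono {g = Z} (λ v → ∧-fst)) (≤-reflexive #Z)

-- Colourings. R = a ∧ b, G = a ∧ ¬ b and B = ¬ a are the three nonzero values of the flow (a , b).

module Colour {N : ℕ} {σ σ⁻ : Fin N → Fin N} (π : Perm σ σ⁻) {mate : Fin N → Fin N} (I : Invol mate) where
  open Cycles π
  open Mate I
  open Nowhere π I
  open Forest π I
  open Five π

  -- For a nowhere-zero flow, red, green and blue occur on a circuit of length five an odd number of
  -- times each, so 3, 1 and 1 times. An apex of `a` is the only blue point of its circuit, an apex
  -- of `b` the only green one.
  apex : S N → S N
  apex c x = five x ∧ (not (c x) ∧ (c (σ x) ∧ (c (σ² x) ∧ (c (σ³ x) ∧ c (σ⁴ x)))))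

  record Apex (c : S N) (x : Fin N) : Set where
    constructor mkApex
    field
      afive : five x ≡ true
      c₀ : c x ≡ false
      c₁ : c (σ x) ≡ true
      c₂ : c (σ² x) ≡ true
      c₃ : c (σ³ x) ≡ true
      c₄ : c (σ⁴ x) ≡ true
  open Apex

  apex-elim : ∀ {c x} → apex c x ≡ true → Apex c x
  apex-elim {c} {x} p = mkApex (∧-fst p) (not-t⁻ (∧-fst p₁)) (∧-fst p₂) (∧-fst p₃) (∧-fst p₄) (∧-snd {c (σ³ x)} p₄)
    where
    p₁ = ∧-snd {five x} p
    p₂ = ∧-snd {not (c x)} p₁
    p₃ = ∧-snd {c (σ x)} p₂
    p₄ = ∧-snd {c (σ² x)} p₃

  not-apex : ∀ {c x} → c x ≡ true → apex c x ≡ false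
  not-apex {c} {x} p = ¬t⇒f (λ q → tf p (c₀ (apex-elim {c} q)))

  apex-sparse : ∀ c → Sparse (apex c)
  apex-sparse c x p = let q = apex-elim {c} p in afive q , not-apex {c} (c₁ q) , not-apex {c} (c₂ q) , not-apex {c} (c₃ q) , not-apex {c} (c₄ q)

  around-case : ∀ {h x} → around h x ≡ true → (h x ≡ true) ⊎ (h (σ x) ≡ true) ⊎ (h (σ² x) ≡ true) ⊎ (h (σ³ x) ≡ true) ⊎ (h (σ⁴ x) ≡ true)
  around-case {h} {x} p with ∨-case {h x} p
  ... | inj₁ q = inj₁ q
  ... | inj₂ p₁ with ∨-case {h (σ x)} p₁
  ... | inj₁ q = inj₂ (inj₁ q)
  ... | inj₂ p₂ with ∨-case {h (σ² x)} p₂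
  ... | inj₁ q = inj₂ (inj₂ (inj₁ q))
  ... | inj₂ p₃ with ∨-case {h (σ³ x)} p₃
  ... | inj₁ q = inj₂ (inj₂ (inj₂ (inj₁ q)))
  ... | inj₂ q = inj₂ (inj₂ (inj₂ (inj₂ q)))

  around-0 : ∀ {h x} → h x ≡ true → around h x ≡ true
  around-0 p = ∨-inl p
  around-1 : ∀ {h x} → h (σ x) ≡ true → around h x ≡ true
  around-1 {h} {x} p = ∨-inr {h x} (∨-inl p)
  around-2 : ∀ {h x} → h (σ² x) ≡ true → around h x ≡ true
  around-2 {h} {x} p = ∨-inr {h x} (∨-inr {h (σ x)} (∨-inl p))
  around-3 : ∀ {h x} → h (σ³ x) ≡ true → around h x ≡ true
  around-3 {h} {x} p = ∨-inr {h x} (∨-inr {h (σ x)} (∨-inr {h (σ² x)} (∨-inl p)))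
  around-4 : ∀ {h x} → h (σ⁴ x) ≡ true → around h x ≡ true
  around-4 {h} {x} p = ∨-inr {h x} (∨-inr {h (σ x)} (∨-inr {h (σ² x)} (∨-inr {h (σ³ x)} p)))

  around-σ : ∀ {h x} → five x ≡ true → around h (σ x) ≡ around h x
  around-σ {h} {x} f = trans (cong (λ z → h (σ x) ∨ (h (σ² x) ∨ (h (σ³ x) ∨ (h (σ⁴ x) ∨ h z)))) (per5 f))
    (eqB-≡ (tauto 5 (λ a b c d e → eqB (b ∨ (c ∨ (d ∨ (e ∨ a)))) (a ∨ (b ∨ (c ∨ (d ∨ e))))) refl (h x) (h (σ x)) (h (σ² x)) (h (σ³ x)) (h (σ⁴ x))))

  around-all : ∀ {h x} → five x ≡ true → (around h (σ x) ≡ around h x) × (around h (σ² x) ≡ around h x) × (around h (σ³ x) ≡ around h x) × (around h (σ⁴ x) ≡ around h x)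
  around-all {h} {x} f = e₁ , e₂ , e₃ , trans (around-σ {h} (trans (five-σ _) (trans (five-σ _) (trans (five-σ _) f)))) e₃
    where
    e₁ = around-σ {h} f
    e₂ = trans (around-σ {h} (trans (five-σ _) f)) e₁
    e₃ = trans (around-σ {h} (trans (five-σ _) (trans (five-σ _) f))) e₂

  -- Adding a green cycle to `b` turns it red and changes nothing else. The number of zeros of `b`
  -- drops, so a minimal choice has no green cycle.
  acyclic-green : O5 → Σ (S N) λ a → Σ (S N) λ b → Flow a × Flow b × (∀ v → (a v ∨ b v) ≡ true) × Acyclic (λ v → not (b v))
  acyclic-green o5 with nowhere-zero o5
  ... | a , b₀ , fa , fb₀ , cov₀ with descend {Σ (S N) λ b → Flow b × (∀ v → (a v ∨ b v) ≡ true)} (λ P → # (λ v → not (proj₁ P v))) (λ P → Acyclic (λ v → not (proj₁ P v))) step (b₀ , fb₀ , cov₀)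
    where
    step : ∀ P → Acyclic (λ v → not (proj₁ P v)) ⊎ Σ (Σ (S N) λ b → Flow b × (∀ v → (a v ∨ b v) ≡ true)) λ P′ → # (λ v → not (proj₁ P′ v)) < # (λ v → not (proj₁ P v))
    step (b , fb , cov) with cycle? (λ v → not (b v))
    ... | inj₁ ac = inj₁ ac
    ... | inj₂ (z , fz , sub , u , zu) = inj₂ ((b ⊕ z , flow-⊕ fb fz , λ v → lem₁ (a v) (b v) (z v) (cov v) (sub v)) ,
            #-mono-< (λ v p → lem₂ (b v) (z v) (sub v) p) u (sub u zu) (lem₃ (b u) (z u) (sub u) zu))
      where
      lem₁ : ∀ a b z → (a ∨ b) ≡ true → (z ≡ true → not b ≡ true) → (a ∨ (b xor z)) ≡ true
      lem₁ true b z p q = refl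
      lem₁ false true true p q = q refl
      lem₁ false true false p q = refl
      lem₂ : ∀ b z → (z ≡ true → not b ≡ true) → not (b xor z) ≡ true → not b ≡ true
      lem₂ true true q p = q refl
      lem₂ false z q p = refl
      lem₃ : ∀ b z → (z ≡ true → not b ≡ true) → z ≡ true → not (b xor z) ≡ false
      lem₃ true true q refl = sym (q refl)
      lem₃ false true q refl = refl
  ... | (b , fb , cov) , ac = a , b , fa , fb , cov , ac

  -- `A` is a forest that contains all red edges. By `hits`, at least half of the apexes x of `b`
  -- also have the edge at `σ x` in it, so that apexes can be charged to edges of the forest.
  record Coloured : Set where
    field
      a b A : S N
      fa : Flow a
      fb : Flow b
      cover : ∀ v → (a v ∨ b v) ≡ true
      green : Acyclic (λ v → not (b v))
      forest : Acyclic A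
      finv : Inv A
      red⊆ : ∀ v → a v ≡ true → b v ≡ true → A v ≡ true
      hits : # (λ x → apex b x ∧ not (A (σ x))) ≤ # (λ x → apex b x ∧ A (σ x))

  -- A₁ is a spanning forest of the edges at the points σ x, x an apex of b, and A extends it to all of b.
  module Hit (o5 : O5) (b : S N) (fb : Flow b) where
    W : S N
    W = apex b
    E : S N
    E v = W (σ⁻ v) ∨ W (σ⁻ (mate v))
    Einv : Inv E
    Einv v = trans (cong (λ z → W (σ⁻ (mate v)) ∨ W (σ⁻ z)) (mm I v)) (lem (W (σ⁻ (mate v))) (W (σ⁻ v)))
      where
      lem : ∀ a b → (a ∨ b) ≡ (b ∨ a)
      lem a b = eqB-≡ (tauto 2 (λ a b → eqB (a ∨ b) (b ∨ a)) refl a b)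
    E⊆b : E ⊆ b
    E⊆b v p with ∨-case {W (σ⁻ v)} p
    ... | inj₁ q = trans (cong b (sym (σσ⁻ v))) (c₁ (apex-elim {b} q))
    ... | inj₂ q = trans (sym (inv fb v)) (trans (cong b (sym (σσ⁻ (mate v)))) (c₁ (apex-elim {b} q)))

    module _ {A₁ A : S N} (sA₁ : Spanning ∅ E A₁) (sA : Spanning A₁ b A) where
      State : Set
      State = Σ (S N) λ a → Flow a × (∀ v → b v ≡ false → a v ≡ true)

      Done : State → Set
      Done P = ∀ v → proj₁ P v ≡ true → b v ≡ true → A v ≡ true

      excess : S N → S N
      excess a v = b v ∧ (not (A v) ∧ a v)

      -- The fundamental cycle of a red edge outside `A` lies in `A` apart from that edge. Adding it
      -- to `a` makes the edge blue and creates red only inside `A`; since it stays within `b`, no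
      -- value becomes zero.
      cancel : ∀ a → Flow a → (∀ v → b v ≡ false → a v ≡ true) → ∀ u → excess a u ≡ true →
        (Σ (S N) λ z → Flow z × (z u ≡ true) × (∀ w → z w ≡ true → (w ≡ u) ⊎ (w ≡ mate u) ⊎ (A w ≡ true))) →
        Σ State λ P → # (excess (proj₁ P)) < # (excess a)
      cancel a fa cov u p (z , fz , zu , sup) = (a ⊕ z , flow-⊕ fa fz , λ v bv → cong₂ _xor_ (cov v bv) (¬t⇒f (λ q → tf (z⊆b v (sup v q)) bv))) ,
          #-mono-< {f = excess (a ⊕ z)} {excess a} (λ v → sub v (bool (z v))) u p (∧-false₂ {b u} (∧-false₂ {not (A u)} (cong₂ _xor_ au zu)))
        where
        bu : b u ≡ true
        bu = ∧-fst p
        au : a u ≡ true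
        au = ∧-snd {not (A u)} (∧-snd {b u} p)
        z⊆b : ∀ v → (v ≡ u) ⊎ (v ≡ mate u) ⊎ (A v ≡ true) → b v ≡ true
        z⊆b v (inj₁ refl) = bu
        z⊆b v (inj₂ (inj₁ refl)) = trans (inv fb u) bu
        z⊆b v (inj₂ (inj₂ r)) = below sA v r
        lem : ∀ x → (x xor false) ≡ x
        lem true = refl
        lem false = refl
        on : ∀ v → excess (a ⊕ z) v ≡ true → (v ≡ u) ⊎ (v ≡ mate u) ⊎ (A v ≡ true) → excess a v ≡ true
        on v q (inj₁ refl) = p
        on v q (inj₂ (inj₁ refl)) = ∧-intro (∧-fst {b v} q) (∧-intro {not (A v)} (∧-fst {not (A v)} (∧-snd {b v} q)) (trans (inv fa u) au))
        on v q (inj₂ (inj₂ s)) = tf s (not-t⁻ (∧-fst (∧-snd {b v} q)))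
        sub : ∀ v → (z v ≡ true) ⊎ (z v ≡ false) → excess (a ⊕ z) v ≡ true → excess a v ≡ true
        sub v (inj₂ r) q = subst (λ x → (b v ∧ (not (A v) ∧ x)) ≡ true) (trans (cong (a v xor_) r) (lem (a v))) q
        sub v (inj₁ r) q = on v q (sup v r)

      step : ∀ P → Done P ⊎ Σ State λ P′ → # (excess (proj₁ P′)) < # (excess (proj₁ P))
      step (a , fa , cov) = go (any? (λ v → excess a v ≟B true))
        where
        go : Dec (Σ (Fin N) λ v → excess a v ≡ true) → Done (a , fa , cov) ⊎ Σ State λ P′ → # (excess (proj₁ P′)) < # (excess a)
        go (no none) = inj₁ (λ v p q → ¬f⇒t (λ r → none (v , ∧-intro q (∧-intro (not-t r) p))))
        go (yes (u , p)) = inj₂ (cancel a fa cov u p (fund sA u (∧-fst p) (not-t⁻ (∧-fst (∧-snd {b u} p)))))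

      chosen : State → Σ State Done
      chosen = descend (λ P → # (excess (proj₁ P))) Done step

      h : S N
      h u = A u ∧ W (σ⁻ (mate u))

      -- By parity on the circuit of `x`, the fundamental cycle of the edge at `σ x` with respect to
      -- `A₁` passes through a second point u of this circuit; it is not the other end of the same
      -- edge, as there are no chords. The edge at u lies in `E`, and since x is the only apex of
      -- its circuit, it is there on account of an apex at its other end.
      hit : ∀ x → Apex b x → W x ≡ true → (Σ (S N) λ z → Flow z × (z (σ x) ≡ true) × (∀ u → z u ≡ true → (u ≡ σ x) ⊎ (u ≡ mate (σ x)) ⊎ (A₁ u ≡ true))) → around h x ≡ true
      hit x wx Wx (z , fz , z₁ , sup) = found (bool (z x)) (bool (z (σ² x))) (bool (z (σ³ x))) (bool (z (σ⁴ x)))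
          where
          f : five x ≡ true
          f = afive wx
          nl : (mate (σ x) ≢ σ² x) × (mate (σ x) ≢ σ³ x) × (mate (σ x) ≢ σ⁴ x) × (mate (σ x) ≢ σ⁵ x)
          nl = five-loopless I o5 {σ x} (trans (five-σ x) f)
          inA : ∀ u → z u ≡ true → u ≢ σ x → mate (σ x) ≢ u → W (σ⁻ u) ≡ false → h u ≡ true
          inA u zu n₁ n₂ nw with sup u zu
          ... | inj₁ e = ⊥-elim (n₁ e)
          ... | inj₂ (inj₁ e) = ⊥-elim (n₂ (sym e))
          ... | inj₂ (inj₂ q) with ∨-case {W (σ⁻ u)} (below sA₁ u q)
          ... | inj₁ r = tf r nw
          ... | inj₂ r = ∧-intro (above sA u q) r
          nw : ∀ {u y} → σ y ≡ u → b y ≡ true → W (σ⁻ u) ≡ false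
          nw {u} {y} refl q = trans (cong W (σ⁻σ y)) (not-apex {b} q)
          found : (z x ≡ true) ⊎ (z x ≡ false) → (z (σ² x) ≡ true) ⊎ (z (σ² x) ≡ false) → (z (σ³ x) ≡ true) ⊎ (z (σ³ x) ≡ false) → (z (σ⁴ x) ≡ true) ⊎ (z (σ⁴ x) ≡ false) → around h x ≡ true
          found (inj₁ q) _ _ _ = around-0 {h} (inA x q (λ e → ne1 f (sym e)) (λ e → proj₂ (proj₂ (proj₂ nl)) (trans e (sym (per5 f)))) (nw (per5 f) (c₄ wx)))
          found _ (inj₁ q) _ _ = around-2 {h} (inA _ q (λ e → ne1 f (σ-inj e)) (proj₁ nl) (nw refl (c₁ wx)))
          found _ _ (inj₁ q) _ = around-3 {h} (inA _ q (λ e → ne2 f (σ-inj e)) (proj₁ (proj₂ nl)) (nw refl (c₂ wx)))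
          found _ _ _ (inj₁ q) = around-4 {h} (inA _ q (λ e → ne3 f (σ-inj e)) (proj₁ (proj₂ (proj₂ nl))) (nw refl (c₃ wx)))
          found (inj₂ p₀) (inj₂ p₂) (inj₂ p₃) (inj₂ p₄) = tf (cong₂ _xor_ p₀ (cong₂ _xor_ z₁ (cong₂ _xor_ p₂ (cong₂ _xor_ p₃ p₄)))) (five-par f {z} (even fz))

      -- The map from y to `mate (σ y)` carries the apexes with `A (σ y)` onto the points of `h`, so
      -- `# h` is the right-hand side.
      hits : # (λ x → W x ∧ not (A (σ x))) ≤ # (λ x → W x ∧ A (σ x))
      hits = ≤-trans (five-inj (λ x → W x ∧ not (A (σ x))) h (sparse-⊆ (λ v p → ∧-fst p) (apex-sparse b))
          (λ x p → hit x (apex-elim {b} (∧-fst p)) (∧-fst p) (fund sA₁ (σ x) (∨-inl (trans (cong W (σ⁻σ x)) (∧-fst p))) (¬t⇒f (λ q → tf (above sA (σ x) q) (not-t⁻ (∧-snd {W x} p)))))))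
        (≤-reflexive (trans (sym (#-perm (λ y → mate (σ y)) (λ u → σ⁻ (mate u)) (λ v → trans (cong mate (σσ⁻ (mate v))) (mm I v)) (λ v → trans (cong σ⁻ (mm I (σ v))) (σ⁻σ v)) h))
          (#-cong (λ y → trans (cong₂ _∧_ (sinv sA (σ y)) (cong W (trans (cong σ⁻ (mm I (σ y))) (σ⁻σ y)))) (lem (A (σ y)) (W y))))))
        where
        lem : ∀ a b → (a ∧ b) ≡ (b ∧ a)
        lem a b = eqB-≡ (tauto 2 (λ a b → eqB (a ∧ b) (b ∧ a)) refl a b)

      finish : Acyclic (λ v → not (b v)) → Σ State Done → Coloured
      finish green ((a , fa , cov) , red) = record { a = a ; b = b ; A = A ; fa = fa ; fb = fb
        ; cover = λ v → case bool (b v) of λ { (inj₁ p) → ∨-inr {a v} p ; (inj₂ p) → ∨-inl (cov v p) }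
        ; green = green ; forest = acyc sA ; finv = sinv sA ; red⊆ = red ; hits = hits }

    colour : ∀ a → Flow a → (∀ v → (a v ∨ b v) ≡ true) → Acyclic (λ v → not (b v)) → Coloured
    colour a fa cov green = go₁ (spanning-forest ∅ E (λ _ → refl) Einv (λ _ ()) (λ z f s v → ¬t⇒f (λ p → t≢f (sym (s v p)))))
      where
      go₂ : ∀ {A₁} → Spanning ∅ E A₁ → Σ (S N) (Spanning A₁ b) → Coloured
      go₂ sA₁ (A , sA) = finish sA₁ sA green (chosen sA₁ sA (a , fa , λ v p → case ∨-case {a v} (cov v) of λ { (inj₁ q) → q ; (inj₂ q) → tf q p }))
      go₁ : Σ (S N) (Spanning ∅ E) → Coloured
      go₁ (A₁ , sA₁) = go₂ sA₁ (spanning-forest A₁ b (sinv sA₁) (inv fb) (λ v p → E⊆b v (below sA₁ v p)) (acyc sA₁))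

  coloured : O5 → Coloured
  coloured o5 = let (a , b , fa , fb , cov , green) = acyclic-green o5 in Hit.colour o5 b fb a fa cov green

-- Missed values on circuits of length five

module Half {N : ℕ} {σ σ⁻ : Fin N → Fin N} (π : Perm σ σ⁻) {mate : Fin N → Fin N} (I : Invol mate) where
  open Cycles π
  open Mate I
  open Nowhere π I
  open Forest π I
  open Five π
  open Colour π I
  open Apex

  -- For an apex x of a, the orbit of x misses a value of s when the neighbours of x differ in b.
  dif : S N → S N
  dif c x = c (σ x) xor c (σ⁴ x)

  dif-⊕ : ∀ c d x → dif (c ⊕ d) x ≡ (dif c x xor dif d x)
  dif-⊕ c d x = xor4 (c (σ x)) (d (σ x)) (c (σ⁴ x)) (d (σ⁴ x))

  Inside : S N → Set
  Inside a = Σ (S N) λ z → Flow z × (z ⊆ a)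

  -- Adding a fixed cycle complements the outcome at all points of X where its two values differ.
  half-good : ∀ a k X → # X ≤ k → (∀ x → X x ≡ true → Σ (Inside a) λ z → dif (proj₁ z) x ≡ true) → ∀ b →
    Σ (Inside a) λ z → # X ≤ 2 * # (λ x → X x ∧ dif (b ⊕ proj₁ z) x)
  half-good a k X le wit b = go (any? (λ x → X x ≟B true)) k le
    where
    Goal : Set
    Goal = Σ (Inside a) λ z → # X ≤ 2 * # (λ x → X x ∧ dif (b ⊕ proj₁ z) x)
    combine : ∀ d → Inside a → (Σ (Inside a) λ z → # (λ x → X x ∧ not (d x)) ≤ 2 * # (λ x → (X x ∧ not (d x)) ∧ dif (b ⊕ proj₁ z) x)) →
      (z₁ : Inside a) → (∀ x → dif (proj₁ z₁) x ≡ d x) → Goal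
    combine d _ ((z , fz , sz) , h₀) (z₁ , f₁ , s₁) e = pick (≤-total g g′)
      where
      g g′ : ℕ
      g = # (λ x → (X x ∧ d x) ∧ dif (b ⊕ z) x)
      g′ = # (λ x → (X x ∧ d x) ∧ not (dif (b ⊕ z) x))
      all : ∀ q → # (λ x → X x ∧ dif (b ⊕ q) x) ≡ # (λ x → (X x ∧ d x) ∧ dif (b ⊕ q) x) + # (λ x → (X x ∧ not (d x)) ∧ dif (b ⊕ q) x)
      all q = trans (#-split _ d) (cong₂ _+_ (#-cong (λ x → sw (X x) (d x) (dif (b ⊕ q) x))) (#-cong (λ x → sw (X x) (not (d x)) (dif (b ⊕ q) x))))
        where
        sw : ∀ x d y → ((x ∧ y) ∧ d) ≡ ((x ∧ d) ∧ y)
        sw x d y = eqB-≡ (tauto 3 (λ x d y → eqB ((x ∧ y) ∧ d) ((x ∧ d) ∧ y)) refl x d y)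
      total : # X ≡ (g + g′) + # (λ x → X x ∧ not (d x))
      total = trans (#-split X d) (cong (_+ # (λ x → X x ∧ not (d x))) (#-split (λ x → X x ∧ d x) (dif (b ⊕ z))))
      arith : ∀ {k u w p q} → k ≡ u + w → u ≤ 2 * p → w ≤ 2 * q → k ≤ 2 * (p + q)
      arith {p = p} {q} refl x y = ≤-trans (+-mono-≤ x y) (≤-reflexive (sym (*-distribˡ-+ 2 p q)))
      new : ∀ x → dif (b ⊕ (z ⊕ z₁)) x ≡ (dif (b ⊕ z) x xor d x)
      new x = trans (dif-⊕ b (z ⊕ z₁) x) (trans (cong (dif b x xor_) (trans (dif-⊕ z z₁ x) (cong (dif z x xor_) (e x))))
        (trans (ass (dif b x) (dif z x) (d x)) (cong (_xor d x) (sym (dif-⊕ b z x)))))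
        where
        ass : ∀ p q r → (p xor (q xor r)) ≡ ((p xor q) xor r)
        ass p q r = eqB-≡ (tauto 3 (λ p q r → eqB (p xor (q xor r)) ((p xor q) xor r)) refl p q r)
      pick : (g ≤ g′) ⊎ (g′ ≤ g) → Goal
      pick (inj₂ q) = (z , fz , sz) , subst (λ y → # X ≤ 2 * y) (sym (all z)) (arith {p = g} total (≤-trans (+-monoʳ-≤ g q) (≤-reflexive (cong (g +_) (sym (+-identityʳ g))))) h₀)
      pick (inj₁ q) = (z ⊕ z₁ , flow-⊕ fz f₁ , λ v p → case bool (z v) of λ { (inj₁ r) → sz v r ; (inj₂ r) → s₁ v (trans (cong (_xor z₁ v) (sym r)) p) }) ,
        subst (λ y → # X ≤ 2 * y) (sym (all (z ⊕ z₁))) (arith {p = # (λ x → (X x ∧ d x) ∧ dif (b ⊕ (z ⊕ z₁)) x)} total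
          (≤-trans (+-monoˡ-≤ g′ q) (≤-reflexive (trans (cong (g′ +_) (sym (+-identityʳ g′))) (cong (2 *_) (#-cong (λ x → fl (X x) (d x) (dif (b ⊕ z) x) (new x)))))))
          (≤-trans h₀ (≤-reflexive (cong (2 *_) (#-cong (λ x → st (X x) (d x) (dif (b ⊕ z) x) (new x)))))))
        where
        fl : ∀ x d y {w} → w ≡ (y xor d) → ((x ∧ d) ∧ not y) ≡ ((x ∧ d) ∧ w)
        fl x d y refl = eqB-≡ (tauto 3 (λ x d y → eqB ((x ∧ d) ∧ not y) ((x ∧ d) ∧ (y xor d))) refl x d y)
        st : ∀ x d y {w} → w ≡ (y xor d) → ((x ∧ not d) ∧ y) ≡ ((x ∧ not d) ∧ w)
        st x d y refl = eqB-≡ (tauto 3 (λ x d y → eqB ((x ∧ not d) ∧ y) ((x ∧ not d) ∧ (y xor d))) refl x d y)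
    go : Dec (Σ (Fin N) λ x → X x ≡ true) → ∀ k → # X ≤ k → Goal
    go (no none) k le = (∅ , flow-∅ , λ _ ()) , ≤-trans (≤-reflexive (#-empty (λ v → ¬t⇒f (λ p → none (v , p))))) z≤n
    go (yes (x , p)) zero le = ⊥-elim (1+n≰n (≤-trans (#-pos X x p) le))
    go (yes (x , p)) (suc k) le with wit x p
    ... | z₁ , d₁ = combine (dif (proj₁ z₁)) z₁ (half-good a k (λ v → X v ∧ not (dif (proj₁ z₁) v))
            (≤-pred (≤-trans (#-mono-< {g = X} (λ v q → ∧-fst q) x p (∧-false₂ {X x} (not-f d₁))) le)) (λ v q → wit v (∧-fst q)) b) z₁ (λ _ → refl)

  imp : ∀ {p q} → (not p ∨ q) ≡ true → p ≡ true → q ≡ true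
  imp h refl = h

  -- No edge of the circuit carries the values (p , q). If the first cover is complemented so that
  -- this pair would mean threefold use, then no edge of the circuit is used three times.
  Miss : S N → S N → Fin N → Set
  Miss s r x = Σ Bool λ p → Σ Bool λ q → around (λ u → eqB (s u) p ∧ eqB (r u) q) x ≡ false

  module _ {a b s r : S N} (bs : Bal σ s a) (br : Bal σ r b) where

    -- Around an apex `s` alternates, so it takes the value `not (s x)` only at `σ x` and `σ³ x`. As
    -- `b x` is true and `b` differs at the neighbours of `x`, evenness gives `b (σ² x)` and
    -- `b (σ³ x)` the same value; hence `r` agrees at the two places and one pair is missed.
    miss-apex : ∀ {x} → Apex a x → b x ≡ true → dif b x ≡ true → Miss s r x
    miss-apex {x} ap b₀ d = not (s x) , not (r (σ x)) ,
      values (s x) _ _ _ _ (r x) _ _ _ _ (b (σ x)) (b (σ² x)) (b (σ³ x)) (b (σ⁴ x))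
        (trans (bs _) (cong (s x xor_) (c₁ ap))) (trans (bs _) (cong (s (σ x) xor_) (c₂ ap))) (trans (bs _) (cong (s (σ² x) xor_) (c₃ ap))) (trans (bs _) (cong (s (σ³ x) xor_) (c₄ ap)))
        (br x) (br _) (br _) (br _) d (trans (cong (λ y → y xor (b (σ x) xor (b (σ² x) xor (b (σ³ x) xor b (σ⁴ x))))) (sym b₀)) (five-par (afive ap) {b} (r , br)))
      where
      values : ∀ s₀ s₁ s₂ s₃ s₄ r₀ r₁ r₂ r₃ r₄ b₁ b₂ b₃ b₄ → s₁ ≡ (s₀ xor true) → s₂ ≡ (s₁ xor true) → s₃ ≡ (s₂ xor true) → s₄ ≡ (s₃ xor true) →
        r₁ ≡ (r₀ xor b₁) → r₂ ≡ (r₁ xor b₂) → r₃ ≡ (r₂ xor b₃) → r₄ ≡ (r₃ xor b₄) → (b₁ xor b₄) ≡ true → (true xor (b₁ xor (b₂ xor (b₃ xor b₄)))) ≡ false →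
        ((eqB s₀ (not s₀) ∧ eqB r₀ (not r₁)) ∨ ((eqB s₁ (not s₀) ∧ eqB r₁ (not r₁)) ∨ ((eqB s₂ (not s₀) ∧ eqB r₂ (not r₁)) ∨ ((eqB s₃ (not s₀) ∧ eqB r₃ (not r₁)) ∨ (eqB s₄ (not s₀) ∧ eqB r₄ (not r₁)))))) ≡ false
      values s₀ _ _ _ _ r₀ _ _ _ _ b₁ b₂ b₃ b₄ refl refl refl refl refl refl refl refl d e = not-t⁻ (imp (tauto 6 (λ s₀ r₀ b₁ b₂ b₃ b₄ →
        let s₁ = s₀ xor true ; s₂ = s₁ xor true ; s₃ = s₂ xor true ; s₄ = s₃ xor true ; r₁ = r₀ xor b₁ ; r₂ = r₁ xor b₂ ; r₃ = r₂ xor b₃ ; r₄ = r₃ xor b₄ in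
        not ((b₁ xor b₄) ∧ not (true xor (b₁ xor (b₂ xor (b₃ xor b₄))))) ∨ not
        ((eqB s₀ (not s₀) ∧ eqB r₀ (not r₁)) ∨ ((eqB s₁ (not s₀) ∧ eqB r₁ (not r₁)) ∨ ((eqB s₂ (not s₀) ∧ eqB r₂ (not r₁)) ∨ ((eqB s₃ (not s₀) ∧ eqB r₃ (not r₁)) ∨ (eqB s₄ (not s₀) ∧ eqB r₄ (not r₁))))))) refl s₀ r₀ b₁ b₂ b₃ b₄)
        (∧-intro d (not-t e)))

    -- If a holds at exactly two points of the orbit and these are adjacent, then s takes one of its values only once.
    miss-adjacent : ∀ {x} → five x ≡ true → a x ≡ true → around (apex a) x ≡ false → (a (σ x) ∨ a (σ⁴ x)) ≡ true → Miss s r x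
    miss-adjacent {x} f a₀ na adj = pick (bool (a (σ x)))
      where
      bad : ∀ {c₁ c₂ c₃ c₄ : Bool} {y} → (apex a y ≡ true → around (apex a) x ≡ true) → (a y ≡ false → c₁ ≡ true → c₂ ≡ true → c₃ ≡ true → c₄ ≡ true → apex a y ≡ true) →
        (not (a y) ∧ (c₁ ∧ (c₂ ∧ (c₃ ∧ c₄)))) ≡ false
      bad {c₁} {c₂} {c₃} {c₄} {y} h k = ¬t⇒f (λ p → let p₁ = ∧-snd {not (a y)} p ; p₂ = ∧-snd {c₁} p₁ ; p₃ = ∧-snd {c₂} p₂ in
        tf (h (k (not-t⁻ (∧-fst {not (a y)} p)) (∧-fst {c₁} p₁) (∧-fst {c₂} p₂) (∧-fst {c₃} p₃) (∧-snd {c₃} p₃))) na)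
      mk : ∀ {y} → five y ≡ true → a y ≡ false → a (σ y) ≡ true → a (σ² y) ≡ true → a (σ³ y) ≡ true → a (σ⁴ y) ≡ true → apex a y ≡ true
      mk f p q r s t = ∧-intro f (∧-intro (not-t p) (∧-intro q (∧-intro r (∧-intro s t))))
      f₁ = trans (five-σ x) f
      f₂ = trans (five-σ _) f₁
      f₃ = trans (five-σ _) f₂
      f₄ = trans (five-σ _) f₃
      p₀ : ∀ {y} → a x ≡ y → a (σ⁵ x) ≡ y
      p₀ e = trans (cong a (per5 f)) e
      p₁ : ∀ {y} → a (σ x) ≡ y → a (σ (σ⁵ x)) ≡ y
      p₁ e = trans (cong (λ y → a (σ y)) (per5 f)) e
      p₂ : ∀ {y} → a (σ² x) ≡ y → a (σ² (σ⁵ x)) ≡ y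
      p₂ e = trans (cong (λ y → a (σ² y)) (per5 f)) e
      p₃ : ∀ {y} → a (σ³ x) ≡ y → a (σ³ (σ⁵ x)) ≡ y
      p₃ e = trans (cong (λ y → a (σ³ y)) (per5 f)) e
      n₁ = bad {a (σ² x)} {a (σ³ x)} {a (σ⁴ x)} {a x} (around-1 {apex a}) (λ e q r s t → mk f₁ e q r s (p₀ t))
      n₂ = bad {a (σ³ x)} {a (σ⁴ x)} {a x} {a (σ x)} (around-2 {apex a}) (λ e q r s t → mk f₂ e q r (p₀ s) (p₁ t))
      n₃ = bad {a (σ⁴ x)} {a x} {a (σ x)} {a (σ² x)} (around-3 {apex a}) (λ e q r s t → mk f₃ e q (p₀ r) (p₁ s) (p₂ t))
      n₄ = bad {a x} {a (σ x)} {a (σ² x)} {a (σ³ x)} (around-4 {apex a}) (λ e q r s t → mk f₄ e (p₀ q) (p₁ r) (p₂ s) (p₃ t))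
      -- With `a x` true, evenness leaves two or four points of `a`. Four would produce an apex, so
      -- there are two, and the first condition makes them adjacent.
      Prem : Bool → Bool → Bool → Bool → Bool
      Prem a₁ a₂ a₃ a₄ = (a₁ ∨ a₄) ∧ (not (true xor (a₁ xor (a₂ xor (a₃ xor a₄)))) ∧ (not (not a₁ ∧ (a₂ ∧ (a₃ ∧ (a₄ ∧ true)))) ∧
        (not (not a₂ ∧ (a₃ ∧ (a₄ ∧ (true ∧ a₁)))) ∧ (not (not a₃ ∧ (a₄ ∧ (true ∧ (a₁ ∧ a₂)))) ∧ not (not a₄ ∧ (true ∧ (a₁ ∧ (a₂ ∧ a₃))))))))
      prem : Prem (a (σ x)) (a (σ² x)) (a (σ³ x)) (a (σ⁴ x)) ≡ true
      prem = ∧-intro adj (∧-intro (not-t (trans (cong (λ y → y xor (a (σ x) xor (a (σ² x) xor (a (σ³ x) xor a (σ⁴ x))))) (sym a₀)) (five-par f {a} (s , bs))))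
        (∧-intro (not-t (trans (cong (λ y → not (a (σ x)) ∧ (a (σ² x) ∧ (a (σ³ x) ∧ (a (σ⁴ x) ∧ y)))) (sym a₀)) n₁))
        (∧-intro (not-t (trans (cong (λ y → not (a (σ² x)) ∧ (a (σ³ x) ∧ (a (σ⁴ x) ∧ (y ∧ a (σ x))))) (sym a₀)) n₂))
        (∧-intro (not-t (trans (cong (λ y → not (a (σ³ x)) ∧ (a (σ⁴ x) ∧ (y ∧ (a (σ x) ∧ a (σ² x))))) (sym a₀)) n₃))
          (not-t (trans (cong (λ y → not (a (σ⁴ x)) ∧ (y ∧ (a (σ x) ∧ (a (σ² x) ∧ a (σ³ x))))) (sym a₀)) n₄))))))
      five-values : Bool → Bool → Bool → Bool → Bool → Bool → Bool → Bool → Bool → Bool → Bool → Bool → Bool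
      five-values s₀ s₁ s₂ s₃ s₄ r₀ r₁ r₂ r₃ r₄ p q = (eqB s₀ p ∧ eqB r₀ q) ∨ ((eqB s₁ p ∧ eqB r₁ q) ∨ ((eqB s₂ p ∧ eqB r₂ q) ∨ ((eqB s₃ p ∧ eqB r₃ q) ∨ (eqB s₄ p ∧ eqB r₄ q))))
      first : ∀ s₀ s₁ s₂ s₃ s₄ r₀ r₁ r₂ r₃ r₄ a₁ a₂ a₃ a₄ → s₁ ≡ (s₀ xor a₁) → s₂ ≡ (s₁ xor a₂) → s₃ ≡ (s₂ xor a₃) → s₄ ≡ (s₃ xor a₄) → a₁ ≡ true → Prem a₁ a₂ a₃ a₄ ≡ true →
        five-values s₀ s₁ s₂ s₃ s₄ r₀ r₁ r₂ r₃ r₄ s₀ (not r₀) ≡ false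
      first s₀ _ _ _ _ r₀ r₁ r₂ r₃ r₄ a₁ a₂ a₃ a₄ refl refl refl refl refl pr = not-t⁻ (imp (tauto 9 (λ s₀ r₀ r₁ r₂ r₃ r₄ a₂ a₃ a₄ →
        let s₁ = s₀ xor true ; s₂ = s₁ xor a₂ ; s₃ = s₂ xor a₃ ; s₄ = s₃ xor a₄ in
        not (Prem true a₂ a₃ a₄) ∨ not (five-values s₀ s₁ s₂ s₃ s₄ r₀ r₁ r₂ r₃ r₄ s₀ (not r₀))) refl s₀ r₀ r₁ r₂ r₃ r₄ a₂ a₃ a₄) pr)
      second : ∀ s₀ s₁ s₂ s₃ s₄ r₀ r₁ r₂ r₃ r₄ a₁ a₂ a₃ a₄ → s₁ ≡ (s₀ xor a₁) → s₂ ≡ (s₁ xor a₂) → s₃ ≡ (s₂ xor a₃) → s₄ ≡ (s₃ xor a₄) → a₁ ≡ false → Prem a₁ a₂ a₃ a₄ ≡ true →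
        five-values s₀ s₁ s₂ s₃ s₄ r₀ r₁ r₂ r₃ r₄ s₄ (not r₄) ≡ false
      second s₀ _ _ _ _ r₀ r₁ r₂ r₃ r₄ a₁ a₂ a₃ a₄ refl refl refl refl refl pr = not-t⁻ (imp (tauto 9 (λ s₀ r₀ r₁ r₂ r₃ r₄ a₂ a₃ a₄ →
        let s₁ = s₀ xor false ; s₂ = s₁ xor a₂ ; s₃ = s₂ xor a₃ ; s₄ = s₃ xor a₄ in
        not (Prem false a₂ a₃ a₄) ∨ not (five-values s₀ s₁ s₂ s₃ s₄ r₀ r₁ r₂ r₃ r₄ s₄ (not r₄))) refl s₀ r₀ r₁ r₂ r₃ r₄ a₂ a₃ a₄) pr)
      pick : (a (σ x) ≡ true) ⊎ (a (σ x) ≡ false) → Miss s r x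
      pick (inj₁ e) = s x , not (r x) , first (s x) _ _ _ _ (r x) (r (σ x)) (r (σ² x)) (r (σ³ x)) (r (σ⁴ x)) _ _ _ _ (bs _) (bs _) (bs _) (bs _) e prem
      pick (inj₂ e) = s (σ⁴ x) , not (r (σ⁴ x)) , second (s x) _ _ _ _ (r x) (r (σ x)) (r (σ² x)) (r (σ³ x)) (r (σ⁴ x)) _ _ _ _ (bs _) (bs _) (bs _) (bs _) e prem

  -- Circuits of length five counted against the forests

  module Account (o5 : O5) (iso : Isolated) (C : Coloured) where
    open Coloured C

    -- Adding a cycle inside `a` to `b` exchanges red and green along it. The point is free if some
    -- such recolouring reverses whether the neighbours of `x` differ.
    Free : Fin N → Set
    Free x = Σ (Inside a) λ z → dif (proj₁ z) x ≡ true

    opaque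
      free? : ∀ x → Dec (Free x)
      free? x = map′ (λ (z , f , s , d) → (z , f , s) , d) (λ ((z , f , s) , d) → z , f , s , d)
        (search (λ h (f , s , d) → flow-ext h f , (λ v p → s v (trans (h v) p)) , trans (sym (cong₂ _xor_ (h _) (h _))) d)
          (λ z → flow? z ×-dec (all? (λ v → (z v ≟B true) →-dec (a v ≟B true)) ×-dec (_ ≟B _))))

    free : S N
    free x = ⌊ free? x ⌋

    free-elim : ∀ {x} → free x ≡ true → Free x
    free-elim {x} p with free? x | p
    ... | yes f | _ = f
    ... | no _ | ()

    stuck-elim : ∀ {x} → free x ≡ false → (z : Inside a) → dif (proj₁ z) x ≡ false
    stuck-elim {x} p z with free? x | p
    ... | yes _ | ()
    ... | no nf | _ = ¬t⇒f (λ d → nf (z , d))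

    -- Apexes of `a` are recolourable (`Nf`) or stuck. A stuck one is good (`SG`) or has two red
    -- (`QR`) or two green (`QG`) neighbours. `Sₒ` takes care of the other circuits of length five:
    -- those with three blue points, represented by the green one.
    Tₐ W Nf SG QR QG Sₒ : S N
    Tₐ = apex a
    W = apex b
    Nf x = Tₐ x ∧ free x
    SG x = (Tₐ x ∧ not (free x)) ∧ dif b x
    QR x = ((Tₐ x ∧ not (free x)) ∧ not (dif b x)) ∧ b (σ x)
    QG x = ((Tₐ x ∧ not (free x)) ∧ not (dif b x)) ∧ not (b (σ x))
    Sₒ x = W x ∧ not (around Tₐ x)

    module Chosen (z : Inside a) (zhalf : # Nf ≤ 2 * # (λ x → Nf x ∧ dif (b ⊕ proj₁ z) x)) where

      -- Only red and green are exchanged, so `a`, its apexes and its size stay the same. The forest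
      -- bounds below refer to the old `b`, the missed values to `b′`; for `Sg` only `a` matters.
      b′ : S N
      b′ = b ⊕ proj₁ z

      fb′ : Flow b′
      fb′ = flow-⊕ fb (proj₁ (proj₂ z))

      cover′ : ∀ v → (a v ∨ b′ v) ≡ true
      cover′ v = lem (a v) (b v) (proj₁ z v) (cover v) (proj₂ (proj₂ z) v)
        where
        lem : ∀ a b z → (a ∨ b) ≡ true → (z ≡ true → a ≡ true) → (a ∨ (b xor z)) ≡ true
        lem true b z p q = refl
        lem false true true p q = q refl
        lem false true false p q = refl

      Tg Sg X Y : S N
      Tg x = Tₐ x ∧ dif b′ x
      Sg x = Sₒ x ∧ (a (σ x) ∨ a (σ⁴ x))
      X x = Tₐ x ∨ Sₒ x
      Y x = Tg x ∨ Sg x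

      X-sparse : Sparse X
      X-sparse x p with ∨-case {Tₐ x} p
      ... | inj₁ q = let (f , n1 , n2 , n3 , n4) = apex-sparse a x q ; (e1 , e2 , e3 , e4) = around-all {Tₐ} f in
             f , ∨-false n1 (nope e1) , ∨-false n2 (nope e2) , ∨-false n3 (nope e3) , ∨-false n4 (nope e4)
        where
        nope : ∀ {y} → around Tₐ y ≡ around Tₐ x → Sₒ y ≡ false
        nope {y} e = ∧-false₂ {W y} (not-f (trans e (around-0 {Tₐ} q)))
      ... | inj₂ q = let (f , n1 , n2 , n3 , n4) = apex-sparse b x (∧-fst q) in
             f , ∨-false (nope (around-1 {Tₐ})) (∧-false₁ n1) , ∨-false (nope (around-2 {Tₐ})) (∧-false₁ n2) , ∨-false (nope (around-3 {Tₐ})) (∧-false₁ n3) , ∨-false (nope (around-4 {Tₐ})) (∧-false₁ n4)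
        where
        nope : ∀ {y} → (Tₐ y ≡ true → around Tₐ x ≡ true) → Tₐ y ≡ false
        nope h = ¬t⇒f (λ t → tf (h t) (not-t⁻ (∧-snd {W x} q)))

      Y-sparse : Sparse Y
      Y-sparse = sparse-⊆ {Y} {X} (λ x p → case ∨-case {Tg x} p of λ { (inj₁ q) → ∨-inl {Tₐ x} (∧-fst {Tₐ x} q) ; (inj₂ q) → ∨-inr {Tₐ x} (∧-fst {Sₒ x} q) }) X-sparse

      -- The colours occur 3, 1 and 1 times. Either blue occurs once, which gives an apex of `a`, or
      -- green does, which gives an apex of `b`.
      X-around : ∀ r → five r ≡ true → around X r ≡ true
      X-around r f = ¬f⇒t (λ ne → tf (someapex (cov r) (cov (σ r)) (cov (σ² r)) (cov (σ³ r)) (cov (σ⁴ r)) (five-par f {a} (even fa)) (five-par f {b} (even fb))) (none ne))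
        where
        cov = cover
        ap : S N → S N
        ap c x = not (c x) ∧ (c (σ x) ∧ (c (σ² x) ∧ (c (σ³ x) ∧ c (σ⁴ x))))
        pat : Bool → Bool → Bool → Bool → Bool → Bool
        pat p q r s t = not p ∧ (q ∧ (r ∧ (s ∧ t)))
        ap5 : Bool → Bool → Bool → Bool → Bool → Bool
        ap5 p q r s t = pat p q r s t ∨ (pat q r s t p ∨ (pat r s t p q ∨ (pat s t p q r ∨ pat t p q r s)))
        someapex : (a r ∨ b r) ≡ true → (a (σ r) ∨ b (σ r)) ≡ true → (a (σ² r) ∨ b (σ² r)) ≡ true → (a (σ³ r) ∨ b (σ³ r)) ≡ true → (a (σ⁴ r) ∨ b (σ⁴ r)) ≡ true →
          (a r xor (a (σ r) xor (a (σ² r) xor (a (σ³ r) xor a (σ⁴ r))))) ≡ false → (b r xor (b (σ r) xor (b (σ² r) xor (b (σ³ r) xor b (σ⁴ r))))) ≡ false →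
          (ap5 (a r) (a (σ r)) (a (σ² r)) (a (σ³ r)) (a (σ⁴ r)) ∨ ap5 (b r) (b (σ r)) (b (σ² r)) (b (σ³ r)) (b (σ⁴ r))) ≡ true
        someapex c0 c1 c2 c3 c4 pa pb = use (tauto 10 (λ a0 a1 a2 a3 a4 b0 b1 b2 b3 b4 →
            not ((a0 ∨ b0) ∧ ((a1 ∨ b1) ∧ ((a2 ∨ b2) ∧ ((a3 ∨ b3) ∧ ((a4 ∨ b4) ∧ (not (a0 xor (a1 xor (a2 xor (a3 xor a4)))) ∧ not (b0 xor (b1 xor (b2 xor (b3 xor b4)))))))))) ∨
            (ap5 a0 a1 a2 a3 a4 ∨ ap5 b0 b1 b2 b3 b4)) refl
            (a r) (a (σ r)) (a (σ² r)) (a (σ³ r)) (a (σ⁴ r)) (b r) (b (σ r)) (b (σ² r)) (b (σ³ r)) (b (σ⁴ r)))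
            (∧-intro c0 (∧-intro c1 (∧-intro c2 (∧-intro c3 (∧-intro c4 (∧-intro (not-t pa) (not-t pb)))))))
          where
          use : ∀ {p q} → (not p ∨ q) ≡ true → p ≡ true → q ≡ true
          use h refl = h
        fiv : ∀ {c} x → five x ≡ true → apex c x ≡ false → ap c x ≡ false
        fiv x f p rewrite f = p
        none : around X r ≡ false → (ap5 (a r) (a (σ r)) (a (σ² r)) (a (σ³ r)) (a (σ⁴ r)) ∨ ap5 (b r) (b (σ r)) (b (σ² r)) (b (σ³ r)) (b (σ⁴ r))) ≡ false
        none ne = ∨-false (five-false a Tno) (five-false b Wno)
          where
          f1 = trans (five-σ r) f
          f2 = trans (five-σ _) f1
          f3 = trans (five-σ _) f2
          f4 = trans (five-σ _) f3
          five-false : ∀ c → around (apex c) r ≡ false → ap5 (c r) (c (σ r)) (c (σ² r)) (c (σ³ r)) (c (σ⁴ r)) ≡ false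
          five-false c q = ∨-false (fiv {c} r f (∨-false₁ q)) (∨-false (wrap1 (fiv {c} (σ r) f1 (∨-false₁ q₁))) (∨-false (wrap2 (fiv {c} (σ² r) f2 (∨-false₁ q₂)))
              (∨-false (wrap3 (fiv {c} (σ³ r) f3 (∨-false₁ q₃))) (wrap4 (fiv {c} (σ⁴ r) f4 (∨-false₂ {apex c (σ³ r)} q₃))))))
            where
            q₁ = ∨-false₂ {apex c r} q
            q₂ = ∨-false₂ {apex c (σ r)} q₁
            q₃ = ∨-false₂ {apex c (σ² r)} q₂
            p5 : c (σ⁵ r) ≡ c r
            p5 = cong c (per5 f)
            wrap1 : ap c (σ r) ≡ false → pat (c (σ r)) (c (σ² r)) (c (σ³ r)) (c (σ⁴ r)) (c r) ≡ false
            wrap1 p rewrite sym p5 = p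
            wrap2 : ap c (σ² r) ≡ false → pat (c (σ² r)) (c (σ³ r)) (c (σ⁴ r)) (c r) (c (σ r)) ≡ false
            wrap2 p rewrite sym p5 | sym (cong (λ y → c (σ y)) (per5 f)) = p
            wrap3 : ap c (σ³ r) ≡ false → pat (c (σ³ r)) (c (σ⁴ r)) (c r) (c (σ r)) (c (σ² r)) ≡ false
            wrap3 p rewrite sym p5 | sym (cong (λ y → c (σ y)) (per5 f)) | sym (cong (λ y → c (σ² y)) (per5 f)) = p
            wrap4 : ap c (σ⁴ r) ≡ false → pat (c (σ⁴ r)) (c r) (c (σ r)) (c (σ² r)) (c (σ³ r)) ≡ false
            wrap4 p rewrite sym p5 | sym (cong (λ y → c (σ y)) (per5 f)) | sym (cong (λ y → c (σ² y)) (per5 f)) | sym (cong (λ y → c (σ³ y)) (per5 f)) = p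
          Tno : around Tₐ r ≡ false
          Tno = ¬t⇒f (λ p → tf (mono p) ne)
            where
            mono : around Tₐ r ≡ true → around X r ≡ true
            mono p with around-case {Tₐ} p
            ... | inj₁ q = around-0 {X} (∨-inl q)
            ... | inj₂ (inj₁ q) = around-1 {X} (∨-inl q)
            ... | inj₂ (inj₂ (inj₁ q)) = around-2 {X} (∨-inl q)
            ... | inj₂ (inj₂ (inj₂ (inj₁ q))) = around-3 {X} (∨-inl q)
            ... | inj₂ (inj₂ (inj₂ (inj₂ q))) = around-4 {X} (∨-inl q)
          Wno : around W r ≡ false
          Wno = ¬t⇒f (λ p → tf (mono p) ne)
            where
            e = around-all {Tₐ} f
            up : ∀ {y} → around Tₐ y ≡ around Tₐ r → W y ≡ true → X y ≡ true
            up {y} q w = ∨-inr {Tₐ y} (∧-intro w (not-t (trans q Tno)))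
            mono : around W r ≡ true → around X r ≡ true
            mono p with around-case {W} p
            ... | inj₁ q = around-0 {X} (up refl q)
            ... | inj₂ (inj₁ q) = around-1 {X} (up (proj₁ e) q)
            ... | inj₂ (inj₂ (inj₁ q)) = around-2 {X} (up (proj₁ (proj₂ e)) q)
            ... | inj₂ (inj₂ (inj₂ (inj₁ q))) = around-3 {X} (up (proj₁ (proj₂ (proj₂ e))) q)
            ... | inj₂ (inj₂ (inj₂ (inj₂ q))) = around-4 {X} (up (proj₂ (proj₂ (proj₂ e))) q)

      count-T : # Tₐ ≡ # Nf + (# SG + (# QR + # QG))
      count-T = trans (#-split Tₐ free) (cong (# Nf +_) (trans (#-split (λ x → Tₐ x ∧ not (free x)) (dif b))
        (cong (# SG +_) (#-split (λ x → (Tₐ x ∧ not (free x)) ∧ not (dif b x)) (λ x → b (σ x))))))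

      count-Tg : # (λ x → Nf x ∧ dif b′ x) + # SG ≤ # Tg
      count-Tg = ≤-trans (+-mono-≤ (#-mono {g = λ x → Tg x ∧ free x} (λ x p → ∧-intro {Tg x} (∧-intro {Tₐ x} (∧-fst {Tₐ x} (∧-fst {Nf x} p)) (∧-snd {Nf x} p)) (∧-snd {Tₐ x} (∧-fst {Nf x} p))))
          (#-mono {g = λ x → Tg x ∧ not (free x)} sg)) (≤-reflexive (sym (#-split Tg free)))
        where
        sg : ∀ x → SG x ≡ true → (Tg x ∧ not (free x)) ≡ true
        sg x p = ∧-intro {Tg x} (∧-intro {Tₐ x} (∧-fst {Tₐ x} q) (trans (dif-⊕ b (proj₁ z) x) (cong₂ _xor_ (∧-snd {Tₐ x ∧ not (free x)} p) (stuck-elim (not-t⁻ (∧-snd {Tₐ x} q)) z)))) (∧-snd {Tₐ x} q)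
          where q = ∧-fst {Tₐ x ∧ not (free x)} p

      QG-off : ∀ x → QG x ≡ true → (b (σ x) ≡ false) × (b (σ⁴ x) ≡ false)
      QG-off x p = b₁ , trans (sym (xor-f⁻ (not-t⁻ (∧-snd {Tₐ x ∧ not (free x)} (∧-fst {(Tₐ x ∧ not (free x)) ∧ not (dif b x)} p))))) b₁
        where
        b₁ : b (σ x) ≡ false
        b₁ = not-t⁻ (∧-snd {(Tₐ x ∧ not (free x)) ∧ not (dif b x)} p)

      QR-on : ∀ x → QR x ≡ true → (b (σ x) ≡ true) × (b (σ⁴ x) ≡ true)
      QR-on x p = b₁ , trans (sym (xor-f⁻ (not-t⁻ (∧-snd {Tₐ x ∧ not (free x)} (∧-fst {(Tₐ x ∧ not (free x)) ∧ not (dif b x)} p))))) b₁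
        where
        b₁ : b (σ x) ≡ true
        b₁ = ∧-snd {(Tₐ x ∧ not (free x)) ∧ not (dif b x)} p

      -- A circuit with an apex of `a` and an apex of `b` has one blue, one green and three red
      -- points, so its apex of `a` cannot have two green neighbours.
      count-W : # (λ x → W x ∧ not (Sₒ x)) ≤ # Nf + (# SG + # QR)
      count-W = ≤-trans (five-inj _ h (sparse-⊆ (λ v p → ∧-fst p) (apex-sparse b)) hit) (≤-reflexive (+-cancelʳ-≡ (# QG) (# h) _ eq))
        where
        h : S N
        h x = Tₐ x ∧ not (QG x)
        eq : # h + # QG ≡ # Nf + (# SG + # QR) + # QG
        eq = trans (+-comm (# h) (# QG)) (trans (cong (_+ # h) (#-cong (λ x → iff (λ p → ∧-intro (∧-fst {Tₐ x} (∧-fst {Tₐ x ∧ not (free x)} (∧-fst {(Tₐ x ∧ not (free x)) ∧ not (dif b x)} p))) p) (∧-snd {Tₐ x}))))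
          (trans (sym (#-split Tₐ QG)) (trans count-T (l (# Nf) (# SG) (# QR) (# QG)))))
          where
          l : ∀ n g r q → n + (g + (r + q)) ≡ n + (g + r) + q
          l = solve-∀
        hit : ∀ x → (W x ∧ not (Sₒ x)) ≡ true → around h x ≡ true
        hit x p = go (around-case {Tₐ} (¬f⇒t (λ q → tf (∧-intro {W x} wx (not-t q)) (not-t⁻ (∧-snd {W x} p)))))
          where
          wx : W x ≡ true
          wx = ∧-fst p
          ap : Apex b x
          ap = apex-elim {b} wx
          f = afive ap
          ok : ∀ {y} → Tₐ y ≡ true → b (σ y) ≡ true → h y ≡ true
          ok {y} t q = ∧-intro t (not-t (¬t⇒f (λ g → tf q (proj₁ (QG-off y g)))))
          go : (Tₐ x ≡ true) ⊎ (Tₐ (σ x) ≡ true) ⊎ (Tₐ (σ² x) ≡ true) ⊎ (Tₐ (σ³ x) ≡ true) ⊎ (Tₐ (σ⁴ x) ≡ true) → around h x ≡ true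
          go (inj₁ t) = around-0 {h} (ok t (c₁ ap))
          go (inj₂ (inj₁ t)) = around-1 {h} (ok t (c₂ ap))
          go (inj₂ (inj₂ (inj₁ t))) = around-2 {h} (ok t (c₃ ap))
          go (inj₂ (inj₂ (inj₂ (inj₁ t)))) = around-3 {h} (ok t (c₄ ap))
          go (inj₂ (inj₂ (inj₂ (inj₂ t)))) = around-4 {h} (∧-intro t (not-t (¬t⇒f (λ g → tf (trans (cong (λ y → b (σ³ y)) (per5 f)) (c₃ ap)) (proj₂ (QG-off (σ⁴ x) g))))))

      -- For x in `Sₒ` the point x is green and `σ x` is red or blue. If it is red, the two points
      -- of `a` are adjacent and the circuit belongs to `Sg`; if it is blue, the forest `A` spends
      -- an edge beyond the red ones.
      Hg Hb : S N
      Hg x = (Sₒ x ∧ A (σ x)) ∧ a (σ x)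
      Hb x = (Sₒ x ∧ A (σ x)) ∧ not (a (σ x))

      -- Points with `A (σ x)` are `Hg` and `Hb`. The others are bounded by means of `hits`; apexes
      -- of `b` that enter there without being in `Sₒ` are bounded by `count-W`.
      count-S : # Sₒ ≤ (# Hg + # Hb) + ((# Hg + # Hb) + (# Nf + (# SG + # QR)))
      count-S = ≤-trans (≤-reflexive (#-split Sₒ (λ x → A (σ x)))) (+-mono-≤ (≤-reflexive sa) (≤-trans (#-mono {g = λ x → W x ∧ not (A (σ x))} (λ x p → ∧-intro (∧-fst {W x} (∧-fst {Sₒ x} p)) (∧-snd {Sₒ x} p)))
        (≤-trans hits (≤-trans (#≤2 _ (λ x → Sₒ x ∧ A (σ x)) (λ x → W x ∧ not (Sₒ x)) (λ x → leN (tauto 3 (λ w r y → ind (w ∧ y) ≤ᵇ (ind ((w ∧ r) ∧ y) + ind (w ∧ not (w ∧ r)))) refl (W x) (not (around Tₐ x)) (A (σ x)))))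
          (+-mono-≤ (≤-reflexive sa) count-W)))))
        where
        sa : # (λ x → Sₒ x ∧ A (σ x)) ≡ # Hg + # Hb
        sa = #-split (λ x → Sₒ x ∧ A (σ x)) (λ x → a (σ x))

      d₂ : ℕ
      d₂ = big-orbits + big-orbits

      -- Red edges and the blue ones behind `Hb` are disjoint parts of the one forest `A`.
      count-A : # (λ v → a v ∧ b v) + # Hb ≤ d₂
      count-A = ≤-trans (+-mono-≤ (#-mono {g = λ v → A v ∧ a v} (λ v p → ∧-intro (red⊆ v (∧-fst p) (∧-snd {a v} p)) (∧-fst p)))
        (≤-trans (#-mono {g = λ x → A (σ x) ∧ not (a (σ x))} (λ x p → ∧-intro (∧-snd {Sₒ x} (∧-fst {Sₒ x ∧ A (σ x)} p)) (∧-snd {Sₒ x ∧ A (σ x)} p))) (≤-reflexive (#-perm σ σ⁻ σσ⁻ σ⁻σ (λ v → A v ∧ not (a v))))))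
        (≤-trans (≤-reflexive (sym (#-split A a))) (forest-bound iso A finv forest))

      -- At a stuck apex, a spanning forest of a contains one of the two neighbouring edges.
      stuck-bound : ∀ K Q → Inv K → Acyclic K → K ⊆ a → Sparse Q → (∀ x → Q x ≡ true → (free x ≡ false) × Apex a x × (K (σ x) ≡ false) × (K (σ⁴ x) ≡ false)) → # K + # Q ≤ d₂
      stuck-bound K Q iK ac K⊆a sp hQ = go (spanning-forest K a iK (inv fa) K⊆a ac)
        where
        go : Σ (S N) (Spanning K a) → # K + # Q ≤ d₂
        go (F , sF) = ≤-trans (+-mono-≤ (#-mono {g = λ v → F v ∧ K v} (λ v p → ∧-intro (above sF v p) p)) (five-inj Q h sp hit))
          (≤-trans (≤-reflexive (sym (#-split F K))) (forest-bound iso F (sinv sF) (acyc sF)))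
          where
          h : S N
          h v = F v ∧ not (K v)
          hit : ∀ x → Q x ≡ true → around h x ≡ true
          hit x q = case-on (hQ x q) (bool (F (σ x))) (bool (F (σ⁴ x)))
            where
            case-on : (free x ≡ false) × Apex a x × (K (σ x) ≡ false) × (K (σ⁴ x) ≡ false) → (F (σ x) ≡ true) ⊎ (F (σ x) ≡ false) → (F (σ⁴ x) ≡ true) ⊎ (F (σ⁴ x) ≡ false) → around h x ≡ true
            case-on (_ , _ , k₁ , _) (inj₁ p) _ = around-1 {h} (∧-intro p (not-t k₁))
            case-on (_ , _ , _ , k₄) _ (inj₁ p) = around-4 {h} (∧-intro p (not-t k₄))
            case-on (st , ap , _ , _) (inj₂ p₁) (inj₂ p₄) = ⊥-elim (cyc (fund sF (σ x) (c₁ ap) p₁))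
              where
              f = afive ap
              nl = five-loopless I o5 {σ x} (trans (five-σ x) f)
              cyc : (Σ (S N) λ z → Flow z × (z (σ x) ≡ true) × (∀ u → z u ≡ true → (u ≡ σ x) ⊎ (u ≡ mate (σ x)) ⊎ (F u ≡ true))) → ⊥
              cyc (y , fy , y₁ , sup) = t≢f (trans (sym (cong₂ _xor_ y₁ y₄)) (stuck-elim st (y , fy , λ u p → ins u (sup u p))))
                where
                ins : ∀ u → (u ≡ σ x) ⊎ (u ≡ mate (σ x)) ⊎ (F u ≡ true) → a u ≡ true
                ins u (inj₁ refl) = c₁ ap
                ins u (inj₂ (inj₁ refl)) = trans (inv fa (σ x)) (c₁ ap)
                ins u (inj₂ (inj₂ r)) = below sF u r
                y₄ : y (σ⁴ x) ≡ false
                y₄ = ¬t⇒f (λ p → case sup (σ⁴ x) p of λ { (inj₁ e) → ne3 f (σ-inj e) ; (inj₂ (inj₁ e)) → proj₁ (proj₂ (proj₂ nl)) (sym e) ; (inj₂ (inj₂ r)) → tf r p₄ })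

      stuck-T : ∀ {x c d} → (((Tₐ x ∧ not (free x)) ∧ c) ∧ d) ≡ true → (free x ≡ false) × Apex a x
      stuck-T {x} {c} p = let q = ∧-fst {Tₐ x ∧ not (free x)} (∧-fst {(Tₐ x ∧ not (free x)) ∧ c} p) in not-t⁻ (∧-snd {Tₐ x} q) , apex-elim {a} (∧-fst {Tₐ x} q)

      stuck-sparse : ∀ Q → (∀ x → Q x ≡ true → Tₐ x ≡ true) → Sparse Q
      stuck-sparse Q h = sparse-⊆ {Q} {Tₐ} h (apex-sparse a)

      -- The red edges are extended to a spanning forest of `a`. An apex in `QG` forces one of its
      -- two green neighbours into this forest, in addition to the red edges.
      count-QG : # (λ v → a v ∧ b v) + # QG ≤ d₂
      count-QG = stuck-bound (λ v → a v ∧ b v) QG (λ v → cong₂ _∧_ (inv fa v) (inv fb v)) (acyclic-⊆ (λ v p → red⊆ v (∧-fst p) (∧-snd {a v} p)) forest) (λ v p → ∧-fst p)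
        (stuck-sparse QG (λ x p → ∧-fst {Tₐ x} (∧-fst {Tₐ x ∧ not (free x)} (∧-fst {(Tₐ x ∧ not (free x)) ∧ not (dif b x)} p))))
        (λ x p → let (s , t) = stuck-T p ; (q₁ , q₄) = QG-off x p in s , t , ∧-false₂ {a (σ x)} q₁ , ∧-false₂ {a (σ⁴ x)} q₄)

      count-QR : # (λ v → not (b v)) + # QR ≤ d₂
      count-QR = stuck-bound (λ v → not (b v)) QR (λ v → cong not (inv fb v)) green (λ v p → case ∨-case {a v} (cover v) of λ { (inj₁ q) → q ; (inj₂ q) → tf q (not-t⁻ p) })
        (stuck-sparse QR (λ x p → ∧-fst {Tₐ x} (∧-fst {Tₐ x ∧ not (free x)} (∧-fst {(Tₐ x ∧ not (free x)) ∧ not (dif b x)} p))))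
        (λ x p → let (s , t) = stuck-T p ; (q₁ , q₄) = QR-on x p in s , t , not-f q₁ , not-f q₄)

      count-Y : # Tg + # Sg ≡ # Y
      count-Y = trans (#-∨∧ Tg Sg) (trans (cong (# Y +_) (#-empty (λ x → ¬t⇒f (λ p → tf (around-0 {Tₐ} (∧-fst {Tₐ x} (∧-fst {Tg x} p))) (not-t⁻ (∧-snd {W x} (∧-fst {Sₒ x} (∧-snd {Tg x} p)))))))) (+-identityʳ _))

      -- Three times red is absorbed by `count-QG` once and `count-A` twice, three times green by
      -- `count-QR` three times. The terms left over count circuits on which a value is missed,
      -- after `zhalf` has replaced the recolourable ones by twice the good ones among them.
      bound : # X + 3 * # a ≤ 6 * d₂ + 6 * # Y
      bound = begin
        # X + 3 * # a ≤⟨ +-mono-≤ (≤-trans (#-∨ Tₐ Sₒ) (+-mono-≤ (≤-reflexive count-T) count-S)) (*-monoʳ-≤ 3 (≤-trans (≤-reflexive (#-split a b)) (+-monoʳ-≤ R (#-mono {g = λ v → not (b v)} (λ v p → ∧-snd {a v} p))))) ⟩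
        -- `qr` occurs twice, through the apexes of `a` and through `count-S`; a third copy matches
        -- the three uses of `count-QR`.
        nf + (g + (qr + qg)) + ((hg + hb) + ((hg + hb) + (nf + (g + qr)))) + 3 * (R + G) ≤⟨ m≤m+n _ qr ⟩
        nf + (g + (qr + qg)) + ((hg + hb) + ((hg + hb) + (nf + (g + qr)))) + 3 * (R + G) + qr ≡⟨ l₁ nf g qr qg hg hb R G ⟩
        2 * nf + 2 * g + 2 * hg + ((R + qg) + 2 * (R + hb) + 3 * (G + qr)) ≤⟨ +-mono-≤ (+-monoˡ-≤ (2 * hg) (+-monoˡ-≤ (2 * g) (*-monoʳ-≤ 2 zhalf))) (+-mono-≤ (+-mono-≤ count-QG (*-monoʳ-≤ 2 count-A)) (*-monoʳ-≤ 3 count-QR)) ⟩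
        2 * (2 * gn) + 2 * g + 2 * hg + (d₂ + 2 * d₂ + 3 * d₂) ≤⟨ m≤m+n _ (2 * gn + 4 * g + 4 * hg) ⟩
        2 * (2 * gn) + 2 * g + 2 * hg + (d₂ + 2 * d₂ + 3 * d₂) + (2 * gn + 4 * g + 4 * hg) ≡⟨ l₂ gn g hg d₂ ⟩
        6 * d₂ + 6 * ((gn + g) + hg) ≤⟨ +-monoʳ-≤ (6 * d₂) (*-monoʳ-≤ 6 (≤-trans (+-mono-≤ count-Tg (#-mono {g = Sg} (λ x p → ∧-intro (∧-fst {Sₒ x} (∧-fst {Sₒ x ∧ A (σ x)} p)) (∨-inl (∧-snd {Sₒ x ∧ A (σ x)} p))))) (≤-reflexive count-Y))) ⟩
        6 * d₂ + 6 * # Y ∎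
        where
        open ≤-Reasoning
        nf = # Nf
        g = # SG
        qr = # QR
        qg = # QG
        hg = # Hg
        hb = # Hb
        gn = # (λ x → Nf x ∧ dif b′ x)
        R = # (λ v → a v ∧ b v)
        G = # (λ v → not (b v))
        l₁ : ∀ n g qr qg hg hb R G → n + (g + (qr + qg)) + ((hg + hb) + ((hg + hb) + (n + (g + qr)))) + 3 * (R + G) + qr ≡ 2 * n + 2 * g + 2 * hg + ((R + qg) + 2 * (R + hb) + 3 * (G + qr))
        l₁ = solve-∀
        l₂ : ∀ gn g hg d → 2 * (2 * gn) + 2 * g + 2 * hg + (d + 2 * d + 3 * d) + (2 * gn + 4 * g + 4 * hg) ≡ 6 * d + 6 * ((gn + g) + hg)
        l₂ = solve-∀

      misses : ∀ {s r} → Bal σ s a → Bal σ r b′ → ∀ x → Y x ≡ true → Miss s r x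
      misses {s} {r} bs br x p with ∨-case {Tg x} p
      ... | inj₁ q = let ap = apex-elim {a} (∧-fst {Tₐ x} q) in
             miss-apex {a} {b′} {s} {r} bs br ap (case ∨-case {a x} (cover′ x) of λ { (inj₁ e) → tf e (c₀ ap) ; (inj₂ e) → e }) (∧-snd {Tₐ x} q)
      ... | inj₂ q = let ap = apex-elim {b} (∧-fst {W x} (∧-fst {Sₒ x} q)) in
             miss-adjacent {a} {b′} {s} {r} bs br (afive ap) (case ∨-case {a x} (cover x) of λ { (inj₁ e) → e ; (inj₂ e) → tf e (c₀ ap) }) (not-t⁻ (∧-snd {W x} (∧-fst {Sₒ x} q))) (∧-snd {Sₒ x} q)

-- Orbits of length two and four

module Small {N : ℕ} {σ σ⁻ : Fin N → Fin N} (π : Perm σ σ⁻) where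
  open Cycles π
  open Five π

  module _ {mate : Fin N → Fin N} (I : Invol mate) where
    open Mate I
    open Nowhere π I
    open Forest π I
    open Half π I using (Miss)

    -- a ∧ b, a ∧ ¬ b, ¬ a is a colouring of the matching; every orbit of five meets X, and Y marks some orbits of five on which (s , r) misses a value.
    record Scheme : Set where
      field
        a b s r X Y : S N
        a-inv : Inv a
        b-inv : Inv b
        bs : Bal σ s a
        br : Bal σ r b
        cov : ∀ v → (a v ∨ b v) ≡ true
        twin : ∀ v → small v ≡ true → Σ (Fin N) λ u → (orbit v u ≡ true) × (a u ≡ a (σ u)) × (b u ≡ b (σ u))
        X-around : ∀ v → five v ≡ true → around X v ≡ true
        Y-sparse : Sparse Y
        bound : # X + 3 * # (λ v → a v ∧ not (small v)) ≤ 12 * big-orbits + 6 * # Y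
        miss : ∀ x → Y x ≡ true → Miss s r x

    open Half π I

    module _ (o5 : O5) (iso : Isolated) (C : Colour.Coloured π I) where
      open Colour.Coloured C using (a; b; fa; fb; cover)
      open Account o5 iso C using (Nf; Tₐ; free; free-elim; module Chosen)

      scheme-chosen : (z : Inside a) → # Nf ≤ 2 * # (λ x → Nf x ∧ dif (b ⊕ proj₁ z) x) → Scheme
      scheme-chosen z h = record
        { a = a ; b = b′ ; s = proj₁ (even fa) ; r = proj₁ (even fb′) ; X = X ; Y = Y ; a-inv = inv fa ; b-inv = inv fb′ ; bs = proj₂ (even fa) ; br = proj₂ (even fb′) ; cov = cover′
        ; twin = λ v p → tw v (iso v p) ; X-around = X-around ; Y-sparse = Y-sparse
        ; bound = ≤-trans (+-monoʳ-≤ (# X) (*-monoʳ-≤ 3 (#-mono {g = a} (λ v p → ∧-fst p)))) (≤-trans bound (≤-reflexive (cong (_+ 6 * # Y) (l big-orbits))))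
        ; miss = misses {proj₁ (even fa)} {proj₁ (even fb′)} (proj₂ (even fa)) (proj₂ (even fb′)) }
        where
        module Acc = Chosen z h
        open Acc using (b′; fb′; X; Y; cover′; X-around; Y-sparse; bound; misses)
        l : ∀ d → 6 * (d + d) ≡ 12 * d
        l = solve-∀
        tw : ∀ v → (mate v ≡ σ v) ⊎ (mate v ≡ σ⁻ v) → Σ (Fin N) λ u → (orbit v u ≡ true) × (a u ≡ a (σ u)) × (b′ u ≡ b′ (σ u))
        -- The matching edge at `v` joins two neighbours on the circuit, which therefore carry the
        -- same values.
        tw v (inj₁ e) = v , conn-refl (lk ∅) v , sym (trans (cong a (sym e)) (inv fa v)) , sym (trans (cong b′ (sym e)) (inv fb′ v))
        tw v (inj₂ e) = σ⁻ v , conn-sym (lk ∅) (trans (cong (orbit (σ⁻ v)) (sym (σσ⁻ v))) (conn-σ ∅ (σ⁻ v))) ,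
          trans (cong a (sym e)) (trans (inv fa v) (cong a (sym (σσ⁻ v)))) , trans (cong b′ (sym e)) (trans (inv fb′ v) (cong b′ (sym (σσ⁻ v))))

      scheme-coloured : Scheme
      scheme-coloured = let (z , h) = half-good a (# Nf) Nf ≤-refl (λ x p → free-elim (∧-snd {Tₐ x} p)) b in scheme-chosen z h

    scheme-isolated : O5 → Isolated → Scheme
    scheme-isolated o5 iso = scheme-coloured o5 iso (Colour.coloured π I o5)

    even-order : par N ≡ false
    even-order = trans (cong par (trans (sym (#-all N)) (#-half I (λ _ → true) (λ _ → refl)))) (par-twice (# (half I)))

    par-not : ∀ Z → par (# Z) ≡ par (# (λ v → not (Z v)))
    par-not Z = xor-f⁻ (trans (sym (par-+ (# Z) (# (λ v → not (Z v))))) (trans (cong par (trans (sym (#-split (λ _ → true) Z)) (#-all N))) even-order))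

    no-fixed : O5 → ∀ v → σ v ≢ v
    no-fixed o5 v e = <⇒≱ {2} {10} (s≤s (s≤s (s≤s z≤n))) (≤-trans (o5 (δ v) (λ u → trans (cong (σ u ==_) (sym e)) (σ-inj-== u v)) (cong par (#-single v)))
      (≤-trans (≤-reflexive (D-out I (δ v))) (+-mono-≤ le le)))
      where
      le : # (λ u → δ v u ∧ not (δ v (mate u))) ≤ 1
      le = ≤-trans (#-mono {g = δ v} (λ u p → ∧-fst p)) (≤-reflexive (#-single v))

  module _ {mate : Fin N → Fin N} (I : Invol mate) (e : Fin N) (e≢ : e ≢ σ e) where
    open Mate I using (inv)
    open Forest π I

    private
      f : Fin N
      f = σ e
      I′ : Invol (repair mate e f)
      I′ = repair-Invol I e f e≢
      mate′ : Fin N → Fin N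
      mate′ = repair mate e f

    open Undo I e f e≢ public

    -- Only the edge from `e` to `σ e` needs a new value. It absorbs the change of the flow at `e`,
    -- and the change at `σ e` is the same, because these two points are partners in the repaired
    -- matching.
    shift : S N → S N → S N
    shift c s v = if v == e then s e xor (c e xor c (mate e)) else s v

    shift-e : ∀ c s → shift c s e ≡ (s e xor (c e xor c (mate e)))
    shift-e c s rewrite ==-refl e = refl
    shift-o : ∀ c s {v} → v ≢ e → shift c s v ≡ s v
    shift-o c s p rewrite ==-false p = refl

    undo-bal : ∀ c s → (∀ v → c (mate′ v) ≡ c v) → Bal σ s c → Bal σ (shift c s) (undo c)
    undo-bal c s h bal v with σ v ≟F e
    ... | yes q = trans (cong (shift c s) q) (trans (shift-e c s) (trans (lem (s v) (c e) (c (mate e)) (trans (cong s (sym q)) (trans (bal v) (cong (λ y → s v xor c y) q))))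
          (sym (cong₂ _xor_ (shift-o c s (λ { refl → e≢ (sym q) })) (trans (cong (undo c) q) (undo-e c))))))
      where
      lem : ∀ x y w {t} → t ≡ (x xor y) → (t xor (y xor w)) ≡ (x xor w)
      lem x y w refl = eqB-≡ (tauto 3 (λ x y w → eqB ((x xor y) xor (y xor w)) (x xor w)) refl x y w)
    ... | no n₁ with v ≟F e
    ... | yes refl = trans (shift-o c s n₁) (trans (bal e) (trans (lem (s e) (c e) (c (mate e)) (trans (cong c (sym (repair-e I e f e≢))) (h e)))
          (sym (cong₂ _xor_ (shift-e c s) (undo-f c)))))
      where
      lem : ∀ x y w {t} → t ≡ y → (x xor t) ≡ ((x xor (y xor w)) xor w)
      lem x y w refl = eqB-≡ (tauto 3 (λ x y w → eqB (x xor y) ((x xor (y xor w)) xor w)) refl x y w)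
    ... | no n₂ = trans (shift-o c s n₁) (trans (bal v) (sym (cong₂ _xor_ (shift-o c s n₂) (undo-o c n₁ (λ q → n₂ (σ-inj q))))))

    -- Undoing the splitting changes the flow only on the small orbit of e.
    unrepair : small e ≡ true → Scheme I′ → Scheme I
    unrepair se sc = record
      { a = undo a ; b = undo b ; s = shift a s ; r = shift b r ; X = X ; Y = Y ; a-inv = undo-inv a a-inv ; b-inv = undo-inv b b-inv
      ; bs = undo-bal a s a-inv bs ; br = undo-bal b r b-inv br
      ; cov = λ v → cover v (v ≟F e) (v ≟F f)
      ; twin = λ v p → tw v (bool (orbit v e)) (twin v p)
      ; X-around = X-around ; Y-sparse = Y-sparse
      ; bound = subst (λ y → # X + 3 * y ≤ 12 * big-orbits + 6 * # Y) (#-cong (λ v → bigs v (bool (small v)))) bound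
      ; miss = λ x p → same x p (miss x p) }
      where
      open Scheme sc
      sf : small f ≡ true
      sf = trans (small-σ e) se
      cover : ∀ v → Dec (v ≡ e) → Dec (v ≡ f) → (undo a v ∨ undo b v) ≡ true
      cover v (yes refl) _ = trans (cong₂ _∨_ (undo-e a) (undo-e b)) (cov (mate e))
      cover v _ (yes refl) = trans (cong₂ _∨_ (undo-f a) (undo-f b)) (cov (mate e))
      cover v (no p) (no q) = trans (cong₂ _∨_ (undo-o a p q) (undo-o b p q)) (cov v)
      tw : ∀ v → (orbit v e ≡ true) ⊎ (orbit v e ≡ false) → (Σ (Fin N) λ u → (orbit v u ≡ true) × (a u ≡ a (σ u)) × (b u ≡ b (σ u))) →
        Σ (Fin N) λ u → (orbit v u ≡ true) × (undo a u ≡ undo a (σ u)) × (undo b u ≡ undo b (σ u))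
      tw v (inj₁ o) _ = e , o , trans (undo-e a) (sym (undo-f a)) , trans (undo-e b) (sym (undo-f b))
      tw v (inj₂ o) (u , ou , p , q) = u , ou , trans (undo-o a u≢e u≢f) (trans p (sym (undo-o a σu≢e σu≢f))) , trans (undo-o b u≢e u≢f) (trans q (sym (undo-o b σu≢e σu≢f)))
        where
        away : ∀ {y} → orbit v y ≡ true → y ≢ e
        away oy refl = tf oy o
        u≢e = away ou
        σu≢e = away (trans (orbit-σ v u) ou)
        u≢f : u ≢ f
        u≢f q = tf (trans (sym (orbit-σ v e)) (trans (cong (orbit v) (sym q)) ou)) o
        σu≢f : σ u ≢ f
        σu≢f q = u≢e (σ-inj q)
      off : ∀ {v} → small v ≡ false → (v ≢ e) × (v ≢ f)
      off p = (λ { refl → tf se p }) , λ { refl → tf sf p }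
      bigs : ∀ v → (small v ≡ true) ⊎ (small v ≡ false) → (a v ∧ not (small v)) ≡ (undo a v ∧ not (small v))
      bigs v (inj₁ p) = trans (∧-false₂ {a v} (not-f p)) (sym (∧-false₂ {undo a v} (not-f p)))
      bigs v (inj₂ p) = cong (_∧ not (small v)) (sym (undo-o a (proj₁ (off p)) (proj₂ (off p))))
      same : ∀ x → Y x ≡ true → Half.Miss π I′ s r x → Half.Miss π I (shift a s) (shift b r) x
      same x p (q₁ , q₂ , h) = q₁ , q₂ , trans (cong₂ _∨_ (eq x b₀) (cong₂ _∨_ (eq (σ x) b₁) (cong₂ _∨_ (eq (σ² x) b₂) (cong₂ _∨_ (eq (σ³ x) b₃) (eq (σ⁴ x) b₄))))) h
        where
        b₀ : small x ≡ false
        b₀ = ==-false (ne4 (proj₁ (Y-sparse x p)))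
        b₁ = trans (small-σ x) b₀
        b₂ = trans (small-σ (σ x)) b₁
        b₃ = trans (small-σ (σ² x)) b₂
        b₄ = trans (small-σ (σ³ x)) b₃
        eq : ∀ u → small u ≡ false → (eqB (shift a s u) q₁ ∧ eqB (shift b r u) q₂) ≡ (eqB (s u) q₁ ∧ eqB (r u) q₂)
        eq u o = cong₂ (λ y w → eqB y q₁ ∧ eqB w q₂) (shift-o a s (proj₁ (off o))) (shift-o b r (proj₁ (off o)))

  O5M : (Fin N → Fin N) → Set
  O5M mate = ∀ Z → (∀ v → Z (σ v) ≡ Z v) → par (# Z) ≡ true → 10 ≤ D mate (λ _ → true) Z

  -- The complement of an odd set is odd, so that one may assume v ∉ Z.
  o5-avoiding : {mate : Fin N → Fin N} (I : Invol mate) (v : Fin N) → (∀ Z → (∀ u → Z (σ u) ≡ Z u) → Z v ≡ false → par (# Z) ≡ true → 10 ≤ D mate (λ _ → true) Z) → O5M mate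
  o5-avoiding {mate} I v h Z zi o with bool (Z v)
  ... | inj₂ p = h Z zi p o
  ... | inj₁ p = subst (10 ≤_) (D-not mate _ Z) (h (λ u → not (Z u)) (λ u → cong not (zi u)) (not-f p) (trans (sym (par-not I Z)) o))

  -- The points that still violate `Isolated`; their number is the measure of the recursion.
  loose : (Fin N → Fin N) → S N
  loose mate u = (σ⁴ u == u) ∧ not ((mate u == σ u) ∨ (mate u == σ⁻ u))

  module _ {mate : Fin N → Fin N} (I : Invol mate) (o5 : O5M mate) where

    private
      loose-iso : ∀ {m : Fin N → Fin N} {u} → (m u ≡ σ u) ⊎ (m u ≡ σ⁻ u) → loose m u ≡ false
      loose-iso {m} {u} (inj₁ e) = ∧-false₂ {σ⁴ u == u} (not-f (∨-inl (subst (λ y → (m u == y) ≡ true) e (==-refl (m u)))))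
      loose-iso {m} {u} (inj₂ e) = ∧-false₂ {σ⁴ u == u} (not-f (∨-inr {m u == σ u} (subst (λ y → (m u == y) ≡ true) e (==-refl (m u)))))

      -- If the pairs of a σ-invariant set Q become loops and nothing else changes, then there are fewer loose points.
      fewer-loose : ∀ {m : Fin N → Fin N} (Q : S N) → (∀ u → Q (σ u) ≡ Q u) → (∀ u → Q u ≡ true → (m u ≡ σ u) ⊎ (m u ≡ σ⁻ u)) →
        (∀ u → Q u ≡ false → Q (mate u) ≡ false → m u ≡ mate u) → ∀ v → Q v ≡ true → loose mate v ≡ true → # (loose m) < # (loose mate)
      fewer-loose {m} Q Qσ on off v qv lv = #-mono-< {f = loose m} {loose mate} (λ u p → ¬f⇒t (λ q → tf p (keep u (∧-fst p) q (bool (Q u))))) v lv (loose-iso {m} (on v qv))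
        where
        iso : ∀ u → (σ⁴ u == u) ≡ true → loose mate u ≡ false → (mate u ≡ σ u) ⊎ (mate u ≡ σ⁻ u)
        iso u s l with ∨-case {mate u == σ u} (not-f⁻ (lem (σ⁴ u == u) _ s l))
          where
          lem : ∀ a b → a ≡ true → (a ∧ b) ≡ false → b ≡ false
          lem true b refl p = p
        ... | inj₁ e = inj₁ (==-true e)
        ... | inj₂ e = inj₂ (==-true e)
        keep : ∀ u → (σ⁴ u == u) ≡ true → loose mate u ≡ false → (Q u ≡ true) ⊎ (Q u ≡ false) → loose m u ≡ false
        keep u s l (inj₁ q) = loose-iso {m} (on u q)
        keep u s l (inj₂ q) = loose-iso {m} (go (iso u s l))
          where
          go : (mate u ≡ σ u) ⊎ (mate u ≡ σ⁻ u) → (m u ≡ σ u) ⊎ (m u ≡ σ⁻ u)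
          go (inj₁ e) = inj₁ (trans (off u q (trans (cong Q e) (trans (Qσ u) q))) e)
          go (inj₂ e) = inj₂ (trans (off u q (trans (cong Q e) (trans (sym (Qσ (σ⁻ u))) (trans (cong Q (σσ⁻ u)) q)))) e)

    Rec : Set
    Rec = ∀ {m : Fin N → Fin N} (J : Invol m) → O5M m → # (loose m) < # (loose mate) → Scheme J

    -- A set that avoids the circuit of length two remains invariant and odd when both of its points
    -- are added. So `D-repair` leads back to a cut of the given matching in either case, and no
    -- choice of a pairing arises.
    scheme-two : Rec → ∀ v → loose mate v ≡ true → σ² v ≡ v → Scheme I
    scheme-two rec v lv e = unrepair I v v≢ (∧-fst lv) (rec J (o5-avoiding J v o5′) (fewer-loose Q Qσ on off v (∪₁-old (δ v) (==-refl v)) lv))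
      where
      v≢ : v ≢ σ v
      v≢ p = no-fixed I o5 v (sym p)
      J = repair-Invol I v (σ v) v≢
      m₀ : Fin N → Fin N
      m₀ = repair mate v (σ v)
      rot : ∀ (Z : S N) → (∀ u → Z (σ u) ≡ Z u) → ∀ u → (Z ∪₁ v ∪₁ σ v) (σ u) ≡ (Z ∪₁ v ∪₁ σ v) u
      rot Z zi u = trans (cong₂ _∨_ (cong₂ _∨_ (zi u) (trans (cong (σ u ==_) (sym e)) (σ-inj-== u (σ v)))) (σ-inj-== u v)) (eqB-≡ (tauto 3 (λ a b c → eqB ((a ∨ b) ∨ c) ((a ∨ c) ∨ b)) refl (Z u) (u == σ v) (u == v)))
      Q : S N
      Q = δ v ∪₁ σ v
      Qσ : ∀ u → Q (σ u) ≡ Q u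
      Qσ u = trans (cong₂ _∨_ (trans (cong (σ u ==_) (sym e)) (σ-inj-== u (σ v))) (σ-inj-== u v)) (eqB-≡ (tauto 2 (λ a b → eqB (a ∨ b) (b ∨ a)) refl (u == σ v) (u == v)))
      on : ∀ u → Q u ≡ true → (m₀ u ≡ σ u) ⊎ (m₀ u ≡ σ⁻ u)
      on u q with ∨-case {u == v} q
      ... | inj₁ p = inj₁ (trans (cong m₀ (==-true p)) (trans (repair-e I v (σ v) v≢) (cong σ (sym (==-true p)))))
      ... | inj₂ p = inj₂ (trans (cong m₀ (==-true p)) (trans (repair-f I v (σ v) v≢) (trans (sym (σ⁻σ v)) (cong σ⁻ (sym (==-true p))))))
      off : ∀ u → Q u ≡ false → Q (mate u) ≡ false → m₀ u ≡ mate u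
      off u p q = repair-o I v (σ v) v≢ (≢-== (∨-false₁ p)) (≢-== (∨-false₂ {u == v} p)) (≢-== (∨-false₁ q)) (≢-== (∨-false₂ {mate u == v} q))
      o5′ : ∀ Z → (∀ u → Z (σ u) ≡ Z u) → Z v ≡ false → par (# Z) ≡ true → 10 ≤ D m₀ (λ _ → true) Z
      o5′ Z zi zv o with D-repair I v (σ v) v≢ (λ _ → true) Z (λ _ → refl) refl zv (trans (zi v) zv)
      ... | inj₁ d = subst (10 ≤_) (sym d) (o5 Z zi o)
      ... | inj₂ d = subst (10 ≤_) (sym d) (o5 (Z ∪₁ v ∪₁ σ v) (rot Z zi)
              (trans (cong par (trans (∪₁-count (Z ∪₁ v) (σ v) (trans (∪₁-other Z (λ p → v≢ (sym p))) (trans (zi v) zv))) (cong suc (∪₁-count Z v zv)))) (trans (nn (par (# Z))) o)))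
        where
        nn : ∀ b → not (not b) ≡ b
        nn true = refl
        nn false = refl

    -- The circuit consists of the consecutive pairs p, `σ p` and r, `σ r`. Both pairs become
    -- parallel edges, and the two repairs are undone in reverse order.
    scheme-pairs : Rec → ∀ p r → p ≢ σ p → r ≢ σ r → p ≢ r → p ≢ σ r → σ p ≢ r → σ p ≢ σ r → (σ⁴ p == p) ≡ true → (σ⁴ r == r) ≡ true →
      (Q : S N) → (∀ u → Q (σ u) ≡ Q u) → (∀ u → Q u ≡ true → (u ≡ p) ⊎ (u ≡ σ p) ⊎ (u ≡ r) ⊎ (u ≡ σ r)) → Q p ≡ true → Q r ≡ true →
      ∀ v → Q v ≡ true → loose mate v ≡ true → O5M (repair (repair mate p (σ p)) r (σ r)) → Scheme I
    scheme-pairs rec p r np nr pr psr spr spsr sp sr Q Qσ Qin Qp Qr v qv lv o5″ = unrepair I p np sp (unrepair I₁ r nr sr (rec I₂ o5″ (fewer-loose Q Qσ (λ u q → on u (Qin u q)) off v qv lv)))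
      where
      I₁ = repair-Invol I p (σ p) np
      I₂ = repair-Invol I₁ r (σ r) nr
      m₁ m₂ : Fin N → Fin N
      m₁ = repair mate p (σ p)
      m₂ = repair m₁ r (σ r)
      m₂p : m₂ p ≡ σ p
      m₂p = trans (repair-o I₁ r (σ r) nr pr psr (λ q → spr (trans (sym (repair-e I p (σ p) np)) q)) (λ q → spsr (trans (sym (repair-e I p (σ p) np)) q))) (repair-e I p (σ p) np)
      on : ∀ u → (u ≡ p) ⊎ (u ≡ σ p) ⊎ (u ≡ r) ⊎ (u ≡ σ r) → (m₂ u ≡ σ u) ⊎ (m₂ u ≡ σ⁻ u)
      on u (inj₁ refl) = inj₁ m₂p
      on u (inj₂ (inj₁ refl)) = inj₂ (trans (trans (cong m₂ (sym m₂p)) (mm I₂ p)) (sym (σ⁻σ p)))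
      on u (inj₂ (inj₂ (inj₁ refl))) = inj₁ (repair-e I₁ r (σ r) nr)
      on u (inj₂ (inj₂ (inj₂ refl))) = inj₂ (trans (repair-f I₁ r (σ r) nr) (sym (σ⁻σ r)))
      ≢Q : ∀ {u w} → Q u ≡ false → Q w ≡ true → u ≢ w
      ≢Q a b refl = tf b a
      off : ∀ u → Q u ≡ false → Q (mate u) ≡ false → m₂ u ≡ mate u
      off u a b = trans (repair-o I₁ r (σ r) nr (≢Q a Qr) (≢Q a Qsr) (λ q → ≢Q b Qr (trans (sym e₁) q)) (λ q → ≢Q b Qsr (trans (sym e₁) q))) e₁
        where
        Qsr = trans (Qσ r) Qr
        e₁ : m₁ u ≡ mate u
        e₁ = repair-o I p (σ p) np (≢Q a Qp) (≢Q a (trans (Qσ p) Qp)) (≢Q b Qp) (≢Q b (trans (Qσ p) Qp))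

    -- The four points of the circuit form the `Quad`, and the family consists of the invariant sets
    -- that avoid it. Adding the whole circuit keeps a set invariant and odd, which gives `h₄`.
    scheme-four : Rec → ∀ v → loose mate v ≡ true → σ² v ≢ v → Scheme I
    scheme-four rec v lv n2 = go (Splitting.splitting I (λ _ → true) family quad)
      where
      C : S N → Set
      C W = (∀ u → W (σ u) ≡ W u) × (W v ≡ false)
      e : σ⁴ v ≡ v
      e = ==-true (∧-fst lv)
      n01 : v ≢ σ v
      n01 q = no-fixed I o5 v (sym q)
      n03 : v ≢ σ³ v
      n03 q = n01 (trans (sym e) (cong σ (sym q)))
      P : S N
      P = δ v ∪₁ σ v ∪₁ σ² v ∪₁ σ³ v
      P₀ : P v ≡ true
      P₀ = ∪₁-old (δ v ∪₁ σ v ∪₁ σ² v) (∪₁-old (δ v ∪₁ σ v) (∪₁-old (δ v) (==-refl v)))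
      P₁ : P (σ v) ≡ true
      P₁ = ∪₁-old (δ v ∪₁ σ v ∪₁ σ² v) (∪₁-old (δ v ∪₁ σ v) (∪₁-self (δ v) (σ v)))
      P₂ : P (σ² v) ≡ true
      P₂ = ∪₁-old (δ v ∪₁ σ v ∪₁ σ² v) (∪₁-self (δ v ∪₁ σ v) (σ² v))
      P₃ : P (σ³ v) ≡ true
      P₃ = ∪₁-self (δ v ∪₁ σ v ∪₁ σ² v) (σ³ v)
      Pσ : ∀ u → P (σ u) ≡ P u
      Pσ u = trans (cong₂ _∨_ (cong₂ _∨_ (cong₂ _∨_ (trans (cong (σ u ==_) (sym e)) (σ-inj-== u (σ³ v))) (σ-inj-== u v)) (σ-inj-== u (σ v))) (σ-inj-== u (σ² v)))
        (eqB-≡ (tauto 4 (λ a b c d → eqB (((d ∨ a) ∨ b) ∨ c) (((a ∨ b) ∨ c) ∨ d)) refl (u == v) (u == σ v) (u == σ² v) (u == σ³ v)))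
      Pin : ∀ u → P u ≡ true → (u ≡ v) ⊎ (u ≡ σ v) ⊎ (u ≡ σ² v) ⊎ (u ≡ σ³ v)
      Pin u q with ∨-case {(δ v ∪₁ σ v ∪₁ σ² v) u} q
      ... | inj₂ a = inj₂ (inj₂ (inj₂ (==-true a)))
      ... | inj₁ q′ with ∨-case {(δ v ∪₁ σ v) u} q′
      ... | inj₂ a = inj₂ (inj₂ (inj₁ (==-true a)))
      ... | inj₁ q″ with ∨-case {u == v} q″
      ... | inj₁ a = inj₁ (==-true a)
      ... | inj₂ a = inj₂ (inj₁ (==-true a))
      #P : # P ≡ 4
      #P = trans (∪₁-count (δ v ∪₁ σ v ∪₁ σ² v) (σ³ v) (∨-false (∨-false (==-false (λ q → n03 (sym q))) (==-false (λ q → n2 (σ-inj q)))) (==-false (λ q → n01 (sym (σ-inj (σ-inj q)))))))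
        (cong suc (trans (∪₁-count (δ v ∪₁ σ v) (σ² v) (∨-false (==-false n2) (==-false (λ q → n01 (sym (σ-inj q)))))) (cong suc (trans (∪₁-count (δ v) (σ v) (==-false (λ q → n01 (sym q)))) (cong suc (#-single v))))))
      odd : ∀ W → (∀ u → W (σ u) ≡ W u) → W v ≡ false → par (# W) ≡ true → par (# (λ u → W u ∨ P u)) ≡ true
      odd W i z o = trans (cong par (sym (trans (#-∨∧ W P) (trans (cong (# (λ u → W u ∨ P u) +_) (#-empty (λ u → ¬t⇒f (λ q → tf (∧-fst {W u} q) (out u (Pin u (∧-snd {W u} q))))))) (+-identityʳ _)))))
          (trans (cong (λ y → par (# W + y)) #P) (trans (par-+ (# W) 4) (cong₂ _xor_ o refl)))
        where
        out : ∀ u → (u ≡ v) ⊎ (u ≡ σ v) ⊎ (u ≡ σ² v) ⊎ (u ≡ σ³ v) → W u ≡ false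
        out u (inj₁ refl) = z
        out u (inj₂ (inj₁ refl)) = trans (i v) z
        out u (inj₂ (inj₂ (inj₁ refl))) = trans (i _) (trans (i v) z)
        out u (inj₂ (inj₂ (inj₂ refl))) = trans (i _) (trans (i _) (trans (i v) z))
      n21 : σ v ≢ σ² v
      n21 q = n01 (σ-inj q)
      family : Family I (λ _ → true)
      family = record { C = C ; C-ext = λ h (i , z) → (λ u → trans (sym (h (σ u))) (trans (i u) (h u))) , trans (sym (h v)) z
        ; C? = λ W → all? (λ u → W (σ u) ≟B W u) ×-dec (W v ≟B false) ; C-∩ = λ (i , z) (j , _) → (λ u → cong₂ _∧_ (i u) (j u)) , ∧-false₁ z
        ; C-∪ = λ (i , z) (j , y) → (λ u → cong₂ _∨_ (i u) (j u)) , ∨-false z y ; C-∖ = λ (i , z) (j , _) → (λ u → cong₂ (λ x y → x ∧ not y) (i u) (j u)) , ∧-false₁ z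
        ; winv = λ _ → refl ; K = 2 ; h₀ = λ W (i , _) o → o5 W i o }
      quad : Splitting.Quad I (λ _ → true) family P v (σ v) (σ² v) (σ³ v)
      quad = record { ab = n01 ; ac = λ q → n2 (sym q) ; ad = n03 ; bc = n21 ; bd = λ q → n2 (sym (σ-inj q)) ; cd = λ q → n01 (σ-inj (σ-inj q))
        ; wa = refl ; wb = refl ; wc = refl ; wd = refl ; Pa = P₀ ; Pb = P₁ ; Pc = P₂ ; Pd = P₃
        ; P-off = λ u a b c d → ∨-false (∨-false (∨-false (==-false a) (==-false b)) (==-false c)) (==-false d)
        ; C-off = λ W (i , z) → z , trans (i v) z , trans (i _) (trans (i v) z) , trans (i _) (trans (i _) (trans (i v) z))
        ; h₄ = λ W (i , z) o → o5 (λ u → W u ∨ P u) (λ u → cong₂ _∨_ (i u) (Pσ u)) (odd W i z o) }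
      Jof : ∀ {p q r s : Fin N} → p ≢ q → r ≢ s → Invol (repair (repair mate p q) r s)
      Jof a b = repair-Invol (repair-Invol I _ _ a) _ _ b
      Gd : (Fin N → Fin N) → Set
      Gd m = ∀ W → C W → Odd I (λ _ → true) W → 10 ≤ D m (λ _ → true) W
      go : Gd (repair (repair mate v (σ v)) (σ² v) (σ³ v)) ⊎ Gd (repair (repair mate (σ³ v) v) (σ v) (σ² v)) → Scheme I
      go (inj₁ h) = scheme-pairs rec v (σ² v) n01 (λ q → n01 (σ-inj (σ-inj q))) (λ q → n2 (sym q)) n03 (λ q → n01 (σ-inj q)) (λ q → n2 (sym (σ-inj q)))
        (∧-fst lv) (trans (trans (σ-inj-== (σ⁵ v) (σ v)) (σ-inj-== (σ⁴ v) v)) (∧-fst lv)) P Pσ Pin P₀ P₂ v P₀ lv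
        (o5-avoiding (Jof n01 (λ q → n01 (σ-inj (σ-inj q)))) v (λ Z zi zv o → h Z (zi , zv) o))
      go (inj₂ h) = scheme-pairs rec (σ³ v) (σ v) (λ q → n03 (sym (trans q e))) n21 (λ q → n2 (σ-inj q)) (λ q → n01 (sym (σ-inj (σ-inj q)))) (λ q → n01 (trans (sym e) q)) (λ q → n2 (sym (trans (sym e) q)))
        (trans (trans (σ-inj-== (σ² (σ⁴ v)) (σ² v)) (trans (σ-inj-== (σ⁵ v) (σ v)) (σ-inj-== (σ⁴ v) v))) (∧-fst lv)) (trans (σ-inj-== (σ⁴ v) v) (∧-fst lv)) P Pσ
        (λ u q → case Pin u q of λ { (inj₁ a) → inj₂ (inj₁ (trans a (sym e))) ; (inj₂ (inj₁ a)) → inj₂ (inj₂ (inj₁ a)) ; (inj₂ (inj₂ (inj₁ a))) → inj₂ (inj₂ (inj₂ a)) ; (inj₂ (inj₂ (inj₂ a))) → inj₁ a })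
        P₃ P₁ v P₀ lv (subst (λ y → O5M (repair (repair mate (σ³ v) y) (σ v) (σ² v))) (sym e)
          (o5-avoiding (Jof (λ q → n03 (sym q)) n21) v (λ Z zi zv o → h Z (zi , zv) o)))

  scheme : ∀ k {mate : Fin N → Fin N} (I : Invol mate) → O5M mate → # (loose mate) ≤ k → Scheme I
  scheme k {mate} I o5 le = go k le (any? (λ v → loose mate v ≟B true))
    where
    go : ∀ k → # (loose mate) ≤ k → Dec (Σ (Fin N) λ v → loose mate v ≡ true) → Scheme I
    go k le (no none) = scheme-isolated I o5 (λ v s → case ∨-case {mate v == σ v} (not-f⁻ (lem (σ⁴ v == v) _ s (¬t⇒f (λ p → none (v , p))))) of λ
      { (inj₁ q) → inj₁ (==-true q) ; (inj₂ q) → inj₂ (==-true q) })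
      where
      lem : ∀ a b → a ≡ true → (a ∧ b) ≡ false → b ≡ false
      lem true b refl p = p
    go zero le (yes (v , p)) = ⊥-elim (1+n≰n (≤-trans (#-pos (loose mate) v p) le))
    go (suc k) le (yes (v , p)) = split (σ² v ≟F v)
      where
      rec : Rec I o5
      rec J o lt = scheme k J o (≤-pred (≤-trans lt le))
      split : Dec (σ² v ≡ v) → Scheme I
      split (yes e) = scheme-two I o5 rec v p e
      split (no n2) = scheme-four I o5 rec v p n2

-- Three cycles of small total length

argmin : (f : Bool → ℕ) → Σ Bool λ p → ∀ q → f p ≤ f q
argmin f with ≤-total (f true) (f false)
... | inj₁ le = true , λ { true → ≤-refl ; false → le }
... | inj₂ le = false , λ { true → le ; false → ≤-refl }

argmin₂ : (f : Bool → Bool → ℕ) → Σ Bool λ p → Σ Bool λ q → ∀ p′ q′ → f p q ≤ f p′ q′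
argmin₂ f with argmin (λ p → f p (proj₁ (argmin (f p))))
... | p , h = p , proj₁ (argmin (f p)) , λ p′ q′ → ≤-trans (h p′) (proj₂ (argmin (f p′)) q′)

module Cover {N : ℕ} {σ σ⁻ : Fin N → Fin N} (π : Perm σ σ⁻) {mate : Fin N → Fin N} (I : Invol mate) where
  open Cycles π
  open Mate I
  open Nowhere π I
  open Forest π I
  open Five π
  open Half π I using (Miss)
  open Colour π I using (around-case)
  open Small π using (Scheme)

  private
    L : Link N
    L = lk ∅

  -- A name for the circuit of a point, by which a choice made per circuit becomes a function on the
  -- vertices.
  lab : Fin N → Fin N
  lab v = proj₁ (rep L v)

  lab-orbit : ∀ {ρ v} → root L ρ ≡ true → orbit ρ v ≡ true → lab v ≡ ρ
  lab-orbit {ρ} {v} p o = root-unique L (proj₁ (proj₂ (rep L v))) p (conn-trans L (proj₂ (proj₂ (rep L v))) (conn-sym L o))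

  lab-σ : ∀ v → lab (σ v) ≡ lab v
  lab-σ v = lab-orbit (proj₁ (proj₂ (rep L v))) (trans (orbit-σ (lab v) v) (proj₂ (proj₂ (rep L v))))

  Σr : (Fin N → ℕ) → ℕ
  Σr h = sum (λ ρ → ind (root L ρ) * h ρ)

  Σr-+ : ∀ h k → Σr (λ ρ → h ρ + k ρ) ≡ Σr h + Σr k
  Σr-+ h k = trans (sum-cong (λ ρ → *-distribˡ-+ (ind (root L ρ)) (h ρ) (k ρ))) (sum-+ _ _)

  Σr-* : ∀ c h → Σr (λ ρ → c * h ρ) ≡ c * Σr h
  Σr-* c h = trans (sum-cong (λ ρ → l (ind (root L ρ)) c (h ρ))) (sum-* c _)
    where
    l : ∀ i c x → i * (c * x) ≡ c * (i * x)
    l = solve-∀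

  Σr-mono : ∀ {h k} → (∀ ρ → root L ρ ≡ true → h ρ ≤ k ρ) → Σr h ≤ Σr k
  Σr-mono {h} {k} p = sum-mono (λ ρ → go ρ (bool (root L ρ)))
    where
    go : ∀ ρ → (root L ρ ≡ true) ⊎ (root L ρ ≡ false) → ind (root L ρ) * h ρ ≤ ind (root L ρ) * k ρ
    go ρ (inj₁ q) = *-monoʳ-≤ (ind (root L ρ)) (p ρ q)
    go ρ (inj₂ q) rewrite q = z≤n

  cls : (f : S N) → # f ≡ Σr (λ ρ → # (λ v → orbit ρ v ∧ f v))
  cls f = trans (#-def f) (trans (class-sum L (λ v → ind (f v))) (sum-cong (λ ρ → cong (ind (root L ρ) *_) (trans (sum-cong (λ v → l (orbit ρ v) (f v))) (sym (#-def _))))))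
    where
    l : ∀ a b → ind a * ind b ≡ ind (a ∧ b)
    l true b = +-identityʳ _
    l false b = refl

  orbit-refl : ∀ v → orbit v v ≡ true
  orbit-refl = conn-refl L

  orbit-five : ∀ {x v} → five x ≡ true → orbit x v ≡ true → around (v ==_) x ≡ true
  orbit-five {x} {v} f o = trans (sym (orbit-inv Z zinv o)) (∨-inl (==-refl x))
    where
    Z : S N
    Z v = around (v ==_) x
    zinv : ∀ v → Z (σ v) ≡ Z v
    zinv v = trans (cong₂ _∨_ (trans (cong (σ v ==_) (sym (per5 f))) (σ-inj-== v (σ⁴ x))) (cong₂ _∨_ (σ-inj-== v x) (cong₂ _∨_ (σ-inj-== v (σ x)) (cong₂ _∨_ (σ-inj-== v (σ² x)) (σ-inj-== v (σ³ x))))))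
      (eqB-≡ (tauto 5 (λ a b c d e → eqB (e ∨ (a ∨ (b ∨ (c ∨ d)))) (a ∨ (b ∨ (c ∨ (d ∨ e))))) refl (v == x) (v == σ x) (v == σ² x) (v == σ³ x) (v == σ⁴ x)))

  orbit-small : ∀ {x v} → small x ≡ true → orbit x v ≡ true → (v ≡ x) ⊎ (v ≡ σ x) ⊎ (v ≡ σ² x) ⊎ (v ≡ σ³ x)
  orbit-small {x} {v} f o = cs (trans (sym (orbit-inv Z zinv o)) (∨-inl (==-refl x)))
    where
    Z : S N
    Z v = (v == x) ∨ ((v == σ x) ∨ ((v == σ² x) ∨ (v == σ³ x)))
    zinv : ∀ v → Z (σ v) ≡ Z v
    zinv v = trans (cong₂ _∨_ (trans (cong (σ v ==_) (sym (==-true f))) (σ-inj-== v (σ³ x))) (cong₂ _∨_ (σ-inj-== v x) (cong₂ _∨_ (σ-inj-== v (σ x)) (σ-inj-== v (σ² x)))))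
      (eqB-≡ (tauto 4 (λ a b c d → eqB (d ∨ (a ∨ (b ∨ c))) (a ∨ (b ∨ (c ∨ d)))) refl (v == x) (v == σ x) (v == σ² x) (v == σ³ x)))
    cs : Z v ≡ true → (v ≡ x) ⊎ (v ≡ σ x) ⊎ (v ≡ σ² x) ⊎ (v ≡ σ³ x)
    cs p with ∨-case {v == x} p
    ... | inj₁ q = inj₁ (==-true q)
    ... | inj₂ p₁ with ∨-case {v == σ x} p₁
    ... | inj₁ q = inj₂ (inj₁ (==-true q))
    ... | inj₂ p₂ with ∨-case {v == σ² x} p₂
    ... | inj₁ q = inj₂ (inj₂ (inj₁ (==-true q)))
    ... | inj₂ q = inj₂ (inj₂ (inj₂ (==-true q)))

  module _ (x : Fin N) (n1 : σ x ≢ x) (n2 : σ² x ≢ x) (n3 : σ³ x ≢ x) (n4 : σ⁴ x ≢ x) where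
    private
      o : S N
      o = orbit x
      o₁ o₂ o₃ o₄ o₅ : S N
      o₁ = o ∖ x
      o₂ = o₁ ∖ σ x
      o₃ = o₂ ∖ σ² x
      o₄ = o₃ ∖ σ³ x
      o₅ = o₄ ∖ σ⁴ x
      i : ∀ {u v} → u ≢ v → σ u ≢ σ v
      i ne e = ne (σ-inj e)
      t₀ : o x ≡ true
      t₀ = orbit-refl x
      up : ∀ {v} → o v ≡ true → o (σ v) ≡ true
      up {v} p = trans (orbit-σ x v) p
      t₁ : o₁ (σ x) ≡ true
      t₁ = trans (∖-other o n1) (up t₀)
      t₂ : o₂ (σ² x) ≡ true
      t₂ = trans (∖-other o₁ (i n1)) (trans (∖-other o n2) (up (up t₀)))
      t₃ : o₃ (σ³ x) ≡ true
      t₃ = trans (∖-other o₂ (i (i n1))) (trans (∖-other o₁ (i n2)) (trans (∖-other o n3) (up (up (up t₀)))))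
      t₄ : o₄ (σ⁴ x) ≡ true
      t₄ = trans (∖-other o₃ (i (i (i n1)))) (trans (∖-other o₂ (i (i n2))) (trans (∖-other o₁ (i n3)) (trans (∖-other o n4) (up (up (up (up t₀)))))))

    orbit-length : # (orbit x) ≡ 5 + # (orbit x ∖ x ∖ σ x ∖ σ² x ∖ σ³ x ∖ σ⁴ x)
    orbit-length = trans (∖-remove o x t₀) (cong suc (trans (∖-remove o₁ _ t₁) (cong suc (trans (∖-remove o₂ _ t₂) (cong suc (trans (∖-remove o₃ _ t₃) (cong suc (∖-remove o₄ _ t₄))))))))

    orbit-six : σ⁵ x ≢ x → 6 ≤ # (orbit x)
    orbit-six n5 = ≤-trans (+-monoʳ-≤ 5 (#-pos o₅ (σ⁵ x) (trans (∖-other o₄ (i (i (i (i n1))))) (trans (∖-other o₃ (i (i (i n2)))) (trans (∖-other o₂ (i (i n3))) (trans (∖-other o₁ (i n4)) (trans (∖-other o n5) (up (up (up (up (up t₀)))))))))))) (≤-reflexive (sym orbit-length))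

    orbit-is-five : five x ≡ true → # (orbit x) ≡ 5
    orbit-is-five f = trans orbit-length (cong (5 +_) (#-empty (λ v → ¬t⇒f (λ p → lem v p))))
      where
      lem : ∀ v → o₅ v ≡ true → ⊥
      lem v p = go (around-case {v ==_} {x} (orbit-five f (∧-fst p₁)))
        where
        p₄ = ∧-fst {o₄ v} p
        p₃ = ∧-fst {o₃ v} p₄
        p₂ = ∧-fst {o₂ v} p₃
        p₁ = ∧-fst {o₁ v} p₂
        go : ((v == x) ≡ true) ⊎ ((v == σ x) ≡ true) ⊎ ((v == σ² x) ≡ true) ⊎ ((v == σ³ x) ≡ true) ⊎ ((v == σ⁴ x) ≡ true) → ⊥
        go (inj₁ q) = tf q (not-t⁻ (∧-snd {o v} p₁))
        go (inj₂ (inj₁ q)) = tf q (not-t⁻ (∧-snd {o₁ v} p₂))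
        go (inj₂ (inj₂ (inj₁ q))) = tf q (not-t⁻ (∧-snd {o₂ v} p₃))
        go (inj₂ (inj₂ (inj₂ (inj₁ q)))) = tf q (not-t⁻ (∧-snd {o₃ v} p₄))
        go (inj₂ (inj₂ (inj₂ (inj₂ q)))) = tf q (not-t⁻ (∧-snd {o₄ v} p))

  -- From length eight on, t ≤ ℓ/4 and p ≤ ℓ/2 suffice. For six and seven they are rounded down to 1
  -- and 3, and 6 + 12 + 12 is exactly five times six.
  long-orbit : ∀ {ℓ t p} → 6 ≤ ℓ → 4 * t ≤ ℓ → 2 * p ≤ ℓ → 6 * t + 4 * p + 12 ≤ 5 * ℓ
  long-orbit {ℓ} {t} {p} h a b with 8 ≤? ℓ
  ... | yes c = *-cancelˡ-≤ 2 (≤-trans (≤-reflexive (l₁ t p)) (≤-trans (+-mono-≤ (+-mono-≤ (*-monoʳ-≤ 3 a) (*-monoʳ-≤ 4 b)) (*-monoʳ-≤ 3 c)) (≤-reflexive (l₂ ℓ))))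
    where
    l₁ : ∀ t p → 2 * (6 * t + 4 * p + 12) ≡ 3 * (4 * t) + 4 * (2 * p) + 3 * 8
    l₁ = solve-∀
    l₂ : ∀ ℓ → 3 * ℓ + 4 * ℓ + 3 * ℓ ≡ 2 * (5 * ℓ)
    l₂ = solve-∀
  ... | no c = ≤-trans (+-monoˡ-≤ 12 (+-mono-≤ (*-monoʳ-≤ 6 (small-t t a)) (*-monoʳ-≤ 4 (small-p p b)))) (*-monoʳ-≤ 5 h)
    where
    ℓ≤7 : ℓ ≤ 7
    ℓ≤7 = ≤-pred (≰⇒> c)
    small-t : ∀ t → 4 * t ≤ ℓ → t ≤ 1
    small-t t a = ≤-pred (*-cancelˡ-< 4 t 2 (≤-trans (s≤s (≤-trans a ℓ≤7)) ≤-refl))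
    small-p : ∀ p → 2 * p ≤ ℓ → p ≤ 3
    small-p p b = ≤-pred (*-cancelˡ-< 2 p 4 (s≤s (≤-trans b ℓ≤7)))

  -- Here t ≤ 1 and p ≤ 2 give 6 + 8 + 12 = 26, one more than five times five; `x` pays for it. If
  -- `y` is 1, its charge of six replaces that of `t`, which is then 0.
  five-orbit : ∀ {t p y x} → 4 * t ≤ 5 → 2 * p ≤ 5 → y ≤ 1 → 1 ≤ x → (1 ≤ y → t ≡ 0) → 6 * t + 4 * p + 12 + 6 * y ≤ 5 * 5 + x
  five-orbit {t} {p} {zero} {x} a b c d e = ≤-trans (+-monoˡ-≤ 0 (+-monoˡ-≤ 12 (+-mono-≤ (*-monoʳ-≤ 6 {t} {1} (≤-pred (*-cancelˡ-< 4 t 2 (s≤s (≤-trans a (m≤m+n 5 2)))))) (*-monoʳ-≤ 4 {p} {2} (≤-pred (*-cancelˡ-< 2 p 3 (s≤s b))))))) (+-monoʳ-≤ 25 d)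
  five-orbit {t} {p} {suc zero} {x} a b c d e rewrite e (s≤s z≤n) = ≤-trans (+-monoˡ-≤ 6 (+-monoˡ-≤ 12 (*-monoʳ-≤ 4 {p} {2} (≤-pred (*-cancelˡ-< 2 p 3 (s≤s b)))))) (+-monoʳ-≤ 25 d)
  five-orbit {y = suc (suc _)} a b (s≤s ()) d e

  module Costs (o5 : O5) (sc : Scheme I) where
    open Scheme sc

    at : Fin N → Bool → Bool → S N
    at ρ p q v = orbit ρ v ∧ (eqB (s v) p ∧ eqB (r v) q)

    best : ∀ ρ → Σ Bool λ p → Σ Bool λ q → ∀ p′ q′ → # (at ρ p q) ≤ # (at ρ p′ q′)
    best ρ = argmin₂ (λ p q → # (at ρ p q))

    P Q : Fin N → Bool
    P ρ = proj₁ (best ρ)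
    Q ρ = proj₁ (proj₂ (best ρ))

    -- `τ` counts the edges of the circuit that the first cover uses three times. Complementing on
    -- the circuit gives this role to any of the four value pairs, so the rarest one is taken.
    τ ℓ : Fin N → ℕ
    τ ρ = # (at ρ (P ρ) (Q ρ))
    ℓ ρ = # (orbit ρ)

    τ-min : ∀ ρ p q → τ ρ ≤ # (at ρ p q)
    τ-min ρ = proj₂ (proj₂ (best ρ))

    4τ : ∀ ρ → 4 * τ ρ ≤ ℓ ρ
    4τ ρ = ≤-trans (≤-reflexive (l (τ ρ))) (≤-trans (+-mono-≤ (+-mono-≤ (τ-min ρ true true) (τ-min ρ true false)) (+-mono-≤ (τ-min ρ false true) (τ-min ρ false false))) (≤-reflexive (sym
      (trans (#-split (orbit ρ) s) (cong₂ _+_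
        (trans (#-split (λ v → orbit ρ v ∧ s v) r) (cong₂ _+_ (#-cong (λ v → e₁ (orbit ρ v) (s v) (r v))) (#-cong (λ v → e₂ (orbit ρ v) (s v) (r v)))))
        (trans (#-split (λ v → orbit ρ v ∧ not (s v)) r) (cong₂ _+_ (#-cong (λ v → e₃ (orbit ρ v) (s v) (r v))) (#-cong (λ v → e₄ (orbit ρ v) (s v) (r v))))))))))
      where
      l : ∀ t → 4 * t ≡ (t + t) + (t + t)
      l = solve-∀
      e₁ : ∀ o s r → ((o ∧ s) ∧ r) ≡ (o ∧ (eqB s true ∧ eqB r true))
      e₁ o s r = eqB-≡ (tauto 3 (λ o s r → eqB ((o ∧ s) ∧ r) (o ∧ (eqB s true ∧ eqB r true))) refl o s r)
      e₂ : ∀ o s r → ((o ∧ s) ∧ not r) ≡ (o ∧ (eqB s true ∧ eqB r false))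
      e₂ o s r = eqB-≡ (tauto 3 (λ o s r → eqB ((o ∧ s) ∧ not r) (o ∧ (eqB s true ∧ eqB r false))) refl o s r)
      e₃ : ∀ o s r → ((o ∧ not s) ∧ r) ≡ (o ∧ (eqB s false ∧ eqB r true))
      e₃ o s r = eqB-≡ (tauto 3 (λ o s r → eqB ((o ∧ not s) ∧ r) (o ∧ (eqB s false ∧ eqB r true))) refl o s r)
      e₄ : ∀ o s r → ((o ∧ not s) ∧ not r) ≡ (o ∧ (eqB s false ∧ eqB r false))
      e₄ o s r = eqB-≡ (tauto 3 (λ o s r → eqB ((o ∧ not s) ∧ not r) (o ∧ (eqB s false ∧ eqB r false))) refl o s r)

    τ-zero : ∀ {ρ p q} → (∀ v → orbit ρ v ≡ true → (eqB (s v) p ∧ eqB (r v) q) ≡ false) → τ ρ ≡ 0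
    τ-zero {ρ} {p} {q} h = n≤0⇒n≡0 (≤-trans (τ-min ρ p q) (≤-reflexive (#-empty (λ v → ¬t⇒f (λ e → tf (∧-snd {orbit ρ v} e) (h v (∧-fst e)))))))

    τ-miss : ∀ {ρ x} → orbit ρ x ≡ true → five x ≡ true → Miss s r x → τ ρ ≡ 0
    τ-miss {ρ} {x} o f (p , q , h) = τ-zero {ρ} {p} {q} (λ v ov → go v (around-case {v ==_} {x} (orbit-five f (conn-trans L (conn-sym L o) ov))))
      where
      g : S N
      g u = eqB (s u) p ∧ eqB (r u) q
      h₁ = ∨-false₂ {g x} h
      h₂ = ∨-false₂ {g (σ x)} h₁
      h₃ = ∨-false₂ {g (σ² x)} h₂
      go : ∀ v → ((v == x) ≡ true) ⊎ ((v == σ x) ≡ true) ⊎ ((v == σ² x) ≡ true) ⊎ ((v == σ³ x) ≡ true) ⊎ ((v == σ⁴ x) ≡ true) → g v ≡ false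
      go v (inj₁ e) = trans (cong g (==-true e)) (∨-false₁ h)
      go v (inj₂ (inj₁ e)) = trans (cong g (==-true e)) (∨-false₁ h₁)
      go v (inj₂ (inj₂ (inj₁ e))) = trans (cong g (==-true e)) (∨-false₁ h₂)
      go v (inj₂ (inj₂ (inj₂ (inj₁ e)))) = trans (cong g (==-true e)) (∨-false₁ h₃)
      go v (inj₂ (inj₂ (inj₂ (inj₂ e)))) = trans (cong g (==-true e)) (∨-false₂ {g (σ³ x)} h₃)

    -- Around a point where the colours of u and σ u agree, s takes the same value before u and after σ u.
    τ-small : ∀ {ρ} → small ρ ≡ true → τ ρ ≡ 0
    τ-small {ρ} sm = go (twin ρ sm)
      where
      go : (Σ (Fin N) λ u → (orbit ρ u ≡ true) × (a u ≡ a (σ u)) × (b u ≡ b (σ u))) → τ ρ ≡ 0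
      go (u , o , p , q) = pick (pigeon (s u) (r u) (s (σ u)) (r (σ u)) (s (σ² u)) (r (σ² u)))
        where
        su : small u ≡ true
        su = trans (sym (orbit-inv small small-σ o)) sm
        turn : ∀ c s → Bal σ s c → c u ≡ c (σ u) → s (σ³ u) ≡ s (σ u)
        turn c s bal e = lem (s (σ³ u)) (s u) (c (σ u)) (trans (sym (cong s (==-true su))) (trans (bal (σ³ u)) (cong (s (σ³ u) xor_) (trans (cong c (==-true su)) e)))) (bal u)
          where
          lem : ∀ x y w {t} → y ≡ (x xor w) → t ≡ (y xor w) → x ≡ t
          lem x y w refl refl = eqB-≡ (tauto 2 (λ x w → eqB x ((x xor w) xor w)) refl x w)
        s₃ = turn a s bs p
        r₃ = turn b r br q
        G : Bool → Bool → S N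
        G p q v = eqB (s v) p ∧ eqB (r v) q
        avoid : ∀ p q → (G p q u ∨ (G p q (σ u) ∨ G p q (σ² u))) ≡ false → τ ρ ≡ 0
        avoid p q h = τ-zero {ρ} {p} {q} (λ v ov → at-v v (orbit-small su (conn-trans L (conn-sym L o) ov)))
          where
          at-v : ∀ v → (v ≡ u) ⊎ (v ≡ σ u) ⊎ (v ≡ σ² u) ⊎ (v ≡ σ³ u) → G p q v ≡ false
          at-v v (inj₁ refl) = ∨-false₁ h
          at-v v (inj₂ (inj₁ refl)) = ∨-false₁ (∨-false₂ {G p q u} h)
          at-v v (inj₂ (inj₂ (inj₁ refl))) = ∨-false₂ {G p q (σ u)} (∨-false₂ {G p q u} h)
          at-v v (inj₂ (inj₂ (inj₂ refl))) = trans (cong₂ (λ x y → eqB x p ∧ eqB y q) s₃ r₃) (∨-false₁ (∨-false₂ {G p q u} h))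
        hit : Bool → Bool → Bool → Bool → Bool → Bool → Bool → Bool → Bool
        hit s₀ r₀ s₁ r₁ s₂ r₂ p q = (eqB s₀ p ∧ eqB r₀ q) ∨ ((eqB s₁ p ∧ eqB r₁ q) ∨ (eqB s₂ p ∧ eqB r₂ q))
        -- The four edges of the circuit carry at most three different pairs of values, so one of
        -- the four pairs is left out.
        pigeon : ∀ s₀ r₀ s₁ r₁ s₂ r₂ → ((not (hit s₀ r₀ s₁ r₁ s₂ r₂ true true) ∨ not (hit s₀ r₀ s₁ r₁ s₂ r₂ true false)) ∨ (not (hit s₀ r₀ s₁ r₁ s₂ r₂ false true) ∨ not (hit s₀ r₀ s₁ r₁ s₂ r₂ false false))) ≡ true
        pigeon = tauto 6 (λ s₀ r₀ s₁ r₁ s₂ r₂ → (not (hit s₀ r₀ s₁ r₁ s₂ r₂ true true) ∨ not (hit s₀ r₀ s₁ r₁ s₂ r₂ true false)) ∨ (not (hit s₀ r₀ s₁ r₁ s₂ r₂ false true) ∨ not (hit s₀ r₀ s₁ r₁ s₂ r₂ false false))) refl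
        H : Bool → Bool → Bool
        H = hit (s u) (r u) (s (σ u)) (r (σ u)) (s (σ² u)) (r (σ² u))
        pick : ((not (H true true) ∨ not (H true false)) ∨ (not (H false true) ∨ not (H false false))) ≡ true → τ ρ ≡ 0
        pick h with ∨-case {not (H true true) ∨ not (H true false)} h
        ... | inj₁ k with ∨-case {not (H true true)} k
        ... | inj₁ y = avoid true true (not-t⁻ y)
        ... | inj₂ y = avoid true false (not-t⁻ y)
        pick h | inj₂ k with ∨-case {not (H false true)} k
        ... | inj₁ y = avoid false true (not-t⁻ y)
        ... | inj₂ y = avoid false false (not-t⁻ y)

-- Three cycles (zᵢ , sᵢ) covering all edges. An edge of the matching is counted from both ends, so that twice the total length is bounded.
record Triple {N : ℕ} (σ mate : Fin N → Fin N) : Set where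
  field
    z₁ z₂ z₃ s₁ s₂ s₃ : S N
    inv₁ : ∀ v → z₁ (mate v) ≡ z₁ v
    inv₂ : ∀ v → z₂ (mate v) ≡ z₂ v
    inv₃ : ∀ v → z₃ (mate v) ≡ z₃ v
    bal₁ : Bal σ s₁ z₁
    bal₂ : Bal σ s₂ z₂
    bal₃ : Bal σ s₃ z₃
    cov-z : ∀ v → (z₁ v ∨ (z₂ v ∨ z₃ v)) ≡ true
    cov-s : ∀ v → (s₁ v ∨ (s₂ v ∨ s₃ v)) ≡ true
    short : 7 * ((# z₁ + # z₂ + # z₃) + 2 * (# s₁ + # s₂ + # s₃)) ≤ 34 * N

-- A small circuit is free of the charge 12 and has `τ` equal to 0, so it can afford a flow `a` that
-- is nonzero everywhere on it: 2ℓ for the minority side and 3ℓ for `a`.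
cost-small : ∀ {t p i y as ℓ x} → t ≡ 0 → y ≡ 0 → i ≡ 0 → 2 * p ≤ ℓ → as ≤ ℓ → (6 * t + 4 * p + 12 * i + 6 * y) + 3 * as ≤ 5 * ℓ + x
cost-small {p = p} {as = as} {ℓ} refl refl refl h k = ≤-trans (+-mono-≤ (≤-trans (≤-reflexive (l p)) (*-monoʳ-≤ 2 h)) (*-monoʳ-≤ 3 k)) (≤-trans (≤-reflexive (l′ ℓ)) (m≤m+n _ _))
  where
  l : ∀ p → 4 * p + 0 + 0 ≡ 2 * (2 * p)
  l = solve-∀
  l′ : ∀ ℓ → 2 * ℓ + 3 * ℓ ≡ 5 * ℓ
  l′ = solve-∀

cost-long : ∀ {t p i y as ℓ x} → y ≡ 0 → as ≡ 0 → i ≡ 1 → 6 * t + 4 * p + 12 ≤ 5 * ℓ → (6 * t + 4 * p + 12 * i + 6 * y) + 3 * as ≤ 5 * ℓ + x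
cost-long {t} {p} refl refl refl h = ≤-trans (≤-reflexive (l (6 * t + 4 * p))) (≤-trans h (m≤m+n _ _))
  where
  l : ∀ x → x + 12 + 0 + 0 ≡ x + 12
  l = solve-∀

cost-five : ∀ {t p i y as ℓ x} → as ≡ 0 → i ≡ 1 → ℓ ≡ 5 → 6 * t + 4 * p + 12 + 6 * y ≤ 5 * 5 + x → (6 * t + 4 * p + 12 * i + 6 * y) + 3 * as ≤ 5 * ℓ + x
cost-five {t} {p} {y = y} refl refl refl h = ≤-trans (≤-reflexive (+-identityʳ _)) h

-- The weights add up to 14, and 68/14 is 34/7.
one-of-three : ∀ N x y z → 6 * x + 4 * y + 4 * z ≤ 68 * N → (7 * x ≤ 34 * N) ⊎ (7 * y ≤ 34 * N) ⊎ (7 * z ≤ 34 * N)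
one-of-three N x y z up with 7 * x ≤? 34 * N | 7 * y ≤? 34 * N | 7 * z ≤? 34 * N
... | yes p | _ | _ = inj₁ p
... | no _ | yes p | _ = inj₂ (inj₁ p)
... | no _ | no _ | yes p = inj₂ (inj₂ p)
... | no n₁ | no n₂ | no n₃ = ⊥-elim (1+n≰n (≤-trans (s≤s (*-monoʳ-≤ 7 up)) (begin
      -- `suc` and 13 together are the sum of the weights: each of the three numbers exceeds its
      -- bound by at least one.
      suc (7 * (68 * N)) ≤⟨ s≤s (m≤m+n _ 13) ⟩
      suc (7 * (68 * N) + 13) ≡⟨ l₁ N ⟩
      6 * suc (34 * N) + 4 * suc (34 * N) + 4 * suc (34 * N) ≤⟨ +-mono-≤ (+-mono-≤ (*-monoʳ-≤ 6 (≰⇒> n₁)) (*-monoʳ-≤ 4 (≰⇒> n₂))) (*-monoʳ-≤ 4 (≰⇒> n₃)) ⟩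
      6 * (7 * x) + 4 * (7 * y) + 4 * (7 * z) ≡⟨ l₂ x y z ⟩
      7 * (6 * x + 4 * y + 4 * z) ∎)))
  where
  open ≤-Reasoning
  l₁ : ∀ n → 1 + (7 * (68 * n) + 13) ≡ 6 * (1 + 34 * n) + 4 * (1 + 34 * n) + 4 * (1 + 34 * n)
  l₁ = solve-∀
  l₂ : ∀ x y z → 6 * (7 * x) + 4 * (7 * y) + 4 * (7 * z) ≡ 7 * (6 * x + 4 * y + 4 * z)
  l₂ = solve-∀

-- The weighted mean of the three covers

module Lengths {N : ℕ} {σ σ⁻ : Fin N → Fin N} (π : Perm σ σ⁻) {mate : Fin N → Fin N} (I : Invol mate)
  (o5 : Nowhere.O5 π I) (sc : Small.Scheme π I) where
  open Cycles π
  open Mate I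
  open Nowhere π I
  open Forest π I
  open Five π
  open Colour π I using (around-case)
  open Cover π I
  open Costs o5 sc
  open Small.Scheme sc

  private
    L : Link N
    L = lk ∅

  Σr-cong : ∀ {h k} → (∀ ρ → root L ρ ≡ true → h ρ ≡ k ρ) → Σr h ≡ Σr k
  Σr-cong {h} {k} p = ≤-antisym (Σr-mono {h} {k} (λ ρ q → ≤-reflexive (p ρ q))) (Σr-mono {k} {h} (λ ρ q → ≤-reflexive (sym (p ρ q))))

  orbit-lab : ∀ {f : Fin N → S N} {ρ} → root L ρ ≡ true → ∀ v → (orbit ρ v ∧ f (lab v) v) ≡ (orbit ρ v ∧ f ρ v)
  orbit-lab {f} {ρ} p v with bool (orbit ρ v)
  ... | inj₁ o = cong (λ y → orbit ρ v ∧ f y v) (lab-orbit p o)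
  ... | inj₂ o = trans (∧-false₁ o) (sym (∧-false₁ o))

  -- Complemented circuit by circuit so that the rarest pair of values becomes (true , true).
  s° r° T° : S N
  s° v = eqB (s v) (P (lab v))
  r° v = eqB (r v) (Q (lab v))
  T° v = s° v ∧ r° v

  #T° : # T° ≡ Σr τ
  #T° = trans (cls T°) (Σr-cong (λ ρ p → #-cong (orbit-lab {λ ρ v → eqB (s v) (P ρ) ∧ eqB (r v) (Q ρ)} p)))

  #N : N ≡ Σr ℓ
  #N = trans (sym (#-all N)) (trans (cls (λ _ → true)) (Σr-cong (λ ρ p → #-cong (λ v → lem (orbit ρ v)))))
    where
    lem : ∀ x → (x ∧ true) ≡ x
    lem true = refl
    lem false = refl

  module _ (y : S N) where

    side : ∀ ρ → Σ Bool λ q → ∀ q′ → # (λ v → orbit ρ v ∧ eqB (y v) q) ≤ # (λ v → orbit ρ v ∧ eqB (y v) q′)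
    side ρ = argmin (λ q → # (λ v → orbit ρ v ∧ eqB (y v) q))

    -- The complement is taken on each circuit where it is the shorter choice.
    less : S N
    less v = eqB (y v) (proj₁ (side (lab v)))

    private
      p : Fin N → ℕ
      p ρ = # (λ v → orbit ρ v ∧ eqB (y v) (proj₁ (side ρ)))

      2p : ∀ ρ → 2 * p ρ ≤ ℓ ρ
      2p ρ = ≤-trans (+-mono-≤ (proj₂ (side ρ) true) (≤-trans (≤-reflexive (+-identityʳ _)) (proj₂ (side ρ) false)))
        (≤-reflexive (sym (trans (#-split (orbit ρ) y) (cong₂ _+_ (#-cong (λ v → cong (orbit ρ v ∧_) (e₁ (y v)))) (#-cong (λ v → cong (orbit ρ v ∧_) (e₂ (y v))))))))
        where
        e₁ : ∀ x → x ≡ eqB x true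
        e₁ true = refl
        e₁ false = refl
        e₂ : ∀ x → not x ≡ eqB x false
        e₂ true = refl
        e₂ false = refl

      #less : # less ≡ Σr p
      #less = trans (cls less) (Σr-cong (λ ρ q → #-cong (orbit-lab {λ ρ v → eqB (y v) (proj₁ (side ρ))} q)))

      as Yr Xr : Fin N → ℕ
      as ρ = # (λ v → orbit ρ v ∧ (a v ∧ small v))
      Yr ρ = # (λ v → orbit ρ v ∧ Y v)
      Xr ρ = # (λ v → orbit ρ v ∧ X v)

      per-orbit : ∀ ρ → root L ρ ≡ true → (6 * τ ρ + 4 * p ρ + 12 * ind (not (small ρ)) + 6 * Yr ρ) + 3 * as ρ ≤ 5 * ℓ ρ + Xr ρ
      per-orbit ρ _ = go (bool (small ρ)) (bool (five ρ))
        where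
        no-Y : five ρ ≡ false → Yr ρ ≡ 0
        no-Y nf = #-empty (λ v → ¬t⇒f (λ e → tf (trans (orbit-inv five five-σ (∧-fst e)) (proj₁ (Y-sparse v (∧-snd {orbit ρ v} e)))) nf))
        no-as : small ρ ≡ false → as ρ ≡ 0
        no-as ns = #-empty (λ v → ¬t⇒f (λ e → tf (trans (orbit-inv small small-σ (∧-fst e)) (∧-snd {a v} (∧-snd {orbit ρ v} e))) ns))
        go : (small ρ ≡ true) ⊎ (small ρ ≡ false) → (five ρ ≡ true) ⊎ (five ρ ≡ false) → (6 * τ ρ + 4 * p ρ + 12 * ind (not (small ρ)) + 6 * Yr ρ) + 3 * as ρ ≤ 5 * ℓ ρ + Xr ρ
        go (inj₁ sm) (inj₁ f) = ⊥-elim (ne4 f (==-true sm))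
        go (inj₁ sm) (inj₂ nf) = cost-small {τ ρ} {p ρ} {ind (not (small ρ))} {Yr ρ} {as ρ} {ℓ ρ} {Xr ρ} (τ-small {ρ} sm) (no-Y nf) (ind-f (not-f sm)) (2p ρ) (#-mono {g = orbit ρ} (λ v e → ∧-fst e))
        go (inj₂ ns) (inj₂ nf) = cost-long {τ ρ} {p ρ} {ind (not (small ρ))} {Yr ρ} {as ρ} {ℓ ρ} {Xr ρ} (no-Y nf) (no-as ns) (ind-t (not-t ns)) (long-orbit {ℓ ρ} {τ ρ} {p ρ} (orbit-six ρ n1 (λ e → ≢-== ns (trans (cong σ² e) e)) n3 (≢-== ns) n5) (4τ ρ) (2p ρ))
          where
          n1 : σ ρ ≢ ρ
          n1 e = ≢-== ns (trans (cong σ³ e) (trans (cong σ² e) (trans (cong σ e) e)))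
          n3 : σ³ ρ ≢ ρ
          n3 e = n1 (no-three I o5 e)
          n5 : σ⁵ ρ ≢ ρ
          n5 e = tf (∧-intro (subst (λ z → (z == ρ) ≡ true) (sym e) (==-refl ρ)) (not-t (==-false n1))) nf
        go (inj₂ ns) (inj₁ f) = cost-five {τ ρ} {p ρ} {ind (not (small ρ))} {Yr ρ} {as ρ} {ℓ ρ} {Xr ρ} (no-as ns) (ind-t (not-t ns)) ℓ5
            (five-orbit {τ ρ} {p ρ} {Yr ρ} {Xr ρ} (subst (4 * τ ρ ≤_) ℓ5 (4τ ρ)) (subst (2 * p ρ ≤_) ℓ5 (2p ρ)) (#≤1 _ unique) some good)
          where
          ℓ5 : ℓ ρ ≡ 5
          ℓ5 = orbit-is-five ρ (ne1 f) (ne2 f) (ne3 f) (ne4 f) f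
          unique : ∀ u v → (orbit ρ u ∧ Y u) ≡ true → (orbit ρ v ∧ Y v) ≡ true → u ≡ v
          unique u v eu ev = sep (around-case {v ==_} {u} (orbit-five fu (conn-trans L (conn-sym L (∧-fst eu)) (∧-fst ev))))
            where
            Yu = ∧-snd {orbit ρ u} eu
            Yv = ∧-snd {orbit ρ v} ev
            fu = proj₁ (Y-sparse u Yu)
            ns′ = proj₂ (Y-sparse u Yu)
            no-way : ∀ {w} → Y w ≡ false → (v == w) ≡ true → u ≡ v
            no-way n e = tf Yv (trans (cong Y (==-true e)) n)
            sep : ((v == u) ≡ true) ⊎ ((v == σ u) ≡ true) ⊎ ((v == σ² u) ≡ true) ⊎ ((v == σ³ u) ≡ true) ⊎ ((v == σ⁴ u) ≡ true) → u ≡ v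
            sep (inj₁ e) = sym (==-true e)
            sep (inj₂ (inj₁ e)) = no-way (proj₁ ns′) e
            sep (inj₂ (inj₂ (inj₁ e))) = no-way (proj₁ (proj₂ ns′)) e
            sep (inj₂ (inj₂ (inj₂ (inj₁ e)))) = no-way (proj₁ (proj₂ (proj₂ ns′))) e
            sep (inj₂ (inj₂ (inj₂ (inj₂ e)))) = no-way (proj₂ (proj₂ (proj₂ ns′))) e
          some : 1 ≤ Xr ρ
          some = put (around-case {X} {ρ} (X-around ρ f))
            where
            h : S N
            h v = orbit ρ v ∧ X v
            up : ∀ {v} → orbit ρ v ≡ true → orbit ρ (σ v) ≡ true
            up {v} o = trans (orbit-σ ρ v) o
            o₀ = orbit-refl ρ
            put : (X ρ ≡ true) ⊎ (X (σ ρ) ≡ true) ⊎ (X (σ² ρ) ≡ true) ⊎ (X (σ³ ρ) ≡ true) ⊎ (X (σ⁴ ρ) ≡ true) → 1 ≤ Xr ρ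
            put (inj₁ e) = #-pos h ρ (∧-intro o₀ e)
            put (inj₂ (inj₁ e)) = #-pos h (σ ρ) (∧-intro (up o₀) e)
            put (inj₂ (inj₂ (inj₁ e))) = #-pos h (σ² ρ) (∧-intro (up (up o₀)) e)
            put (inj₂ (inj₂ (inj₂ (inj₁ e)))) = #-pos h (σ³ ρ) (∧-intro (up (up (up o₀))) e)
            put (inj₂ (inj₂ (inj₂ (inj₂ e)))) = #-pos h (σ⁴ ρ) (∧-intro (up (up (up (up o₀)))) e)
          good : 1 ≤ Yr ρ → τ ρ ≡ 0
          good le = let (x , e) = #-pos⁻ (λ v → orbit ρ v ∧ Y v) le ; Yx = ∧-snd {orbit ρ x} e in τ-miss {ρ} {x} (∧-fst e) (proj₁ (Y-sparse x Yx)) (miss x Yx)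

    -- The inequality per circuit is summed over all circuits. The charges for big circuits, for `Y`
    -- and for `X` then cancel against `bound`, which trades them for the points of `a` on big
    -- circuits.
    core : 6 * # T° + 4 * # less + 3 * # a ≤ 5 * N
    core = +-cancelʳ-≤ (12 * big-orbits + 6 * # Y + # X) _ _ (begin
      6 * # T° + 4 * # less + 3 * # a + (12 * big-orbits + 6 * # Y + # X)
        ≡⟨ cong (λ z → 6 * # T° + 4 * # less + 3 * z + (12 * big-orbits + 6 * # Y + # X)) (#-split a small) ⟩
      6 * # T° + 4 * # less + 3 * (aS + aB) + (12 * big-orbits + 6 * # Y + # X)
        ≡⟨ l₁ (# T°) (# less) aS aB big-orbits (# Y) (# X) ⟩
      (6 * # T° + 4 * # less + 12 * big-orbits + 6 * # Y) + 3 * aS + (# X + 3 * aB)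
        ≤⟨ +-mono-≤ total bound ⟩
      (5 * N + # X) + (12 * big-orbits + 6 * # Y)
        ≡⟨ l₂ N (# X) big-orbits (# Y) ⟩
      5 * N + (12 * big-orbits + 6 * # Y + # X) ∎)
      where
      open ≤-Reasoning
      aS aB : ℕ
      aS = # (λ v → a v ∧ small v)
      aB = # (λ v → a v ∧ not (small v))
      l₁ : ∀ t p s b d y x → 6 * t + 4 * p + 3 * (s + b) + (12 * d + 6 * y + x) ≡ (6 * t + 4 * p + 12 * d + 6 * y) + 3 * s + (x + 3 * b)
      l₁ = solve-∀
      l₂ : ∀ n x d y → (5 * n + x) + (12 * d + 6 * y) ≡ 5 * n + (12 * d + 6 * y + x)
      l₂ = solve-∀
      bigs : Σr (λ ρ → ind (not (small ρ))) ≡ big-orbits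
      bigs = trans (sum-cong (λ ρ → lem (root L ρ) (not (small ρ)))) (sym (#-def _))
        where
        lem : ∀ x y → ind x * ind y ≡ ind (x ∧ y)
        lem true y = +-identityʳ _
        lem false y = refl
      total : (6 * # T° + 4 * # less + 12 * big-orbits + 6 * # Y) + 3 * aS ≤ 5 * N + # X
      total = subst₂ _≤_
        (trans (Σr-+ _ _) (cong₂ _+_ (trans (Σr-+ _ _) (cong₂ _+_ (trans (Σr-+ _ _) (cong₂ _+_ (trans (Σr-+ _ _) (cong₂ _+_ (trans (Σr-* 6 τ) (cong (6 *_) (sym #T°))) (trans (Σr-* 4 p) (cong (4 *_) (sym #less)))))
          (trans (Σr-* 12 _) (cong (12 *_) bigs)))) (trans (Σr-* 6 Yr) (cong (6 *_) (sym (cls Y)))))) (trans (Σr-* 3 as) (cong (3 *_) (sym (cls (λ v → a v ∧ small v)))))))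
        (trans (Σr-+ _ _) (cong₂ _+_ (trans (Σr-* 5 ℓ) (cong (5 *_) (sym #N))) (sym (cls X))))
        (Σr-mono per-orbit)

  eq-bal : ∀ {c y : S N} (q : Fin N → Bool) → Bal σ y c → Bal σ (λ v → eqB (y v) (q (lab v))) c
  eq-bal {c} {y} q bal v = trans (cong₂ eqB (bal v) (cong q (lab-σ v))) (lem (y v) (c (σ v)) (q (lab v)))
    where
    lem : ∀ y c q → eqB (y xor c) q ≡ (eqB y q xor c)
    lem y c q = eqB-≡ (tauto 3 (λ y c q → eqB (eqB (y xor c) q) (eqB y q xor c)) refl y c q)

  ab-count : # a + # b + # (a ⊕ b) ≡ 2 * N
  ab-count = trans (cong₂ _+_ (cong₂ _+_ (#-def a) (#-def b)) (#-def (a ⊕ b))) (trans (cong (_+ sum (λ v → ind ((a ⊕ b) v))) (sym (sum-+ _ _))) (trans (sym (sum-+ _ _))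
    (trans (sum-cong (λ v → lem (a v) (b v) (cov v))) (trans (sum-* 2 _) (cong (2 *_) (trans (sym (#-def {N} (λ _ → true))) (#-all N)))))))
    where
    lem : ∀ x y → (x ∨ y) ≡ true → ind x + ind y + ind (x xor y) ≡ 2 * ind true
    lem true true p = refl
    lem true false p = refl
    lem false true p = refl

  -- The complemented sum extends a + b as well as the sum does, and it is true wherever `s°` and
  -- `r°` are both false. Every edge of the 2-factor is thus covered, three times on `T°` and once
  -- elsewhere.
  c° : S N
  c° v = not (s° v xor r° v)

  s-count : # s° + # r° + # c° ≡ N + 2 * # T°
  s-count = trans (cong₂ _+_ (cong₂ _+_ (#-def s°) (#-def r°)) (#-def c°)) (trans (cong (_+ sum (λ v → ind (c° v))) (sym (sum-+ _ _))) (trans (sym (sum-+ _ _))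
    (trans (sum-cong (λ v → eqN (tauto 2 (λ x y → (ind x + ind y + ind (not (x xor y))) ≡ᵇ (ind true + 2 * ind (x ∧ y))) refl (s° v) (r° v))))
      (trans (sum-+ _ _) (cong₂ _+_ (trans (sym (#-def {N} (λ _ → true))) (#-all N)) (trans (sum-* 2 _) (cong (2 *_) (sym (#-def T°)))))))))

  doubled : ∀ (y : S N) → # s + # (λ v → not (s v)) + # y ≡ N + # y
  doubled y = cong (_+ # y) (trans (sym (#-split (λ _ → true) s)) (#-all N))

  len₁ len₂ len₃ : ℕ
  len₁ = (# a + # b + # (a ⊕ b)) + 2 * (# s° + # r° + # c°)
  len₂ = (# a + # a + # b) + 2 * (# s + # (λ v → not (s v)) + # (less r))
  len₃ = (# a + # a + # (a ⊕ b)) + 2 * (# s + # (λ v → not (s v)) + # (less (s ⊕ r)))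

  -- Expanding yields 24 times `# T°`. This is divided evenly between two applications of `core`,
  -- one for the minority side of each of the other two covers.
  average : 6 * len₁ + 4 * len₂ + 4 * len₃ ≤ 68 * N
  average = begin
    6 * len₁ + 4 * len₂ + 4 * len₃
      ≡⟨ cong₂ _+_ (cong₂ _+_ (cong₂ (λ x y → 6 * (x + 2 * y)) ab-count s-count) (cong (λ y → 4 * ((# a + # a + # b) + 2 * y)) (doubled (less r)))) (cong (λ y → 4 * ((# a + # a + # (a ⊕ b)) + 2 * y)) (doubled (less (s ⊕ r)))) ⟩
    6 * (2 * N + 2 * (N + 2 * # T°)) + 4 * ((# a + # a + # b) + 2 * (N + # (less r))) + 4 * ((# a + # a + # (a ⊕ b)) + 2 * (N + # (less (s ⊕ r))))
      ≡⟨ l₁ N (# T°) (# a) (# b) (# (a ⊕ b)) (# (less r)) (# (less (s ⊕ r))) ⟩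
    40 * N + 4 * (# a + # b + # (a ⊕ b)) + 2 * (6 * # T° + 4 * # (less r) + 3 * # a) + 2 * (6 * # T° + 4 * # (less (s ⊕ r)) + 3 * # a)
      ≤⟨ +-mono-≤ (+-mono-≤ (+-monoʳ-≤ (40 * N) (≤-reflexive (cong (4 *_) ab-count))) (*-monoʳ-≤ 2 (core r))) (*-monoʳ-≤ 2 (core (s ⊕ r))) ⟩
    40 * N + 4 * (2 * N) + 2 * (5 * N) + 2 * (5 * N) ≡⟨ l₂ N ⟩
    68 * N ∎
    where
    open ≤-Reasoning
    l₁ : ∀ n t a b c p q → 6 * (2 * n + 2 * (n + 2 * t)) + 4 * ((a + a + b) + 2 * (n + p)) + 4 * ((a + a + c) + 2 * (n + q)) ≡
      40 * n + 4 * (a + b + c) + 2 * (6 * t + 4 * p + 3 * a) + 2 * (6 * t + 4 * q + 3 * a)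
    l₁ = solve-∀
    l₂ : ∀ n → 40 * n + 4 * (2 * n) + 2 * (5 * n) + 2 * (5 * n) ≡ 68 * n
    l₂ = solve-∀

  not-bal : Bal σ (λ v → not (s v)) a
  not-bal v = trans (cong not (bs v)) (lem (s v) (a (σ v)))
    where
    lem : ∀ x y → not (x xor y) ≡ (not x xor y)
    lem x y = eqB-≡ (tauto 2 (λ x y → eqB (not (x xor y)) (not x xor y)) refl x y)

  triple : Triple σ mate
  triple = go (one-of-three N len₁ len₂ len₃ average)
    where
    bs° : Bal σ s° a
    bs° = eq-bal {a} {s} P bs
    br° : Bal σ r° b
    br° = eq-bal {b} {r} Q br
    xor-inv : ∀ v → (a ⊕ b) (mate v) ≡ (a ⊕ b) v
    xor-inv v = cong₂ _xor_ (a-inv v) (b-inv v)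
    c-bal : Bal σ c° (a ⊕ b)
    c-bal v = trans (cong₂ (λ x y → not (x xor y)) (bs° v) (br° v)) (lem (s° v) (a (σ v)) (r° v) (b (σ v)))
      where
      lem : ∀ x a y b → not ((x xor a) xor (y xor b)) ≡ (not (x xor y) xor (a xor b))
      lem x a y b = eqB-≡ (tauto 4 (λ x a y b → eqB (not ((x xor a) xor (y xor b))) (not (x xor y) xor (a xor b))) refl x a y b)
    covs : ∀ x y → (x ∨ (y ∨ not (x xor y))) ≡ true
    covs = tauto 2 (λ x y → x ∨ (y ∨ not (x xor y))) refl
    cov3 : ∀ x y z → (x ∨ y) ≡ true → (x ∨ (y ∨ z)) ≡ true
    cov3 true y z p = refl
    cov3 false true z p = refl
    cov2 : ∀ x y → (x ∨ y) ≡ true → (x ∨ (x ∨ y)) ≡ true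
    cov2 true y p = refl
    cov2 false y p = p
    covx : ∀ x y → (x ∨ y) ≡ true → (x ∨ (x ∨ (x xor y))) ≡ true
    covx true y p = refl
    covx false y p = p
    cov-not : ∀ x y → (x ∨ (not x ∨ y)) ≡ true
    cov-not true y = refl
    cov-not false y = refl
    go : (7 * len₁ ≤ 34 * N) ⊎ (7 * len₂ ≤ 34 * N) ⊎ (7 * len₃ ≤ 34 * N) → Triple σ mate
    go (inj₁ le) = record { z₁ = a ; z₂ = b ; z₃ = a ⊕ b ; s₁ = s° ; s₂ = r° ; s₃ = c° ; inv₁ = a-inv ; inv₂ = b-inv ; inv₃ = xor-inv
      ; bal₁ = bs° ; bal₂ = br° ; bal₃ = c-bal ; cov-z = λ v → cov3 (a v) (b v) _ (cov v) ; cov-s = λ v → covs (s° v) (r° v) ; short = le }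
    go (inj₂ (inj₁ le)) = record { z₁ = a ; z₂ = a ; z₃ = b ; s₁ = s ; s₂ = λ v → not (s v) ; s₃ = less r ; inv₁ = a-inv ; inv₂ = a-inv ; inv₃ = b-inv
      ; bal₁ = bs ; bal₂ = not-bal ; bal₃ = eq-bal {b} {r} (λ ρ → proj₁ (side r ρ)) br ; cov-z = λ v → cov2 (a v) (b v) (cov v) ; cov-s = λ v → cov-not (s v) _ ; short = le }
    go (inj₂ (inj₂ le)) = record { z₁ = a ; z₂ = a ; z₃ = a ⊕ b ; s₁ = s ; s₂ = λ v → not (s v) ; s₃ = less (s ⊕ r) ; inv₁ = a-inv ; inv₂ = a-inv ; inv₃ = xor-inv
      ; bal₁ = bs ; bal₂ = not-bal ; bal₃ = eq-bal {a ⊕ b} {s ⊕ r} (λ ρ → proj₁ (side (s ⊕ r) ρ)) (bal-⊕ {σ = σ} {s} {a} {r} {b} bs br) ; cov-z = λ v → covx (a v) (b v) (cov v) ; cov-s = λ v → cov-not (s v) _ ; short = le }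

short-triple : {N : ℕ} {σ σ⁻ mate : Fin N → Fin N} (π : Perm σ σ⁻) (I : Invol mate) → Small.O5M π mate → Triple σ mate
short-triple {mate = mate} π I o5 = Lengths.triple π I o5 (Small.scheme π (# (Small.loose π mate)) I o5 ≤-refl)

-- Perfect matchings of cubic graphs. Darts are Fin N; rot cycles through the three darts at a vertex and rev through the two of an edge.

record CubicMap {N : ℕ} (rev rot : Fin N → Fin N) (alive : S N) : Set where
  field
    I : Invol rev
    -- Reductions only shrink `alive` and change the two maps, so the type of darts stays fixed
    -- throughout the induction.
    a-rev : ∀ v → alive (rev v) ≡ alive v
    a-rot : ∀ {v} → alive v ≡ true → alive (rot v) ≡ true
    rot³ : ∀ {v} → alive v ≡ true → rot (rot (rot v)) ≡ v
    rot≢ : ∀ {v} → alive v ≡ true → rot v ≢ v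
    bridgeless : ∀ Z → (∀ v → alive v ≡ true → Z (rot v) ≡ Z v) → D rev alive Z ≢ 2

-- In `tight`, 6 is a cut of three edges and 2 allows one matching edge. A perfect matching meets
-- such a cut an odd number of times, so the upper bound is the whole content.
record Matching {N : ℕ} (rev rot : Fin N → Fin N) (alive M : S N) : Set where
  field
    M-rev : ∀ {v} → alive v ≡ true → M (rev v) ≡ M v
    one : ∀ {v} → alive v ≡ true → ind (M v) + ind (M (rot v)) + ind (M (rot (rot v))) ≡ 1
    tight : ∀ A → (∀ v → alive v ≡ true → A (rot v) ≡ A v) → D rev alive A ≡ 6 → D rev (λ v → alive v ∧ M v) A ≤ 2

opaque
  three : {N : ℕ} (f : S N) → # f ≡ 3 → Σ (Fin N) λ x → Σ (Fin N) λ y → Σ (Fin N) λ z →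
    (f x ≡ true) × (f y ≡ true) × (f z ≡ true) × (y ≢ x) × (z ≢ x) × (z ≢ y) × (∀ v → f v ≡ true → (v ≡ x) ⊎ (v ≡ y) ⊎ (v ≡ z))
  three {N} f e = go₁ (#-pos⁻ f (≤-trans (s≤s z≤n) (≤-reflexive (sym e))))
    where
    Goal : Set
    Goal = Σ (Fin N) λ x → Σ (Fin N) λ y → Σ (Fin N) λ z →
      (f x ≡ true) × (f y ≡ true) × (f z ≡ true) × (y ≢ x) × (z ≢ x) × (z ≢ y) × (∀ v → f v ≡ true → (v ≡ x) ⊎ (v ≡ y) ⊎ (v ≡ z))
    ∖-in : ∀ {g : S N} {u v} → (g ∖ u) v ≡ true → (g v ≡ true) × (v ≢ u)
    ∖-in {g} {u} {v} p = ∧-fst p , ≢-== (not-t⁻ (∧-snd {g v} p))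
    drop : ∀ {g : S N} {k u} → g u ≡ true → # g ≡ suc k → # (g ∖ u) ≡ k
    drop {g} {k} {u} p q = suc-injective (trans (sym (∖-remove g u p)) q)
    go₁ : Σ (Fin N) (λ x → f x ≡ true) → Goal
    go₁ (x , fx) = go₂ (#-pos⁻ (f ∖ x) (≤-trans (s≤s z≤n) (≤-reflexive (sym e₂))))
      where
      e₂ : # (f ∖ x) ≡ 2
      e₂ = drop {f} fx e
      go₂ : Σ (Fin N) (λ y → (f ∖ x) y ≡ true) → Goal
      go₂ (y , fy) = go₃ (#-pos⁻ (f ∖ x ∖ y) (≤-trans (s≤s z≤n) (≤-reflexive (sym e₃))))
        where
        e₃ : # (f ∖ x ∖ y) ≡ 1
        e₃ = drop {f ∖ x} fy e₂
        go₃ : Σ (Fin N) (λ z → (f ∖ x ∖ y) z ≡ true) → Goal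
        go₃ (z , fz) = x , y , z , fx , proj₁ (∖-in {f} fy) , proj₁ (∖-in {f} (proj₁ (∖-in {f ∖ x} fz))) , proj₂ (∖-in {f} fy) , proj₂ (∖-in {f} (proj₁ (∖-in {f ∖ x} fz))) , proj₂ (∖-in {f ∖ x} fz) , all
          where
          all : ∀ v → f v ≡ true → (v ≡ x) ⊎ (v ≡ y) ⊎ (v ≡ z)
          all v p with v ≟F x
          ... | yes q = inj₁ q
          ... | no n₁ with v ≟F y
          ... | yes q = inj₂ (inj₁ q)
          ... | no n₂ with v ≟F z
          ... | yes q = inj₂ (inj₂ q)
          ... | no n₃ = tf (trans (∖-other (f ∖ x ∖ y) n₃) (trans (∖-other (f ∖ x) n₂) (trans (∖-other f n₁) p))) (#-zero (f ∖ x ∖ y ∖ z) (drop {f ∖ x ∖ y} fz e₃) v)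

D-in : {N : ℕ} {rev : Fin N → Fin N} (I : Invol rev) (w : S N) → (∀ v → w (rev v) ≡ w v) → (Z : S N) →
  D rev w Z ≡ # (λ v → w v ∧ (Z v ∧ not (Z (rev v)))) + # (λ v → w v ∧ (Z v ∧ not (Z (rev v))))
D-in {rev = rev} I w winv Z = trans (D-def rev w Z) (trans (#-split _ Z) (cong₂ _+_ (#-cong (λ v → eqB-≡ (tauto 3 (λ w a b → eqB ((w ∧ (a xor b)) ∧ a) (w ∧ (a ∧ not b))) refl (w v) (Z v) (Z (rev v)))))
  (trans (#-cong (λ v → trans (eqB-≡ (tauto 3 (λ w a b → eqB ((w ∧ (a xor b)) ∧ not a) (w ∧ (b ∧ not a))) refl (w v) (Z v) (Z (rev v)))) (cong₂ (λ x z → x ∧ (Z (rev v) ∧ not (Z z))) (sym (winv v)) (sym (mm I v))))) (#-mate I (λ v → w v ∧ (Z v ∧ not (Z (rev v))))))))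

half-6 : ∀ {k} → 6 ≡ k + k → k ≡ 3
half-6 {k} e = *-cancelˡ-≡ k 3 2 (trans (cong (k +_) (+-identityʳ k)) (sym e))

module Maps {N : ℕ} {rev rot : Fin N → Fin N} {alive : S N} (Cu : CubicMap rev rot alive) where
  open CubicMap Cu

  RInv : S N → Set
  RInv Z = ∀ v → alive v ≡ true → Z (rot v) ≡ Z v

  rinv? : ∀ Z → Dec (RInv Z)
  rinv? Z = all? (λ v → (alive v ≟B true) →-dec (Z (rot v) ≟B Z v))

  rinv-ext : ∀ {Z Z′} → (∀ v → Z v ≡ Z′ v) → RInv Z → RInv Z′
  rinv-ext h i v p = trans (sym (h (rot v))) (trans (i v p) (h v))

  rinv-not : ∀ {Z} → RInv Z → RInv (λ v → not (Z v))
  rinv-not i v p = cong not (i v p)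

  -- Odd sets have cuts that are 2 modulo 4; without bridges the value 2 drops out.
  odd-cut : ∀ Z → RInv Z → Odd I alive Z → 6 ≤ D rev alive Z
  odd-cut Z i o with D-parity I alive Z a-rev
  ... | j , e = go j (trans e (cong (λ b → 4 * j + 2 * ind b) o))
    where
    go : ∀ j → D rev alive Z ≡ 4 * j + 2 → 6 ≤ D rev alive Z
    go zero e = ⊥-elim (bridgeless Z i e)
    go (suc j) e = ≤-trans (+-monoˡ-≤ 2 (*-monoʳ-≤ 4 {1} {suc j} (s≤s z≤n))) (≤-reflexive (sym e))

  cut-odd : ∀ {Z} → D rev alive Z ≡ 6 → Odd I alive Z
  cut-odd {Z} d with D-parity I alive Z a-rev
  ... | j , e = ¬f⇒t (λ q → bad j (trans (sym d) (trans e (cong (λ b → 4 * j + 2 * ind b) q))))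
    where
    bad : ∀ j → 6 ≡ 4 * j + 0 → ⊥
    bad (suc (suc j)) e with trans e (cong (_+ 0) (*-distribˡ-+ 4 2 j))
    ... | ()
    bad zero ()
    bad (suc zero) ()

  rot-inj : ∀ {u v} → alive u ≡ true → alive v ≡ true → rot u ≡ rot v → u ≡ v
  rot-inj p q e = trans (sym (rot³ p)) (trans (cong (rot ∘ rot) e) (rot³ q))

  rot-== : ∀ {u v} → alive u ≡ true → alive v ≡ true → (rot u == rot v) ≡ (u == v)
  rot-== {u} {v} p q with u ≟F v
  ... | yes refl = trans (==-refl (rot u)) (sym (==-refl u))
  ... | no ne = trans (==-false (λ e → ne (rot-inj p q e))) (sym (==-false ne))

  rot²≢ : ∀ {v} → alive v ≡ true → rot (rot v) ≢ v
  rot²≢ p e = rot≢ p (trans (cong rot (sym e)) (rot³ p))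

  vs : Fin N → S N
  vs u v = (v == u) ∨ ((v == rot u) ∨ (v == rot (rot u)))

  vs-case : ∀ {u v} → vs u v ≡ true → (v ≡ u) ⊎ (v ≡ rot u) ⊎ (v ≡ rot (rot u))
  vs-case {u} {v} p with ∨-case {v == u} p
  ... | inj₁ q = inj₁ (==-true q)
  ... | inj₂ q with ∨-case {v == rot u} q
  ... | inj₁ r = inj₂ (inj₁ (==-true r))
  ... | inj₂ r = inj₂ (inj₂ (==-true r))

  vs-0 : ∀ u → vs u u ≡ true
  vs-0 u = ∨-inl (==-refl u)
  vs-1 : ∀ u → vs u (rot u) ≡ true
  vs-1 u = ∨-inr {rot u == u} (∨-inl (==-refl (rot u)))
  vs-2 : ∀ u → vs u (rot (rot u)) ≡ true
  vs-2 u = ∨-inr {rot (rot u) == u} (∨-inr {rot (rot u) == rot u} (==-refl (rot (rot u))))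

  vs-alive : ∀ {u v} → alive u ≡ true → vs u v ≡ true → alive v ≡ true
  vs-alive p q with vs-case q
  ... | inj₁ refl = p
  ... | inj₂ (inj₁ refl) = a-rot p
  ... | inj₂ (inj₂ refl) = a-rot (a-rot p)

  vs-rinv : ∀ {u} → alive u ≡ true → RInv (vs u)
  vs-rinv {u} p v q = trans (cong₂ _∨_ (trans (cong (rot v ==_) (sym (rot³ p))) (rot-== q (a-rot (a-rot p)))) (cong₂ _∨_ (rot-== q p) (rot-== q (a-rot p))))
    (eqB-≡ (tauto 3 (λ a b c → eqB (c ∨ (a ∨ b)) (a ∨ (b ∨ c))) refl (v == u) (v == rot u) (v == rot (rot u))))

  #-at : ∀ u (f : S N) → # (λ v → (v == u) ∧ f v) ≡ ind (f u)
  #-at u f = trans (#-def _) (trans (sum-single u _ (λ v ne → ind-f (∧-false₁ (==-false ne)))) (cong ind (cong (_∧ f u) (==-refl u))))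

  #-vs : ∀ {u} → alive u ≡ true → # (vs u) ≡ 3
  #-vs {u} p = trans (∖-remove (vs u) u (vs-0 u)) (cong suc (trans (∖-remove (vs u ∖ u) (rot u) (trans (∖-other (vs u) (rot≢ p)) (vs-1 u)))
    (cong suc (trans (∖-remove (vs u ∖ u ∖ rot u) (rot (rot u)) (trans (∖-other (vs u ∖ u) (λ e → rot≢ (a-rot p) e)) (trans (∖-other (vs u) (rot²≢ p)) (vs-2 u))))
    (cong suc (#-empty (λ v → ¬t⇒f (λ q → rest v q))))))))
    where
    rest : ∀ v → (vs u ∖ u ∖ rot u ∖ rot (rot u)) v ≡ true → ⊥
    rest v q = go (vs-case (∧-fst q₁))
      where
      q₂ = ∧-fst {(vs u ∖ u ∖ rot u) v} q
      q₁ = ∧-fst {(vs u ∖ u) v} q₂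
      go : (v ≡ u) ⊎ (v ≡ rot u) ⊎ (v ≡ rot (rot u)) → ⊥
      go (inj₁ e) = ≢-== (not-t⁻ (∧-snd {vs u v} q₁)) e
      go (inj₂ (inj₁ e)) = ≢-== (not-t⁻ (∧-snd {(vs u ∖ u) v} q₂)) e
      go (inj₂ (inj₂ e)) = ≢-== (not-t⁻ (∧-snd {(vs u ∖ u ∖ rot u) v} q)) e

  rot-step : ∀ {Z} → RInv Z → ∀ {u v} → alive u ≡ true → vs u v ≡ true → Z v ≡ Z u
  rot-step {Z} i {u} {v} p q with vs-case q
  ... | inj₁ refl = refl
  ... | inj₂ (inj₁ refl) = i u p
  ... | inj₂ (inj₂ refl) = trans (i (rot u) (a-rot p)) (i u p)

record Ends {N : ℕ} (outer : S N) : Set where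
  field
    o₁ o₂ o₃ : Fin N
    out₁ : outer o₁ ≡ true
    out₂ : outer o₂ ≡ true
    out₃ : outer o₃ ≡ true
    n21 : o₂ ≢ o₁
    n31 : o₃ ≢ o₁
    n32 : o₃ ≢ o₂
    out-all : ∀ v → outer v ≡ true → (v ≡ o₁) ⊎ (v ≡ o₂) ⊎ (v ≡ o₃)

ends-of : {N : ℕ} (f : S N) → # f ≡ 3 → Ends f
ends-of f e = let (x , y , z , fx , fy , fz , yx , zx , zy , all) = three f e in
  record { o₁ = x ; o₂ = y ; o₃ = z ; out₁ = fx ; out₂ = fy ; out₃ = fz ; n21 = yx ; n31 = zx ; n32 = zy ; out-all = all }

entering : {N : ℕ} → (Fin N → Fin N) → S N → S N → S N
entering rev alive A v = alive v ∧ (not (A v) ∧ A (rev v))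

entering-ends : {N : ℕ} {rev rot : Fin N → Fin N} {alive : S N} → CubicMap rev rot alive → ∀ A → D rev alive A ≡ 6 → Ends (entering rev alive A)
entering-ends {rev = rev} {alive = alive} Cu A A6 = ends-of _ (half-6 (trans (sym A6) (trans (sym (D-not rev alive A)) (trans (D-in I alive a-rev (λ v → not (A v))) (cong₂ _+_ (#-cong nn) (#-cong nn))))))
  where
  open CubicMap Cu
  nn : ∀ v → (alive v ∧ (not (A v) ∧ not (not (A (rev v))))) ≡ entering rev alive A v
  nn v = eqB-≡ (tauto 3 (λ a b c → eqB (a ∧ (b ∧ not (not c))) (a ∧ (b ∧ c))) refl (alive v) (not (A v)) (A (rev v)))

-- Contraction of the complement of A to a single vertex.
module Side {N : ℕ} {rev rot : Fin N → Fin N} {alive : S N} (Cu : CubicMap rev rot alive)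
  (A : S N) (Ai : ∀ v → alive v ≡ true → A (rot v) ≡ A v) (E : Ends (entering rev alive A)) where
  open CubicMap Cu
  open Maps Cu
  open Ends E

  outer : S N
  outer = entering rev alive A

  out-A : ∀ {v} → outer v ≡ true → A v ≡ false
  out-A {v} p = not-t⁻ (∧-fst (∧-snd {alive v} p))

  alive₁ : S N
  alive₁ v = alive v ∧ (A v ∨ A (rev v))

  cyc rot₁ : Fin N → Fin N
  cyc v = if v == o₁ then o₂ else if v == o₂ then o₃ else o₁
  rot₁ v = if A v then rot v else cyc v

  rot₁-in : ∀ {v} → A v ≡ true → rot₁ v ≡ rot v
  rot₁-in p rewrite p = refl
  rot₁-out : ∀ {v} → A v ≡ false → rot₁ v ≡ cyc v
  rot₁-out p rewrite p = refl

  private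
    cyc₁ : cyc o₁ ≡ o₂
    cyc₁ rewrite ==-refl o₁ = refl
    cyc₂ : cyc o₂ ≡ o₃
    cyc₂ rewrite ==-false n21 | ==-refl o₂ = refl
    cyc₃ : cyc o₃ ≡ o₁
    cyc₃ rewrite ==-false n31 | ==-false n32 = refl

  r₁ : rot₁ o₁ ≡ o₂
  r₁ = trans (rot₁-out (out-A out₁)) cyc₁
  r₂ : rot₁ o₂ ≡ o₃
  r₂ = trans (rot₁-out (out-A out₂)) cyc₂
  r₃ : rot₁ o₃ ≡ o₁
  r₃ = trans (rot₁-out (out-A out₃)) cyc₃

  rot₁-outer : ∀ {v} → outer v ≡ true → A (rot₁ v) ≡ false
  rot₁-outer {v} p = go (out-all v p)
    where
    go : (v ≡ o₁) ⊎ (v ≡ o₂) ⊎ (v ≡ o₃) → A (rot₁ v) ≡ false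
    go (inj₁ e) = trans (cong A (trans (cong rot₁ e) r₁)) (out-A out₂)
    go (inj₂ (inj₁ e)) = trans (cong A (trans (cong rot₁ e) r₂)) (out-A out₃)
    go (inj₂ (inj₂ e)) = trans (cong A (trans (cong rot₁ e) r₃)) (out-A out₁)

  alive-in : ∀ {v} → alive v ≡ true → A v ≡ true → alive₁ v ≡ true
  alive-in p q = ∧-intro p (∨-inl q)
  alive-out : ∀ {v} → outer v ≡ true → alive₁ v ≡ true
  alive-out {v} p = ∧-intro (∧-fst p) (∨-inr {A v} (∧-snd {not (A v)} (∧-snd {alive v} p)))
  out-intro : ∀ {v} → alive₁ v ≡ true → A v ≡ false → outer v ≡ true
  out-intro {v} p q = ∧-intro {alive v} (∧-fst {alive v} p) (∧-intro {not (A v)} (not-t q) (case ∨-case {A v} (∧-snd {alive v} p) of λ { (inj₁ r) → tf r q ; (inj₂ r) → r }))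

  -- Undoes the contraction for vertex sets: the new vertex is expanded to the whole complement of
  -- `A`.
  lift : S N → S N
  lift Z v = if A v then Z v else Z o₁

  lift-in : ∀ Z {v} → A v ≡ true → lift Z v ≡ Z v
  lift-in Z p rewrite p = refl
  lift-out : ∀ Z {v} → A v ≡ false → lift Z v ≡ Z o₁
  lift-out Z p rewrite p = refl

  RInv₁ : S N → Set
  RInv₁ Z = ∀ v → alive₁ v ≡ true → Z (rot₁ v) ≡ Z v

  outer-same : ∀ {Z} → RInv₁ Z → ∀ {v} → outer v ≡ true → Z v ≡ Z o₁
  outer-same {Z} i {v} p = go (out-all v p)
    where
    go : (v ≡ o₁) ⊎ (v ≡ o₂) ⊎ (v ≡ o₃) → Z v ≡ Z o₁
    go (inj₁ e) = cong Z e
    go (inj₂ (inj₁ e)) = trans (cong Z (trans e (sym r₁))) (i o₁ (alive-out out₁))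
    go (inj₂ (inj₂ e)) = trans (cong Z e) (trans (sym (i o₃ (alive-out out₃))) (cong Z r₃))

  lift-rinv : ∀ {Z} → RInv₁ Z → RInv (lift Z)
  lift-rinv {Z} i v p with bool (A v)
  ... | inj₁ q = trans (lift-in Z (trans (Ai v p) q)) (trans (trans (cong Z (sym (rot₁-in q))) (i v (alive-in p q))) (sym (lift-in Z q)))
  ... | inj₂ q = trans (lift-out Z (trans (Ai v p) q)) (sym (lift-out Z q))

  D-lift : ∀ {Z} (w w₁ : S N) → RInv₁ Z → (∀ v → alive₁ v ≡ true → w₁ v ≡ w v) → D rev (λ v → alive₁ v ∧ w₁ v) Z ≡ D rev (λ v → alive v ∧ w v) (lift Z)
  D-lift {Z} w w₁ i h = trans (D-def rev _ Z) (trans (#-cong (λ v → pt v (bool (alive v)) (bool (A v)) (bool (A (rev v))))) (sym (D-def rev _ (lift Z))))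
    where
    pt : ∀ v → (alive v ≡ true) ⊎ (alive v ≡ false) → (A v ≡ true) ⊎ (A v ≡ false) → (A (rev v) ≡ true) ⊎ (A (rev v) ≡ false) →
      ((alive₁ v ∧ w₁ v) ∧ (Z v xor Z (rev v))) ≡ ((alive v ∧ w v) ∧ (lift Z v xor lift Z (rev v)))
    pt v (inj₂ n) _ _ = trans (∧-false₁ (∧-false₁ (∧-false₁ n))) (sym (∧-false₁ (∧-false₁ n)))
    pt v (inj₁ p) (inj₂ q) (inj₂ r) = trans (∧-false₁ (∧-false₁ (∧-false₂ {alive v} (∨-false q r)))) (sym (∧-false₂ {alive v ∧ w v} (xor-f (trans (lift-out Z q) (sym (lift-out Z r))))))
    pt v (inj₁ p) (inj₁ q) r = cong₂ _∧_ (cong₂ _∧_ (trans a₁ (sym p)) (h v a₁)) (cong₂ _xor_ (sym (lift-in Z q)) (far r))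
      where
      a₁ = alive-in p q
      far : (A (rev v) ≡ true) ⊎ (A (rev v) ≡ false) → Z (rev v) ≡ lift Z (rev v)
      far (inj₁ r) = sym (lift-in Z r)
      far (inj₂ r) = trans (outer-same {Z} i (∧-intro (trans (a-rev v) p) (∧-intro (not-t r) (trans (cong A (mm I v)) q)))) (sym (lift-out Z r))
    pt v (inj₁ p) (inj₂ q) (inj₁ r) = cong₂ _∧_ (cong₂ _∧_ (trans a₁ (sym p)) (h v a₁)) (cong₂ _xor_ (trans (outer-same {Z} i o) (sym (lift-out Z q))) (sym (lift-in Z r)))
      where
      o : outer v ≡ true
      o = ∧-intro p (∧-intro (not-t q) r)
      a₁ = alive-out o

  private
    true-∧ : ∀ {rev : Fin N → Fin N} {w : S N} {Z : S N} → D rev w Z ≡ D rev (λ v → w v ∧ true) Z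
    true-∧ {rev} {w} {Z} = trans (D-def rev w Z) (trans (#-cong (λ v → cong (_∧ (Z v xor Z (rev v))) (lem (w v)))) (sym (D-def rev _ Z)))
      where
      lem : ∀ x → x ≡ (x ∧ true)
      lem true = refl
      lem false = refl

  D-side : ∀ {Z} → RInv₁ Z → D rev alive₁ Z ≡ D rev alive (lift Z)
  D-side {Z} i = trans (true-∧ {rev} {alive₁} {Z}) (trans (D-lift {Z} (λ _ → true) (λ _ → true) i (λ _ _ → refl)) (sym (true-∧ {rev} {alive} {lift Z})))

  side : CubicMap rev rot₁ alive₁
  side = record
    { I = I
    ; a-rev = λ v → cong₂ _∧_ (a-rev v) (trans (cong (A (rev v) ∨_) (cong A (mm I v))) (or-comm (A (rev v)) (A v)))
    ; a-rot = λ {v} p → al v p (bool (A v)) ; rot³ = λ {v} p → r³ v p (bool (A v)) ; rot≢ = λ {v} p → r≢ v p (bool (A v))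
    ; bridgeless = λ Z i d → bridgeless (lift Z) (lift-rinv {Z} i) (trans (sym (D-side {Z} i)) d) }
    where
    or-comm : ∀ a b → (a ∨ b) ≡ (b ∨ a)
    or-comm a b = eqB-≡ (tauto 2 (λ a b → eqB (a ∨ b) (b ∨ a)) refl a b)
    al : ∀ v → alive₁ v ≡ true → (A v ≡ true) ⊎ (A v ≡ false) → alive₁ (rot₁ v) ≡ true
    al v p (inj₁ q) = trans (cong alive₁ (rot₁-in q)) (alive-in (a-rot (∧-fst p)) (trans (Ai v (∧-fst p)) q))
    al v p (inj₂ q) = go (out-all v (out-intro p q))
      where
      go : (v ≡ o₁) ⊎ (v ≡ o₂) ⊎ (v ≡ o₃) → alive₁ (rot₁ v) ≡ true
      go (inj₁ e) = trans (cong alive₁ (trans (cong rot₁ e) r₁)) (alive-out out₂)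
      go (inj₂ (inj₁ e)) = trans (cong alive₁ (trans (cong rot₁ e) r₂)) (alive-out out₃)
      go (inj₂ (inj₂ e)) = trans (cong alive₁ (trans (cong rot₁ e) r₃)) (alive-out out₁)
    r³ : ∀ v → alive₁ v ≡ true → (A v ≡ true) ⊎ (A v ≡ false) → rot₁ (rot₁ (rot₁ v)) ≡ v
    r³ v p (inj₁ q) = trans (cong (rot₁ ∘ rot₁) (rot₁-in q)) (trans (cong rot₁ (rot₁-in q₁)) (trans (rot₁-in (trans (Ai (rot v) a₁) q₁)) (rot³ (∧-fst p))))
      where
      a₁ = a-rot (∧-fst p)
      q₁ : A (rot v) ≡ true
      q₁ = trans (Ai v (∧-fst p)) q
    r³ v p (inj₂ q) = go (out-all v (out-intro p q))
      where
      turn : ∀ {x y z} → v ≡ x → rot₁ x ≡ y → rot₁ y ≡ z → rot₁ z ≡ x → rot₁ (rot₁ (rot₁ v)) ≡ v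
      turn e f g h = trans (cong rot₁ (trans (cong rot₁ (trans (cong rot₁ e) f)) g)) (trans h (sym e))
      go : (v ≡ o₁) ⊎ (v ≡ o₂) ⊎ (v ≡ o₃) → rot₁ (rot₁ (rot₁ v)) ≡ v
      go (inj₁ e) = turn e r₁ r₂ r₃
      go (inj₂ (inj₁ e)) = turn e r₂ r₃ r₁
      go (inj₂ (inj₂ e)) = turn e r₃ r₁ r₂
    r≢ : ∀ v → alive₁ v ≡ true → (A v ≡ true) ⊎ (A v ≡ false) → rot₁ v ≢ v
    r≢ v p (inj₁ q) e = rot≢ (∧-fst p) (trans (sym (rot₁-in q)) e)
    r≢ v p (inj₂ q) e = go (out-all v (out-intro p q))
      where
      go : (v ≡ o₁) ⊎ (v ≡ o₂) ⊎ (v ≡ o₃) → ⊥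
      go (inj₁ f) = n21 (trans (trans (sym r₁) (trans (cong rot₁ (sym f)) e)) f)
      go (inj₂ (inj₁ f)) = n32 (trans (trans (sym r₂) (trans (cong rot₁ (sym f)) e)) f)
      go (inj₂ (inj₂ f)) = n31 (sym (trans (trans (sym r₃) (trans (cong rot₁ (sym f)) e)) f))

  side-smaller : ∀ u → alive u ≡ true → A u ≡ false → A (rev u) ≡ false → # alive₁ < # alive
  side-smaller u p q r = #-mono-< (λ v → ∧-fst) u p (∧-false₂ {alive u} (∨-false q r))

  module _ {M : S N} (Mm : Matching rev rot₁ alive₁ M) where
    open Matching Mm

    private
      sum₁ : ind (M o₁) + ind (M o₂) + ind (M o₃) ≡ 1
      sum₁ = trans (sym (cong₂ _+_ (cong (λ y → ind (M o₁) + ind (M y)) r₁) (cong (λ y → ind (M y)) (trans (cong rot₁ r₁) r₂)))) (one (alive-out out₁))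

    outer-matched : Σ (Fin N) λ o → (outer o ≡ true) × (M o ≡ true)
    outer-matched = go (M o₁) (M o₂) (M o₃) refl refl refl sum₁
      where
      go : ∀ x y z → M o₁ ≡ x → M o₂ ≡ y → M o₃ ≡ z → ind x + ind y + ind z ≡ 1 → Σ (Fin N) λ o → (outer o ≡ true) × (M o ≡ true)
      go true y z p q r e = o₁ , out₁ , p
      go false true z p q r e = o₂ , out₂ , q
      go false false true p q r e = o₃ , out₃ , r
      go false false false p q r ()

    private
      two! : ∀ x y z → ind x + ind y + ind z ≡ 1 → ((x ∧ y) ∨ ((x ∧ z) ∨ (y ∧ z))) ≡ false
      two! true true z ()
      two! true false true ()
      two! true false false e = refl
      two! false true true ()
      two! false true false e = refl
      two! false false z e = refl
      none = two! (M o₁) (M o₂) (M o₃) sum₁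
      not12 : M o₁ ≡ true → M o₂ ≡ true → ⊥
      not12 x y = tf (∧-intro x y) (∨-false₁ none)
      not13 : M o₁ ≡ true → M o₃ ≡ true → ⊥
      not13 x y = tf (∧-intro x y) (∨-false₁ (∨-false₂ {M o₁ ∧ M o₂} none))
      not23 : M o₂ ≡ true → M o₃ ≡ true → ⊥
      not23 x y = tf (∧-intro x y) (∨-false₂ {M o₁ ∧ M o₃} (∨-false₂ {M o₁ ∧ M o₂} none))
      sep : ∀ {u v} → (u ≡ o₁) ⊎ (u ≡ o₂) ⊎ (u ≡ o₃) → (v ≡ o₁) ⊎ (v ≡ o₂) ⊎ (v ≡ o₃) → M u ≡ true → M v ≡ true → u ≡ v
      sep (inj₁ refl) (inj₁ refl) x y = refl
      sep (inj₁ refl) (inj₂ (inj₁ refl)) x y = ⊥-elim (not12 x y)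
      sep (inj₁ refl) (inj₂ (inj₂ refl)) x y = ⊥-elim (not13 x y)
      sep (inj₂ (inj₁ refl)) (inj₁ refl) x y = ⊥-elim (not12 y x)
      sep (inj₂ (inj₁ refl)) (inj₂ (inj₁ refl)) x y = refl
      sep (inj₂ (inj₁ refl)) (inj₂ (inj₂ refl)) x y = ⊥-elim (not23 x y)
      sep (inj₂ (inj₂ refl)) (inj₁ refl) x y = ⊥-elim (not13 y x)
      sep (inj₂ (inj₂ refl)) (inj₂ (inj₁ refl)) x y = ⊥-elim (not23 y x)
      sep (inj₂ (inj₂ refl)) (inj₂ (inj₂ refl)) x y = refl

    outer-unique : ∀ {u v} → outer u ≡ true → outer v ≡ true → M u ≡ true → M v ≡ true → u ≡ v
    outer-unique {u} {v} p q = sep (out-all u p) (out-all v q)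

-- Gluing two matchings along a cut of three edges

module Glue {N : ℕ} {rev rot : Fin N → Fin N} {alive : S N} (Cu : CubicMap rev rot alive)
  (A : S N) (Ai : Maps.RInv Cu A) (A6 : D rev alive A ≡ 6)
  (E₁ : Ends (entering rev alive A)) (E₂ : Ends (entering rev alive (λ v → not (A v)))) where
  open CubicMap Cu
  open Maps Cu
  module S₁ = Side Cu A Ai E₁
  module S₂ = Side Cu (λ v → not (A v)) (rinv-not {A} Ai) E₂

  out₁₂ : ∀ {v} → S₁.outer v ≡ true → S₂.outer (rev v) ≡ true
  out₁₂ {v} p = ∧-intro (trans (a-rev v) (∧-fst p)) (∧-intro (not-t (not-f (∧-snd {not (A v)} (∧-snd {alive v} p)))) (trans (cong (λ y → not (A y)) (mm I v)) (∧-fst (∧-snd {alive v} p))))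

  module _ {M₁ M₂ : S N} (m₁ : Matching rev S₁.rot₁ S₁.alive₁ M₁) (m₂ : Matching rev S₂.rot₁ S₂.alive₁ M₂)
    (o : Fin N) (oo : S₁.outer o ≡ true) (M₁o : M₁ o ≡ true) (M₂o : M₂ (rev o) ≡ true) where

    M : S N
    M v = if A v then M₁ v else M₂ v

    private
      M-in : ∀ {v} → A v ≡ true → M v ≡ M₁ v
      M-in p rewrite p = refl
      M-out : ∀ {v} → A v ≡ false → M v ≡ M₂ v
      M-out p rewrite p = refl

      alive-both : ∀ {v} → S₁.outer v ≡ true → S₂.alive₁ v ≡ true
      alive-both {v} p = ∧-intro {alive v} (∧-fst {alive v} p) (∨-inl {not (A v)} (∧-fst {not (A v)} (∧-snd {alive v} p)))

      agree-outer : ∀ {v} → S₁.outer v ≡ true → M₁ v ≡ M₂ v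
      agree-outer {v} p = trans (iff (λ x → trans (cong (M₂ ∘ rev) (S₁.outer-unique m₁ p oo x M₁o)) M₂o)
          (λ x → trans (cong M₁ (trans (sym (mm I v)) (trans (cong rev (S₂.outer-unique m₂ (out₁₂ p) (out₁₂ oo) x M₂o)) (mm I o)))) M₁o))
        (Matching.M-rev m₂ (alive-both p))

      agree₁ : ∀ v → S₁.alive₁ v ≡ true → M₁ v ≡ M v
      agree₁ v p with bool (A v)
      ... | inj₁ q = sym (M-in q)
      ... | inj₂ q = trans (agree-outer (S₁.out-intro p q)) (sym (M-out q))

      agree₂ : ∀ v → S₂.alive₁ v ≡ true → M₂ v ≡ M v
      agree₂ v p with bool (A v)
      ... | inj₂ q = sym (M-out q)
      ... | inj₁ q = trans (sym (Matching.M-rev m₂ p)) (trans (sym (agree-outer out)) (trans (Matching.M-rev m₁ (S₁.alive-in (∧-fst p) q)) (sym (M-in q))))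
        where
        out : S₁.outer (rev v) ≡ true
        out = ∧-intro (trans (a-rev v) (∧-fst p)) (∧-intro (lem (A v) (A (rev v)) (∧-snd {alive v} p) q) (trans (cong A (mm I v)) q))
          where
          lem : ∀ a b → (not a ∨ not b) ≡ true → a ≡ true → not b ≡ true
          lem true b p refl = p

      M-rev′ : ∀ {v} → alive v ≡ true → M (rev v) ≡ M v
      M-rev′ {v} p with bool (A v)
      ... | inj₁ q = trans (sym (agree₁ (rev v) (trans (CubicMap.a-rev S₁.side v) a))) (trans (Matching.M-rev m₁ a) (agree₁ v a))
        where a = S₁.alive-in p q
      ... | inj₂ q = trans (sym (agree₂ (rev v) (trans (CubicMap.a-rev S₂.side v) a))) (trans (Matching.M-rev m₂ a) (agree₂ v a))
        where a = S₂.alive-in p (not-t q)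

      one′ : ∀ {v} → alive v ≡ true → ind (M v) + ind (M (rot v)) + ind (M (rot (rot v))) ≡ 1
      one′ {v} p with bool (A v)
      ... | inj₁ q = trans (cong₂ _+_ (cong₂ (λ x y → ind x + ind y) (M-in q) (trans (M-in q₁) (cong M₁ e₁))) (cong ind (trans (M-in q₂) (cong M₁ e₂)))) (Matching.one m₁ (S₁.alive-in p q))
        where
        q₁ : A (rot v) ≡ true
        q₁ = trans (Ai v p) q
        q₂ : A (rot (rot v)) ≡ true
        q₂ = trans (Ai (rot v) (a-rot p)) q₁
        e₁ : rot v ≡ S₁.rot₁ v
        e₁ = sym (S₁.rot₁-in q)
        e₂ : rot (rot v) ≡ S₁.rot₁ (S₁.rot₁ v)
        e₂ = trans (sym (S₁.rot₁-in q₁)) (cong S₁.rot₁ e₁)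
      ... | inj₂ q = trans (cong₂ _+_ (cong₂ (λ x y → ind x + ind y) (M-out q) (trans (M-out q₁) (cong M₂ e₁))) (cong ind (trans (M-out q₂) (cong M₂ e₂)))) (Matching.one m₂ (S₂.alive-in p (not-t q)))
        where
        q₁ : A (rot v) ≡ false
        q₁ = trans (Ai v p) q
        q₂ : A (rot (rot v)) ≡ false
        q₂ = trans (Ai (rot v) (a-rot p)) q₁
        e₁ : rot v ≡ S₂.rot₁ v
        e₁ = sym (S₂.rot₁-in (not-t q))
        e₂ : rot (rot v) ≡ S₂.rot₁ (S₂.rot₁ v)
        e₂ = trans (sym (S₂.rot₁-in (not-t q₁))) (cong S₂.rot₁ e₁)

      w : S N
      w v = alive v ∧ M v

      winv : ∀ v → w (rev v) ≡ w v
      winv v with bool (alive v)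
      ... | inj₁ p = cong₂ _∧_ (a-rev v) (M-rev′ p)
      ... | inj₂ p = trans (∧-false₁ (trans (a-rev v) p)) (sym (∧-false₁ p))

      meet-A : 2 ≤ D rev w A
      meet-A = ≤-trans (+-mono-≤ one≤ one≤) (≤-reflexive (sym (D-in I w winv A)))
        where
        i : Fin N
        i = rev o
        Ai′ : A i ≡ true
        Ai′ = ∧-snd {not (A o)} (∧-snd {alive o} oo)
        one≤ : 1 ≤ # (λ v → w v ∧ (A v ∧ not (A (rev v))))
        one≤ = #-pos _ i (∧-intro (∧-intro (trans (a-rev o) (∧-fst oo)) (trans (M-in Ai′) (trans (Matching.M-rev m₁ (S₁.alive-out oo)) M₁o)))
          (∧-intro Ai′ (trans (cong (λ y → not (A y)) (mm I o)) (∧-fst (∧-snd {alive o} oo)))))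

      -- Intersection and union are odd, so their cuts have at least three edges; as there are six
      -- in total, both have exactly three and no edge joins the two differences. Hence the matching
      -- edges in the cuts add up as well. The intersection lives in one contraction and the union
      -- in the other, so each is met at most once, while `A` is met; this leaves at most one edge
      -- for `B`.
      uncross : ∀ B → RInv B → D rev alive B ≡ 6 → Odd I alive (λ v → A v ∧ B v) → D rev w B ≤ 2
      uncross B Bi B6 odd = +-cancelˡ-≤ 2 (D rev w B) 2 (begin
        2 + D rev w B ≤⟨ +-monoˡ-≤ (D rev w B) meet-A ⟩
        D rev w A + D rev w B ≡⟨ D-uncross rev w A B ⟩
        (D rev w X + D rev w Y) + (# (diag rev w A B) + # (diag rev w A B)) ≡⟨ cong (λ z → (D rev w X + D rev w Y) + (z + z)) (n≤0⇒n≡0 (≤-trans (#-mono {f = diag rev w A B} {diag rev alive A B} (λ v p → ∧-intro (∧-fst {alive v} (∧-fst {w v} p)) (∧-snd {w v} p))) (≤-reflexive (proj₂ (proj₂ exact))))) ⟩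
        (D rev w X + D rev w Y) + 0 ≤⟨ +-monoˡ-≤ 0 (+-mono-≤ wX wY) ⟩
        4 ∎)
        where
        open ≤-Reasoning
        X Y : S N
        X v = A v ∧ B v
        Y v = A v ∨ B v
        Xi : RInv X
        Xi v p = cong₂ _∧_ (Ai v p) (Bi v p)
        Yi : RInv Y
        Yi v p = cong₂ _∨_ (Ai v p) (Bi v p)
        exact : (D rev alive X ≡ 6) × (D rev alive Y ≡ 6) × (# (diag rev alive A B) ≡ 0)
        exact = squeeze (odd-cut X Xi odd) (odd-cut Y Yi (odd-∪ I alive A B (cut-odd A6) (cut-odd B6) odd)) (trans (sym (D-uncross rev alive A B)) (cong₂ _+_ A6 B6))
          where
          squeeze : ∀ {x y d} → 6 ≤ x → 6 ≤ y → (x + y) + (d + d) ≡ 12 → (x ≡ 6) × (y ≡ 6) × (d ≡ 0)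
          squeeze {x} {y} {d} p q e = ≤-antisym (+-cancelʳ-≤ 6 x 6 (≤-trans (+-monoʳ-≤ x q) sum≤)) p , ≤-antisym (+-cancelˡ-≤ 6 y 6 (≤-trans (+-monoˡ-≤ y p) sum≤)) q ,
              n≤0⇒n≡0 (≤-trans (m≤m+n d d) (+-cancelˡ-≤ 12 (d + d) 0 (≤-trans (+-monoˡ-≤ (d + d) (+-mono-≤ p q)) (≤-reflexive e))))
            where
            sum≤ : x + y ≤ 12
            sum≤ = ≤-trans (m≤m+n (x + y) (d + d)) (≤-reflexive e)
        X₁ : S₁.RInv₁ X
        X₁ v p with bool (A v)
        ... | inj₁ q = trans (cong X (S₁.rot₁-in q)) (Xi v (∧-fst p))
        ... | inj₂ q = trans (∧-false₁ (S₁.rot₁-outer (S₁.out-intro p q))) (sym (∧-false₁ q))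
        lX : ∀ v → S₁.lift X v ≡ X v
        lX v with bool (A v)
        ... | inj₁ q = S₁.lift-in X q
        ... | inj₂ q = trans (S₁.lift-out X q) (trans (∧-false₁ (S₁.out-A (Ends.out₁ E₁))) (sym (∧-false₁ q)))
        wX : D rev w X ≤ 2
        wX = subst (_≤ 2) (trans (S₁.D-lift {X} M M₁ X₁ agree₁) (D-cong rev w lX)) (Matching.tight m₁ X X₁ (trans (S₁.D-side {X} X₁) (trans (D-cong rev alive lX) (proj₁ exact))))
        Y₂ : S₂.RInv₁ Y
        Y₂ v p with bool (A v)
        ... | inj₂ q = trans (cong Y (S₂.rot₁-in (not-t q))) (Yi v (∧-fst p))
        ... | inj₁ q = trans (∨-inl (not-f⁻ (S₂.rot₁-outer (S₂.out-intro p (not-f q))))) (sym (∨-inl q))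
        lY : ∀ v → S₂.lift Y v ≡ Y v
        lY v with bool (A v)
        ... | inj₂ q = S₂.lift-in Y (not-t q)
        ... | inj₁ q = trans (S₂.lift-out Y (not-f q)) (trans (∨-inl (not-f⁻ (S₂.out-A (Ends.out₁ E₂)))) (sym (∨-inl q)))
        wY : D rev w Y ≤ 2
        wY = subst (_≤ 2) (trans (S₂.D-lift {Y} M M₂ Y₂ agree₂) (D-cong rev w lY)) (Matching.tight m₂ Y Y₂ (trans (S₂.D-side {Y} Y₂) (trans (D-cong rev alive lY) (proj₁ (proj₂ exact)))))

    glued : Matching rev rot alive M
    glued = record { M-rev = M-rev′ ; one = one′ ; tight = tight′ }
      where
      tight′ : ∀ B → RInv B → D rev alive B ≡ 6 → D rev w B ≤ 2
      tight′ B Bi B6 with odd-∩ I alive A B (cut-odd A6)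
      ... | inj₁ odd = uncross B Bi B6 odd
      ... | inj₂ odd = subst (_≤ 2) (D-not rev w B) (uncross (λ v → not (B v)) (rinv-not {B} Bi) (trans (D-not rev alive B) B6) odd)

    glued-in : ∀ {e} → alive e ≡ true → A e ≡ true → M₁ e ≡ true → M e ≡ true
    glued-in p q r = trans (M-in q) r

-- Maps whose cuts of three edges surround single vertices

module Trivial {N : ℕ} {rev rot : Fin N → Fin N} {alive : S N} (Cu : CubicMap rev rot alive) where
  open CubicMap Cu
  open Maps Cu

  Nontrivial : S N → Set
  Nontrivial A = RInv A × (D rev alive A ≡ 6) × (Σ (Fin N) λ u → (alive u ≡ true) × (A u ≡ true) × (A (rev u) ≡ true)) × (Σ (Fin N) λ u → (alive u ≡ true) × (A u ≡ false) × (A (rev u) ≡ false))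

  nontrivial? : Dec (Σ (S N) Nontrivial)
  nontrivial? = search
    (λ h (i , d , (u , a , p , q) , (v , b , r , s)) → rinv-ext h i , trans (sym (D-cong rev alive h)) d , (u , a , trans (sym (h u)) p , trans (sym (h (rev u))) q) , (v , b , trans (sym (h v)) r , trans (sym (h (rev v))) s))
    (λ A → rinv? A ×-dec ((_ ≟ℕ _) ×-dec (any? (λ u → (alive u ≟B true) ×-dec ((A u ≟B true) ×-dec (A (rev u) ≟B true))) ×-dec any? (λ u → (alive u ≟B true) ×-dec ((A u ≟B false) ×-dec (A (rev u) ≟B false))))))

  module _ {M : S N} (M-rev : ∀ {v} → alive v ≡ true → M (rev v) ≡ M v) (one : ∀ {v} → alive v ≡ true → ind (M v) + ind (M (rot v)) + ind (M (rot (rot v))) ≡ 1) where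

    -- Without an inner edge all darts of `A` cross the cut. So there are three of them, which form
    -- a single vertex, and exactly one is matched.
    star : ∀ A → RInv A → D rev alive A ≡ 6 → (∀ u → alive u ≡ true → A u ≡ true → A (rev u) ≡ false) → D rev (λ v → alive v ∧ M v) A ≤ 2
    star A Ai A6 none = ≤-trans (≤-reflexive (D-in I w winv A)) (+-mono-≤ le le)
      where
      w : S N
      w v = alive v ∧ M v
      winv : ∀ v → w (rev v) ≡ w v
      winv v with bool (alive v)
      ... | inj₁ p = cong₂ _∧_ (a-rev v) (M-rev p)
      ... | inj₂ p = trans (∧-false₁ (trans (a-rev v) p)) (sym (∧-false₁ p))
      AA : S N
      AA v = alive v ∧ A v
      #AA : # AA ≡ 3
      #AA = half-6 (trans (sym A6) (trans (D-in I alive a-rev A) (cong₂ _+_ (#-cong same) (#-cong same))))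
        where
        same : ∀ v → (alive v ∧ (A v ∧ not (A (rev v)))) ≡ AA v
        same v = iff (λ p → ∧-intro {alive v} (∧-fst {alive v} p) (∧-fst {A v} (∧-snd {alive v} p))) (λ p → ∧-intro {alive v} (∧-fst {alive v} p) (∧-intro {A v} (∧-snd {alive v} p) (not-t (none v (∧-fst p) (∧-snd {alive v} p)))))
      point : Σ (Fin N) λ u → AA u ≡ true
      point = #-pos⁻ AA (≤-trans (s≤s z≤n) (≤-reflexive (sym #AA)))
      u : Fin N
      u = proj₁ point
      au : alive u ≡ true
      au = ∧-fst (proj₂ point)
      inside : ∀ v → AA v ≡ true → vs u v ≡ true
      inside = #-full {f = vs u} {AA} (λ v p → ∧-intro (vs-alive au p) (trans (rot-step {A} Ai au p) (∧-snd {alive u} (proj₂ point)))) (≤-reflexive (trans #AA (sym (#-vs au))))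
      le : # (λ v → w v ∧ (A v ∧ not (A (rev v)))) ≤ 1
      le = begin
        # (λ v → w v ∧ (A v ∧ not (A (rev v)))) ≤⟨ #-mono {g = λ v → (((v == u) ∧ M v) ∨ ((v == rot u) ∧ M v)) ∨ ((v == rot (rot u)) ∧ M v)} (λ v p → lem (v == u) (v == rot u) (v == rot (rot u)) (M v)
             (inside v (∧-intro (∧-fst {alive v} (∧-fst {w v} p)) (∧-fst {A v} (∧-snd {w v} p)))) (∧-snd {alive v} (∧-fst {w v} p))) ⟩
        # (λ v → (((v == u) ∧ M v) ∨ ((v == rot u) ∧ M v)) ∨ ((v == rot (rot u)) ∧ M v)) ≤⟨ ≤-trans (#-∨ _ _) (+-monoˡ-≤ _ (#-∨ _ _)) ⟩
        # (λ v → (v == u) ∧ M v) + # (λ v → (v == rot u) ∧ M v) + # (λ v → (v == rot (rot u)) ∧ M v) ≡⟨ cong₂ _+_ (cong₂ _+_ (#-at u M) (#-at (rot u) M)) (#-at (rot (rot u)) M) ⟩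
        ind (M u) + ind (M (rot u)) + ind (M (rot (rot u))) ≡⟨ one au ⟩
        1 ∎
        where
        open ≤-Reasoning
        lem : ∀ a b c m → (a ∨ (b ∨ c)) ≡ true → m ≡ true → (((a ∧ m) ∨ (b ∧ m)) ∨ (c ∧ m)) ≡ true
        lem true b c .true p refl = refl
        lem false true c .true p refl = refl
        lem false false true .true p refl = refl

    trivial-tight : ¬ Σ (S N) Nontrivial → Matching rev rot alive M
    trivial-tight no-cut = record { M-rev = M-rev ; one = one ; tight = tight′ }
      where
      tight′ : ∀ A → RInv A → D rev alive A ≡ 6 → D rev (λ v → alive v ∧ M v) A ≤ 2
      tight′ A Ai A6 = go (any? (λ u → (alive u ≟B true) ×-dec ((A u ≟B true) ×-dec (A (rev u) ≟B true))))
        where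
        go : Dec (Σ (Fin N) λ u → (alive u ≡ true) × (A u ≡ true) × (A (rev u) ≡ true)) → D rev (λ v → alive v ∧ M v) A ≤ 2
        go (no n₁) = star A Ai A6 (λ u p q → ¬t⇒f (λ r → n₁ (u , p , q , r)))
        go (yes x) = subst (_≤ 2) (D-not rev _ A) (star (λ v → not (A v)) (rinv-not {A} Ai) (trans (D-not rev alive A) A6)
          (λ u p q → ¬t⇒f (λ r → no-cut (A , Ai , A6 , x , u , p , not-t⁻ q , not-t⁻ r))))

-- Frink reduction: the ends of an edge h are removed and the four remaining half-edges are joined in pairs.

par-disjoint : {N : ℕ} (w A B : S N) → (∀ v → A v ≡ true → B v ≡ false) → par (# (λ v → w v ∧ (A v ∨ B v))) ≡ (par (# (λ v → w v ∧ A v)) xor par (# (λ v → w v ∧ B v)))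
par-disjoint w A B dis = trans (cong par (#-cong (λ v → lem (w v) (A v) (B v) (dis v)))) (par-xor (λ v → w v ∧ A v) (λ v → w v ∧ B v))
  where
  lem : ∀ w a b → (a ≡ true → b ≡ false) → (w ∧ (a ∨ b)) ≡ ((w ∧ a) xor (w ∧ b))
  lem true true b h rewrite h refl = refl
  lem true false b h = refl
  lem false a b h = refl

module Loops {N : ℕ} {rev rot : Fin N → Fin N} {alive : S N} (Cu : CubicMap rev rot alive) where
  open CubicMap Cu
  open Maps Cu

  -- An odd set left by at most one edge would have a bridge as its cut.
  few : ∀ Z → RInv Z → Odd I alive Z → # (λ v → alive v ∧ (Z v ∧ not (Z (rev v)))) ≤ 1 → ⊥
  few Z i o le = <⇒≱ {2} {6} (s≤s (s≤s (s≤s z≤n))) (≤-trans (odd-cut Z i o) (≤-trans (≤-reflexive (D-in I alive a-rev Z)) (+-mono-≤ le le)))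

  vs-odd : ∀ {u} → alive u ≡ true → Odd I alive (vs u)
  vs-odd {u} p = trans (cong par (trans (#-cong (λ v → iff (∧-snd {alive v}) (λ q → ∧-intro (vs-alive p q) q))) (#-vs p))) refl

  -- The vertex of a loop is left only by its third edge, which would be a bridge.
  no-loop : ∀ {v} → alive v ≡ true → vs v (rev v) ≡ false
  no-loop {v} p = ¬t⇒f (λ q → few (vs v) (vs-rinv p) (vs-odd p) (≤-trans (#-mono {g = vs v ∖ v ∖ rev v} (sub q)) (≤-reflexive (count q))))
    where
    sub : vs v (rev v) ≡ true → ∀ x → (alive x ∧ (vs v x ∧ not (vs v (rev x)))) ≡ true → (vs v ∖ v ∖ rev v) x ≡ true
    sub q x r = trans (∖-other (vs v ∖ v) (λ { refl → tf (trans (cong (vs v) (mm I v)) (vs-0 v)) nr })) (trans (∖-other (vs v) (λ { refl → tf q nr })) (∧-fst (∧-snd {alive x} r)))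
      where
      nr : vs v (rev x) ≡ false
      nr = not-t⁻ (∧-snd {vs v x} (∧-snd {alive x} r))
    count : vs v (rev v) ≡ true → # (vs v ∖ v ∖ rev v) ≡ 1
    count q = suc-injective (suc-injective (trans (sym (trans (∖-remove (vs v) v (vs-0 v)) (cong suc (∖-remove (vs v ∖ v) (rev v) (trans (∖-other (vs v) (mf I v)) q))))) (#-vs p)))

  vs-eq : ∀ {u v} → alive u ≡ true → vs u v ≡ true → ∀ t → vs v t ≡ vs u t
  vs-eq {u} {v} p q t = go (vs-case q)
    where
    go : (v ≡ u) ⊎ (v ≡ rot u) ⊎ (v ≡ rot (rot u)) → vs v t ≡ vs u t
    go (inj₁ e) = cong (λ y → vs y t) e
    go (inj₂ (inj₁ e)) = trans (cong (λ y → vs y t) e) (trans (cong (λ y → (t == rot u) ∨ ((t == rot (rot u)) ∨ (t == y))) (rot³ p))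
      (eqB-≡ (tauto 3 (λ a b c → eqB (b ∨ (c ∨ a)) (a ∨ (b ∨ c))) refl (t == u) (t == rot u) (t == rot (rot u)))))
    go (inj₂ (inj₂ e)) = trans (cong (λ y → vs y t) e) (trans (cong (λ y → (t == rot (rot u)) ∨ ((t == y) ∨ (t == rot y))) (rot³ p))
      (eqB-≡ (tauto 3 (λ a b c → eqB (c ∨ (a ∨ b)) (a ∨ (b ∨ c))) refl (t == u) (t == rot u) (t == rot (rot u)))))

  vs-disjoint : ∀ {u v} → alive u ≡ true → alive v ≡ true → vs u v ≡ false → ∀ t → vs u t ≡ true → vs v t ≡ false
  vs-disjoint {u} {v} p q n t r = ¬t⇒f (λ s → tf r (trans (rot-step {vs u} (vs-rinv p) q s) n))

  one-rot : ∀ {M : S N} {u v} → alive u ≡ true → vs u v ≡ true → ind (M u) + ind (M (rot u)) + ind (M (rot (rot u))) ≡ 1 → ind (M v) + ind (M (rot v)) + ind (M (rot (rot v))) ≡ 1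
  one-rot {M} {u} {v} p q e = go (vs-case q)
    where
    l₁ : ∀ a b c → b + c + a ≡ a + b + c
    l₁ = solve-∀
    l₂ : ∀ a b c → c + a + b ≡ a + b + c
    l₂ = solve-∀
    go : (v ≡ u) ⊎ (v ≡ rot u) ⊎ (v ≡ rot (rot u)) → ind (M v) + ind (M (rot v)) + ind (M (rot (rot v))) ≡ 1
    go (inj₁ f) = trans (cong (λ y → ind (M y) + ind (M (rot y)) + ind (M (rot (rot y)))) f) e
    go (inj₂ (inj₁ f)) = trans (cong (λ y → ind (M y) + ind (M (rot y)) + ind (M (rot (rot y)))) f) (trans (cong (λ y → ind (M (rot u)) + ind (M (rot (rot u))) + ind (M y)) (rot³ p)) (trans (l₁ (ind (M u)) _ _) e))
    go (inj₂ (inj₂ f)) = trans (cong (λ y → ind (M y) + ind (M (rot y)) + ind (M (rot (rot y)))) f) (trans (cong (λ y → ind (M (rot (rot u))) + ind (M y) + ind (M (rot y))) (rot³ p)) (trans (l₂ (ind (M u)) (ind (M (rot u))) _) e))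

  only-one : ∀ {M : S N} {u v} → alive u ≡ true → ind (M u) + ind (M (rot u)) + ind (M (rot (rot u))) ≡ 1 → M u ≡ true → vs u v ≡ true → v ≢ u → M v ≡ false
  only-one {M} {u} {v} p e m q ne = go (vs-case q)
    where
    lem : ∀ a b c → ind a + ind b + ind c ≡ 1 → a ≡ true → (b ≡ false) × (c ≡ false)
    lem true false false e refl = refl , refl
    go : (v ≡ u) ⊎ (v ≡ rot u) ⊎ (v ≡ rot (rot u)) → M v ≡ false
    go (inj₁ f) = ⊥-elim (ne f)
    go (inj₂ (inj₁ f)) = trans (cong M f) (proj₁ (lem (M u) _ _ e m))
    go (inj₂ (inj₂ f)) = trans (cong M f) (proj₂ (lem (M u) _ _ e m))

-- Removal of a set O of vertices that is closed under a new pairing of the darts.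
module Remove {N : ℕ} {rev rot : Fin N → Fin N} {alive : S N} (Cu : CubicMap rev rot alive) (O : S N) (Oi : Maps.RInv Cu O)
  {rev′ : Fin N → Fin N} (I′ : Invol rev′) (a-rev′ : ∀ v → alive (rev′ v) ≡ alive v) (O-rev′ : ∀ v → O (rev′ v) ≡ O v)
  (bl : ∀ W → Maps.RInv Cu W → (∀ v → O v ≡ true → W v ≡ false) → D rev′ alive W ≢ 2) where
  open CubicMap Cu
  open Maps Cu

  alive′ : S N
  alive′ v = alive v ∧ not (O v)

  remove : CubicMap rev′ rot alive′
  remove = record { I = I′ ; a-rev = λ v → cong₂ (λ x y → x ∧ not y) (a-rev′ v) (O-rev′ v)
    ; a-rot = λ {v} p → ∧-intro (a-rot (∧-fst p)) (trans (cong not (Oi v (∧-fst p))) (∧-snd {alive v} p)) ; rot³ = λ p → rot³ (∧-fst p) ; rot≢ = λ p → rot≢ (∧-fst p)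
    ; bridgeless = λ Z i d → bl (W Z) (Wi Z i) (λ v p → ∧-false₂ {Z v} (not-f p)) (trans (sym (same Z)) d) }
    where
    W : S N → S N
    W Z v = Z v ∧ not (O v)
    Wi : ∀ Z → (∀ v → alive′ v ≡ true → Z (rot v) ≡ Z v) → RInv (W Z)
    Wi Z i v p = go (bool (O v))
      where
      go : (O v ≡ true) ⊎ (O v ≡ false) → W Z (rot v) ≡ W Z v
      go (inj₁ q) = trans (∧-false₂ {Z (rot v)} (not-f (trans (Oi v p) q))) (sym (∧-false₂ {Z v} (not-f q)))
      go (inj₂ q) = cong₂ _∧_ (i v (∧-intro p (not-t q))) (cong not (Oi v p))
    same : ∀ Z → D rev′ alive′ Z ≡ D rev′ alive (W Z)
    same Z = trans (D-def rev′ alive′ Z) (trans (#-cong (λ v → lem (alive v) (O v) (O (rev′ v)) (Z v) (Z (rev′ v)) (O-rev′ v))) (sym (D-def rev′ alive (W Z))))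
      where
      lem : ∀ a o o′ z z′ → o′ ≡ o → ((a ∧ not o) ∧ (z xor z′)) ≡ (a ∧ ((z ∧ not o) xor (z′ ∧ not o′)))
      lem a o o′ z z′ refl = eqB-≡ (tauto 4 (λ a o z z′ → eqB ((a ∧ not o) ∧ (z xor z′)) (a ∧ ((z ∧ not o) xor (z′ ∧ not o)))) refl a o z z′)

  smaller : ∀ u → alive u ≡ true → O u ≡ true → # alive′ < # alive
  smaller u p q = #-mono-< (λ v → ∧-fst) u p (∧-false₂ {alive u} (not-f q))

PreMatching : {N : ℕ} (rev rot : Fin N → Fin N) (alive M : S N) → Set
PreMatching rev rot alive M = (∀ {v} → alive v ≡ true → M (rev v) ≡ M v) × (∀ {v} → alive v ≡ true → ind (M v) + ind (M (rot v)) + ind (M (rot (rot v))) ≡ 1)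

module Theta {N : ℕ} {rev rot : Fin N → Fin N} {alive : S N} (Cu : CubicMap rev rot alive) (e : Fin N) (ae : alive e ≡ true)
  (t₁ : Maps.vs Cu (rev e) (rev (rot e)) ≡ true) (t₂ : Maps.vs Cu (rev e) (rev (rot (rot e))) ≡ true) where
  open CubicMap Cu
  open Maps Cu
  open Loops Cu

  private
    e′ : Fin N
    e′ = rev e
    ae′ : alive e′ ≡ true
    ae′ = trans (a-rev e) ae

  O : S N
  O v = vs e v ∨ vs e′ v

  Oi : RInv O
  Oi v p = cong₂ _∨_ (vs-rinv ae v p) (vs-rinv ae′ v p)

  private
    to : ∀ t → vs e t ≡ true → vs e′ (rev t) ≡ true
    to t q = go (vs-case q)
      where
      go : (t ≡ e) ⊎ (t ≡ rot e) ⊎ (t ≡ rot (rot e)) → vs e′ (rev t) ≡ true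
      go (inj₁ f) = trans (cong (vs e′ ∘ rev) f) (vs-0 e′)
      go (inj₂ (inj₁ f)) = trans (cong (vs e′ ∘ rev) f) t₁
      go (inj₂ (inj₂ f)) = trans (cong (vs e′ ∘ rev) f) t₂
    from : ∀ t → vs e′ t ≡ true → vs e (rev t) ≡ true
    from = #-full {f = λ t → vs e (rev t)} {vs e′} (λ t q → trans (cong (vs e′) (sym (mm I t))) (to (rev t) q))
      (≤-reflexive (trans (#-vs ae′) (sym (trans (#-mate I (vs e)) (#-vs ae)))))
    O-in : ∀ v → O v ≡ true → O (rev v) ≡ true
    O-in v p = case ∨-case {vs e v} p of λ { (inj₁ q) → ∨-inr {vs e (rev v)} (to v q) ; (inj₂ q) → ∨-inl (from v q) }

  O-rev : ∀ v → O (rev v) ≡ O v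
  O-rev v = iff (λ p → trans (cong O (sym (mm I v))) (O-in (rev v) p)) (O-in v)

  open Remove Cu O Oi I a-rev O-rev (λ W i _ → bridgeless W i) public

  -- All three edges at the vertex of `e` lead to the other end of `e`. These two vertices form a
  -- component, on which the edge `e` alone is a perfect matching.
  theta : ∀ {M′} → PreMatching rev rot alive′ M′ → Σ (S N) λ M → PreMatching rev rot alive M × (M e ≡ true)
  theta {M′} (r′ , o′) = M , ((λ {v} p → r v p (bool (O v))) , (λ {v} p → o v p (bool (O v)))) , trans (M-in (∨-inl (vs-0 e))) (∨-inl (==-refl e))
    where
    M : S N
    M v = if O v then (v == e) ∨ (v == e′) else M′ v
    M-in : ∀ {v} → O v ≡ true → M v ≡ ((v == e) ∨ (v == e′))
    M-in p rewrite p = refl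
    M-out : ∀ {v} → O v ≡ false → M v ≡ M′ v
    M-out p rewrite p = refl
    sw : ∀ u v → (rev v == u) ≡ (v == rev u)
    sw u v = iff (λ p → subst (λ y → (y == rev u) ≡ true) (trans (cong rev (sym (==-true p))) (mm I v)) (==-refl (rev u))) (λ p → subst (λ y → (y == u) ≡ true) (trans (sym (mm I u)) (cong rev (sym (==-true p)))) (==-refl u))
    r : ∀ v → alive v ≡ true → (O v ≡ true) ⊎ (O v ≡ false) → M (rev v) ≡ M v
    r v p (inj₁ q) = trans (M-in (O-in v q)) (trans (cong₂ _∨_ (sw e v) (trans (sw e′ v) (cong (v ==_) (mm I e)))) (trans (eqB-≡ (tauto 2 (λ a b → eqB (a ∨ b) (b ∨ a)) refl (v == e′) (v == e))) (sym (M-in q))))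
    r v p (inj₂ q) = trans (M-out (trans (O-rev v) q)) (trans (r′ (∧-intro p (not-t q))) (sym (M-out q)))
    nl : vs e e′ ≡ false
    nl = no-loop ae
    nl′ : vs e′ e ≡ false
    nl′ = trans (cong (vs e′) (sym (mm I e))) (no-loop ae′)
    ne : ∀ {u v} → vs u v ≡ true → ∀ {w} → vs u w ≡ false → v ≢ w
    ne p q refl = tf p q
    at-e : ind (M e) + ind (M (rot e)) + ind (M (rot (rot e))) ≡ 1
    at-e = cong₂ _+_ (cong₂ _+_ (ind-t (trans (M-in (∨-inl (vs-0 e))) (∨-inl (==-refl e)))) (ind-f (trans (M-in (∨-inl (vs-1 e))) (∨-false (==-false (rot≢ ae)) (==-false (ne (vs-1 e) nl))))))
      (ind-f (trans (M-in (∨-inl (vs-2 e))) (∨-false (==-false (rot²≢ ae)) (==-false (ne (vs-2 e) nl)))))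
    at-e′ : ind (M e′) + ind (M (rot e′)) + ind (M (rot (rot e′))) ≡ 1
    at-e′ = cong₂ _+_ (cong₂ _+_ (ind-t (trans (M-in (∨-inr {vs e e′} (vs-0 e′))) (∨-inr {e′ == e} (==-refl e′)))) (ind-f (trans (M-in (∨-inr {vs e (rot e′)} (vs-1 e′))) (∨-false (==-false (ne (vs-1 e′) nl′)) (==-false (rot≢ ae′))))))
      (ind-f (trans (M-in (∨-inr {vs e (rot (rot e′))} (vs-2 e′))) (∨-false (==-false (ne (vs-2 e′) nl′)) (==-false (rot²≢ ae′)))))
    o : ∀ v → alive v ≡ true → (O v ≡ true) ⊎ (O v ≡ false) → ind (M v) + ind (M (rot v)) + ind (M (rot (rot v))) ≡ 1
    o v p (inj₁ q) = case ∨-case {vs e v} q of λ { (inj₁ x) → one-rot {M} ae x at-e ; (inj₂ x) → one-rot {M} ae′ x at-e′ }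
    o v p (inj₂ q) = trans (cong₂ _+_ (cong₂ (λ x y → ind x + ind y) (M-out q) (M-out q₁)) (cong ind (M-out q₂))) (o′ (∧-intro p (not-t q)))
      where
      q₁ : O (rot v) ≡ false
      q₁ = trans (Oi v p) q
      q₂ : O (rot (rot v)) ≡ false
      q₂ = trans (Oi (rot v) (a-rot p)) q₁

-- h₀ is the dart opposite to g at the vertex x; h is a dart at x whose other end y is not an end of e.
module Frink {N : ℕ} {rev rot : Fin N → Fin N} {alive : S N} (Cu : CubicMap rev rot alive) (e g : Fin N) (ae : alive e ≡ true)
  (ge : Maps.vs Cu e g ≡ true) (g≢e : g ≢ e) (far : Maps.vs Cu (rev e) (rev g) ≡ false) where
  open CubicMap Cu
  open Maps Cu
  open Loops Cu

  e′ h₀ : Fin N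
  e′ = rev e
  h₀ = rev g

  ae′ : alive e′ ≡ true
  ae′ = trans (a-rev e) ae
  ag : alive g ≡ true
  ag = vs-alive ae ge
  ah₀ : alive h₀ ≡ true
  ah₀ = trans (a-rev g) ag

  near : vs e h₀ ≡ false
  near = trans (sym (vs-eq ae ge h₀)) (no-loop ag)

  atEnd : S N
  atEnd h = vs e (rev h) ∨ vs e′ (rev h)

  rev≢ : ∀ {u v} → u ≢ v → rev u ≢ rev v
  rev≢ ne q = ne (trans (sym (mm I _)) (trans (cong rev q) (mm I _)))

  -- Otherwise a single edge leaves the vertices of e, e′ and h₀.
  not-both : atEnd (rot h₀) ≡ true → atEnd (rot (rot h₀)) ≡ true → ⊥
  not-both b₁ b₂ = few Z (λ v p → cong₂ _∨_ (cong₂ _∨_ (vs-rinv ae v p) (vs-rinv ae′ v p)) (vs-rinv ah₀ v p)) odd (≤-trans (#-mono {g = U ∖ e ∖ e′ ∖ g ∖ p₁ ∖ p₂} sub) count)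
    where
    U Z : S N
    U v = vs e v ∨ vs e′ v
    Z v = U v ∨ vs h₀ v
    p₁ p₂ : Fin N
    p₁ = rev (rot h₀)
    p₂ = rev (rot (rot h₀))
    Uh : ∀ t → vs h₀ t ≡ true → U t ≡ false
    Uh t q = ∨-false (trans (rot-step {vs e} (vs-rinv ae) ah₀ q) near) (trans (rot-step {vs e′} (vs-rinv ae′) ah₀ q) far)
    odd : Odd I alive Z
    odd = trans (par-disjoint alive U (vs h₀) (λ v p → ¬t⇒f (λ q → tf p (Uh v q)))) (cong₂ _xor_ (trans (par-disjoint alive (vs e) (vs e′) (vs-disjoint ae ae′ (no-loop ae))) (cong₂ _xor_ (vs-odd ae) (vs-odd ae′))) (vs-odd ah₀))
    ≢h : ∀ {t u} → vs h₀ t ≡ true → U u ≡ true → t ≢ u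
    ≢h p q refl = tf q (Uh _ p)
    Ue : U e ≡ true
    Ue = ∨-inl (vs-0 e)
    Ue′ : U e′ ≡ true
    Ue′ = ∨-inr {vs e e′} (vs-0 e′)
    Ug : U g ≡ true
    Ug = ∨-inl ge
    swap≢ : ∀ {t u} → t ≢ rev u → rev t ≢ u
    swap≢ {t} ne q = ne (trans (sym (mm I t)) (cong rev q))
    e≢e′ : e′ ≢ e
    e≢e′ = mf I e
    g≢e′ : g ≢ e′
    g≢e′ q = tf (subst (λ y → vs e y ≡ true) q ge) (no-loop ae)
    p₁≢e : p₁ ≢ e
    p₁≢e = swap≢ (≢h (vs-1 h₀) Ue′)
    p₁≢e′ : p₁ ≢ e′
    p₁≢e′ = rev≢ (≢h (vs-1 h₀) Ue)
    p₁≢g : p₁ ≢ g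
    p₁≢g = swap≢ (rot≢ ah₀)
    p₂≢e : p₂ ≢ e
    p₂≢e = swap≢ (≢h (vs-2 h₀) Ue′)
    p₂≢e′ : p₂ ≢ e′
    p₂≢e′ = rev≢ (≢h (vs-2 h₀) Ue)
    p₂≢g : p₂ ≢ g
    p₂≢g = swap≢ (rot²≢ ah₀)
    p₂≢p₁ : p₂ ≢ p₁
    p₂≢p₁ = rev≢ (rot≢ (a-rot ah₀))
    r₁ : # U ≡ suc (# (U ∖ e))
    r₁ = ∖-remove U e Ue
    r₂ : # (U ∖ e) ≡ suc (# (U ∖ e ∖ e′))
    r₂ = ∖-remove (U ∖ e) e′ (trans (∖-other U e≢e′) Ue′)
    r₃ : # (U ∖ e ∖ e′) ≡ suc (# (U ∖ e ∖ e′ ∖ g))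
    r₃ = ∖-remove (U ∖ e ∖ e′) g (trans (∖-other (U ∖ e) g≢e′) (trans (∖-other U g≢e) Ug))
    r₄ : # (U ∖ e ∖ e′ ∖ g) ≡ suc (# (U ∖ e ∖ e′ ∖ g ∖ p₁))
    r₄ = ∖-remove (U ∖ e ∖ e′ ∖ g) p₁ (trans (∖-other (U ∖ e ∖ e′) p₁≢g) (trans (∖-other (U ∖ e) p₁≢e′) (trans (∖-other U p₁≢e) b₁)))
    r₅ : # (U ∖ e ∖ e′ ∖ g ∖ p₁) ≡ suc (# (U ∖ e ∖ e′ ∖ g ∖ p₁ ∖ p₂))
    r₅ = ∖-remove (U ∖ e ∖ e′ ∖ g ∖ p₁) p₂ (trans (∖-other (U ∖ e ∖ e′ ∖ g) p₂≢p₁) (trans (∖-other (U ∖ e ∖ e′) p₂≢g) (trans (∖-other (U ∖ e) p₂≢e′) (trans (∖-other U p₂≢e) b₂))))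
    count : # (U ∖ e ∖ e′ ∖ g ∖ p₁ ∖ p₂) ≤ 1
    count = +-cancelˡ-≤ 5 (# (U ∖ e ∖ e′ ∖ g ∖ p₁ ∖ p₂)) 1 (≤-trans (≤-reflexive (sym (trans r₁ (cong suc (trans r₂ (cong suc (trans r₃ (cong suc (trans r₄ (cong suc r₅))))))))))
      (≤-trans (#-∨ (vs e) (vs e′)) (≤-reflexive (cong₂ _+_ (#-vs ae) (#-vs ae′)))))
    sub : ∀ x → (alive x ∧ (Z x ∧ not (Z (rev x)))) ≡ true → (U ∖ e ∖ e′ ∖ g ∖ p₁ ∖ p₂) x ≡ true
    sub x q = trans (∖-other (U ∖ e ∖ e′ ∖ g ∖ p₁) (out (∨-inr {U (rev p₂)} (trans (cong (vs h₀) (mm I _)) (vs-2 h₀))))) (trans (∖-other (U ∖ e ∖ e′ ∖ g) (out (∨-inr {U (rev p₁)} (trans (cong (vs h₀) (mm I _)) (vs-1 h₀)))))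
        (trans (∖-other (U ∖ e ∖ e′) (out (∨-inr {U h₀} (vs-0 h₀)))) (trans (∖-other (U ∖ e) (out (∨-inl {U (rev e′)} (trans (cong U (mm I e)) Ue)))) (trans (∖-other U (out (∨-inl {U e′} Ue′))) inU))))
      where
      nz : Z (rev x) ≡ false
      nz = not-t⁻ (∧-snd {Z x} (∧-snd {alive x} q))
      out : ∀ {u} → Z (rev u) ≡ true → x ≢ u
      out p refl = tf p nz
      inU : U x ≡ true
      inU = case ∨-case {U x} (∧-fst (∧-snd {alive x} q)) of λ { (inj₁ r) → r ; (inj₂ r) → ⊥-elim (bad (vs-case r)) }
        where
        bad : (x ≡ h₀) ⊎ (x ≡ rot h₀) ⊎ (x ≡ rot (rot h₀)) → ⊥
        bad (inj₁ f) = tf (trans (cong (U ∘ rev) f) (trans (cong U (mm I g)) Ug)) (∨-false₁ nz)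
        bad (inj₂ (inj₁ f)) = tf (trans (cong (U ∘ rev) f) b₁) (∨-false₁ nz)
        bad (inj₂ (inj₂ f)) = tf (trans (cong (U ∘ rev) f) b₂) (∨-false₁ nz)

  -- Names the two further darts at the vertex of `h₀` in whichever order makes `h` lead away from
  -- the ends of `e`; `xcase` and `xsum` hide that order from what follows.
  record Fork : Set where
    field
      h v₂ : Fin N
      xh : vs h₀ h ≡ true
      xv : vs h₀ v₂ ≡ true
      h≢ : h ≢ h₀
      v≢ : v₂ ≢ h₀
      v≢h : v₂ ≢ h
      xcase : ∀ t → vs h₀ t ≡ true → (t ≡ h₀) ⊎ (t ≡ h) ⊎ (t ≡ v₂)
      xsum : ∀ (M : S N) → ind (M h₀) + ind (M (rot h₀)) + ind (M (rot (rot h₀))) ≡ ind (M h₀) + ind (M h) + ind (M v₂)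
      away : atEnd h ≡ false

  module Edge (X : Fork) where
    open Fork X

    h′ v₁ v₃ : Fin N
    h′ = rev h
    v₁ = rot h′
    v₃ = rot (rot h′)

    ah : alive h ≡ true
    ah = vs-alive ah₀ xh
    ah′ : alive h′ ≡ true
    ah′ = trans (a-rev h) ah

    O : S N
    O v = vs h₀ v ∨ vs h′ v

    Oi : RInv O
    Oi v p = cong₂ _∨_ (vs-rinv ah₀ v p) (vs-rinv ah′ v p)

    xy : vs h₀ h′ ≡ false
    xy = trans (sym (vs-eq ah₀ xh h′)) (no-loop ah)

    X≢Y : ∀ {t u} → vs h₀ t ≡ true → vs h′ u ≡ true → t ≢ u
    X≢Y p q refl = tf q (vs-disjoint ah₀ ah′ xy _ p)

    Ocase : ∀ t → O t ≡ true → ((t ≡ h₀) ⊎ (t ≡ h) ⊎ (t ≡ v₂)) ⊎ ((t ≡ h′) ⊎ (t ≡ v₁) ⊎ (t ≡ v₃))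
    Ocase t p = case ∨-case {vs h₀ t} p of λ { (inj₁ q) → inj₁ (xcase t q) ; (inj₂ q) → inj₂ (vs-case q) }

    e∉ : ∀ {t} → vs e t ≡ true → O t ≡ false
    e∉ {t} p = ∨-false (¬t⇒f (λ q → tf p (trans (rot-step {vs e} (vs-rinv ae) ah₀ q) near))) (¬t⇒f (λ q → tf p (trans (rot-step {vs e} (vs-rinv ae) ah′ q) (∨-false₁ away))))

    C : S N → Set
    C W = RInv W × (W h₀ ≡ false) × (W h′ ≡ false)

    K₀ K₁ K₂ P : S N
    K₀ v = v == h₀
    K₁ = K₀ ∪₁ v₁
    K₂ = K₁ ∪₁ v₂
    P = K₂ ∪₁ v₃

    C-O : ∀ {W} → C W → ∀ t → O t ≡ true → W t ≡ false
    C-O {W} (i , p , q) t o = case ∨-case {vs h₀ t} o of λ { (inj₁ x) → trans (rot-step {W} i ah₀ x) p ; (inj₂ x) → trans (rot-step {W} i ah′ x) q }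

    private
      P₀ : P h₀ ≡ true
      P₀ = ∪₁-old K₂ (∪₁-old K₁ (∪₁-old K₀ (==-refl h₀)))
      P₁ : P v₁ ≡ true
      P₁ = ∪₁-old K₂ (∪₁-old K₁ (∪₁-self K₀ v₁))
      P₂ : P v₂ ≡ true
      P₂ = ∪₁-old K₂ (∪₁-self K₁ v₂)
      P₃ : P v₃ ≡ true
      P₃ = ∪₁-self K₂ v₃
      P-off : ∀ v → v ≢ h₀ → v ≢ v₁ → v ≢ v₂ → v ≢ v₃ → P v ≡ false
      P-off v a b c d = ∨-false (∨-false (∨-false (==-false a) (==-false b)) (==-false c)) (==-false d)
      O₀ : O h₀ ≡ true
      O₀ = ∨-inl (vs-0 h₀)
      PO : ∀ {v} → v ≢ h → v ≢ h′ → P v ≡ O v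
      PO {v} a b = iff (λ p → ¬f⇒t (λ q → tf p (P-off v (λ { refl → tf O₀ q }) (λ { refl → tf (∨-inr {vs h₀ v₁} (vs-1 h′)) q }) (λ { refl → tf (∨-inl xv) q }) (λ { refl → tf (∨-inr {vs h₀ v₃} (vs-2 h′)) q }))))
        (λ q → put (Ocase v q))
        where
        put : ((v ≡ h₀) ⊎ (v ≡ h) ⊎ (v ≡ v₂)) ⊎ ((v ≡ h′) ⊎ (v ≡ v₁) ⊎ (v ≡ v₃)) → P v ≡ true
        put (inj₁ (inj₁ f)) = trans (cong P f) P₀
        put (inj₁ (inj₂ (inj₁ f))) = ⊥-elim (a f)
        put (inj₁ (inj₂ (inj₂ f))) = trans (cong P f) P₂
        put (inj₂ (inj₁ f)) = ⊥-elim (b f)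
        put (inj₂ (inj₂ (inj₁ f))) = trans (cong P f) P₁
        put (inj₂ (inj₂ (inj₂ f))) = trans (cong P f) P₃
      Ph : P h ≡ false
      Ph = P-off h h≢ (X≢Y xh (vs-1 h′)) (λ q → v≢h (sym q)) (X≢Y xh (vs-2 h′))
      Ph′ : P h′ ≡ false
      Ph′ = P-off h′ (λ q → X≢Y (vs-0 h₀) (vs-0 h′) (sym q)) (λ q → rot≢ ah′ (sym q)) (λ q → X≢Y xv (vs-0 h′) (sym q)) (λ q → rot²≢ ah′ (sym q))
      Oh : O h ≡ true
      Oh = ∨-inl xh
      Oh′ : O h′ ≡ true
      Oh′ = ∨-inr {vs h₀ h′} (vs-0 h′)

      -- Adding both removed vertices keeps an odd set odd. `P` omits only the two darts of the edge
      -- `h`, which crosses neither of the two cuts.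
      four : ∀ W → C W → Odd I alive W → 6 ≤ D rev alive (λ v → W v ∨ P v)
      four W c o = subst (6 ≤_) (trans (D-def rev alive _) (trans (#-cong (λ v → cong (alive v ∧_) (pt v (v ≟F h) (v ≟F h′)))) (sym (D-def rev alive _)))) (odd-cut (λ v → W v ∨ O v) (λ v p → cong₂ _∨_ (proj₁ c v p) (Oi v p)) odd)
        where
        odd : Odd I alive (λ v → W v ∨ O v)
        odd = trans (par-disjoint alive W O (λ v p → ¬t⇒f (λ q → tf p (C-O {W} c v q)))) (cong₂ _xor_ o (trans (par-disjoint alive (vs h₀) (vs h′) (vs-disjoint ah₀ ah′ xy)) (cong₂ _xor_ (vs-odd ah₀) (vs-odd ah′))))
        pt : ∀ v → Dec (v ≡ h) → Dec (v ≡ h′) → ((W v ∨ O v) xor (W (rev v) ∨ O (rev v))) ≡ ((W v ∨ P v) xor (W (rev v) ∨ P (rev v)))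
        pt v (yes f) _ = trans (cong (λ y → (W y ∨ O y) xor (W (rev y) ∨ O (rev y))) f) (trans (cong₂ _xor_ (∨-inr {W h} Oh) (∨-inr {W h′} Oh′))
          (sym (trans (cong (λ y → (W y ∨ P y) xor (W (rev y) ∨ P (rev y))) f) (cong₂ _xor_ (∨-false (C-O {W} c h Oh) Ph) (∨-false (C-O {W} c h′ Oh′) Ph′)))))
        pt v _ (yes f) = trans (cong (λ y → (W y ∨ O y) xor (W (rev y) ∨ O (rev y))) f) (trans (cong₂ _xor_ (∨-inr {W h′} Oh′) (trans (cong (λ y → W y ∨ O y) (mm I h)) (∨-inr {W h} Oh)))
          (sym (trans (cong (λ y → (W y ∨ P y) xor (W (rev y) ∨ P (rev y))) f) (cong₂ _xor_ (∨-false (C-O {W} c h′ Oh′) Ph′) (trans (cong (λ y → W y ∨ P y) (mm I h)) (∨-false (C-O {W} c h Oh) Ph))))))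
        pt v (no a) (no b) = cong₂ _xor_ (cong (W v ∨_) (sym (PO a b))) (cong (W (rev v) ∨_) (sym (PO (λ q → b (trans (sym (mm I v)) (cong rev q))) (λ q → a (trans (sym (mm I v)) (trans (cong rev q) (mm I h)))))))

    family : Family I alive
    family = record { C = C ; C-ext = λ f (i , p , q) → rinv-ext f i , trans (sym (f h₀)) p , trans (sym (f h′)) q ; C? = λ W → rinv? W ×-dec ((W h₀ ≟B false) ×-dec (W h′ ≟B false))
      ; C-∩ = λ (i , p , q) (j , _ , _) → (λ v a → cong₂ _∧_ (i v a) (j v a)) , ∧-false₁ p , ∧-false₁ q ; C-∪ = λ (i , p , q) (j , r , s) → (λ v a → cong₂ _∨_ (i v a) (j v a)) , ∨-false p r , ∨-false q s
      ; C-∖ = λ (i , p , q) (j , _ , _) → (λ v a → cong₂ (λ x y → x ∧ not y) (i v a) (j v a)) , ∧-false₁ p , ∧-false₁ q ; winv = a-rev ; K = 1 ; h₀ = λ W c o → odd-cut W (proj₁ c) o }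

    quad : Splitting.Quad I alive family P h₀ v₁ v₂ v₃
    quad = record { ab = X≢Y (vs-0 h₀) (vs-1 h′) ; ac = λ q → v≢ (sym q) ; ad = X≢Y (vs-0 h₀) (vs-2 h′) ; bc = λ q → X≢Y xv (vs-1 h′) (sym q) ; bd = λ q → rot≢ (a-rot ah′) (sym q) ; cd = X≢Y xv (vs-2 h′)
      ; wa = ah₀ ; wb = a-rot ah′ ; wc = vs-alive ah₀ xv ; wd = a-rot (a-rot ah′) ; Pa = P₀ ; Pb = P₁ ; Pc = P₂ ; Pd = P₃ ; P-off = P-off
      ; C-off = λ W c → C-O {W} c h₀ O₀ , C-O {W} c v₁ (∨-inr {vs h₀ v₁} (vs-1 h′)) , C-O {W} c v₂ (∨-inl xv) , C-O {W} c v₃ (∨-inr {vs h₀ v₃} (vs-2 h′)) ; h₄ = four }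

    Good : (Fin N → Fin N) → Set
    Good rev′ = ∀ W → C W → Odd I alive W → 6 ≤ D rev′ alive W

    split : Good (repair (repair rev h₀ v₁) v₂ v₃) ⊎ Good (repair (repair rev v₃ h₀) v₁ v₂)
    split = Splitting.splitting I alive family quad

    -- p, q and r, t are the pairs of darts that are joined; one of p, q is h₀.
    record Pairing : Set where
      field
        p q r t : Fin N
        pq : p ≢ q
        rt : r ≢ t
        pr : p ≢ r
        pt : p ≢ t
        qr : q ≢ r
        qt : q ≢ t
        Op : O p ≡ true
        Oq : O q ≡ true
        Or : O r ≡ true
        Ot : O t ≡ true
        p≢h : p ≢ h
        q≢h : q ≢ h
        r≢h : r ≢ h
        t≢h : t ≢ h
        p≢h′ : p ≢ h′
        q≢h′ : q ≢ h′
        r≢h′ : r ≢ h′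
        t≢h′ : t ≢ h′
        h₀-in : (h₀ ≡ p) ⊎ (h₀ ≡ q)
        v₂-in : (v₂ ≡ r) ⊎ (v₂ ≡ t)
        y-in : ((v₁ ≡ p) ⊎ (v₁ ≡ q)) × ((v₃ ≡ r) ⊎ (v₃ ≡ t)) ⊎ ((v₃ ≡ p) ⊎ (v₃ ≡ q)) × ((v₁ ≡ r) ⊎ (v₁ ≡ t))
        good : Good (repair (repair rev p q) r t)

    module Join (J : Pairing) where
      open Pairing J

      rev₁ rev₂ : Fin N → Fin N
      rev₁ = repair rev p q
      rev₂ = repair rev₁ r t
      I₁ : Invol rev₁
      I₁ = repair-Invol I p q pq
      I₂ : Invol rev₂
      I₂ = repair-Invol I₁ r t rt

      private
        aO : ∀ {u} → O u ≡ true → alive u ≡ true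
        aO {u} o = case ∨-case {vs h₀ u} o of λ { (inj₁ x) → vs-alive ah₀ x ; (inj₂ x) → vs-alive ah′ x }
        a₁ : ∀ v → alive (rev₁ v) ≡ alive v
        a₁ = repair-inv I p q pq alive a-rev (trans (aO Op) (sym (aO Oq)))
        a₂ : ∀ v → alive (rev₂ v) ≡ alive v
        a₂ = repair-inv I₁ r t rt alive a₁ (trans (aO Or) (sym (aO Ot)))
        rev₁h : rev₁ h ≡ h′
        rev₁h = repair-o I p q pq (λ x → p≢h (sym x)) (λ x → q≢h (sym x)) (λ x → p≢h′ (sym x)) (λ x → q≢h′ (sym x))
        rev₂h : rev₂ h ≡ h′
        rev₂h = trans (repair-o I₁ r t rt (λ x → r≢h (sym x)) (λ x → t≢h (sym x)) (λ x → r≢h′ (sym (trans (sym rev₁h) x))) (λ x → t≢h′ (sym (trans (sym rev₁h) x)))) rev₁h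
        rev₂p : rev₂ p ≡ q
        rev₂p = trans (repair-o I₁ r t rt pr pt (λ x → qr (trans (sym (repair-e I p q pq)) x)) (λ x → qt (trans (sym (repair-e I p q pq)) x))) (repair-e I p q pq)
        flip : ∀ {u v} → rev₂ u ≡ v → rev₂ v ≡ u
        flip {u} f = trans (cong rev₂ (sym f)) (mm I₂ u)
        pair : ∀ {u x y} → (u ≡ x) ⊎ (u ≡ y) → rev₂ x ≡ y → O x ≡ true → O y ≡ true → O (rev₂ u) ≡ true
        pair (inj₁ refl) f ox oy = trans (cong O f) oy
        pair (inj₂ refl) f ox oy = trans (cong O (flip f)) ox
        pqP : ∀ {u} → (u ≡ p) ⊎ (u ≡ q) → O (rev₂ u) ≡ true
        pqP x = pair x rev₂p Op Oq
        rtP : ∀ {u} → (u ≡ r) ⊎ (u ≡ t) → O (rev₂ u) ≡ true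
        rtP x = pair x (repair-e I₁ r t rt) Or Ot
        O-in : ∀ v → O v ≡ true → O (rev₂ v) ≡ true
        O-in v o = go (Ocase v o)
          where
          yy : (((v₁ ≡ p) ⊎ (v₁ ≡ q)) × ((v₃ ≡ r) ⊎ (v₃ ≡ t)) ⊎ ((v₃ ≡ p) ⊎ (v₃ ≡ q)) × ((v₁ ≡ r) ⊎ (v₁ ≡ t))) → (O (rev₂ v₁) ≡ true) × (O (rev₂ v₃) ≡ true)
          yy (inj₁ (x , y)) = pqP x , rtP y
          yy (inj₂ (x , y)) = rtP y , pqP x
          go : ((v ≡ h₀) ⊎ (v ≡ h) ⊎ (v ≡ v₂)) ⊎ ((v ≡ h′) ⊎ (v ≡ v₁) ⊎ (v ≡ v₃)) → O (rev₂ v) ≡ true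
          go (inj₁ (inj₁ f)) = trans (cong (O ∘ rev₂) f) (pqP h₀-in)
          go (inj₁ (inj₂ (inj₁ f))) = trans (cong (O ∘ rev₂) f) (trans (cong O rev₂h) Oh′)
          go (inj₁ (inj₂ (inj₂ f))) = trans (cong (O ∘ rev₂) f) (rtP v₂-in)
          go (inj₂ (inj₁ f)) = trans (cong (O ∘ rev₂) f) (trans (cong O (flip rev₂h)) Oh)
          go (inj₂ (inj₂ (inj₁ f))) = trans (cong (O ∘ rev₂) f) (proj₁ (yy y-in))
          go (inj₂ (inj₂ (inj₂ f))) = trans (cong (O ∘ rev₂) f) (proj₂ (yy y-in))
        O-rev₂ : ∀ v → O (rev₂ v) ≡ O v
        O-rev₂ v = iff (λ o → trans (cong O (sym (mm I₂ v))) (O-in (rev₂ v) o)) (O-in v)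
        bl : ∀ W → RInv W → (∀ v → O v ≡ true → W v ≡ false) → D rev₂ alive W ≢ 2
        bl W i off d = <⇒≱ {2} {6} (s≤s (s≤s (s≤s z≤n))) (≤-trans (good W (i , off h₀ (∨-inl (vs-0 h₀)) , off h′ Oh′) odd) (≤-reflexive d))
          where
          -- A cut of a single edge belongs to an odd set, since the cuts of even sets are multiples
          -- of four.
          odd : Odd I alive W
          odd with D-parity I₂ alive W a₂
          ... | j , f = ¬f⇒t (λ x → bad j (trans (sym d) (trans f (cong (λ b → 4 * j + 2 * ind b) x))))
            where
            bad : ∀ j → 2 ≡ 4 * j + 0 → ⊥
            bad zero ()
            bad (suc j) x with trans x (cong (_+ 0) (*-distribˡ-+ 4 1 j))
            ... | ()

      open Remove Cu O Oi I₂ a₂ O-rev₂ bl public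

      ae-after : alive′ e ≡ true
      ae-after = ∧-intro ae (not-t (e∉ (vs-0 e)))

      module _ {M′ : S N} (pre : PreMatching rev₂ rot alive′ M′) (M′e : M′ e ≡ true) where
        private
          module U₁ = Undo I p q pq
          module U₂ = Undo I₁ r t rt
          N₂ N₁ N₀ : S N
          N₂ u = alive′ u ∧ M′ u
          N₁ = U₂.undo N₂
          N₀ = U₁.undo N₁
          i₂ : ∀ v → N₂ (rev₂ v) ≡ N₂ v
          i₂ v with bool (alive′ v)
          ... | inj₁ x = cong₂ _∧_ (CubicMap.a-rev remove v) (proj₁ pre x)
          ... | inj₂ x = trans (∧-false₁ (trans (CubicMap.a-rev remove v) x)) (sym (∧-false₁ x))
          i₁ : ∀ v → N₁ (rev₁ v) ≡ N₁ v
          i₁ = U₂.undo-inv N₂ i₂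
          i₀ : ∀ v → N₀ (rev v) ≡ N₀ v
          i₀ = U₁.undo-inv N₁ i₁
          mv : Bool
          mv = N₁ r
          N₁t : N₁ t ≡ mv
          N₁t = trans (U₂.undo-f N₂) (sym (U₂.undo-e N₂))
          ≢O : ∀ {u w} → O u ≡ false → O w ≡ true → u ≢ w
          ≢O a b refl = tf b a
          N₁o : ∀ {u} → O u ≡ false → N₁ u ≡ N₂ u
          N₁o x = U₂.undo-o N₂ (≢O x Or) (≢O x Ot)
          N₀o : ∀ {u} → O u ≡ false → N₀ u ≡ N₂ u
          N₀o x = trans (U₁.undo-o N₁ (≢O x Op) (≢O x Oq)) (N₁o x)
          N₁g : N₁ g ≡ false
          N₁g = trans (N₁o (e∉ ge)) (∧-false₂ {alive′ g} (Loops.only-one remove {M′} ae-after (proj₂ pre ae-after) M′e ge g≢e))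
          N₁rp : N₁ (rev p) ≡ false
          N₁rp = go h₀-in
            where
            go : (h₀ ≡ p) ⊎ (h₀ ≡ q) → N₁ (rev p) ≡ false
            go (inj₁ f) = trans (cong (N₁ ∘ rev) (sym f)) (trans (cong N₁ (mm I g)) N₁g)
            go (inj₂ f) = trans (sym (i₁ (rev p))) (trans (cong N₁ (trans (repair-me I p q pq) (cong rev (sym f)))) (trans (cong N₁ (mm I g)) N₁g))
          on-pq : ∀ {u} → (u ≡ p) ⊎ (u ≡ q) → N₀ u ≡ false
          on-pq (inj₁ f) = trans (cong N₀ f) (trans (U₁.undo-e N₁) N₁rp)
          on-pq (inj₂ f) = trans (cong N₀ f) (trans (U₁.undo-f N₁) N₁rp)
          on-rt : ∀ {u} → (u ≡ r) ⊎ (u ≡ t) → N₀ u ≡ mv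
          on-rt (inj₁ f) = trans (cong N₀ f) (U₁.undo-o N₁ (λ x → pr (sym x)) (λ x → qr (sym x)))
          on-rt (inj₂ f) = trans (cong N₀ f) (trans (U₁.undo-o N₁ (λ x → pt (sym x)) (λ x → qt (sym x))) N₁t)
          M : S N
          M u = if (u == h) ∨ (u == h′) then not mv else N₀ u
          Mh : M h ≡ not mv
          Mh rewrite ==-refl h = refl
          Mh′ : M h′ ≡ not mv
          Mh′ rewrite ∨-inr {h′ == h} (==-refl h′) = refl
          Mo : ∀ {u} → u ≢ h → u ≢ h′ → M u ≡ N₀ u
          Mo a b rewrite ==-false a | ==-false b = refl
          Mout : ∀ {u} → O u ≡ false → alive u ≡ true → M u ≡ M′ u
          Mout x a = trans (Mo (≢O x Oh) (≢O x Oh′)) (trans (N₀o x) (cong (_∧ M′ _) (∧-intro a (not-t x))))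
          M-pq : ∀ {u} → u ≢ h → u ≢ h′ → (u ≡ p) ⊎ (u ≡ q) → M u ≡ false
          M-pq a b x = trans (Mo a b) (on-pq x)
          M-rt : ∀ {u} → u ≢ h → u ≢ h′ → (u ≡ r) ⊎ (u ≡ t) → M u ≡ mv
          M-rt a b x = trans (Mo a b) (on-rt x)
          M-rev′ : ∀ v → Dec (v ≡ h) → Dec (v ≡ h′) → M (rev v) ≡ M v
          M-rev′ v (yes f) _ = trans (cong (M ∘ rev) f) (trans Mh′ (sym (trans (cong M f) Mh)))
          M-rev′ v _ (yes f) = trans (cong (M ∘ rev) f) (trans (cong M (mm I h)) (trans Mh (sym (trans (cong M f) Mh′))))
          M-rev′ v (no a) (no b) = trans (Mo (λ x → b (trans (sym (mm I v)) (cong rev x))) (λ x → a (trans (sym (mm I v)) (trans (cong rev x) (mm I h))))) (trans (i₀ v) (sym (Mo a b)))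
          lem₁ : ∀ {x y z} m → x ≡ false → y ≡ not m → z ≡ m → ind x + ind y + ind z ≡ 1
          lem₁ true refl refl refl = refl
          lem₁ false refl refl refl = refl
          lem₂ : ∀ {x y z} m → x ≡ not m → y ≡ false → z ≡ m → ind x + ind y + ind z ≡ 1
          lem₂ true refl refl refl = refl
          lem₂ false refl refl refl = refl
          lem₃ : ∀ {x y z} m → x ≡ not m → y ≡ m → z ≡ false → ind x + ind y + ind z ≡ 1
          lem₃ true refl refl refl = refl
          lem₃ false refl refl refl = refl
          v₁≢h : v₁ ≢ h
          v₁≢h x = X≢Y xh (vs-1 h′) (sym x)
          v₃≢h : v₃ ≢ h
          v₃≢h x = X≢Y xh (vs-2 h′) (sym x)
          at-x : ind (M h₀) + ind (M (rot h₀)) + ind (M (rot (rot h₀))) ≡ 1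
          at-x = trans (xsum M) (lem₁ mv (M-pq (λ x → h≢ (sym x)) (X≢Y (vs-0 h₀) (vs-0 h′)) h₀-in) Mh (M-rt v≢h (X≢Y xv (vs-0 h′)) v₂-in))
          at-y : ind (M h′) + ind (M v₁) + ind (M v₃) ≡ 1
          at-y = go y-in
            where
            go : (((v₁ ≡ p) ⊎ (v₁ ≡ q)) × ((v₃ ≡ r) ⊎ (v₃ ≡ t)) ⊎ ((v₃ ≡ p) ⊎ (v₃ ≡ q)) × ((v₁ ≡ r) ⊎ (v₁ ≡ t))) → ind (M h′) + ind (M v₁) + ind (M v₃) ≡ 1
            go (inj₁ (x , y)) = lem₂ mv Mh′ (M-pq v₁≢h (rot≢ ah′) x) (M-rt v₃≢h (rot²≢ ah′) y)
            go (inj₂ (x , y)) = lem₃ mv Mh′ (M-rt v₁≢h (rot≢ ah′) y) (M-pq v₃≢h (rot²≢ ah′) x)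
          one′ : ∀ v → alive v ≡ true → (O v ≡ true) ⊎ (O v ≡ false) → ind (M v) + ind (M (rot v)) + ind (M (rot (rot v))) ≡ 1
          one′ v a (inj₁ o) = case ∨-case {vs h₀ v} o of λ { (inj₁ x) → one-rot {M} ah₀ x at-x ; (inj₂ x) → one-rot {M} ah′ x at-y }
          one′ v a (inj₂ o) = trans (cong₂ _+_ (cong₂ (λ x y → ind x + ind y) (Mout o a) (Mout o₁ (a-rot a))) (cong ind (Mout o₂ (a-rot (a-rot a))))) (proj₂ pre (∧-intro a (not-t o)))
            where
            o₁ : O (rot v) ≡ false
            o₁ = trans (Oi v a) o
            o₂ : O (rot (rot v)) ≡ false
            o₂ = trans (Oi (rot v) (a-rot a)) o₁

        -- The matching contains `e`, hence not `g`, hence not the new edge through `h₀`. At most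
        -- one of the two new edges is therefore matched: the one through `v₂`. If it is, its halves
        -- serve both removed vertices; if not, the edge `h` does.
        joined : Σ (S N) λ M → PreMatching rev rot alive M × (M e ≡ true)
        joined = M , ((λ {v} _ → M-rev′ v (v ≟F h) (v ≟F h′)) , (λ {v} a → one′ v a (bool (O v)))) , trans (Mout (e∉ (vs-0 e)) ae) M′e

-- Induction on the number of darts

Rec : ℕ → ℕ → Set
Rec N k = ∀ {rev rot : Fin N → Fin N} {alive : S N} → CubicMap rev rot alive → # alive ≤ k → ∀ e → alive e ≡ true → Σ (S N) λ M → Matching rev rot alive M × (M e ≡ true)

pre-of : {N : ℕ} {rev rot : Fin N → Fin N} {alive M : S N} → Matching rev rot alive M → PreMatching rev rot alive M
pre-of m = Matching.M-rev m , Matching.one m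

module Reduce {N k : ℕ} (rec : Rec N k) {rev rot : Fin N → Fin N} {alive : S N} (Cu : CubicMap rev rot alive) (le : # alive ≤ suc k) where
  open CubicMap Cu
  open Maps Cu

  Goal : Fin N → Set
  Goal e = Σ (S N) λ M → PreMatching rev rot alive M × (M e ≡ true)

  some : ∀ {rev′ rot′ : Fin N → Fin N} {alive′ : S N} → CubicMap rev′ rot′ alive′ → # alive′ ≤ k → Σ (S N) (PreMatching rev′ rot′ alive′)
  some {alive′ = alive′} Cu′ le′ = go (any? (λ v → alive′ v ≟B true))
    where
    go : Dec (Σ (Fin N) λ v → alive′ v ≡ true) → Σ (S N) (PreMatching _ _ alive′)
    go (yes (v , p)) = let (M , m , _) = rec Cu′ le′ v p in M , pre-of m
    go (no none) = (λ _ → false) , (λ {v} p → ⊥-elim (none (v , p))) , (λ {v} p → ⊥-elim (none (v , p)))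

  module _ (e g : Fin N) (ae : alive e ≡ true) (ge : vs e g ≡ true) (g≢e : g ≢ e) (far : vs (rev e) (rev g) ≡ false) where
    module F = Frink Cu e g ae ge g≢e far
    open F using (h₀; ah₀)

    module Go (X : F.Fork) where
      open F.Fork X
      module E = F.Edge X
      open E using (h′; v₁; v₃; ah′; X≢Y; O)
      private
        n01 : h₀ ≢ v₁
        n01 = X≢Y (vs-0 h₀) (vs-1 h′)
        n03 : h₀ ≢ v₃
        n03 = X≢Y (vs-0 h₀) (vs-2 h′)
        n21 : v₂ ≢ v₁
        n21 = X≢Y xv (vs-1 h′)
        n23 : v₂ ≢ v₃
        n23 = X≢Y xv (vs-2 h′)
        n13 : v₃ ≢ v₁
        n13 = rot≢ (a-rot ah′)
        O₀ : O h₀ ≡ true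
        O₀ = ∨-inl (vs-0 h₀)
        O₁ : O v₁ ≡ true
        O₁ = ∨-inr {vs h₀ v₁} (vs-1 h′)
        O₂ : O v₂ ≡ true
        O₂ = ∨-inl xv
        O₃ : O v₃ ≡ true
        O₃ = ∨-inr {vs h₀ v₃} (vs-2 h′)
        v₁h : v₁ ≢ h
        v₁h x = X≢Y xh (vs-1 h′) (sym x)
        v₃h : v₃ ≢ h
        v₃h x = X≢Y xh (vs-2 h′) (sym x)
        h₀h : h₀ ≢ h
        h₀h x = h≢ (sym x)
        h₀h′ : h₀ ≢ h′
        h₀h′ = X≢Y (vs-0 h₀) (vs-0 h′)
        v₂h′ : v₂ ≢ h′
        v₂h′ = X≢Y xv (vs-0 h′)

      first : E.Good (repair (repair rev h₀ v₁) v₂ v₃) → Goal e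
      first good = let (M , m , p) = rec J.remove (≤-pred (≤-trans (J.smaller h₀ ah₀ O₀) le)) e J.ae-after in J.joined {M} (pre-of m) p
        where
        pairing : E.Pairing
        pairing = record { p = h₀ ; q = v₁ ; r = v₂ ; t = v₃ ; pq = n01 ; rt = n23 ; pr = λ x → v≢ (sym x) ; pt = n03 ; qr = λ x → n21 (sym x) ; qt = λ x → n13 (sym x)
          ; Op = O₀ ; Oq = O₁ ; Or = O₂ ; Ot = O₃ ; p≢h = h₀h ; q≢h = v₁h ; r≢h = v≢h ; t≢h = v₃h ; p≢h′ = h₀h′ ; q≢h′ = rot≢ ah′ ; r≢h′ = v₂h′ ; t≢h′ = rot²≢ ah′
          ; h₀-in = inj₁ refl ; v₂-in = inj₁ refl ; y-in = inj₁ (inj₂ refl , inj₂ refl) ; good = good }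
        module J = E.Join pairing

      second : E.Good (repair (repair rev v₃ h₀) v₁ v₂) → Goal e
      second good = let (M , m , p) = rec J.remove (≤-pred (≤-trans (J.smaller h₀ ah₀ O₀) le)) e J.ae-after in J.joined {M} (pre-of m) p
        where
        pairing : E.Pairing
        pairing = record { p = v₃ ; q = h₀ ; r = v₁ ; t = v₂ ; pq = λ x → n03 (sym x) ; rt = λ x → n21 (sym x) ; pr = n13 ; pt = λ x → n23 (sym x) ; qr = n01 ; qt = λ x → v≢ (sym x)
          ; Op = O₃ ; Oq = O₀ ; Or = O₁ ; Ot = O₂ ; p≢h = v₃h ; q≢h = h₀h ; r≢h = v₁h ; t≢h = v≢h ; p≢h′ = rot²≢ ah′ ; q≢h′ = h₀h′ ; r≢h′ = rot≢ ah′ ; t≢h′ = v₂h′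
          ; h₀-in = inj₂ refl ; v₂-in = inj₂ refl ; y-in = inj₂ (inj₁ refl , inj₁ refl) ; good = good }
        module J = E.Join pairing

      goal : Goal e
      goal = [ first , second ]′ E.split

    frink : Goal e
    frink = go (bool (F.atEnd (rot h₀))) (bool (F.atEnd (rot (rot h₀))))
      where
      sw : ∀ a b c → a + b + c ≡ a + c + b
      sw = solve-∀
      go : (F.atEnd (rot h₀) ≡ true) ⊎ (F.atEnd (rot h₀) ≡ false) → (F.atEnd (rot (rot h₀)) ≡ true) ⊎ (F.atEnd (rot (rot h₀)) ≡ false) → Goal e
      go (inj₂ p) _ = Go.goal (record { h = rot h₀ ; v₂ = rot (rot h₀) ; xh = vs-1 h₀ ; xv = vs-2 h₀ ; h≢ = rot≢ ah₀ ; v≢ = rot²≢ ah₀ ; v≢h = rot≢ (a-rot ah₀) ; xcase = λ t → vs-case ; xsum = λ M → refl ; away = p })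
      go (inj₁ _) (inj₂ p) = Go.goal (record { h = rot (rot h₀) ; v₂ = rot h₀ ; xh = vs-2 h₀ ; xv = vs-1 h₀ ; h≢ = rot²≢ ah₀ ; v≢ = rot≢ ah₀ ; v≢h = λ x → rot≢ (a-rot ah₀) (sym x)
        ; xcase = λ t q → case vs-case q of λ { (inj₁ x) → inj₁ x ; (inj₂ (inj₁ x)) → inj₂ (inj₂ x) ; (inj₂ (inj₂ x)) → inj₂ (inj₁ x) } ; xsum = λ M → sw (ind (M h₀)) (ind (M (rot h₀))) (ind (M (rot (rot h₀)))) ; away = p })
      go (inj₁ p) (inj₁ q) = ⊥-elim (F.not-both p q)

  -- Either one of the other edges at the vertex of `e` avoids the other end of `e`, and Frink's
  -- reduction applies to its far end, or all three edges are parallel.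
  reduce : ∀ e → alive e ≡ true → Goal e
  reduce e ae = go (bool (vs (rev e) (rev (rot e)))) (bool (vs (rev e) (rev (rot (rot e)))))
    where
    go : (vs (rev e) (rev (rot e)) ≡ true) ⊎ (vs (rev e) (rev (rot e)) ≡ false) → (vs (rev e) (rev (rot (rot e))) ≡ true) ⊎ (vs (rev e) (rev (rot (rot e))) ≡ false) → Goal e
    go (inj₂ p) _ = frink e (rot e) ae (vs-1 e) (rot≢ ae) p
    go (inj₁ _) (inj₂ p) = frink e (rot (rot e)) ae (vs-2 e) (rot²≢ ae) p
    go (inj₁ p) (inj₁ q) = let (M , m) = some T.remove (≤-pred (≤-trans (T.smaller e ae (∨-inl (vs-0 e))) le)) in T.theta {M} m
      where
      module T = Theta Cu e ae p q

  -- A nontrivial cut with three edges: match both contractions so that they agree on the cut.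
  module _ (A : S N) (Ai : RInv A) (A6 : D rev alive A ≡ 6) (u : Fin N) (au : alive u ≡ true) (u₁ : A u ≡ true) (u₂ : A (rev u) ≡ true)
    (v : Fin N) (av : alive v ≡ true) (v₁ : A v ≡ false) (v₂ : A (rev v) ≡ false) (e : Fin N) (ae : alive e ≡ true) (Ae : A e ≡ true) where

    private
      E₁ = entering-ends Cu A A6
      E₂ = entering-ends Cu (λ v → not (A v)) (trans (D-not rev alive A) A6)
      module G = Glue Cu A Ai A6 E₁ E₂
      open G using (module S₁; module S₂)

    contract : Σ (S N) λ M → Matching rev rot alive M × (M e ≡ true)
    contract = go₁ (rec S₁.side (≤-pred (≤-trans (S₁.side-smaller v av v₁ v₂) le)) e (S₁.alive-in ae Ae))
      where
      go₁ : (Σ (S N) λ M → Matching rev S₁.rot₁ S₁.alive₁ M × (M e ≡ true)) → Σ (S N) λ M → Matching rev rot alive M × (M e ≡ true)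
      go₁ (M₁ , m₁ , p₁) = go₂ (S₁.outer-matched m₁)
        where
        go₂ : (Σ (Fin N) λ o → (S₁.outer o ≡ true) × (M₁ o ≡ true)) → Σ (S N) λ M → Matching rev rot alive M × (M e ≡ true)
        go₂ (o , oo , M₁o) = go₃ (rec S₂.side (≤-pred (≤-trans (S₂.side-smaller u au (not-f u₁) (not-f u₂)) le)) (rev o) (S₂.alive-out (G.out₁₂ oo)))
          where
          go₃ : (Σ (S N) λ M → Matching rev S₂.rot₁ S₂.alive₁ M × (M (rev o) ≡ true)) → Σ (S N) λ M → Matching rev rot alive M × (M e ≡ true)
          go₃ (M₂ , m₂ , p₂) = G.M m₁ m₂ o oo M₁o p₂ , G.glued m₁ m₂ o oo M₁o p₂ , G.glued-in m₁ m₂ o oo M₁o p₂ ae Ae p₁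

-- The prescribed edge carries the induction: it lets the matchings of two contractions agree on the
-- cut between them, and it keeps one new edge unmatched in Frink's reduction.
matching : ∀ {N} k → Rec N k
matching zero Cu le e ae = ⊥-elim (1+n≰n (≤-trans (#-pos _ e ae) le))
matching {N} (suc k) {rev} {rot} {alive} Cu le e ae = go nontrivial?
  where
  open CubicMap Cu
  open Maps Cu
  open Trivial Cu
  open Reduce (matching k) Cu le
  go : Dec (Σ (S N) Nontrivial) → Σ (S N) λ M → Matching rev rot alive M × (M e ≡ true)
  go (no none) = let (M , (r , o) , p) = reduce e ae in M , trivial-tight {M} r o none , p
  go (yes (A , Ai , A6 , (u , au , u₁ , u₂) , (v , av , v₁ , v₂))) = side (bool (A e))
    where
    side : (A e ≡ true) ⊎ (A e ≡ false) → Σ (S N) λ M → Matching rev rot alive M × (M e ≡ true)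
    side (inj₁ p) = contract A Ai A6 u au u₁ u₂ v av v₁ v₂ e ae p
    side (inj₂ p) = contract (λ v → not (A v)) (rinv-not {A} Ai) (trans (D-not rev alive A) A6) v av (not-t v₁) (not-t v₂) u au (not-f u₁) (not-f u₂) e ae (not-t p)

-- Orienting a 2-factor: two fixed-point-free involutions have a common proper 2-colouring.

alternate : ∀ {N} k {p q : Fin N → Fin N} (Ip : Invol p) (Iq : Invol q) → # (λ v → not (p v == q v)) ≤ k →
  Σ (S N) λ c → (∀ v → c (p v) ≡ not (c v)) × (∀ v → c (q v) ≡ not (c v))
alternate {N} k {p} {q} Ip Iq le = go k le (any? (λ v → not (p v == q v) ≟B true))
  where
  Goal : Set
  Goal = Σ (S N) λ c → (∀ v → c (p v) ≡ not (c v)) × (∀ v → c (q v) ≡ not (c v))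
  go : ∀ k → # (λ v → not (p v == q v)) ≤ k → Dec (Σ (Fin N) λ v → not (p v == q v) ≡ true) → Goal
  go k le (no none) = half Ip , half-mate Ip , λ v → trans (cong (half Ip) (sym (==-true (¬f⇒t (λ e → none (v , not-t e)))))) (half-mate Ip v)
  go zero le (yes (v , x)) = ⊥-elim (1+n≰n (≤-trans (#-pos _ v x) le))
  go (suc k) le (yes (v , x)) = finish (alternate k Ip Iq′ (≤-pred (≤-trans fewer le)))
    where
    w : Fin N
    w = p v
    v≢w : v ≢ w
    v≢w e = mf Ip v (sym e)
    pq : p v ≢ q v
    pq = ≢-== (not-t⁻ x)
    -- Repairing `q` at `v` and `p v` makes it agree with `p` there and destroys no agreement
    -- elsewhere.
    q′ : Fin N → Fin N
    q′ = repair q v w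
    Iq′ : Invol q′
    Iq′ = repair-Invol Iq v w v≢w
    swap : ∀ {f : Fin N → Fin N} (J : Invol f) {a b} → f a ≡ b → a ≡ f b
    swap J {a} e = trans (sym (mm J a)) (cong _ e)
    fewer : # (λ u → not (p u == q′ u)) < # (λ u → not (p u == q u))
    fewer = #-mono-< (λ u y → ¬f⇒t (λ z → tf y (not-f (same u (==-true (not-f⁻ z)))))) v x (not-f (subst (λ y → (p v == y) ≡ true) (sym (repair-e Iq v w v≢w)) (==-refl (p v))))
      where
      same : ∀ u → p u ≡ q u → (p u == q′ u) ≡ true
      same u e = subst (λ y → (p u == y) ≡ true) (sym (trans (repair-o Iq v w v≢w
          (λ y → pq (trans (cong p (sym y)) (trans e (cong q y))))
          (λ y → pq (swap Iq (trans (cong q (sym y)) (trans (sym e) (trans (cong p y) (mm Ip v))))))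
          (λ y → pq (trans (sym (swap Ip (trans e y))) (swap Iq y)))
          (λ y → pq (sym (trans (cong q (sym (trans (swap Ip (trans e y)) (mm Ip v)))) y)))) (sym e))) (==-refl (p u))
    finish : Σ (S N) (λ c → (∀ u → c (p u) ≡ not (c u)) × (∀ u → c (q′ u) ≡ not (c u))) → Goal
    finish (c , cp , cq) = c* , cp* , cq*
      where
      -- `q v` and `q w` are partners under `q′` and so have opposite colours. Recolouring `v` and
      -- `w` against them gives opposite colours to `v` and `w`, as `p` demands.
      c* : S N
      c* u = if u == v then not (c (q v)) else if u == w then c (q v) else c u
      at-v : c* v ≡ not (c (q v))
      at-v rewrite ==-refl v = refl
      at-w : c* w ≡ c (q v)
      at-w rewrite ==-false (λ e → v≢w (sym e)) | ==-refl w = refl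
      at-o : ∀ {u} → u ≢ v → u ≢ w → c* u ≡ c u
      at-o a b rewrite ==-false a | ==-false b = refl
      nn : ∀ b → b ≡ not (not b)
      nn true = refl
      nn false = refl
      cp* : ∀ u → c* (p u) ≡ not (c* u)
      cp* u with u ≟F v
      ... | yes refl = trans at-w (trans (nn (c (q v))) (cong not (sym at-v)))
      ... | no a with u ≟F w
      ... | yes refl = trans (cong c* (mm Ip v)) (trans at-v (cong not (sym at-w)))
      ... | no b = trans (at-o (λ y → b (swap Ip y)) (λ y → a (trans (swap Ip y) (mm Ip v)))) (trans (cp u) (cong not (sym (at-o a b))))
      qv≢v : q v ≢ v
      qv≢v = mf Iq v
      qv≢w : q v ≢ w
      qv≢w e = pq (sym e)
      qw≢w : q w ≢ w
      qw≢w = mf Iq w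
      qw≢v : q w ≢ v
      qw≢v e = pq (swap Iq e)
      cqw : c (q w) ≡ not (c (q v))
      cqw = trans (cong c (sym (repair-me Iq v w v≢w))) (cq (q v))
      cq* : ∀ u → c* (q u) ≡ not (c* u)
      cq* u with u ≟F v
      ... | yes refl = trans (at-o qv≢v qv≢w) (trans (nn (c (q v))) (cong not (sym at-v)))
      ... | no a with u ≟F w
      ... | yes refl = trans (at-o qw≢v qw≢w) (trans cqw (cong not (sym at-w)))
      ... | no b with q u ≟F v
      ... | yes y = trans (cong c* y) (trans at-v (cong not (sym (trans (at-o a b) (cong c (swap Iq y))))))
      ... | no d with q u ≟F w
      ... | yes y = trans (cong c* y) (trans at-w (trans (nn (c (q v))) (cong not (sym (trans (at-o a b) (trans (cong c (swap Iq y)) cqw))))))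
      ... | no f = trans (at-o d f) (trans (trans (cong c (sym (repair-o Iq v w v≢w a b d f))) (cq u)) (cong not (sym (at-o a b))))

-- From graphs to darts

sumFin-++ : ∀ a {b} (f : Fin (a + b) → ℕ) → sumFin f ≡ sumFin (λ i → f (i ↑ˡ b)) + sumFin (λ j → f (a ↑ʳ j))
sumFin-++ zero f = refl
sumFin-++ (suc a) f = trans (cong (f zero +_) (sumFin-++ a (λ i → f (suc i)))) (sym (+-assoc (f zero) _ _))

#-++ : ∀ a {b} (f : S (a + b)) → # f ≡ sumFin (λ i → ind (f (i ↑ˡ b))) + sumFin (λ j → ind (f (a ↑ʳ j)))
#-++ a f = trans (#-def f) (trans (sum-def _) (sumFin-++ a (λ v → ind (f v))))

sumFin-cong : ∀ {N} {f g : Fin N → ℕ} → (∀ v → f v ≡ g v) → sumFin f ≡ sumFin g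
sumFin-cong {f = f} {g} h = trans (sym (sum-def f)) (trans (sum-cong h) (sum-def g))

sumFin-+ : ∀ {N} (f g : Fin N → ℕ) → sumFin (λ v → f v + g v) ≡ sumFin f + sumFin g
sumFin-+ f g = trans (sym (sum-def _)) (trans (sum-+ f g) (cong₂ _+_ (sum-def f) (sum-def g)))

module Darts (G : Graph) where

  Nᵈ : ℕ
  Nᵈ = m G + m G

  left right : Edge G → Fin Nᵈ
  left e = e ↑ˡ m G
  right e = m G ↑ʳ e

  src : Fin Nᵈ → Vertex G
  src v = [ (λ e → proj₁ (ends G e)) , (λ e → proj₂ (ends G e)) ]′ (splitAt (m G) v)

  rev : Fin Nᵈ → Fin Nᵈ
  rev v = [ right , left ]′ (splitAt (m G) v)

  src-left : ∀ e → src (left e) ≡ proj₁ (ends G e)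
  src-left e rewrite splitAt-↑ˡ (m G) e (m G) = refl
  src-right : ∀ e → src (right e) ≡ proj₂ (ends G e)
  src-right e rewrite splitAt-↑ʳ (m G) (m G) e = refl
  rev-left : ∀ e → rev (left e) ≡ right e
  rev-left e rewrite splitAt-↑ˡ (m G) e (m G) = refl
  rev-right : ∀ e → rev (right e) ≡ left e
  rev-right e rewrite splitAt-↑ʳ (m G) (m G) e = refl

  dart-view : ∀ v → (Σ (Edge G) λ e → v ≡ left e) ⊎ (Σ (Edge G) λ e → v ≡ right e)
  dart-view v with splitAt (m G) v in eq
  ... | inj₁ e = inj₁ (e , sym (splitAt⁻¹-↑ˡ eq))
  ... | inj₂ e = inj₂ (e , sym (splitAt⁻¹-↑ʳ eq))

  left≢right : ∀ {e f} → left e ≢ right f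
  left≢right {e} {f} q with trans (sym (splitAt-↑ˡ (m G) e (m G))) (trans (cong (splitAt (m G)) q) (splitAt-↑ʳ (m G) (m G) f))
  ... | ()

  rev-Invol : Invol rev
  mm rev-Invol v with dart-view v
  ... | inj₁ (e , refl) = trans (cong rev (rev-left e)) (rev-right e)
  ... | inj₂ (e , refl) = trans (cong rev (rev-right e)) (rev-left e)
  mf rev-Invol v q with dart-view v
  ... | inj₁ (e , refl) = left≢right (sym (trans (sym (rev-left e)) q))
  ... | inj₂ (e , refl) = left≢right (trans (sym (rev-right e)) q)

  sym-count : ∀ (f : S Nᵈ) → (∀ v → f (rev v) ≡ f v) → # f ≡ sumFin (λ e → ind (f (left e))) + sumFin (λ e → ind (f (left e)))
  sym-count f h = trans (#-++ (m G) f) (cong (sumFin (λ e → ind (f (left e))) +_) (sumFin-cong (λ e → cong ind (trans (cong f (sym (rev-left e))) (h (left e))))))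

  -- Both darts of a loop start at its vertex, in agreement with the weight two of a loop.
  deg-count : ∀ (C : EdgeSet G) (f : S Nᵈ) → (∀ v → f (rev v) ≡ f v) → (∀ e → f (left e) ≡ C e) → ∀ x → degIn G C x ≡ # (λ v → (src v == x) ∧ f v)
  deg-count C f h k x = trans (trans (sumFin-cong (λ e → pt e (C e) (k e))) (sumFin-+ (λ e → ind ((src (left e) == x) ∧ f (left e))) (λ e → ind ((src (right e) == x) ∧ f (right e))))) (sym (#-++ (m G) (λ v → (src v == x) ∧ f v)))
    where
    fr : ∀ e → f (right e) ≡ C e
    fr e = trans (cong f (sym (rev-left e))) (trans (h (left e)) (k e))
    lem : ∀ a b → ind (a ∧ b) ≡ (if b then ind a else 0)
    lem true true = refl
    lem true false = refl
    lem false true = refl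
    lem false false = refl
    plus : ∀ b {x y} → (if b then x + y else 0) ≡ (if b then x else 0) + (if b then y else 0)
    plus true = refl
    plus false = refl
    pt : ∀ e b → f (left e) ≡ b → (if C e then endsAt G e x else 0) ≡ ind ((src (left e) == x) ∧ f (left e)) + ind ((src (right e) == x) ∧ f (right e))
    pt e b _ = trans (plus (C e)) (cong₂ _+_
      (sym (trans (lem (src (left e) == x) (f (left e))) (cong₂ (λ u w → if u then ind w else 0) (k e) (trans (cong (_== x) (src-left e)) (==-def _ x)))))
      (sym (trans (lem (src (right e) == x) (f (right e))) (cong₂ (λ u w → if u then ind w else 0) (fr e) (trans (cong (_== x) (src-right e)) (==-def _ x))))))

  cut-count : ∀ (A : Vertex G → Bool) → D rev (λ _ → true) (λ v → A (src v)) ≡ cutSize G A + cutSize G A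
  cut-count A = trans (D-def rev _ _) (trans (sym-count _ (λ v → trans (cong (λ y → A (src (rev v)) xor A (src y)) (mm rev-Invol v)) (xor-comm (A (src (rev v))) (A (src v)))))
    (cong₂ _+_ (sumFin-cong pt) (sumFin-cong pt)))
    where
    xor-comm : ∀ a b → (a xor b) ≡ (b xor a)
    xor-comm a b = eqB-≡ (tauto 2 (λ a b → eqB (a xor b) (b xor a)) refl a b)
    lem : ∀ a b → (a xor b) ≡ (if a then not b else b)
    lem true b = refl
    lem false b = refl
    pt : ∀ e → ind (A (src (left e)) xor A (src (rev (left e)))) ≡ ind (crosses G A e)
    pt e = cong ind (trans (cong₂ _xor_ (cong A (src-left e)) (cong A (trans (cong src (rev-left e)) (src-right e)))) (lem (A (proj₁ (ends G e))) (A (proj₂ (ends G e)))))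

  module _ (cubic : Cubic G) where

    opaque
      at-vertex : ∀ x → Ends (λ v → src v == x)
      at-vertex x = ends-of _ (trans (#-cong (λ v → sym (lem (src v == x)))) (trans (sym (deg-count (λ _ → true) (λ _ → true) (λ _ → refl) (λ _ → refl) x)) (cubic x)))
        where
        lem : ∀ a → (a ∧ true) ≡ a
        lem true = refl
        lem false = refl

    next : Vertex G → Fin Nᵈ → Fin Nᵈ
    next x v = if v == Ends.o₁ (at-vertex x) then Ends.o₂ (at-vertex x) else if v == Ends.o₂ (at-vertex x) then Ends.o₃ (at-vertex x) else Ends.o₁ (at-vertex x)

    rot : Fin Nᵈ → Fin Nᵈ
    rot v = next (src v) v

    private
      module At (x : Vertex G) where
        open Ends (at-vertex x) public
        s₁ : src o₁ ≡ x
        s₁ = ==-true out₁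
        s₂ : src o₂ ≡ x
        s₂ = ==-true out₂
        s₃ : src o₃ ≡ x
        s₃ = ==-true out₃
        r₁ : rot o₁ ≡ o₂
        r₁ = trans (cong (λ y → next y o₁) s₁) (lem (==-refl o₁))
          where
          lem : (o₁ == o₁) ≡ true → next x o₁ ≡ o₂
          lem p rewrite p = refl
        r₂ : rot o₂ ≡ o₃
        r₂ = trans (cong (λ y → next y o₂) s₂) (lem (==-false n21) (==-refl o₂))
          where
          lem : (o₂ == o₁) ≡ false → (o₂ == o₂) ≡ true → next x o₂ ≡ o₃
          lem p q rewrite p | q = refl
        r₃ : rot o₃ ≡ o₁
        r₃ = trans (cong (λ y → next y o₃) s₃) (lem (==-false n31) (==-false n32))
          where
          lem : (o₃ == o₁) ≡ false → (o₃ == o₂) ≡ false → next x o₃ ≡ o₁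
          lem p q rewrite p | q = refl

    private
      module _ (v : Fin Nᵈ) where
        open At (src v)
        which : (v ≡ o₁) ⊎ (v ≡ o₂) ⊎ (v ≡ o₃)
        which = out-all v (==-refl (src v))

    rot³′ : ∀ v → rot (rot (rot v)) ≡ v
    rot³′ v = go (which v)
      where
      open At (src v)
      turn : ∀ {x y z} → v ≡ x → rot x ≡ y → rot y ≡ z → rot z ≡ x → rot (rot (rot v)) ≡ v
      turn e f g h = trans (cong rot (trans (cong rot (trans (cong rot e) f)) g)) (trans h (sym e))
      go : (v ≡ o₁) ⊎ (v ≡ o₂) ⊎ (v ≡ o₃) → rot (rot (rot v)) ≡ v
      go (inj₁ e) = turn e r₁ r₂ r₃
      go (inj₂ (inj₁ e)) = turn e r₂ r₃ r₁
      go (inj₂ (inj₂ e)) = turn e r₃ r₁ r₂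

    rot≢′ : ∀ v → rot v ≢ v
    rot≢′ v e = go (which v)
      where
      open At (src v)
      go : (v ≡ o₁) ⊎ (v ≡ o₂) ⊎ (v ≡ o₃) → ⊥
      go (inj₁ f) = n21 (trans (trans (sym r₁) (trans (cong rot (sym f)) e)) f)
      go (inj₂ (inj₁ f)) = n32 (trans (trans (sym r₂) (trans (cong rot (sym f)) e)) f)
      go (inj₂ (inj₂ f)) = n31 (sym (trans (trans (sym r₃) (trans (cong rot (sym f)) e)) f))

    src-rot : ∀ v → src (rot v) ≡ src v
    src-rot v = go (which v)
      where
      open At (src v)
      go : (v ≡ o₁) ⊎ (v ≡ o₂) ⊎ (v ≡ o₃) → src (rot v) ≡ src v
      go (inj₁ f) = trans (cong src (trans (cong rot f) r₁)) s₂
      go (inj₂ (inj₁ f)) = trans (cong src (trans (cong rot f) r₂)) s₃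
      go (inj₂ (inj₂ f)) = trans (cong src (trans (cong rot f) r₃)) s₁

    same-vertex : ∀ u v → src u ≡ src v → (u ≡ v) ⊎ (u ≡ rot v) ⊎ (u ≡ rot (rot v))
    same-vertex u v e = go (out-all u (subst (λ x → (src u == x) ≡ true) e (==-refl (src u)))) (which v)
      where
      open At (src v)
      go : (u ≡ o₁) ⊎ (u ≡ o₂) ⊎ (u ≡ o₃) → (v ≡ o₁) ⊎ (v ≡ o₂) ⊎ (v ≡ o₃) → (u ≡ v) ⊎ (u ≡ rot v) ⊎ (u ≡ rot (rot v))
      go (inj₁ a) (inj₁ b) = inj₁ (trans a (sym b))
      go (inj₁ a) (inj₂ (inj₁ b)) = inj₂ (inj₂ (trans a (sym (trans (cong (rot ∘ rot) b) (trans (cong rot r₂) r₃)))))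
      go (inj₁ a) (inj₂ (inj₂ b)) = inj₂ (inj₁ (trans a (sym (trans (cong rot b) r₃))))
      go (inj₂ (inj₁ a)) (inj₁ b) = inj₂ (inj₁ (trans a (sym (trans (cong rot b) r₁))))
      go (inj₂ (inj₁ a)) (inj₂ (inj₁ b)) = inj₁ (trans a (sym b))
      go (inj₂ (inj₁ a)) (inj₂ (inj₂ b)) = inj₂ (inj₂ (trans a (sym (trans (cong (rot ∘ rot) b) (trans (cong rot r₃) r₁)))))
      go (inj₂ (inj₂ a)) (inj₁ b) = inj₂ (inj₂ (trans a (sym (trans (cong (rot ∘ rot) b) (trans (cong rot r₁) r₂)))))
      go (inj₂ (inj₂ a)) (inj₂ (inj₁ b)) = inj₂ (inj₁ (trans a (sym (trans (cong rot b) r₂))))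
      go (inj₂ (inj₂ a)) (inj₂ (inj₂ b)) = inj₁ (trans a (sym b))

    dart-at : Vertex G → Fin Nᵈ
    dart-at x = Ends.o₁ (at-vertex x)
    src-at : ∀ x → src (dart-at x) ≡ x
    src-at x = At.s₁ x

    everything : S Nᵈ
    everything _ = true

    map : Bridgeless G → CubicMap rev rot everything
    map br = record { I = rev-Invol ; a-rev = λ _ → refl ; a-rot = λ _ → refl ; rot³ = λ {v} _ → rot³′ v ; rot≢ = λ {v} _ → rot≢′ v
      ; bridgeless = λ Z i d → br (λ x → Z (dart-at x)) (half-2 (trans (sym d) (trans (D-cong rev _ (λ v → const Z i v)) (cut-count (λ x → Z (dart-at x)))))) }
      where
      half-2 : ∀ {k} → 2 ≡ k + k → k ≡ 1
      half-2 {k} e = *-cancelˡ-≡ k 1 2 (trans (cong (k +_) (+-identityʳ k)) (sym e))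
      const : ∀ Z → (∀ v → true ≡ true → Z (rot v) ≡ Z v) → ∀ v → Z v ≡ Z (dart-at (src v))
      const Z i v = go (same-vertex v (dart-at (src v)) (sym (src-at (src v))))
        where
        w = dart-at (src v)
        go : (v ≡ w) ⊎ (v ≡ rot w) ⊎ (v ≡ rot (rot w)) → Z v ≡ Z w
        go (inj₁ e) = cong Z e
        go (inj₂ (inj₁ e)) = trans (cong Z e) (i w refl)
        go (inj₂ (inj₂ e)) = trans (cong Z e) (trans (i (rot w) refl) (i w refl))

-- The oriented 2-factor and the way back to edge sets

module Assemble (G : Graph) (cubic : Cubic G) (br : Bridgeless G) where
  open Darts G
  open Invol rev-Invol renaming (mm to rr; mf to rf)

  private
    rt : Fin Nᵈ → Fin Nᵈ
    rt = rot cubic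

  Mat : Set
  Mat = Σ (S Nᵈ) (Matching rev rt (λ _ → true))

  mat : Mat
  mat = go (any? {P = λ (_ : Fin Nᵈ) → ⊤} (λ _ → yes tt))
    where
    go : Dec (Σ (Fin Nᵈ) λ _ → ⊤) → Mat
    go (yes (v , _)) = let (M , p , _) = matching (# {Nᵈ} (λ _ → true)) (map cubic br) ≤-refl v refl in M , p
    -- A graph without edges has no dart to prescribe, and every condition holds vacuously.
    go (no none) = (λ _ → false) , record { M-rev = λ {v} _ → ⊥-elim (none (v , tt)) ; one = λ {v} _ → ⊥-elim (none (v , tt))
      ; tight = λ A _ _ → ≤-trans (≤-reflexive (trans (D-def rev _ A) (#-empty (λ v → ⊥-elim (none (v , tt)))))) z≤n }

  -- The 2-factor consists of the darts outside M; c orients it.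
  module Factor (M : S Nᵈ) (mt : Matching rev rt (λ _ → true) M) where
    open Matching mt

    M-rv : ∀ v → M (rev v) ≡ M v
    M-rv v = M-rev {v} refl

    private
      one′ : ∀ v → ind (M v) + ind (M (rt v)) + ind (M (rt (rt v))) ≡ 1
      one′ v = one {v} refl

      sel : ∀ a b c → ind a + ind b + ind c ≡ 1 → ((a ≡ true) × (b ≡ false) × (c ≡ false)) ⊎ ((a ≡ false) × (b ≡ true) × (c ≡ false)) ⊎ ((a ≡ false) × (b ≡ false) × (c ≡ true))
      sel true false false e = inj₁ (refl , refl , refl)
      sel false true false e = inj₂ (inj₁ (refl , refl , refl))
      sel false false true e = inj₂ (inj₂ (refl , refl , refl))

      Sel : Fin Nᵈ → Set
      Sel v = ((M v ≡ true) × (M (rt v) ≡ false) × (M (rt (rt v)) ≡ false)) ⊎ ((M v ≡ false) × (M (rt v) ≡ true) × (M (rt (rt v)) ≡ false)) ⊎ ((M v ≡ false) × (M (rt v) ≡ false) × (M (rt (rt v)) ≡ true))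
      sel-at : ∀ v → Sel v
      sel-at v = sel (M v) (M (rt v)) (M (rt (rt v))) (one′ v)

    -- At an unmatched dart this is the other unmatched dart of the same vertex. At a matched one it
    -- is `rev`, which keeps the involution free of fixed points and imposes no new condition on the
    -- colouring.
    other : Fin Nᵈ → Fin Nᵈ
    other v = if M v then rev v else (if M (rt v) then rt (rt v) else rt v)

    private
      oth-m : ∀ {v} → M v ≡ true → other v ≡ rev v
      oth-m p rewrite p = refl
      oth-2 : ∀ {v} → M v ≡ false → M (rt v) ≡ true → other v ≡ rt (rt v)
      oth-2 p q rewrite p | q = refl
      oth-1 : ∀ {v} → M v ≡ false → M (rt v) ≡ false → other v ≡ rt v
      oth-1 p q rewrite p | q = refl
      r3 : ∀ v → rt (rt (rt v)) ≡ v
      r3 = rot³′ cubic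

    other-Invol : Invol other
    mm other-Invol v = go (sel-at v)
      where
      go : Sel v → other (other v) ≡ v
      go (inj₁ (a , _)) = trans (cong other (oth-m a)) (trans (oth-m (trans (M-rv v) a)) (rr v))
      go (inj₂ (inj₁ (a , b , c))) = trans (cong other (oth-2 a b)) (trans (oth-1 c (trans (cong M (r3 v)) a)) (r3 v))
      go (inj₂ (inj₂ (a , b , c))) = trans (cong other (oth-1 a b)) (trans (oth-2 b c) (r3 v))
    mf other-Invol v e = go (sel-at v)
      where
      go : Sel v → ⊥
      go (inj₁ (a , _)) = rf v (trans (sym (oth-m a)) e)
      go (inj₂ (inj₁ (a , b , c))) = rot≢′ cubic v (trans (cong rt (sym (trans (sym (oth-2 a b)) e))) (r3 v))
      go (inj₂ (inj₂ (a , b , c))) = rot≢′ cubic v (trans (sym (oth-1 a b)) e)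

    module Oriented (c : S Nᵈ) (c-rev : ∀ v → c (rev v) ≡ not (c v)) (c-oth : ∀ v → c (other v) ≡ not (c v)) where

      record Star (x : Vertex G) : Set where
        field
          md out inn : Fin Nᵈ
          s-md : src md ≡ x
          s-out : src out ≡ x
          s-inn : src inn ≡ x
          M-md : M md ≡ true
          M-out : M out ≡ false
          M-inn : M inn ≡ false
          c-out : c out ≡ true
          c-inn : c inn ≡ false
          all : ∀ v → src v ≡ x → (v ≡ md) ⊎ (v ≡ out) ⊎ (v ≡ inn)

      private
        star-of : ∀ x d → src d ≡ x → M d ≡ true → M (rt d) ≡ false → M (rt (rt d)) ≡ false → Star x
        star-of x d s a b e = go (bool (c (rt d)))
          where
          s₁ : src (rt d) ≡ x
          s₁ = trans (src-rot cubic d) s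
          s₂ : src (rt (rt d)) ≡ x
          s₂ = trans (src-rot cubic (rt d)) s₁
          flip : c (rt (rt d)) ≡ not (c (rt d))
          flip = trans (cong c (sym (oth-1 b e))) (c-oth (rt d))
          which : ∀ v → src v ≡ x → (v ≡ d) ⊎ (v ≡ rt d) ⊎ (v ≡ rt (rt d))
          which v p = same-vertex cubic v d (trans p (sym s))
          go : (c (rt d) ≡ true) ⊎ (c (rt d) ≡ false) → Star x
          go (inj₁ t) = record { md = d ; out = rt d ; inn = rt (rt d) ; s-md = s ; s-out = s₁ ; s-inn = s₂ ; M-md = a ; M-out = b ; M-inn = e ; c-out = t ; c-inn = trans flip (not-f t) ; all = which }
          go (inj₂ t) = record { md = d ; out = rt (rt d) ; inn = rt d ; s-md = s ; s-out = s₂ ; s-inn = s₁ ; M-md = a ; M-out = e ; M-inn = b ; c-out = trans flip (not-t t) ; c-inn = t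
            ; all = λ v p → case which v p of λ { (inj₁ q) → inj₁ q ; (inj₂ (inj₁ q)) → inj₂ (inj₂ q) ; (inj₂ (inj₂ q)) → inj₂ (inj₁ q) } }

      opaque
        star : ∀ x → Star x
        star x = go (sel-at d)
          where
          d : Fin Nᵈ
          d = dart-at cubic x
          s : src d ≡ x
          s = src-at cubic x
          s₁ : src (rt d) ≡ x
          s₁ = trans (src-rot cubic d) s
          s₂ : src (rt (rt d)) ≡ x
          s₂ = trans (src-rot cubic (rt d)) s₁
          go : Sel d → Star x
          go (inj₁ (a , b , e)) = star-of x d s a b e
          go (inj₂ (inj₁ (a , b , e))) = star-of x (rt d) s₁ b e (trans (cong M (r3 d)) a)
          go (inj₂ (inj₂ (a , b , e))) = star-of x (rt (rt d)) s₂ e (trans (cong M (r3 d)) a) (trans (cong (M ∘ rt) (r3 d)) b)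

      md out inn : Vertex G → Fin Nᵈ
      md x = Star.md (star x)
      out x = Star.out (star x)
      inn x = Star.inn (star x)

      is-md : ∀ {v x} → src v ≡ x → M v ≡ true → v ≡ md x
      is-md {v} {x} s p = case Star.all (star x) v s of λ
        { (inj₁ q) → q ; (inj₂ (inj₁ q)) → tf p (trans (cong M q) (Star.M-out (star x))) ; (inj₂ (inj₂ q)) → tf p (trans (cong M q) (Star.M-inn (star x))) }
      is-out : ∀ {v x} → src v ≡ x → M v ≡ false → c v ≡ true → v ≡ out x
      is-out {v} {x} s p t = case Star.all (star x) v s of λ
        { (inj₁ q) → tf (trans (cong M q) (Star.M-md (star x))) p ; (inj₂ (inj₁ q)) → q ; (inj₂ (inj₂ q)) → tf t (trans (cong c q) (Star.c-inn (star x))) }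
      is-inn : ∀ {v x} → src v ≡ x → M v ≡ false → c v ≡ false → v ≡ inn x
      is-inn {v} {x} s p t = case Star.all (star x) v s of λ
        { (inj₁ q) → tf (trans (cong M q) (Star.M-md (star x))) p ; (inj₂ (inj₁ q)) → tf (trans (cong c q) (Star.c-out (star x))) t ; (inj₂ (inj₂ q)) → q }

      σ σ⁻ mate : Vertex G → Vertex G
      σ x = src (rev (out x))
      σ⁻ x = src (rev (inn x))
      mate x = src (rev (md x))

      rev-out : ∀ x → rev (out x) ≡ inn (σ x)
      rev-out x = is-inn refl (trans (M-rv _) (Star.M-out (star x))) (trans (c-rev _) (not-f (Star.c-out (star x))))
      rev-inn : ∀ x → rev (inn x) ≡ out (σ⁻ x)
      rev-inn x = is-out refl (trans (M-rv _) (Star.M-inn (star x))) (trans (c-rev _) (not-t (Star.c-inn (star x))))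
      rev-md : ∀ x → rev (md x) ≡ md (mate x)
      rev-md x = is-md refl (trans (M-rv _) (Star.M-md (star x)))

      perm : Perm σ σ⁻
      perm = record { σσ⁻ = λ x → trans (cong (src ∘ rev) (sym (rev-inn x))) (trans (cong src (rr _)) (Star.s-inn (star x)))
        ; σ⁻σ = λ x → trans (cong (src ∘ rev) (sym (rev-out x))) (trans (cong src (rr _)) (Star.s-out (star x))) }

      mate-Invol : Invol mate
      mm mate-Invol x = trans (cong (src ∘ rev) (sym (rev-md x))) (trans (cong src (rr _)) (Star.s-md (star x)))
      mf mate-Invol x e = rf (md x) (trans (rev-md x) (cong md e))

      at-star : (h : S Nᵈ) (x : Vertex G) → # (λ v → (src v == x) ∧ h v) ≡ ind (h (md x)) + ind (h (out x)) + ind (h (inn x))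
      at-star h x = trans (#-def _) (trans (sum-cong pt) (trans (sum-+ _ _) (cong₂ _+_ (trans (sum-+ _ _) (cong₂ _+_ (sing (md x)) (sing (out x)))) (sing (inn x)))))
        where
        sing : ∀ u → sum (λ v → ind ((v == u) ∧ h v)) ≡ ind (h u)
        sing u = trans (sum-single u _ (λ v ne → ind-f (∧-false₁ (==-false ne)))) (cong ind (cong (_∧ h u) (==-refl u)))
        ≢₁ : md x ≢ out x
        ≢₁ e = tf (trans (sym (cong M e)) (Star.M-md (star x))) (Star.M-out (star x))
        ≢₂ : md x ≢ inn x
        ≢₂ e = tf (trans (sym (cong M e)) (Star.M-md (star x))) (Star.M-inn (star x))
        ≢₃ : out x ≢ inn x
        ≢₃ e = tf (trans (sym (cong c e)) (Star.c-out (star x))) (Star.c-inn (star x))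
        on : ∀ {u} → src u ≡ x → (src u == x) ≡ true
        on {u} s = subst (λ y → (src u == y) ≡ true) s (==-refl (src u))
        lem : ∀ a b e f g {y : Bool} → (a ≡ true) × (b ≡ true) × (e ≡ false) × (f ≡ false) ⊎ (a ≡ true) × (b ≡ false) × (e ≡ true) × (f ≡ false) ⊎ (a ≡ true) × (b ≡ false) × (e ≡ false) × (f ≡ true) ⊎ (a ≡ false) × (b ≡ false) × (e ≡ false) × (f ≡ false) →
          ind (a ∧ g) ≡ ind (b ∧ g) + ind (e ∧ g) + ind (f ∧ g)
        lem a b e f g (inj₁ (refl , refl , refl , refl)) = sym (trans (+-identityʳ _) (+-identityʳ _))
        lem a b e f g (inj₂ (inj₁ (refl , refl , refl , refl))) = sym (+-identityʳ _)
        lem a b e f g (inj₂ (inj₂ (inj₁ (refl , refl , refl , refl)))) = refl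
        lem a b e f g (inj₂ (inj₂ (inj₂ (refl , refl , refl , refl)))) = refl
        pt : ∀ v → ind ((src v == x) ∧ h v) ≡ ind ((v == md x) ∧ h v) + ind ((v == out x) ∧ h v) + ind ((v == inn x) ∧ h v)
        pt v = lem (src v == x) (v == md x) (v == out x) (v == inn x) (h v) {true} (go (bool (src v == x)))
          where
          self : ∀ {u} → v ≡ u → (v == u) ≡ true
          self e = subst (λ y → (v == y) ≡ true) e (==-refl v)
          go : ((src v == x) ≡ true) ⊎ ((src v == x) ≡ false) → _
          go (inj₂ p) = inj₂ (inj₂ (inj₂ (p , ==-false (λ { refl → tf (on (Star.s-md (star x))) p }) , ==-false (λ { refl → tf (on (Star.s-out (star x))) p }) , ==-false (λ { refl → tf (on (Star.s-inn (star x))) p }))))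
          go (inj₁ p) = case Star.all (star x) v (==-true p) of λ
            { (inj₁ e) → inj₁ (p , self e , ==-false (λ f → ≢₁ (trans (sym e) f)) , ==-false (λ f → ≢₂ (trans (sym e) f)))
            ; (inj₂ (inj₁ e)) → inj₂ (inj₁ (p , ==-false (λ f → ≢₁ (trans (sym f) e)) , self e , ==-false (λ f → ≢₃ (trans (sym e) f))))
            ; (inj₂ (inj₂ e)) → inj₂ (inj₂ (inj₁ (p , ==-false (λ f → ≢₂ (trans (sym f) e)) , ==-false (λ f → ≢₃ (trans (sym f) e)) , self e))) }

      dart-sum : (h : S Nᵈ) → # h ≡ # (λ x → h (md x)) + # (λ x → h (out x)) + # (λ x → h (inn x))
      dart-sum h = begin
        # h ≡⟨ #-def h ⟩
        sum (λ v → ind (h v)) ≡⟨ sum-cong (λ v → sym (trans (sum-single (src v) _ (λ x ne → ind-f (∧-false₁ (==-false (λ e → ne (sym e)))))) (cong ind (cong (_∧ h v) (==-refl (src v)))))) ⟩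
        sum (λ v → sum (λ x → ind ((src v == x) ∧ h v))) ≡⟨ sum-swap (λ v x → ind ((src v == x) ∧ h v)) ⟩
        sum (λ x → sum (λ v → ind ((src v == x) ∧ h v))) ≡⟨ sum-cong (λ x → trans (sym (#-def _)) (at-star h x)) ⟩
        sum (λ x → ind (h (md x)) + ind (h (out x)) + ind (h (inn x))) ≡⟨ trans (sum-+ _ _) (cong₂ _+_ (trans (sum-+ _ _) (cong₂ _+_ (sym (#-def _)) (sym (#-def _)))) (sym (#-def _))) ⟩
        # (λ x → h (md x)) + # (λ x → h (out x)) + # (λ x → h (inn x)) ∎
        where open ≡-Reasoning

      -- An invariant set is crossed by no edge of the 2-factor, so only matched darts contribute,
      -- and there is one of them at every vertex.
      cut-equal : ∀ (Z : Vertex G → Bool) (w : S Nᵈ) → (∀ v → M v ≡ true → w v ≡ true) → (∀ x → Z (σ x) ≡ Z x) → D rev w (λ v → Z (src v)) ≡ D mate (λ _ → true) Z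
      cut-equal Z w hw zi = trans (D-def rev w _) (trans (dart-sum _) (trans (cong₂ _+_ (cong₂ _+_ (#-cong at-md) (#-empty at-out)) (#-empty at-inn)) (trans (+-identityʳ _) (trans (+-identityʳ _) (sym (D-def mate _ Z))))))
        where
        at-md : ∀ x → (w (md x) ∧ (Z (src (md x)) xor Z (src (rev (md x))))) ≡ (Z x xor Z (mate x))
        at-md x = cong₂ _∧_ (hw _ (Star.M-md (star x))) (cong (λ y → Z y xor Z (mate x)) (Star.s-md (star x)))
        at-out : ∀ x → (w (out x) ∧ (Z (src (out x)) xor Z (src (rev (out x))))) ≡ false
        at-out x = ∧-false₂ {w (out x)} (xor-f (trans (cong Z (Star.s-out (star x))) (sym (zi x))))
        at-inn : ∀ x → (w (inn x) ∧ (Z (src (inn x)) xor Z (src (rev (inn x))))) ≡ false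
        at-inn x = ∧-false₂ {w (inn x)} (xor-f (trans (cong Z (trans (Star.s-inn (star x)) (sym (Perm.σσ⁻ perm x)))) (zi (σ⁻ x))))

      -- One edge would be a bridge. Three edges would all belong to the matching, since the
      -- 2-factor does not cross, against `tight`. Parity rules out two and four.
      o5 : Small.O5M perm mate
      o5 Z zi o = go (D-parity mate-Invol (λ _ → true) Z (λ _ → refl))
        where
        A : S Nᵈ
        A v = Z (src v)
        Ai : ∀ v → true ≡ true → A (rt v) ≡ A v
        Ai v _ = cong Z (src-rot cubic v)
        fwd : D rev (λ _ → true) A ≡ D mate (λ _ → true) Z
        fwd = cut-equal Z (λ _ → true) (λ _ _ → refl) zi
        go : (Σ ℕ λ j → D mate (λ _ → true) Z ≡ 4 * j + 2 * ind (par (# (λ v → true ∧ Z v)))) → 10 ≤ D mate (λ _ → true) Z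
        go (j , e) = by j (trans e (cong (λ b → 4 * j + 2 * ind b) o))
          where
          by : ∀ j → D mate (λ _ → true) Z ≡ 4 * j + 2 → 10 ≤ D mate (λ _ → true) Z
          by zero d = ⊥-elim (CubicMap.bridgeless (map cubic br) A Ai (trans fwd d))
          by (suc zero) d = ⊥-elim (<⇒≱ {2} {6} (s≤s (s≤s (s≤s z≤n))) (≤-trans (≤-reflexive (sym (trans (cut-equal Z (λ v → true ∧ M v) (λ _ p → p) zi) d))) (tight A Ai (trans fwd d))))
          by (suc (suc j)) d = ≤-trans (+-monoˡ-≤ 2 (*-monoʳ-≤ 4 {2} {suc (suc j)} (s≤s (s≤s z≤n)))) (≤-reflexive (sym d))

      module Cyc (z s : Vertex G → Bool) (zi : ∀ x → z (mate x) ≡ z x) (bal : Bal σ s z) where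

        -- On the 2-factor `c` is true at the tail of an edge, and `s` is indexed by tails.
        Cd : S Nᵈ
        Cd v = if M v then z (src v) else (if c v then s (src v) else s (src (rev v)))

        Cd-m : ∀ {v} → M v ≡ true → Cd v ≡ z (src v)
        Cd-m p rewrite p = refl
        Cd-o : ∀ {v} → M v ≡ false → c v ≡ true → Cd v ≡ s (src v)
        Cd-o p q rewrite p | q = refl
        Cd-i : ∀ {v} → M v ≡ false → c v ≡ false → Cd v ≡ s (src (rev v))
        Cd-i p q rewrite p | q = refl

        Cd-rev : ∀ v → Cd (rev v) ≡ Cd v
        Cd-rev v = go (bool (M v)) (bool (c v))
          where
          go : (M v ≡ true) ⊎ (M v ≡ false) → (c v ≡ true) ⊎ (c v ≡ false) → Cd (rev v) ≡ Cd v
          go (inj₁ p) _ = trans (Cd-m (trans (M-rv v) p)) (trans (cong (z ∘ src ∘ rev) (is-md refl p)) (trans (zi (src v)) (sym (Cd-m p))))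
          go (inj₂ p) (inj₁ q) = trans (Cd-i (trans (M-rv v) p) (trans (c-rev v) (not-f q))) (trans (cong (s ∘ src) (rr v)) (sym (Cd-o p q)))
          go (inj₂ p) (inj₂ q) = trans (Cd-o (trans (M-rv v) p) (trans (c-rev v) (not-t q))) (sym (Cd-i p q))

        C : EdgeSet G
        C e = Cd (left e)

        at-md : ∀ x → Cd (md x) ≡ z x
        at-md x = trans (Cd-m (Star.M-md (star x))) (cong z (Star.s-md (star x)))
        at-out : ∀ x → Cd (out x) ≡ s x
        at-out x = trans (Cd-o (Star.M-out (star x)) (Star.c-out (star x))) (cong s (Star.s-out (star x)))
        at-inn : ∀ x → Cd (inn x) ≡ s (σ⁻ x)
        at-inn x = Cd-i (Star.M-inn (star x)) (Star.c-inn (star x))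

        cycle : IsCycle G C
        cycle x = even (degIn G C x) (trans (cong par (trans (deg-count C Cd Cd-rev (λ _ → refl) x) (at-star Cd x))) (parity (Cd (md x)) (Cd (out x)) (Cd (inn x))
            (trans (at-out x) (trans (trans (cong s (sym (Perm.σσ⁻ perm x))) (trans (bal (σ⁻ x)) (cong (λ y → s (σ⁻ x) xor z y) (Perm.σσ⁻ perm x)))) (sym (cong₂ _xor_ (at-inn x) (at-md x)))))))
          where
          parity : ∀ a b d → b ≡ (d xor a) → par (ind a + ind b + ind d) ≡ false
          parity true .true false refl = refl
          parity true .false true refl = refl
          parity false .true true refl = refl
          parity false .false false refl = refl
          even : ∀ k → par k ≡ false → 2 ∣ k
          even k p with halve k
          ... | j , e = divides j (trans e (trans (cong (λ b → ind b + (j + j)) p) (l j)))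
            where
            l : ∀ j → j + j ≡ j * 2
            l = solve-∀

        -- Every edge is counted at both ends. A matching edge has a point of `z` at either end,
        -- whereas an edge of the 2-factor has one value of `s`, met at its tail and at its head.
        length : size G C + size G C ≡ # z + 2 * # s
        length = trans (sym (sym-count Cd Cd-rev)) (trans (dart-sum Cd) (trans (cong₂ _+_ (cong₂ _+_ (#-cong at-md) (#-cong at-out)) (trans (#-cong at-inn) (#-perm σ⁻ σ (Perm.σ⁻σ perm) (Perm.σσ⁻ perm) s))) (l (# z) (# s))))
          where
          l : ∀ x y → x + y + y ≡ x + 2 * y
          l = solve-∀

      Goal : Set
      Goal = Σ[ C₁ ∈ EdgeSet G ] Σ[ C₂ ∈ EdgeSet G ] Σ[ C₃ ∈ EdgeSet G ]
        (IsCycle G C₁ × IsCycle G C₂ × IsCycle G C₃ × Covers3 G C₁ C₂ C₃ × 21 * (size G C₁ + size G C₂ + size G C₃) ≤ 34 * m G)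

      handshake : m G + m G ≡ 3 * n G
      handshake = trans (sym (#-all Nᵈ)) (trans (dart-sum (λ _ → true)) (trans (cong (λ y → y + y + y) (#-all (n G))) (l (n G))))
        where
        l : ∀ x → x + x + x ≡ 3 * x
        l = solve-∀

      cover : Triple σ mate → Goal
      cover t = K₁.C , K₂.C , K₃.C , K₁.cycle , K₂.cycle , K₃.cycle , covers , short′
        where
        open Triple t
        module K₁ = Cyc z₁ s₁ inv₁ bal₁
        module K₂ = Cyc z₂ s₂ inv₂ bal₂
        module K₃ = Cyc z₃ s₃ inv₃ bal₃
        three-cases : ∀ {a b d} → (a ∨ (b ∨ d)) ≡ true → (a ≡ true) ⊎ ((b ≡ true) ⊎ (d ≡ true))
        three-cases {a} {b} p = case ∨-case {a} p of λ { (inj₁ q) → inj₁ q ; (inj₂ q) → inj₂ (∨-case {b} q) }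
        covers : Covers3 G K₁.C K₂.C K₃.C
        covers e = three-cases (go (bool (M v)) (bool (c v)))
          where
          v : Fin Nᵈ
          v = left e
          go : (M v ≡ true) ⊎ (M v ≡ false) → (c v ≡ true) ⊎ (c v ≡ false) → (K₁.Cd v ∨ (K₂.Cd v ∨ K₃.Cd v)) ≡ true
          go (inj₁ p) _ = trans (cong₂ _∨_ (K₁.Cd-m p) (cong₂ _∨_ (K₂.Cd-m p) (K₃.Cd-m p))) (cov-z (src v))
          go (inj₂ p) (inj₁ q) = trans (cong₂ _∨_ (K₁.Cd-o p q) (cong₂ _∨_ (K₂.Cd-o p q) (K₃.Cd-o p q))) (cov-s (src v))
          go (inj₂ p) (inj₂ q) = trans (cong₂ _∨_ (K₁.Cd-i p q) (cong₂ _∨_ (K₂.Cd-i p q) (K₃.Cd-i p q))) (cov-s (src (rev v)))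
        S₁ S₂ S₃ : ℕ
        S₁ = size G K₁.C
        S₂ = size G K₂.C
        S₃ = size G K₃.C
        short′ : 21 * (S₁ + S₂ + S₃) ≤ 34 * m G
        short′ = *-cancelˡ-≤ 2 (begin
          2 * (21 * (S₁ + S₂ + S₃)) ≡⟨ l₁ S₁ S₂ S₃ ⟩
          3 * (7 * ((S₁ + S₁) + (S₂ + S₂) + (S₃ + S₃))) ≡⟨ cong (λ y → 3 * (7 * y)) (cong₂ _+_ (cong₂ _+_ K₁.length K₂.length) K₃.length) ⟩
          3 * (7 * ((# z₁ + 2 * # s₁) + (# z₂ + 2 * # s₂) + (# z₃ + 2 * # s₃))) ≡⟨ cong (λ y → 3 * (7 * y)) (l₂ (# z₁) (# z₂) (# z₃) (# s₁) (# s₂) (# s₃)) ⟩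
          3 * (7 * ((# z₁ + # z₂ + # z₃) + 2 * (# s₁ + # s₂ + # s₃))) ≤⟨ *-monoʳ-≤ 3 short ⟩
          3 * (34 * n G) ≡⟨ l₃ (n G) ⟩
          34 * (3 * n G) ≡⟨ cong (34 *_) (sym handshake) ⟩
          34 * (m G + m G) ≡⟨ l₄ (m G) ⟩
          2 * (34 * m G) ∎)
          where
          open ≤-Reasoning
          l₁ : ∀ x y z → 2 * (21 * (x + y + z)) ≡ 3 * (7 * ((x + x) + (y + y) + (z + z)))
          l₁ = solve-∀
          l₂ : ∀ a b d x y z → (a + 2 * x) + (b + 2 * y) + (d + 2 * z) ≡ (a + b + d) + 2 * (x + y + z)
          l₂ = solve-∀
          l₃ : ∀ x → 3 * (34 * x) ≡ 34 * (3 * x)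
          l₃ = solve-∀
          l₄ : ∀ x → 34 * (x + x) ≡ 2 * (34 * x)
          l₄ = solve-∀

    orient : Σ (S Nᵈ) λ c → (∀ v → c (rev v) ≡ not (c v)) × (∀ v → c (other v) ≡ not (c v))
    orient = alternate _ rev-Invol other-Invol ≤-refl

theorem17 : (G : Graph) → Cubic G → Bridgeless G →
    Σ[ C₁ ∈ EdgeSet G ] Σ[ C₂ ∈ EdgeSet G ] Σ[ C₃ ∈ EdgeSet G ]
    (IsCycle G C₁ × IsCycle G C₂ × IsCycle G C₃ × Covers3 G C₁ C₂ C₃
    × 21 * (size G C₁ + size G C₂ + size G C₃) ≤ 34 * m G)
theorem17 G cubic br = go (mat)
  where
  open Assemble G cubic br
  go : Mat → _
  go (M , mt) = orientation orient
    where
    open Factor M mt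
    orientation : (Σ (S (Darts.Nᵈ G)) λ c → (∀ v → c (Darts.rev G v) ≡ not (c v)) × (∀ v → c (other v) ≡ not (c v))) → _
    orientation (c , c-rev , c-oth) = cover (short-triple perm mate-Invol o5)
      where open Oriented c c-rev c-oth
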